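{- Let $p$ be a prime, let $A\subseteq \mathbb{Z}/p\mathbb{Z}$ be a nonempty subset, and write $|2A|=2|A|+r$. Let $\alpha\approx 0.136861$ be the unique real root of the cubic $4x^3+9x^2+6x-1$. Suppose that $$|2A|\leq (2+\alpha)|A|-3\qquad\text{and}\qquad |2A|\leq \tfrac34 p.$$ Then there exist arithmetic progressions $P_A,P_{2A}\subseteq \mathbb{Z}/p\mathbb{Z}$ with the same common difference such that $A\subseteq P_A$, $|P_A|\leq |A|+r+1$, $P_{2A}\subseteq 2A$, and $|P_{2A}|\geq 2|A|-1$.
   Context: For $A\subseteq \mathbb{Z}/p\mathbb{Z}$, $2A=A+A=\{x+y: x,y\in A\}$. An arithmetic progression in $\mathbb{Z}/p\mathbb{Z}$ with difference $g\neq 0$ is a set of the form $\{a, a+g, a+2g,\dots,a+(k-1)g\}$ with $1\le k\le p$. -}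

module Defs where

open import Data.Fin.Base using (Fin; toℕ)
open import Data.Fin.Properties using (any?; _≟_; nonZeroIndex)
open import Data.Fin.Subset using (Subset; _∈_)
open import Data.Fin.Subset.Properties using (_∈?_)
open import Data.Integer.Base using (+_)
open import Data.Nat.Base as ℕ using (ℕ; zero; suc; _⊔_)
import Data.Nat.Properties as ℕ
open import Data.Nat.DivMod using (_mod_)
open import Data.Product.Base using (∃-syntax; _×_; _,_; proj₁; proj₂)
open import Data.Rational.Base hiding (_⊔_)
open import Data.Rational.Properties hiding (_≟_)
open import Data.Rational.Solver using (module +-*-Solver)
open import Data.Vec.Base using (tabulate)
open import Function.Bundles using (_⇔_)
open import Relation.Binary.PropositionalEquality
  using (_≡_; _≢_; refl; sym; trans; cong; subst; subst₂)
open import Relation.Nullary.Decidable using (does; _×-dec_)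

------------------------------------------------------------------------
-- ℤ/nℤ, with residues represented by Fin n

infixl 6 _⊕_ _⊞_

_⊕_ : ∀ {n} → Fin n → Fin n → Fin n
_⊕_ {n} x y = _mod_ (toℕ x ℕ.+ toℕ y) n {{nonZeroIndex x}}

-- Minkowski sum {x + y : x ∈ A, y ∈ B}.
_⊞_ : ∀ {n} → Subset n → Subset n → Subset n
A ⊞ B = tabulate λ z → does
  (any? λ x → any? λ y → x ∈? A ×-dec (y ∈? B ×-dec z ≟ x ⊕ y))

-- The residue a + i g.
apTerm : ∀ {n} → Fin n → Fin n → ℕ → Fin n
apTerm {n} a g i = _mod_ (toℕ a ℕ.+ i ℕ.* toℕ g) n {{nonZeroIndex a}}

-- P is an arithmetic progression with (nonzero) difference g.
IsAP : ∀ {n} → Fin n → Subset n → Set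
IsAP {n} g P =
  toℕ g ≢ 0 ×
  ∃[ a ] ∃[ k ] 1 ℕ.≤ k × k ℕ.≤ n ×
    (∀ x → x ∈ P ⇔ (∃[ i ] i ℕ.< k × x ≡ apTerm a g i))

------------------------------------------------------------------------
-- Real numbers, as Cauchy sequences of rationals up to _≃ᴿ_

IsCauchy : (ℕ → ℚ) → Set
IsCauchy s = ∀ ε → 0ℚ < ε →
  ∃[ N ] (∀ m n → N ℕ.≤ m → N ℕ.≤ n → ∣ s m - s n ∣ < ε)

record ℝ : Set where
  constructor mkℝ
  field
    seq    : ℕ → ℚ
    cauchy : IsCauchy seq

open ℝ public

infix 4 _≃ᴿ_ _≤ᴿ_

_≃ᴿ_ : ℝ → ℝ → Set
x ≃ᴿ y = ∀ ε → 0ℚ < ε →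
  ∃[ N ] (∀ n → N ℕ.≤ n → ∣ seq x n - seq y n ∣ < ε)

_≤ᴿ_ : ℝ → ℝ → Set
x ≤ᴿ y = ∀ ε → 0ℚ < ε →
  ∃[ N ] (∀ n → N ℕ.≤ n → seq x n < seq y n + ε)

private
  open +-*-Solver using (solve; _:=_; _:+_; _:*_; :-_; _:-_)

  half-pos : ∀ {ε} → 0ℚ < ε → 0ℚ < ½ * ε
  half-pos {ε} 0<ε = subst (_< ½ * ε) (*-zeroʳ ½) (*-monoʳ-<-pos ½ 0<ε)

  halves : ∀ ε → ½ * ε + ½ * ε ≡ ε
  halves ε = trans (sym (*-distribʳ-+ ε ½ ½)) (*-identityˡ ε)

  const-cauchy : ∀ q → IsCauchy (λ _ → q)
  const-cauchy q ε 0<ε = 0 , λ _ _ _ _ →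
    subst (λ d → ∣ d ∣ < ε) (sym (+-inverseʳ q)) 0<ε

  +-cauchy : ∀ {s t} → IsCauchy s → IsCauchy t → IsCauchy (λ n → s n + t n)
  +-cauchy {s} {t} cs ct ε 0<ε
    with M , hs ← cs (½ * ε) (half-pos 0<ε)
       | N , ht ← ct (½ * ε) (half-pos 0<ε)
    = M ⊔ N , λ m n m≥ n≥ → subst₂ _<_
        (cong ∣_∣ (rearr (s m) (s n) (t m) (t n))) (halves ε)
        (≤-<-trans (∣p+q∣≤∣p∣+∣q∣ (s m - s n) (t m - t n))
          (+-mono-<
            (hs m n (ℕ.m⊔n≤o⇒m≤o M N m≥) (ℕ.m⊔n≤o⇒m≤o M N n≥))
            (ht m n (ℕ.m⊔n≤o⇒n≤o M N m≥) (ℕ.m⊔n≤o⇒n≤o M N n≥))))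
    where
    rearr : ∀ a b c d → (a - b) + (c - d) ≡ (a + c) - (b + d)
    rearr = solve 4 (λ a b c d →
      (a :- b) :+ (c :- d) := (a :+ c) :- (b :+ d)) refl

  neg-cauchy : ∀ {s} → IsCauchy s → IsCauchy (λ n → - s n)
  neg-cauchy {s} cs ε 0<ε with N , hs ← cs ε 0<ε = N , λ m n m≥ n≥ →
    subst (_< ε)
      (trans (sym (∣-p∣≡∣p∣ (s m - s n)))
             (cong ∣_∣ (neg-distrib-+ (s m) (- s n))))
      (hs m n m≥ n≥)

  Bounded : (ℕ → ℚ) → Set
  Bounded s = ∃[ B ] 0ℚ < B × ∃[ N ] (∀ n → N ℕ.≤ n → ∣ s n ∣ ≤ B)

  bounded : ∀ {s} → IsCauchy s → Bounded s
  bounded {s} cs with N , hs ← cs 1ℚ (positive⁻¹ 1ℚ) =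
    1ℚ + ∣ s N ∣ , +-mono-<-≤ (positive⁻¹ 1ℚ) (0≤∣p∣ (s N)) , N ,
    λ n n≥ → subst (λ q → ∣ q ∣ ≤ 1ℚ + ∣ s N ∣) (cancel (s n) (s N))
      (≤-trans (∣p+q∣≤∣p∣+∣q∣ (s n - s N) (s N))
        (+-monoˡ-≤ ∣ s N ∣ (<⇒≤ (hs n N n≥ ℕ.≤-refl))))
    where
    cancel : ∀ a b → (a - b) + b ≡ a
    cancel = solve 2 (λ a b → (a :- b) :+ b := a) refl

  *-bound : ∀ {a b B δ} → 0ℚ < B → ∣ a ∣ ≤ B → ∣ b ∣ < δ → ∣ a * b ∣ < B * δ
  *-bound {a} {b} {B} {δ} 0<B a≤B b<δ =
    subst (_< B * δ) (sym (∣p*q∣≡∣p∣*∣q∣ a b))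
      (≤-<-trans (*-monoʳ-≤-nonNeg ∣ b ∣ {{∣-∣-nonNeg b}} a≤B)
                 (*-monoʳ-<-pos B {{positive 0<B}} b<δ))

  split : ∀ {B C ε} → 0ℚ < B → 0ℚ < C → 0ℚ < ε →
          ∃[ δ ] 0ℚ < δ × B * δ + C * δ ≡ ε
  split {B} {C} {ε} 0<B 0<C 0<ε = δ , 0<δ , total
    where
    D : ℚ
    D = B + C

    D⁺ : Positive D
    D⁺ = positive (+-mono-< 0<B 0<C)

    D≢0 : NonZero D
    D≢0 = pos⇒nonZero D {{D⁺}}

    D⁻¹ : ℚ
    D⁻¹ = (1/ D) {{D≢0}}

    δ : ℚ
    δ = D⁻¹ * ε

    0<δ : 0ℚ < δ
    0<δ = subst (_< δ) (*-zeroʳ D⁻¹)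
      (*-monoʳ-<-pos D⁻¹ {{1/pos⇒pos D {{D⁺}}}} 0<ε)

    total : B * δ + C * δ ≡ ε
    total = trans (sym (*-distribʳ-+ δ B C))
      (trans (sym (*-assoc D D⁻¹ ε))
        (trans (cong (_* ε) (*-inverseʳ D {{D≢0}})) (*-identityˡ ε)))

  *-diff : ∀ a b c d {B C δ ε} → 0ℚ < B → 0ℚ < C → B * δ + C * δ ≡ ε →
           ∣ a ∣ ≤ B → ∣ d ∣ ≤ C → ∣ a - b ∣ < δ → ∣ c - d ∣ < δ →
           ∣ a * c - b * d ∣ < ε
  *-diff a b c d {B} {C} {δ} 0<B 0<C total a≤B d≤C ab<δ cd<δ =
    subst₂ _<_ (cong ∣_∣ (rearr a b c d)) total
      (≤-<-trans (∣p+q∣≤∣p∣+∣q∣ (a * (c - d)) (d * (a - b)))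
        (+-mono-< (*-bound {a} {c - d} 0<B a≤B cd<δ)
                  (*-bound {d} {a - b} 0<C d≤C ab<δ)))
    where
    rearr : ∀ a b c d → a * (c - d) + d * (a - b) ≡ a * c - b * d
    rearr = solve 4 (λ a b c d →
      a :* (c :- d) :+ d :* (a :- b) := a :* c :- b :* d) refl

  *-cauchy : ∀ {s t} → IsCauchy s → IsCauchy t → IsCauchy (λ n → s n * t n)
  *-cauchy {s} {t} cs ct ε 0<ε =
    let B , 0<B , K , bs = bounded cs
        C , 0<C , L , bt = bounded ct
        δ , 0<δ , total  = split {B} {C} {ε} 0<B 0<C 0<ε
        M , hs = cs δ 0<δ
        N , ht = ct δ 0<δ
    in (K ⊔ L) ⊔ (M ⊔ N) , λ m n m≥ n≥ →
      let mMN = ℕ.m⊔n≤o⇒n≤o (K ⊔ L) (M ⊔ N) m≥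
          nMN = ℕ.m⊔n≤o⇒n≤o (K ⊔ L) (M ⊔ N) n≥
      in *-diff (s m) (s n) (t m) (t n) {B} {C} {δ} {ε} 0<B 0<C total
           (bs m (ℕ.m⊔n≤o⇒m≤o K L (ℕ.m⊔n≤o⇒m≤o (K ⊔ L) (M ⊔ N) m≥)))
           (bt n (ℕ.m⊔n≤o⇒n≤o K L (ℕ.m⊔n≤o⇒m≤o (K ⊔ L) (M ⊔ N) n≥)))
           (hs m n (ℕ.m⊔n≤o⇒m≤o M N mMN) (ℕ.m⊔n≤o⇒m≤o M N nMN))
           (ht m n (ℕ.m⊔n≤o⇒n≤o M N mMN) (ℕ.m⊔n≤o⇒n≤o M N nMN))

infixl 6 _+ᴿ_ _-ᴿ_
infixl 7 _*ᴿ_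
infixr 8 _^ᴿ_ -ᴿ_

fromℚ : ℚ → ℝ
fromℚ q = mkℝ (λ _ → q) (const-cauchy q)

fromℕ : ℕ → ℝ
fromℕ n = fromℚ (+ n / 1)

_+ᴿ_ : ℝ → ℝ → ℝ
x +ᴿ y = mkℝ (λ n → seq x n + seq y n) (+-cauchy {seq x} {seq y} (cauchy x) (cauchy y))

-ᴿ_ : ℝ → ℝ
-ᴿ x = mkℝ (λ n → - seq x n) (neg-cauchy {seq x} (cauchy x))

_-ᴿ_ : ℝ → ℝ → ℝ
x -ᴿ y = x +ᴿ -ᴿ y

_*ᴿ_ : ℝ → ℝ → ℝ
x *ᴿ y = mkℝ (λ n → seq x n * seq y n) (*-cauchy {seq x} {seq y} (cauchy x) (cauchy y))

_^ᴿ_ : ℝ → ℕ → ℝ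
x ^ᴿ zero  = fromℕ 1
x ^ᴿ suc n = x *ᴿ x ^ᴿ n

-- Let k = |A|, s = |2A|, y = s + 3 - 2k. The cubic turns the bound on s into 4y³ + 9y²k + 6yk² ≤ k³.
--
-- Suppose that for every dilate of A each half circle contains at most (s + 3)/3 points. Then every nontrivial
-- Fourier coefficient of A is at most M = (k + 2y)/3: rotate it to the real axis and sum by parts, so that it
-- becomes an integral of half-circle counts against a sine wave. As Σ|Â|⁴ is p times the additive energy, which
-- is at least k⁴/s, and Σ|Â|² = pk, this gives 9k³(p - s) ≤ (k + 2y)²(p - k)s, against the cubic and 4s ≤ 3p.
-- Everything stays rational: the p-th root of unity is replaced by a rational point ζ of the unit circle that
-- approximates it arbitrarily well, and the finitely many resulting inequalities between integers survive the error.
--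
-- So for some dilate a half circle contains a part A′ of A with 3|A′| ≥ s + 4. Sums of A′ do not wrap around, and
-- Freiman's theorem on sets of integers with |2A′| ≤ 3|A′| - 4 puts A′ on a short progression and a long interval
-- of that progression inside 2A′. Let C be the complement of 2A. It avoids this interval, hence lies in a short arc
-- too, and |C| + |A′| - |C - A′| is large enough to force a long interval in C - A′. As c ∉ 2A and a ∈ A imply
-- c - a ∉ A, this interval misses A, so all of A lies in a half circle, and Freiman's theorem applies to A itself.

module Submission where

import Algebra.Structures
import Data.Rational.Base as ℚ
open import Relation.Binary.PropositionalEquality using (_≡_)

-- The constants hang together. Freiman's theorem asks for 3n ≥ s + 4, so in the other case a half
-- circle holds at most (s + 3)/3 points; doubling this and subtracting k gives 2(s + 3)/3 - k = (k
-- + 2y)/3, which is M. At the extreme 3p = 4s the Fourier inequality reads 9k³ ≤ (4s - 3k)(k +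
-- 2y)², and since 4s = 8k + 4y - 12 its right side is less than (5k + 4y)(k + 2y)² = 5k³ + 4(4y³ +
-- 9y²k + 6yk²). The cubic defining α is the one that makes this at most 9k³, and the -3 in the
-- hypothesis makes the contradiction strict.
--
-- As p is odd, the point opposite to a residue is not a residue. Half circles are therefore windows
-- in ½ℤ/p, and the number to approximate is exp(πi/p), whose square is ζ. Only algebra remains of
-- trigonometry: addition formulas, the sign of the imaginary parts of the first p powers, and the
-- smallness of the p-th power plus 1.

module Sum {R : Set} {_+_ _*_ : R → R → R} {0# 1# : R}
           (isCSR : Algebra.Structures.IsCommutativeSemiring _≡_ _+_ _*_ 0# 1#) where
  open import Algebra.Structures using (IsCommutativeSemiring)
  open import Relation.Binary.PropositionalEquality
  open import Data.Nat.Base as ℕ using (ℕ; zero; suc; _<_; _∸_)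
  import Data.Nat.Properties as ℕ
  open import Relation.Nullary using (yes; no)
  open import Data.Empty using (⊥-elim)
  open import Function using (_∘_)
  open IsCommutativeSemiring isCSR using
    (+-assoc; +-comm; +-identityˡ; +-identityʳ; distribˡ; zeroʳ)
  open ≡-Reasoning

  -- Finite sums over a commutative semiring.

  ∑ : (ℕ → R) → ℕ → R
  ∑ f zero    = 0#
  ∑ f (suc n) = ∑ f n + f n

  +-interchange : ∀ a b c d → (a + b) + (c + d) ≡ (a + c) + (b + d)
  +-interchange a b c d = begin
    (a + b) + (c + d)  ≡⟨ +-assoc a b (c + d) ⟩
    a + (b + (c + d))  ≡⟨ cong (a +_) (+-assoc b c d) ⟨
    a + ((b + c) + d)  ≡⟨ cong (λ x → a + (x + d)) (+-comm b c) ⟩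
    a + ((c + b) + d)  ≡⟨ cong (a +_) (+-assoc c b d) ⟩
    a + (c + (b + d))  ≡⟨ +-assoc a c (b + d) ⟨
    (a + c) + (b + d)  ∎

  ∑-cong : ∀ {f g} n → (∀ i → i < n → f i ≡ g i) → ∑ f n ≡ ∑ g n
  ∑-cong zero    eq = refl
  ∑-cong (suc n) eq =
    cong₂ _+_ (∑-cong n λ i i<n → eq i (ℕ.m<n⇒m<1+n i<n)) (eq n (ℕ.n<1+n n))

  ∑-0 : ∀ n → ∑ (λ _ → 0#) n ≡ 0#
  ∑-0 zero    = refl
  ∑-0 (suc n) = trans (+-identityʳ _) (∑-0 n)

  ∑-+ : ∀ f g n → ∑ (λ i → f i + g i) n ≡ ∑ f n + ∑ g n
  ∑-+ f g zero    = sym (+-identityʳ 0#)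
  ∑-+ f g (suc n) = trans (cong (_+ (f n + g n)) (∑-+ f g n)) (+-interchange _ _ _ _)

  ∑-*ˡ : ∀ c f n → c * ∑ f n ≡ ∑ (λ i → c * f i) n
  ∑-*ˡ c f zero    = zeroʳ c
  ∑-*ˡ c f (suc n) = trans (distribˡ c _ _) (cong (_+ (c * f n)) (∑-*ˡ c f n))

  ∑-swap : ∀ (f : ℕ → ℕ → R) m n →
           ∑ (λ i → ∑ (f i) n) m ≡ ∑ (λ j → ∑ (λ i → f i j) m) n
  ∑-swap f zero    n = sym (∑-0 n)
  ∑-swap f (suc m) n =
    trans (cong (_+ ∑ (f m) n) (∑-swap f m n)) (sym (∑-+ _ (f m) n))

  ∑-split : ∀ f m n → ∑ f (m ℕ.+ n) ≡ ∑ f m + ∑ (λ i → f (m ℕ.+ i)) n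
  ∑-split f m zero    = trans (cong (∑ f) (ℕ.+-identityʳ m)) (sym (+-identityʳ _))
  ∑-split f m (suc n) = begin
    ∑ f (m ℕ.+ suc n)                                   ≡⟨ cong (∑ f) (ℕ.+-suc m n) ⟩
    ∑ f (m ℕ.+ n) + f (m ℕ.+ n)                         ≡⟨ cong (_+ _) (∑-split f m n) ⟩
    (∑ f m + ∑ (λ i → f (m ℕ.+ i)) n) + f (m ℕ.+ n)     ≡⟨ +-assoc _ _ _ ⟩
    ∑ f m + (∑ (λ i → f (m ℕ.+ i)) n + f (m ℕ.+ n))     ∎

  ∑-head : ∀ f n → ∑ f (suc n) ≡ f 0 + ∑ (f ∘ suc) n
  ∑-head f n = trans (∑-split f 1 n) (cong (_+ ∑ (f ∘ suc) n) (+-identityˡ (f 0)))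

  ∑-rev : ∀ f n → ∑ (λ i → f (n ∸ suc i)) n ≡ ∑ f n
  ∑-rev f zero    = refl
  ∑-rev f (suc n) = begin
    ∑ (λ i → f (n ∸ i)) (suc n)          ≡⟨ ∑-head (λ i → f (n ∸ i)) n ⟩
    f n + ∑ (λ i → f (n ∸ suc i)) n      ≡⟨ cong (f n +_) (∑-rev f n) ⟩
    f n + ∑ f n                          ≡⟨ +-comm _ _ ⟩
    ∑ f n + f n                          ∎

  ∑-single : ∀ f {n} j → j < n → (∀ i → i < n → i ≢ j → f i ≡ 0#) → ∑ f n ≡ f j
  ∑-single f {suc n} j j<n z with j ℕ.≟ n
  ... | yes refl = trans (cong (_+ f n) (trans
        (∑-cong n λ i i<n → z i (ℕ.m<n⇒m<1+n i<n) (ℕ.<⇒≢ i<n)) (∑-0 n)))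
        (+-identityˡ _)
  ... | no j≢n = trans (cong₂ _+_
        (∑-single f j (ℕ.≤∧≢⇒< (ℕ.≤-pred j<n) j≢n) λ i i<n → z i (ℕ.m<n⇒m<1+n i<n))
        (z n (ℕ.n<1+n n) λ n≡j → j≢n (sym n≡j))) (+-identityʳ _)

  -- Both sides are the total of a matrix `δ` that carries `f (π i)` at the place (i , π i) and
  -- vanishes elsewhere. As π and ρ are mutually inverse on [0 , n), each row and each column
  -- contains one such place.
  ∑-reindex : ∀ f n (π ρ : ℕ → ℕ) → (∀ i → i < n → π i < n) → (∀ j → j < n → ρ j < n) →
              (∀ i → i < n → ρ (π i) ≡ i) → (∀ j → j < n → π (ρ j) ≡ j) →
              ∑ (f ∘ π) n ≡ ∑ f n
  ∑-reindex f n π ρ π< ρ< ρπ πρ = begin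
    ∑ (f ∘ π) n                        ≡⟨ ∑-cong n (λ i i<n → sym (row i i<n)) ⟩
    ∑ (λ i → ∑ (λ j → δ i j) n) n      ≡⟨ ∑-swap δ n n ⟩
    ∑ (λ j → ∑ (λ i → δ i j) n) n      ≡⟨ ∑-cong n column ⟩
    ∑ f n                              ∎
    where
    δ : ℕ → ℕ → R
    δ i j with π i ℕ.≟ j
    ... | yes _ = f j
    ... | no  _ = 0#

    δ-yes : ∀ i j → π i ≡ j → δ i j ≡ f j
    δ-yes i j eq with π i ℕ.≟ j
    ... | yes _ = refl
    ... | no ne = ⊥-elim (ne eq)

    δ-no : ∀ i j → π i ≢ j → δ i j ≡ 0#
    δ-no i j ne with π i ℕ.≟ j
    ... | yes eq = ⊥-elim (ne eq)
    ... | no  _  = refl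

    row : ∀ i → i < n → ∑ (δ i) n ≡ f (π i)
    row i i<n = trans
      (∑-single (δ i) (π i) (π< i i<n) λ j _ j≢ → δ-no i j λ eq → j≢ (sym eq))
      (δ-yes i (π i) refl)

    column : ∀ j → j < n → ∑ (λ i → δ i j) n ≡ f j
    column j j<n = trans
      (∑-single (λ i → δ i j) (ρ j) (ρ< j j<n) λ i i<n i≢ → δ-no i j λ eq →
        i≢ (trans (sym (ρπ i i<n)) (cong ρ eq)))
      (δ-yes (ρ j) j (πρ j j<n))

-- Sets of naturals as Boolean predicates: counting, search, sumsets.

module Count where
  open import Data.Nat.Base
  open import Data.Nat.Properties
  open import Data.Nat.Tactic.RingSolver using (solve-∀)
  open import Data.Bool.Base using (Bool; T; true; false; _∧_; _∨_; not; if_then_else_)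
  open import Data.Product.Base using (∃-syntax; _×_; _,_)
  open import Data.Sum.Base using (_⊎_; inj₁; inj₂)
  open import Data.Empty using (⊥; ⊥-elim)
  open import Relation.Binary.PropositionalEquality
  open Sum +-*-isCommutativeSemiring public

  swapʳ : ∀ a b c → a + b + c ≡ a + c + b
  swapʳ = solve-∀

  Pred : Set
  Pred = ℕ → Bool

  infix 4 _∋_ _∌_
  _∋_ _∌_ : Pred → ℕ → Set
  P ∋ x = P x ≡ true
  P ∌ x = P x ≡ false

  ∋-∌ : ∀ P x → P ∋ x → P ∌ x → ⊥
  ∋-∌ P x p q with () ← trans (sym p) q

  ∋? : ∀ P x → P ∋ x ⊎ P ∌ x
  ∋? P x with P x
  ... | true  = inj₁ refl
  ... | false = inj₂ refl

  not-∋ : ∀ P x → (P ∋ x → ⊥) → P ∌ x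
  not-∋ P x h with ∋? P x
  ... | inj₁ p = ⊥-elim (h p)
  ... | inj₂ q = q

  ⟦_⟧ : Bool → ℕ
  ⟦ b ⟧ = if b then 1 else 0

  ⟦⟧≤1 : ∀ b → ⟦ b ⟧ ≤ 1
  ⟦⟧≤1 true  = ≤-refl
  ⟦⟧≤1 false = z≤n

  ⟦⟧-mono : ∀ {a b} → (a ≡ true → b ≡ true) → ⟦ a ⟧ ≤ ⟦ b ⟧
  ⟦⟧-mono {false} h = z≤n
  ⟦⟧-mono {true}  h rewrite h refl = ≤-refl

  ∋⇒1≤ : ∀ {b} → b ≡ true → 1 ≤ ⟦ b ⟧
  ∋⇒1≤ refl = ≤-refl

  cnt : Pred → ℕ → ℕ
  cnt P = ∑ (λ i → ⟦ P i ⟧)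

  ∑-mono : ∀ {f g} n → (∀ i → i < n → f i ≤ g i) → ∑ f n ≤ ∑ g n
  ∑-mono zero    h = z≤n
  ∑-mono (suc n) h = +-mono-≤ (∑-mono n λ i i<n → h i (m<n⇒m<1+n i<n)) (h n (n<1+n n))

  ∑-const : ∀ c n → ∑ (λ _ → c) n ≡ n * c
  ∑-const c zero    = refl
  ∑-const c (suc n) = trans (cong (_+ c) (∑-const c n)) (+-comm (n * c) c)

  ∑-term : ∀ f n i → i < n → f i ≤ ∑ f n
  ∑-term f (suc n) i i<n with m≤n⇒m<n∨m≡n (≤-pred i<n)
  ... | inj₁ i<n' = ≤-trans (∑-term f n i i<n') (m≤m+n _ _)
  ... | inj₂ refl = m≤n+m _ _

  ∑-monoʳ : ∀ f {m n} → m ≤ n → ∑ f m ≤ ∑ f n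
  ∑-monoʳ f {m} {n} m≤n = begin
    ∑ f m                                         ≤⟨ m≤m+n _ _ ⟩
    ∑ f m + ∑ (λ i → f (m + i)) (n ∸ m)           ≡⟨ ∑-split f m (n ∸ m) ⟨
    ∑ f (m + (n ∸ m))                             ≡⟨ cong (∑ f) (m+[n∸m]≡n m≤n) ⟩
    ∑ f n                                         ∎
    where open ≤-Reasoning

  cnt≤ : ∀ P n → cnt P n ≤ n
  cnt≤ P n = ≤-trans (∑-mono n λ i _ → ⟦⟧≤1 (P i)) (≤-reflexive (trans (∑-const 1 n) (*-identityʳ n)))

  cnt-full : ∀ P n → (∀ i → i < n → P ∋ i) → cnt P n ≡ n
  cnt-full P n h = trans (∑-cong n λ i i<n → cong ⟦_⟧ (h i i<n)) (trans (∑-const 1 n) (*-identityʳ n))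

  cnt-empty : ∀ P n → (∀ i → i < n → P ∌ i) → cnt P n ≡ 0
  cnt-empty P n h = trans (∑-cong n λ i i<n → cong ⟦_⟧ (h i i<n)) (∑-0 n)

  cnt-mono : ∀ {P Q : Pred} n → (∀ i → i < n → P ∋ i → Q ∋ i) → cnt P n ≤ cnt Q n
  cnt-mono n h = ∑-mono n λ i i<n → ⟦⟧-mono (h i i<n)

  cnt-cong : ∀ {P Q : Pred} n → (∀ i → i < n → P i ≡ Q i) → cnt P n ≡ cnt Q n
  cnt-cong n h = ∑-cong n λ i i<n → cong ⟦_⟧ (h i i<n)

  shift : ℕ → Pred → Pred
  shift a P i = P (a + i)

  cnt-split : ∀ P m n → cnt P (m + n) ≡ cnt P m + cnt (shift m P) n
  cnt-split P = ∑-split (λ i → ⟦ P i ⟧)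

  cnt-stop : ∀ P m n → m ≤ n → (∀ i → m ≤ i → i < n → P ∌ i) → cnt P n ≡ cnt P m
  cnt-stop P m n m≤n h = begin
    cnt P n                                  ≡⟨ cong (cnt P) (m+[n∸m]≡n m≤n) ⟨
    cnt P (m + (n ∸ m))                      ≡⟨ cnt-split P m (n ∸ m) ⟩
    cnt P m + cnt (shift m P) (n ∸ m)        ≡⟨ cong (cnt P m +_) (cnt-empty (shift m P) (n ∸ m) λ i i< →
                                                  h (m + i) (m≤m+n m i) (<-≤-trans (+-monoʳ-< m i<)
                                                      (≤-reflexive (m+[n∸m]≡n m≤n)))) ⟩
    cnt P m + 0                              ≡⟨ +-identityʳ _ ⟩
    cnt P m                                  ∎
    where open ≡-Reasoning

  cnt-step : ∀ P n → P ∋ n → cnt P (suc n) ≡ suc (cnt P n)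
  cnt-step P n e rewrite e = +-comm (cnt P n) 1

  -- The reflection i ↦ u - i. The guard keeps truncated subtraction from sending every i > u to 0.
  flip-at : ℕ → Pred → Pred
  flip-at u P i = (i ≤ᵇ u) ∧ P (u ∸ i)

  ∧-true : ∀ {a b} → a ∧ b ≡ true → a ≡ true × b ≡ true
  ∧-true {true} e = refl , e

  ∨-true : ∀ {a b} → a ∨ b ≡ true → a ≡ true ⊎ b ≡ true
  ∨-true {true}  e = inj₁ refl
  ∨-true {false} e = inj₂ e

  ∨ˡ : ∀ {a b} → a ≡ true → a ∨ b ≡ true
  ∨ˡ refl = refl

  ∨ʳ : ∀ {a b} → b ≡ true → a ∨ b ≡ true
  ∨ʳ {true}  e = refl
  ∨ʳ {false} e = e

  ∧-intro : ∀ {a b} → a ≡ true → b ≡ true → a ∧ b ≡ true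
  ∧-intro refl refl = refl

  not-true : ∀ {b} → not b ≡ true → b ≡ false
  not-true {false} _ = refl

  not-false : ∀ {b} → not b ≡ false → b ≡ true
  not-false {true} _ = refl

  T⇒≡ : ∀ {b} → T b → b ≡ true
  T⇒≡ {true} _ = refl

  ≡⇒T : ∀ {b} → b ≡ true → T b
  ≡⇒T refl = _

  ≤ᵇ-true : ∀ {m n} → m ≤ n → (m ≤ᵇ n) ≡ true
  ≤ᵇ-true m≤n = T⇒≡ (≤⇒≤ᵇ m≤n)

  ≤ᵇ-≤ : ∀ {m n} → (m ≤ᵇ n) ≡ true → m ≤ n
  ≤ᵇ-≤ {m} e = ≤ᵇ⇒≤ m _ (≡⇒T e)

  flip-intro : ∀ u P x i → x + i ≡ u → P ∋ x → flip-at u P ∋ i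
  flip-intro u P x i refl px = ∧-intro (≤ᵇ-true (m≤n+m i x)) (trans (cong P (m+n∸n≡m x i)) px)

  flip-elim : ∀ u P i → flip-at u P ∋ i → ∃[ x ] x + i ≡ u × P ∋ x
  flip-elim u P i e with h₁ , h₂ ← ∧-true {i ≤ᵇ u} e = u ∸ i , m∸n+n≡m (≤ᵇ-≤ {i} h₁) , h₂

  cnt-flip : ∀ u P → cnt (flip-at u P) (suc u) ≡ cnt P (suc u)
  cnt-flip u P = trans
    (∑-cong (suc u) λ i i<u → cong (λ b → ⟦ b ∧ P (u ∸ i) ⟧) (≤ᵇ-true (≤-pred i<u)))
    (∑-rev (λ i → ⟦ P i ⟧) (suc u))

  any : Pred → ℕ → Bool
  any P zero    = false
  any P (suc n) = P n ∨ any P n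

  any-intro : ∀ P n i → i < n → P ∋ i → any P n ≡ true
  any-intro P (suc n) i i<n p with m≤n⇒m<n∨m≡n (≤-pred i<n)
  ... | inj₁ i<n' = ∨ʳ {P n} (any-intro P n i i<n' p)
  ... | inj₂ refl = ∨ˡ p

  any-elim : ∀ P n → any P n ≡ true → ∃[ i ] i < n × P ∋ i
  any-elim P (suc n) e with ∨-true {P n} e
  ... | inj₁ p = n , n<1+n n , p
  ... | inj₂ q with i , i<n , p ← any-elim P n q = i , m<n⇒m<1+n i<n , p

  any-none : ∀ P n → any P n ≡ false → ∀ i → i < n → P ∌ i
  any-none P n e i i<n = not-∋ P i λ p → ∋-∌ (any P) n (any-intro P n i i<n p) e

  find : ∀ P n → (∃[ i ] i < n × P ∋ i) ⊎ (∀ i → i < n → P ∌ i)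
  find P n with ∋? (any P) n
  ... | inj₁ e = inj₁ (any-elim P n e)
  ... | inj₂ e = inj₂ (any-none P n e)

  first : ∀ P n → (∃[ i ] i < n × P ∋ i × (∀ j → j < i → P ∌ j)) ⊎ (∀ i → i < n → P ∌ i)
  first P zero = inj₂ λ _ ()
  first P (suc n) with first P n
  ... | inj₁ (i , i<n , p , h) = inj₁ (i , m<n⇒m<1+n i<n , p , h)
  ... | inj₂ none with ∋? P n
  ...   | inj₁ p = inj₁ (n , n<1+n n , p , none)
  ...   | inj₂ q = inj₂ λ i i<n → case i i<n
    where
    case : ∀ i → i < suc n → P ∌ i
    case i i<n with m≤n⇒m<n∨m≡n (≤-pred i<n)
    ... | inj₁ i<n' = none i i<n'
    ... | inj₂ refl = q

  last : ∀ P n → (∃[ i ] i < n × P ∋ i × (∀ j → i < j → j < n → P ∌ j)) ⊎ (∀ i → i < n → P ∌ i)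
  last P zero = inj₂ λ _ ()
  last P (suc n) with ∋? P n
  ... | inj₁ p = inj₁ (n , n<1+n n , p , λ j n<j j<n → ⊥-elim (<-irrefl refl (<-≤-trans n<j (≤-pred j<n))))
  ... | inj₂ q with last P n
  ...   | inj₁ (i , i<n , p , h) = inj₁ (i , m<n⇒m<1+n i<n , p , λ j i<j j<n → case j i<j j<n)
    where
    case : ∀ j → i < j → j < suc n → P ∌ j
    case j i<j j<n with m≤n⇒m<n∨m≡n (≤-pred j<n)
    ... | inj₁ j<n' = h j i<j j<n'
    ... | inj₂ refl = q
  ...   | inj₂ none = inj₂ λ i i<n → case i i<n
    where
    case : ∀ i → i < suc n → P ∌ i
    case i i<n with m≤n⇒m<n∨m≡n (≤-pred i<n)
    ... | inj₁ i<n' = none i i<n'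
    ... | inj₂ refl = q

  infixl 6 _⊹_
  abstract
    -- The sumset in ℕ, with no reduction modulo p. It is sealed, so later proofs see it only
    -- through introduction, elimination and the pigeonhole bound, and memberships do not unfold
    -- into searches.
    _⊹_ : Pred → Pred → Pred
    (A ⊹ B) z = any (λ i → A i ∧ B (z ∸ i)) (suc z)

    ⊹-intro : ∀ A B {x y} → A ∋ x → B ∋ y → A ⊹ B ∋ x + y
    ⊹-intro A B {x} {y} ax by = any-intro _ (suc (x + y)) x (s≤s (m≤m+n x y))
      (∧-intro ax (trans (cong B (m+n∸m≡n x y)) by))

    ⊹-intro≡ : ∀ A B {x y z} → A ∋ x → B ∋ y → x + y ≡ z → A ⊹ B ∋ z
    ⊹-intro≡ A B ax by refl = ⊹-intro A B ax by

    ⊹-elim : ∀ A B z → A ⊹ B ∋ z → ∃[ x ] ∃[ y ] x + y ≡ z × A ∋ x × B ∋ y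
    ⊹-elim A B z e with i , i<z , h ← any-elim _ (suc z) e
      with ax , by ← ∧-true {A i} h =
      i , z ∸ i , m+[n∸m]≡n (≤-pred i<z) , ax , by

    -- If z were no sum, each i ≤ z would satisfy at most one of i ∈ A and z - i ∈ B, and the two
    -- counts on [0 , z] would add up to at most z + 1.
    pigeon : ∀ A B z → suc z < cnt A (suc z) + cnt B (suc z) → A ⊹ B ∋ z
    pigeon A B z big with ∋? (A ⊹ B) z
    ... | inj₁ e = e
    ... | inj₂ e = ⊥-elim (<-irrefl refl (begin-strict
      suc z                                                       <⟨ big ⟩
      cnt A (suc z) + cnt B (suc z)                               ≡⟨ cong (cnt A (suc z) +_)
          (∑-rev (λ i → ⟦ B i ⟧) (suc z)) ⟨
      cnt A (suc z) + ∑ (λ i → ⟦ B (z ∸ i) ⟧) (suc z)             ≡⟨ ∑-+ _ _ (suc z) ⟨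
      ∑ (λ i → ⟦ A i ⟧ + ⟦ B (z ∸ i) ⟧) (suc z)                   ≤⟨ ∑-mono (suc z)
          (λ i i<z → disj {A i} (any-none _ (suc z) e i i<z)) ⟩
      ∑ (λ i → 1) (suc z)                                         ≡⟨ trans (∑-const 1 (suc z)) (*-identityʳ _) ⟩
      suc z                                                       ∎))
      where
      open ≤-Reasoning
      disj : ∀ {a b} → a ∧ b ≡ false → ⟦ a ⟧ + ⟦ b ⟧ ≤ 1
      disj {true}  {false} _ = ≤-refl
      disj {false} {b}     _ = ⟦⟧≤1 b

  interchange-shift : ∀ e x y → (e + x) + (e + y) ≡ e + (e + (x + y))
  interchange-shift = solve-∀

  -- The pigeonhole for the upper ends of the two sets, where only elements from e on are counted.
  pigeon-shift : ∀ A B e z → suc z < cnt (shift e A) (suc z) + cnt (shift e B) (suc z) →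
                 A ⊹ B ∋ e + (e + z)
  pigeon-shift A B e z big
    with x , y , eq , ax , by ← ⊹-elim (shift e A) (shift e B) z (pigeon (shift e A) (shift e B) z big) =
    ⊹-intro≡ A B ax by (trans (interchange-shift e x y) (cong (λ w → e + (e + w)) eq))

-- Linear inequalities over ℕ from Farkas certificates.

module LinearArithmetic where
  open import Data.Nat.Base
  open import Data.Nat.Properties
  open import Data.Nat.Tactic.RingSolver using (solve-∀)
  open import Data.Bool.Base using (Bool; true; _∧_; T)
  open import Data.Bool.Properties using (T-∧)
  open import Data.Empty using (⊥)
  open import Data.Fin.Base using (Fin; zero; suc)
  open import Data.Product.Base using (_,_)
  open import Data.Vec.Base using (Vec; []; _∷_; lookup; replicate; zipWith; map; allFin)
  open import Data.Vec.N-ary using (N-ary; _$ⁿ_)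
  open import Function.Bundles using (Equivalence)
  open import Relation.Nullary using (contradiction)
  open import Relation.Binary.PropositionalEquality

  infixr 1 _·_⇒_
  infix 2 ⊢_·_
  infix 4 _⩽_ _≺_ _≐_ _≐˘_
  infixl 6 _⊕_
  infixl 7 _⊛_

  data Linear (n : ℕ) : Set where
    var  : Fin n → Linear n
    con  : ℕ → Linear n
    _⊕_  : Linear n → Linear n → Linear n
    _⊛_  : ℕ → Linear n → Linear n

  eval : ∀ {n} → Linear n → Vec ℕ n → ℕ
  eval (var i) ρ = lookup ρ i
  eval (con c) ρ = c
  eval (e ⊕ f) ρ = eval e ρ + eval f ρ
  eval (k ⊛ e) ρ = k * eval e ρ

  unit : ∀ {n} → Fin n → Vec ℕ n
  unit zero    = 1 ∷ replicate _ 0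
  unit (suc i) = 0 ∷ unit i

  coeffs : ∀ {n} → Linear n → Vec ℕ n
  coeffs (var i) = unit i
  coeffs (con c) = replicate _ 0
  coeffs (e ⊕ f) = zipWith _+_ (coeffs e) (coeffs f)
  coeffs (k ⊛ e) = map (k *_) (coeffs e)

  constant : ∀ {n} → Linear n → ℕ
  constant (var i) = 0
  constant (con c) = c
  constant (e ⊕ f) = constant e + constant f
  constant (k ⊛ e) = k * constant e

  dot : ∀ {n} → Vec ℕ n → Vec ℕ n → ℕ
  dot []      []      = 0
  dot (c ∷ v) (x ∷ ρ) = c * x + dot v ρ

  private
    mid : ∀ a b c d → (a + b) + (c + d) ≡ (a + c) + (b + d)
    mid = solve-∀

    step : ∀ a b x c d → (a + b) * x + (c + d) ≡ (a * x + c) + (b * x + d)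
    step = solve-∀

    scale : ∀ k a x d → k * (a * x + d) ≡ k * a * x + k * d
    scale = solve-∀

  dot-0 : ∀ {n} (ρ : Vec ℕ n) → dot (replicate _ 0) ρ ≡ 0
  dot-0 []      = refl
  dot-0 (x ∷ ρ) = dot-0 ρ

  dot-unit : ∀ {n} i (ρ : Vec ℕ n) → dot (unit i) ρ ≡ lookup ρ i
  dot-unit zero    (x ∷ ρ) = trans (cong (x + 0 +_) (dot-0 ρ)) (trans (+-identityʳ _) (+-identityʳ x))
  dot-unit (suc i) (x ∷ ρ) = dot-unit i ρ

  dot-+ : ∀ {n} (v w ρ : Vec ℕ n) → dot (zipWith _+_ v w) ρ ≡ dot v ρ + dot w ρ
  dot-+ []      []      []      = refl
  dot-+ (a ∷ v) (b ∷ w) (x ∷ ρ) = trans (cong ((a + b) * x +_) (dot-+ v w ρ)) (step a b x (dot v ρ) (dot w ρ))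

  dot-* : ∀ {n} k (v ρ : Vec ℕ n) → dot (map (k *_) v) ρ ≡ k * dot v ρ
  dot-* k []      []      = sym (*-zeroʳ k)
  dot-* k (a ∷ v) (x ∷ ρ) = trans (cong (k * a * x +_) (dot-* k v ρ)) (sym (scale k a x (dot v ρ)))

  eval-normal : ∀ {n} (e : Linear n) ρ → eval e ρ ≡ constant e + dot (coeffs e) ρ
  eval-normal (var i) ρ = sym (dot-unit i ρ)
  eval-normal (con c) ρ = sym (trans (cong (c +_) (dot-0 ρ)) (+-identityʳ c))
  eval-normal (e ⊕ f) ρ = trans (cong₂ _+_ (eval-normal e ρ) (eval-normal f ρ))
    (trans (mid (constant e) (dot (coeffs e) ρ) (constant f) (dot (coeffs f) ρ))
           (cong (constant e + constant f +_) (sym (dot-+ (coeffs e) (coeffs f) ρ))))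
  eval-normal (k ⊛ e) ρ = trans (cong (k *_) (eval-normal e ρ))
    (trans (*-distribˡ-+ k (constant e) _) (cong (k * constant e +_) (sym (dot-* k (coeffs e) ρ))))

  suc′ : ∀ {n} → Linear n → Linear n
  suc′ e = con 1 ⊕ e

  -- e ≐˘ f is the hypothesis e ≡ f used as f ≤ e.
  data Atom (n : ℕ) : Set where
    _⩽_ _≺_ _≐_ _≐˘_ : Linear n → Linear n → Atom n

  ⟦_⟧ᴬ : ∀ {n} → Atom n → Vec ℕ n → Set
  ⟦ e ⩽ f ⟧ᴬ ρ  = eval e ρ ≤ eval f ρ
  ⟦ e ≺ f ⟧ᴬ ρ  = eval e ρ < eval f ρ
  ⟦ e ≐ f ⟧ᴬ ρ  = eval e ρ ≡ eval f ρ
  ⟦ e ≐˘ f ⟧ᴬ ρ = eval e ρ ≡ eval f ρ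

  lhs rhs : ∀ {n} → Atom n → Linear n
  lhs (e ⩽ f)  = e
  lhs (e ≺ f)  = suc′ e
  lhs (e ≐ f)  = e
  lhs (e ≐˘ f) = f
  rhs (e ⩽ f)  = f
  rhs (e ≺ f)  = f
  rhs (e ≐ f)  = f
  rhs (e ≐˘ f) = e

  atom-≤ : ∀ {n} (a : Atom n) ρ → ⟦ a ⟧ᴬ ρ → eval (lhs a) ρ ≤ eval (rhs a) ρ
  atom-≤ (e ⩽ f)  ρ h = h
  atom-≤ (e ≺ f)  ρ h = h
  atom-≤ (e ≐ f)  ρ h = ≤-reflexive h
  atom-≤ (e ≐˘ f) ρ h = ≤-reflexive (sym h)

  -- An implication together with its Farkas certificate: each hypothesis carries
  -- its multiplier, and ⊢ k · a concludes a from suc k times a.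
  data Claim (n : ℕ) : Set where
    _·_⇒_  : ℕ → Atom n → Claim n → Claim n
    ⊢_·_   : ℕ → Atom n → Claim n
    ⊢⊥ : Claim n

  ⟦_⟧ : ∀ {n} → Claim n → Vec ℕ n → Set
  ⟦ k · a ⇒ c ⟧ ρ = ⟦ a ⟧ᴬ ρ → ⟦ c ⟧ ρ
  ⟦ ⊢ k · a ⟧ ρ   = eval (lhs a) ρ ≤ eval (rhs a) ρ
  ⟦ ⊢⊥ ⟧ ρ    = ⊥

  _≤ᵛ_ : ∀ {n} → Vec ℕ n → Vec ℕ n → Bool
  []      ≤ᵛ []      = true
  (a ∷ v) ≤ᵛ (b ∷ w) = (a ≤ᵇ b) ∧ (v ≤ᵛ w)

  -- Variables range over ℕ, so comparing constants and coefficients one by one suffices for an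
  -- inequality at every valuation.
  dominated : ∀ {n} → Linear n → Linear n → Bool
  dominated e f = (constant e ≤ᵇ constant f) ∧ (coeffs e ≤ᵛ coeffs f)

  -- L ⩽ R accumulates the hypotheses met so far.
  valid : ∀ {n} → Linear n → Linear n → Claim n → Bool
  valid L R (k · a ⇒ c) = valid (k ⊛ lhs a ⊕ L) (k ⊛ rhs a ⊕ R) c
  valid L R (⊢ k · a)   = dominated (suc k ⊛ lhs a ⊕ R) (suc k ⊛ rhs a ⊕ con k ⊕ L)
  valid L R ⊢⊥      = dominated (con 1 ⊕ R) L

  dot-mono : ∀ {n} (v w ρ : Vec ℕ n) → T (v ≤ᵛ w) → dot v ρ ≤ dot w ρ
  dot-mono []      []      []      _  = z≤n
  dot-mono (a ∷ v) (b ∷ w) (x ∷ ρ) ok with le , ok′ ← Equivalence.to (T-∧ {a ≤ᵇ b}) ok =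
    +-mono-≤ (*-monoˡ-≤ x (≤ᵇ⇒≤ a b le)) (dot-mono v w ρ ok′)

  dominated-sound : ∀ {n} (e f : Linear n) ρ → T (dominated e f) → eval e ρ ≤ eval f ρ
  dominated-sound e f ρ ok with le , ok′ ← Equivalence.to (T-∧ {constant e ≤ᵇ constant f}) ok =
    subst₂ _≤_ (sym (eval-normal e ρ)) (sym (eval-normal f ρ))
      (+-mono-≤ (≤ᵇ⇒≤ (constant e) (constant f) le) (dot-mono (coeffs e) (coeffs f) ρ ok′))

  -- Rounding: (k + 1) a ≤ (k + 1) b + k already forces a ≤ b over the integers. A conclusion
  -- multiplied by k + 1 may thus miss by k, which admits bounds that fail over the rationals.
  divide : ∀ k {a b L R} → L ≤ R → suc k * a + R ≤ suc k * b + k + L → a ≤ b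
  divide k {a} {b} {L} {R} L≤R le = ≮⇒≥ λ b<a → <-irrefl refl (begin-strict
    suc k * b + k + L         <⟨ +-monoˡ-< L (begin-strict
      suc k * b + k             <⟨ +-monoʳ-< (suc k * b) (n<1+n k) ⟩
      suc k * b + suc k         ≡⟨ trans (*-suc (suc k) b) (+-comm (suc k) _) ⟨
      suc k * suc b             ≤⟨ *-monoʳ-≤ (suc k) b<a ⟩
      suc k * a                 ∎) ⟩
    suc k * a + L             ≤⟨ +-monoʳ-≤ (suc k * a) L≤R ⟩
    suc k * a + R             ≤⟨ le ⟩
    suc k * b + k + L         ∎)
    where open ≤-Reasoning

  sound : ∀ {n} (L R : Linear n) c ρ → T (valid L R c) → eval L ρ ≤ eval R ρ → ⟦ c ⟧ ρ
  sound L R (k · a ⇒ c) ρ ok L≤R h =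
    sound (k ⊛ lhs a ⊕ L) (k ⊛ rhs a ⊕ R) c ρ ok (+-mono-≤ (*-monoʳ-≤ k (atom-≤ a ρ h)) L≤R)
  sound L R (⊢ k · a) ρ ok L≤R =
    divide k L≤R (dominated-sound (suc k ⊛ lhs a ⊕ R) (suc k ⊛ rhs a ⊕ con k ⊕ L) ρ ok)
  sound L R ⊢⊥ ρ ok L≤R = contradiction (dominated-sound (con 1 ⊕ R) L ρ ok) (≤⇒≯ L≤R)

  Curried : ∀ n → (Vec ℕ n → Set) → Set
  Curried zero    P = P []
  Curried (suc n) P = ∀ x → Curried n (λ ρ → P (x ∷ ρ))

  curried : ∀ n {P : Vec ℕ n → Set} → (∀ ρ → P ρ) → Curried n P
  curried zero    h   = h []
  curried (suc n) h x = curried n (λ ρ → h (x ∷ ρ))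

  -- The implicit argument computes to the unit type when the multipliers certify the claim, and is
  -- then found by unification; wrong multipliers leave an empty type to inhabit.
  linear : ∀ n (f : N-ary n (Linear n) (Claim n)) →
           let c = f $ⁿ map var (allFin n) in {T (valid (con 0) (con 0) c)} → Curried n ⟦ c ⟧
  linear n f {ok} = curried n λ ρ → sound (con 0) (con 0) (f $ⁿ map var (allFin n)) ρ ok z≤n

-- The sumset of two subsets of one interval.

module TwoSets where
  open import Data.Nat.Base
  open import Data.Nat.Properties
  open import Data.Bool.Base using (Bool; true; false; not)
  open import Data.List.Base using ([])
  open import Data.Vec.Base using ([])
  open LinearArithmetic using (linear; _⊕_; con; suc′; _⩽_; _≺_; _≐_; _·_⇒_; ⊢_·_; ⊢⊥)
  open import Data.Product.Base using (∃-syntax; _×_; _,_)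
  open import Data.Sum.Base using (_⊎_; inj₁; inj₂)
  open import Data.Empty using (⊥; ⊥-elim)
  open import Relation.Nullary using (yes; no)
  open import Relation.Binary.PropositionalEquality
  open Count

  Supp : Pred → ℕ → Set
  Supp P u = ∀ i → P ∋ i → i ≤ u

  private abstract
    low-or-high : ∀ a e τ σ σ' → σ ≤ σ' → σ' ≤ suc e → e + τ ≤ suc a + σ → a + 3 ≤ τ → ⊥
    low-or-high = linear 5 (λ a e τ σ σ' → 1 · σ ⩽ σ' ⇒ 1 · σ' ⩽ suc′ e ⇒
        1 · e ⊕ τ ⩽ suc′ a ⊕ σ ⇒ 1 · a ⊕ con 3 ⩽ τ ⇒ ⊢⊥)

    persist : ∀ z b τ W a w β → z + b + τ ≤ W + (a + 3) → 1 + β ≤ w →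
              suc z + (b + β) + τ ≤ W + w + (a + 3)
    persist = linear 7 (λ z b τ W a w β → 1 · z ⊕ b ⊕ τ ⩽ W ⊕ (a ⊕ con 3) ⇒ 1 · con 1 ⊕ β ⩽ w ⇒
        ⊢ 0 · suc′ z ⊕ (b ⊕ β) ⊕ τ ⩽ W ⊕ w ⊕ (a ⊕ con 3))

    start : ∀ z b τ W σ a → z + b ≤ W → z + τ ≤ suc a + σ → z + z + b + τ ≤ W + σ + (a + 2)
    start = linear 6 (λ z b τ W σ a → 1 · z ⊕ b ⩽ W ⇒ 1 · z ⊕ τ ⩽ suc′ a ⊕ σ ⇒
        ⊢ 0 · z ⊕ z ⊕ b ⊕ τ ⩽ W ⊕ σ ⊕ (a ⊕ con 2))

    grow : ∀ z b τ W σ a w α β → z + z + b + τ ≤ W + σ + (a + 2) → 1 + β ≤ w → 1 ≤ α + β →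
           suc z + suc z + (b + β) + τ ≤ W + w + (σ + (α + β)) + (a + 2)
    grow = linear 9 (λ z b τ W σ a w α β → 1 · z ⊕ z ⊕ b ⊕ τ ⩽ W ⊕ σ ⊕ (a ⊕ con 2) ⇒
        1 · con 1 ⊕ β ⩽ w ⇒ 1 · con 1 ⩽ α ⊕ β ⇒
        ⊢ 0 · suc′ z ⊕ suc′ z ⊕ (b ⊕ β) ⊕ τ ⩽ W ⊕ w ⊕ (σ ⊕ (α ⊕ β)) ⊕ (a ⊕ con 2))

    grow₂ : ∀ z b τ W σ a w → z + z + b + τ ≤ W + σ + (a + 2) → 2 ≤ w →
            suc z + suc z + (b + 0) + τ ≤ W + w + (σ + 0) + (a + 2)
    grow₂ = linear 7 (λ z b τ W σ a w → 1 · z ⊕ z ⊕ b ⊕ τ ⩽ W ⊕ σ ⊕ (a ⊕ con 2) ⇒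
        1 · con 2 ⩽ w ⇒
        ⊢ 0 · suc′ z ⊕ suc′ z ⊕ (b ⊕ con 0) ⊕ τ ⩽ W ⊕ w ⊕ (σ ⊕ con 0) ⊕ (a ⊕ con 2))

    fall : ∀ z b τ W σ a w → z + z + b + τ ≤ W + σ + (a + 2) → 1 ≤ w → σ + 0 ≤ suc z →
           suc z + (b + 0) + τ ≤ W + w + (a + 3)
    fall = linear 7 (λ z b τ W σ a w → 1 · z ⊕ z ⊕ b ⊕ τ ⩽ W ⊕ σ ⊕ (a ⊕ con 2) ⇒ 1 · con 1 ⩽ w ⇒
        1 · σ ⊕ con 0 ⩽ suc′ z ⇒ ⊢ 0 · suc′ z ⊕ (b ⊕ con 0) ⊕ τ ⩽ W ⊕ w ⊕ (a ⊕ con 3))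

    high : ∀ z b τ W σ a w → z + b ≤ W → 1 ≤ w → z + τ ≤ suc a + σ →
           suc z + suc z + (b + 0) + τ ≤ W + w + (σ + 0) + (a + 2)
    high = linear 7 (λ z b τ W σ a w → 1 · z ⊕ b ⩽ W ⇒ 1 · con 1 ⩽ w ⇒ 1 · z ⊕ τ ⩽ suc′ a ⊕ σ ⇒
        ⊢ 0 · suc′ z ⊕ suc′ z ⊕ (b ⊕ con 0) ⊕ τ ⩽ W ⊕ w ⊕ (σ ⊕ con 0) ⊕ (a ⊕ con 2))

    settle : ∀ z b τ W σ a → z + z + b + τ ≤ W + σ + (a + 2) → σ ≤ z → z + b + τ ≤ W + (a + 3)
    settle = linear 6 (λ z b τ W σ a → 1 · z ⊕ z ⊕ b ⊕ τ ⩽ W ⊕ σ ⊕ (a ⊕ con 2) ⇒ 1 · σ ⩽ z ⇒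
        ⊢ 0 · z ⊕ b ⊕ τ ⩽ W ⊕ (a ⊕ con 3))

    finish : ∀ a b β τ W t c → a + b + τ ≤ W + (a + 3) → β ≤ t → W + t ≤ c → b + β + τ ≤ c + 3
    finish = linear 7 (λ a b β τ W t c → 1 · a ⊕ b ⊕ τ ⩽ W ⊕ (a ⊕ con 3) ⇒ 1 · β ⩽ t ⇒
        1 · W ⊕ t ⩽ c ⇒ ⊢ 0 · b ⊕ β ⊕ τ ⩽ c ⊕ con 3)

    run : ∀ τ a d θ σ σ' i → (θ + d) + τ ≤ suc a + σ' → σ' ≤ σ + (d + d) → σ ≤ θ → suc i < τ →
          i < d + a
    run = linear 7 (λ τ a d θ σ σ' i → 1 · (θ ⊕ d) ⊕ τ ⩽ suc′ a ⊕ σ' ⇒ 1 · σ' ⩽ σ ⊕ (d ⊕ d) ⇒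
        1 · σ ⩽ θ ⇒ 1 · suc′ i ≺ τ ⇒ ⊢ 0 · i ≺ d ⊕ a)

    high-arith : ∀ a z c1 c2 s1 s2 t1 t2 → t1 ≡ c1 + s1 → t2 ≡ c2 + s2 → s1 + s2 ≤ suc z →
                 a + (t1 + t2) ≤ suc (a + z) + (c1 + c2)
    high-arith = linear 8 (λ a z c1 c2 s1 s2 t1 t2 → 1 · t1 ≐ c1 ⊕ s1 ⇒ 1 · t2 ≐ c2 ⊕ s2 ⇒
        1 · s1 ⊕ s2 ⩽ suc′ z ⇒ ⊢ 0 · a ⊕ (t1 ⊕ t2) ⩽ suc′ (a ⊕ z) ⊕ (c1 ⊕ c2))

    count-arith : ∀ a b W t c → a + b ≤ W → W + t ≤ c → a + (b + t) ≤ c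
    count-arith = linear 5 (λ a b W t c → 1 · a ⊕ b ⩽ W ⇒ 1 · W ⊕ t ⩽ c ⇒ ⊢ 0 · a ⊕ (b ⊕ t) ⩽ c)

    row-ok : ∀ z b W w β → z + b ≤ W → 1 + β ≤ w → suc z + (b + β) ≤ W + w
    row-ok = linear 5 (λ z b W w β → 1 · z ⊕ b ⩽ W ⇒ 1 · con 1 ⊕ β ⩽ w ⇒
        ⊢ 0 · suc′ z ⊕ (b ⊕ β) ⩽ W ⊕ w)

  -- σ z - z plays the role of the surplus: a missing low sum forces it to be ≤ 0, a missing high sum
  -- forces it to be ≥ τ - 1 - a.
  module Sumset (A B : Pred) (a : ℕ) (A≤a : Supp A a) (B≤a : Supp B a) where

    S : Pred
    S = A ⊹ B

    σ : ℕ → ℕ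
    σ z = cnt A z + cnt B z

    τ : ℕ
    τ = σ (suc a)

    σ-mono : ∀ {m n} → m ≤ n → σ m ≤ σ n
    σ-mono m≤n = +-mono-≤ (∑-monoʳ _ m≤n) (∑-monoʳ _ m≤n)

    σ-suc : ∀ z → σ (suc z) ≡ σ z + (⟦ A z ⟧ + ⟦ B z ⟧)
    σ-suc z = +-interchange (cnt A z) ⟦ A z ⟧ (cnt B z) ⟦ B z ⟧

    σ-width : ∀ z d → σ (z + d) ≤ σ z + (d + d)
    σ-width z d = begin
      cnt A (z + d) + cnt B (z + d)
        ≡⟨ cong₂ _+_ (cnt-split A z d) (cnt-split B z d) ⟩
      (cnt A z + cnt (shift z A) d) + (cnt B z + cnt (shift z B) d)
        ≡⟨ +-interchange (cnt A z) _ (cnt B z) _ ⟩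
      σ z + (cnt (shift z A) d + cnt (shift z B) d)
        ≤⟨ +-monoʳ-≤ (σ z) (+-mono-≤ (cnt≤ (shift z A) d) (cnt≤ (shift z B) d)) ⟩
      σ z + (d + d) ∎
      where open ≤-Reasoning

    low-missing : ∀ z → S ∌ z → σ (suc z) ≤ suc z
    low-missing z ∌z = ≮⇒≥ λ big → ∋-∌ S z (pigeon A B z big) ∌z

    -- The mirror image of `low-missing`: a + e is a sum only of elements of [e , a], of which A and
    -- B have τ - σ e together. The case e = a + 1, beyond all sums, is included for the sake of
    -- `first-high`.
    high-missing : ∀ e → e ≤ suc a → S ∌ a + e → e + τ ≤ suc a + σ e
    high-missing e e≤ ∌ with m≤n⇒m<n∨m≡n e≤
    ... | inj₂ refl = ≤-refl
    ... | inj₁ e≤a with z , eq ← m≤n⇒∃[o]m+o≡n (≤-pred e≤a) =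
      subst (λ t → e + τ ≤ suc t + σ e) eq (high-arith e z (cnt A e) (cnt B e) (cnt (shift e A) (suc z))
          (cnt (shift e B) (suc z)) _ _ (part A) (part B)
        (≮⇒≥ λ big → ∋-∌ S (a + e)
          (subst (S ∋_) (trans (cong (e +_) eq) (+-comm e a)) (pigeon-shift A B e z big)) ∌))
      where
      part : ∀ P → cnt P (suc a) ≡ cnt P e + cnt (shift e P) (suc z)
      part P = trans (cong (cnt P) (trans (cong suc (sym eq)) (sym (+-suc e z)))) (cnt-split P e (suc z))

    ∌top : S ∌ a + suc a
    ∌top = not-∋ S _ λ h → let x , y , eq , ax , by = ⊹-elim A B _ h in
      <⇒≢ (s≤s (+-mono-≤ (A≤a x ax) (B≤a y by))) (trans eq (+-suc a a))

    -- Folds the sumset modulo a: the residue e < a is represented by e and by a + e, and the sum 2a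
    -- is left over.
    copies : ℕ → ℕ
    copies e = ⟦ S e ⟧ + ⟦ S (a + e) ⟧

    cnt-copies : ∑ copies a + ⟦ S (a + a) ⟧ ≤ cnt S (suc (a + a))
    cnt-copies = ≤-reflexive (cong (_+ ⟦ S (a + a) ⟧) (trans (∑-+ _ _ a) (sym (cnt-split S a a))))

    module Dense (0∈A : A ∋ 0) (a∈A : A ∋ a) (dense : a + 3 ≤ τ) where

      -- An element e of B gives both e + 0 and e + a. For any other e, if both copies were missing,
      -- `low-missing` and `high-missing` would combine to τ ≤ a + 2.
      copies≥ : ∀ e → e ≤ suc a → 1 + ⟦ B e ⟧ ≤ copies e
      copies≥ e e≤ with B e in eb
      ... | true = +-mono-≤ (∋⇒1≤ (⊹-intro A B 0∈A eb)) (∋⇒1≤ (⊹-intro A B a∈A eb))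
      ... | false with ∋? S e
      ...   | inj₁ h = ≤-trans (∋⇒1≤ h) (m≤m+n _ _)
      ...   | inj₂ ∌e with ∋? S (a + e)
      ...     | inj₁ h = ≤-trans (∋⇒1≤ h) (m≤n+m _ _)
      ...     | inj₂ ∌ae = ⊥-elim (low-or-high a e τ (σ e) _ (σ-mono (n≤1+n e)) (low-missing e ∌e)
                             (high-missing e e≤ ∌ae) dense)

      rows : ∀ z → z ≤ suc a → z + cnt B z ≤ ∑ copies z
      rows zero    _  = z≤n
      rows (suc z) z≤ = row-ok z (cnt B z) (∑ copies z) (copies z) ⟦ B z ⟧ (rows z (<⇒≤ z≤)) (copies≥ z (<⇒≤ z≤))

      top : ⟦ B a ⟧ ≤ ⟦ S (a + a) ⟧
      top = ⟦⟧-mono (⊹-intro A B a∈A)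

      sumset-size : a + cnt B (suc a) ≤ cnt S (suc (a + a))
      sumset-size = count-arith a (cnt B a) (∑ copies a) ⟦ B a ⟧ _ (rows a (n≤1+n a))
        (≤-trans (+-monoʳ-≤ (∑ copies a) top) cnt-copies)

      -- Both bound from below the excess of `∑ copies z` over the trivial z + `cnt B z` of `rows`.
      -- `Settled` asks for τ - a - 3, which is all that `Large` needs; `Pending` asks for τ - a - 2
      -- minus the surplus σ z - z, and so becomes `Settled` when the surplus is spent.
      Settled Pending : ℕ → Set
      Settled z = z + cnt B z + τ ≤ ∑ copies z + (a + 3)
      Pending z = z + z + cnt B z + τ ≤ ∑ copies z + σ z + (a + 2)

      step-settled : ∀ z → z ≤ a → Settled z → Settled (suc z)
      step-settled z z≤a h = persist z (cnt B z) τ (∑ copies z) a (copies z) ⟦ B z ⟧ h (copies≥ z (m≤n⇒m≤1+n z≤a))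

      neither : ∀ z (s t : Bool) → Pending z → z + cnt B z ≤ ∑ copies z → 1 ≤ ⟦ s ⟧ + ⟦ t ⟧ →
                (s ≡ false → σ z + 0 ≤ suc z) → (t ≡ false → z + τ ≤ suc a + σ z) →
                suc z + (cnt B z + 0) + τ ≤ ∑ copies z + (⟦ s ⟧ + ⟦ t ⟧) + (a + 3) ⊎
                suc z + suc z + (cnt B z + 0) + τ ≤ ∑ copies z + (⟦ s ⟧ + ⟦ t ⟧) + (σ z + 0) + (a + 2)
      neither z true  true  h r c lo hi = inj₂ (grow₂ z (cnt B z) τ (∑ copies z) (σ z) a 2 h ≤-refl)
      neither z false t     h r c lo hi = inj₁ (fall z (cnt B z) τ (∑ copies z) (σ z) a ⟦ t ⟧ h c (lo refl))
      neither z true  false h r c lo hi = inj₂ (high z (cnt B z) τ (∑ copies z) (σ z) a 1 r c (hi refl))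

      -- The surplus drops only at a residue in neither set. There either both copies occur and the
      -- excess grows, or the low copy is missing and the surplus is spent, or the high copy is
      -- missing and the surplus is still so large that `Pending` asks no more than `rows`.
      step-pending : ∀ z → z ≤ a → Pending z → Settled (suc z) ⊎ Pending (suc z)
      step-pending z z≤a h
        with c₁ ← copies≥ z (m≤n⇒m≤1+n z≤a) | r ← rows z (m≤n⇒m≤1+n z≤a)
           | lo ← low-missing z | hi ← high-missing z (m≤n⇒m≤1+n z≤a)
        rewrite σ-suc z with A z | B z
      ... | true  | β     = inj₂ (grow z (cnt B z) τ (∑ copies z) (σ z) a (copies z) 1 ⟦ β ⟧ h c₁ (m≤m+n 1 _))
      ... | false | true  = inj₂ (grow z (cnt B z) τ (∑ copies z) (σ z) a (copies z) 0 1 h c₁ ≤-refl)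
      ... | false | false = neither z (S z) (S (a + z)) h r c₁ lo hi

      settled : ∀ z k → z + k ≤ suc a → Settled z → Settled (z + k)
      settled z zero    _  h = subst Settled (sym (+-identityʳ z)) h
      settled z (suc k) z≤ h = subst Settled (sym (+-suc z k))
        (step-settled (z + k) z+k≤a (settled z k (m≤n⇒m≤1+n z+k≤a) h))
        where z+k≤a = ≤-pred (subst (_≤ suc a) (+-suc z k) z≤)

      pending : ∀ z k → z + k ≤ suc a → Pending z → Settled (z + k) ⊎ Pending (z + k)
      pending z zero    _  h = inj₂ (subst Pending (sym (+-identityʳ z)) h)
      pending z (suc k) z≤ h with z+k≤a ← ≤-pred (subst (_≤ suc a) (+-suc z k) z≤)
                             rewrite +-suc z k with pending z k (m≤n⇒m≤1+n z+k≤a) h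
      ... | inj₁ s = inj₁ (step-settled (z + k) z+k≤a s)
      ... | inj₂ q = step-pending (z + k) z+k≤a q

      Large Interval : Set
      Large = cnt B (suc a) + τ ≤ cnt S (suc (a + a)) + 3
      Interval = ∃[ θ ] θ ≤ a × (∀ i → suc i < τ → S ∋ θ + i)

      -- Between a missing high sum and a later missing low sum the surplus descends through every
      -- intermediate level, and each descent is a residue represented twice.
      descent : ∀ e₁ e₂ → e₂ ≤ e₁ → e₁ < a → S ∌ e₁ → S ∌ a + e₂ → Large
      descent e₁ e₂ e₂≤e₁ e₁<a ∌e₁ ∌e₂
        with k , eq ← m≤n⇒∃[o]m+o≡n (m≤n⇒m≤1+n e₂≤e₁)
        = finish a (cnt B a) ⟦ B a ⟧ τ (∑ copies a) ⟦ S (a + a) ⟧ _ at-a top cnt-copies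
        where
        e₂≤a = ≤-trans e₂≤e₁ (<⇒≤ e₁<a)

        at-e₁ : Settled (suc e₁)
        at-e₁ with pending e₂ k (subst (_≤ suc a) (sym eq) (m≤n⇒m≤1+n e₁<a))
                     (start e₂ (cnt B e₂) τ (∑ copies e₂) (σ e₂) a (rows e₂ (m≤n⇒m≤1+n e₂≤a))
                       (high-missing e₂ (m≤n⇒m≤1+n e₂≤a) ∌e₂))
        ... | inj₁ s = subst Settled eq s
        ... | inj₂ q = settle (suc e₁) (cnt B (suc e₁)) τ (∑ copies (suc e₁)) (σ (suc e₁)) a (subst Pending eq q)
            (low-missing e₁ ∌e₁)

        at-a : Settled a
        at-a with j , eq ← m≤n⇒∃[o]m+o≡n e₁<a =
          subst Settled eq (settled (suc e₁) j (≤-trans (≤-reflexive eq) (n≤1+n a)) at-e₁)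

      -- The run from θ to a + e₂ - 1 is long enough: with d = e₂ - θ, `high-missing` and σ e₂ ≤ σ θ
      -- + 2d ≤ θ + 2d give τ ≤ a + 1 + d, while the run has a + d elements.
      gap : ∀ θ e₂ → θ ≤ a → e₂ ≤ suc a → θ ≤ e₂ → σ θ ≤ θ → S ∌ a + e₂ →
            (∀ z → θ ≤ z → z < a → S ∋ z) → (∀ e → e < e₂ → S ∋ a + e) → Interval
      gap θ e₂ θ≤a e₂≤ θ≤e₂ σθ ∌e₂ low high with d , refl ← m≤n⇒∃[o]m+o≡n θ≤e₂ =
        θ , θ≤a , mem
        where
        mem : ∀ i → suc i < τ → S ∋ θ + i
        mem i i< with θ + i <? a
        ... | yes lt = low (θ + i) (m≤m+n θ i) lt
        ... | no ≮a with e , eq ← m≤n⇒∃[o]m+o≡n (≮⇒≥ ≮a) =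
          subst (S ∋_) eq (high e (+-cancelˡ-< a e (θ + d) (begin-strict
            a + e          ≡⟨ eq ⟩
            θ + i          <⟨ +-monoʳ-< θ (run τ a d θ (σ θ) (σ (θ + d)) i (high-missing (θ + d) e₂≤ ∌e₂)
                (σ-width θ d) σθ i<) ⟩
            θ + (d + a)    ≡⟨ +-assoc θ d a ⟨
            θ + d + a      ≡⟨ +-comm (θ + d) a ⟩
            a + (θ + d)    ∎)))
          where open ≤-Reasoning

      first-high : ∃[ e₂ ] e₂ ≤ suc a × S ∌ a + e₂ × (∀ e → e < e₂ → S ∋ a + e)
      first-high with first (λ e → not (S (a + e))) (suc (suc a))
      ... | inj₁ (e , e< , h , below) = e , ≤-pred e< , not-true h , λ j j< → not-false (below j j<)
      ... | inj₂ none with S (a + suc a) | none (suc a) (n<1+n _) | ∌top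
      ...   | false | () | _
      ...   | true  | _  | ()

      -- Compares the last missing low sum e₁ with the first missing high sum a + e₂. If e₁ < e₂,
      -- everything strictly between e₁ and a + e₂ is a sum; if e₂ ≤ e₁, the descent between them
      -- makes the sumset large.
      large-or-interval : Large ⊎ Interval
      large-or-interval with e₂ , e₂≤ , ∌e₂ , high ← first-high
                        with last (λ e → not (S e)) a
      ... | inj₂ none = inj₂ (gap 0 e₂ z≤n e₂≤ z≤n z≤n ∌e₂ (λ z _ z<a → not-false (none z z<a)) high)
      ... | inj₁ (e₁ , e₁<a , h , above) with e₂ ≤? e₁
      ...   | yes e₂≤e₁ = inj₁ (descent e₁ e₂ e₂≤e₁ e₁<a (not-true h) ∌e₂)
      ...   | no e₂≰e₁ = inj₂ (gap (suc e₁) e₂ e₁<a e₂≤ (≰⇒> e₂≰e₁) (low-missing e₁ (not-true h)) ∌e₂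
                           (λ z lt z<a → not-false (above z lt z<a)) high)

-- Freiman's 3k - 4 theorem for sets of integers.

module Freiman where
  open import Data.Nat.Base
  open import Data.Nat.Properties
  open import Data.Nat.Divisibility
  open import Data.Nat.Induction using (<-rec)
  open import Data.Nat.Tactic.RingSolver using (solve-∀)
  open import Data.Bool.Base using (true; false; not; _∧_; _∨_)
  open import Data.List.Base using ([])
  open import Data.Vec.Base using ([])
  open LinearArithmetic using (linear; _⊕_; _⊛_; con; suc′; _⩽_; _≺_; _≐_; _≐˘_; _·_⇒_; ⊢_·_; ⊢⊥)
  open import Data.Product.Base using (∃-syntax; _×_; _,_)
  open import Data.Sum.Base using (_⊎_; inj₁; inj₂)
  open import Data.Empty using (⊥; ⊥-elim)
  open import Relation.Nullary using (yes; no)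
  open import Relation.Binary.PropositionalEquality
  open Count
  open TwoSets

  gapped : Pred → ℕ → Pred
  gapped Q g e = Q e ∨ ((g ≤ᵇ e) ∧ (Q ⊹ Q) (e ∸ g))

  -- Read outwards from a gap of length g in A, the two sides of A contribute gapped sets to A + A; they are
  -- nearly disjoint there, so A is Saturated once both sides are Good.
  Good : Pred → ℕ → ℕ → Set
  Good Q u g = 3 * cnt Q (suc u) ≤ cnt (gapped Q g) (suc (g + (u + u))) + 1

  Saturated : Pred → ℕ → Set
  Saturated A L = 3 * cnt A (suc L) ≤ cnt (A ⊹ A) (suc (L + L)) + 3

  gapped-elim : ∀ Q g e → gapped Q g ∋ e → Q ∋ e ⊎ ∃[ f ] g + f ≡ e × Q ⊹ Q ∋ f
  gapped-elim Q g e h with ∨-true {Q e} h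
  ... | inj₁ q = inj₁ q
  ... | inj₂ r with l , s ← ∧-true {g ≤ᵇ e} r = inj₂ (e ∸ g , m+[n∸m]≡n (≤ᵇ-≤ {g} l) , s)

  delayed : Pred → ℕ → Pred
  delayed S g e = (g ≤ᵇ e) ∧ S (e ∸ g)

  delayed-intro : ∀ S g f → S ∋ f → delayed S g ∋ g + f
  delayed-intro S g f s = ∧-intro (≤ᵇ-true (m≤m+n g f)) (trans (cong S (m+n∸m≡n g f)) s)

  cnt-delayed : ∀ S g w → cnt S w ≤ cnt (delayed S g) (g + w)
  cnt-delayed S g w = begin
    cnt S w                                            ≤⟨ cnt-mono w (λ f _ s → delayed-intro S g f s) ⟩
    cnt (shift g (delayed S g)) w                      ≤⟨ m≤n+m _ _ ⟩
    cnt (delayed S g) g + cnt (shift g (delayed S g)) w ≡⟨ cnt-split (delayed S g) g w ⟨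
    cnt (delayed S g) (g + w)                          ∎
    where open ≤-Reasoning

  private abstract
    T≤e₂ : ∀ e τ u σ → e + τ ≤ suc u + σ → σ ≤ e + e → τ ≤ suc u + e
    T≤e₂ = linear 4 (λ e τ u σ → 1 · e ⊕ τ ⩽ suc′ u ⊕ σ ⇒ 1 · σ ⩽ e ⊕ e ⇒ ⊢ 0 · τ ⩽ suc′ u ⊕ e)

    run : ∀ τ u z d σ σ' T θ → (suc z + d) + τ ≤ suc u + σ' → σ' ≤ σ + (d + d) → σ ≤ suc z →
          τ ≡ suc u + T → T + θ ≡ suc z + d → z < θ
    run = linear 8 (λ τ u z d σ σ' T θ → 1 · (suc′ z ⊕ d) ⊕ τ ⩽ suc′ u ⊕ σ' ⇒
        1 · σ' ⩽ σ ⊕ (d ⊕ d) ⇒ 1 · σ ⩽ suc′ z ⇒ 1 · τ ≐˘ suc′ u ⊕ T ⇒ 1 · T ⊕ θ ≐˘ suc′ z ⊕ d ⇒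
        ⊢ 0 · z ≺ θ)

    E₁ : ∀ q τ u θ T X S s R k → τ ≡ q + q → τ ≡ suc u + T → q + S ≤ X + s → S ≡ s + θ + R + 1 →
         R ≡ k + k → T + θ ≡ suc u → θ + k ≡ u → 3 * q ≤ X + 1
    E₁ = linear 10 (λ q τ u θ T X S s R k → 1 · τ ≐˘ q ⊕ q ⇒ 1 · τ ≐ suc′ u ⊕ T ⇒
        1 · q ⊕ S ⩽ X ⊕ s ⇒ 1 · S ≐˘ s ⊕ θ ⊕ R ⊕ con 1 ⇒ 1 · R ≐˘ k ⊕ k ⇒ 1 · T ⊕ θ ≐ suc′ u ⇒
        2 · θ ⊕ k ≐˘ u ⇒ ⊢ 0 · 3 ⊛ q ⩽ X ⊕ con 1)

    E₂ : ∀ q τ u θ T X S s R k c cu ce → τ ≡ q + q → τ ≡ suc u + T → c + S ≤ X + s →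
         S ≡ s + θ + R + 1 → ce ≤ c → T + T + k + cu ≤ R + ce → cu + 1 ≡ q → T + θ + k ≡ u →
         3 * q ≤ X + 1
    E₂ = linear 13 (λ q τ u θ T X S s R k c cu ce → 1 · τ ≐˘ q ⊕ q ⇒ 1 · τ ≐ suc′ u ⊕ T ⇒
        1 · c ⊕ S ⩽ X ⊕ s ⇒ 1 · S ≐˘ s ⊕ θ ⊕ R ⊕ con 1 ⇒ 1 · ce ⩽ c ⇒
        1 · T ⊕ T ⊕ k ⊕ cu ⩽ R ⊕ ce ⇒ 1 · cu ⊕ con 1 ≐˘ q ⇒ 1 · T ⊕ θ ⊕ k ≐˘ u ⇒
        ⊢ 0 · 3 ⊛ q ⩽ X ⊕ con 1)

    T₁ : ∀ θ T g e u τ → T + θ ≡ e → τ ≡ suc u + T → τ ≤ suc (u + g) → e ≤ g + θ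
    T₁ = linear 6 (λ θ T g e u τ → 1 · T ⊕ θ ≐˘ e ⇒ 1 · τ ≐˘ suc′ u ⊕ T ⇒ 1 · τ ⩽ suc′ (u ⊕ g) ⇒
        ⊢ 0 · e ⩽ g ⊕ θ)

    θ<u : ∀ θ T e u τ → T + θ ≡ e → τ ≡ suc u + T → u + 3 ≤ τ → e ≤ suc u → θ < u
    θ<u = linear 5 (λ θ T e u τ → 1 · T ⊕ θ ≐ e ⇒ 1 · τ ≐ suc′ u ⊕ T ⇒ 1 · u ⊕ con 3 ⩽ τ ⇒
        1 · e ⩽ suc′ u ⇒ ⊢ 0 · θ ≺ u)

  module _ (Q : Pred) (u : ℕ) (Q≤u : Supp Q u) (0∈Q : Q ∋ 0) (u∈Q : Q ∋ u) where

    q : ℕ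
    q = cnt Q (suc u)

    cnt-Q : cnt Q u + 1 ≡ q
    cnt-Q = trans (+-comm (cnt Q u) 1) (sym (cnt-step Q u u∈Q))

    doubling : q + q ≤ cnt (Q ⊹ Q) (suc (u + u)) + 1
    doubling = begin
      q + q                                                    ≡⟨ cong (_+ q) cnt-Q ⟨
      cnt Q u + 1 + q                                          ≤⟨ +-mono-≤
          (+-monoˡ-≤ 1 (cnt-mono u λ i _ → ⊹-intro Q Q 0∈Q))
                                                                           (cnt-mono (suc u) λ i _ → ⊹-intro Q Q u∈Q) ⟩
      cnt (Q ⊹ Q) u + 1 + cnt (shift u (Q ⊹ Q)) (suc u)        ≡⟨ swapʳ (cnt (Q ⊹ Q) u) 1 _ ⟩
      cnt (Q ⊹ Q) u + cnt (shift u (Q ⊹ Q)) (suc u) + 1        ≡⟨ cong (_+ 1) (cnt-split (Q ⊹ Q) u (suc u)) ⟨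
      cnt (Q ⊹ Q) (u + suc u) + 1                              ≡⟨ cong (λ n → cnt (Q ⊹ Q) n + 1) (+-suc u u) ⟩
      cnt (Q ⊹ Q) (suc (u + u)) + 1                            ∎
      where open ≤-Reasoning

    open Sumset Q Q u Q≤u Q≤u

    -- Let T = 2q - u - 1, let u + e₂ be the first sum from u on that is missing, and θ = e₂ - T.
    -- For each of the T residues in [θ , e₂) both copies modulo u are sums. The gapped set is then
    -- counted as Q below g + θ and as g + Q + Q from there on; `g-big` says T ≤ g, so the first
    -- piece reaches at least to e₂.
    dense⇒good : ∀ g → u + 3 ≤ q + q → q + q ≤ suc (u + g) → Good Q u g
    dense⇒good g dense g-big
      with e₂ , e₂≤ , ∌e₂ , high ← Dense.first-high 0∈Q u∈Q dense
      with hi ← high-missing e₂ e₂≤ ∌e₂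
      with T , eT ← m≤n⇒∃[o]m+o≡n {suc u} {τ} (≤-trans (s≤s (m≤m+n u 2))
          (≤-trans (≤-reflexive (sym (+-suc u 2))) dense))
      with θ , eθ ← m≤n⇒∃[o]m+o≡n {T} {e₂}
             (+-cancelˡ-≤ (suc u) T e₂ (≤-trans (≤-reflexive eT)
               (T≤e₂ e₂ τ u (σ e₂) hi (+-mono-≤ (cnt≤ Q e₂) (cnt≤ Q e₂)))))
      = main
      where
      open Dense 0∈Q u∈Q dense

      X = gapped Q g

      low : ∀ z → θ ≤ z → z < e₂ → S ∋ z
      low z θ≤z z<e₂ with ∋? S z
      ... | inj₁ h = h
      ... | inj₂ ∌z with d , refl ← m≤n⇒∃[o]m+o≡n z<e₂ =
        ⊥-elim (<⇒≱ (run τ u z d (σ (suc z)) (σ (suc z + d)) T θ hi (σ-width (suc z) d)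
                      (low-missing z ∌z) (sym eT) eθ) θ≤z)

      θ≤u : θ ≤ u
      θ≤u = <⇒≤ (θ<u θ T e₂ u τ eθ (sym eT) dense e₂≤)

      size-X : cnt Q (g + θ) + cnt S (suc (u + u)) ≤ cnt X (suc (g + (u + u))) + cnt S θ
      size-X with w , ew ← m≤n⇒∃[o]m+o≡n {θ} {suc (u + u)} (≤-trans θ≤u (≤-trans (m≤m+n u u) (n≤1+n _))) = begin
        cnt Q (g + θ) + cnt S (suc (u + u))                         ≡⟨ cong (λ n → cnt Q (g + θ) + cnt S n) ew ⟨
        cnt Q (g + θ) + cnt S (θ + w)                               ≡⟨ cong (cnt Q (g + θ) +_) (cnt-split S θ w) ⟩
        cnt Q (g + θ) + (cnt S θ + cnt (shift θ S) w)               ≤⟨ +-mono-≤ (cnt-mono (g + θ) λ i _ → ∨ˡ)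
              (+-monoʳ-≤ (cnt S θ) (cnt-mono w λ i _ h → ∨ʳ {Q (g + θ + i)}
                (trans (cong (delayed S g) (+-assoc g θ i)) (delayed-intro S g (θ + i) h)))) ⟩
        cnt X (g + θ) + (cnt S θ + cnt (shift (g + θ) X) w)         ≡⟨ regroup (cnt X (g + θ)) (cnt S θ) _ ⟩
        cnt X (g + θ) + cnt (shift (g + θ) X) w + cnt S θ           ≡⟨ cong (_+ cnt S θ) (cnt-split X (g + θ) w) ⟨
        cnt X (g + θ + w) + cnt S θ                                 ≡⟨ cong (λ n → cnt X n + cnt S θ)
              (trans (+-assoc g θ w) (trans (cong (g +_) ew) (+-suc g (u + u)))) ⟩
        cnt X (suc (g + (u + u))) + cnt S θ                         ∎
        where
        open ≤-Reasoning
        regroup : ∀ a b c → a + (b + c) ≡ a + c + b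
        regroup = solve-∀

      2u∈S : S ∋ u + u
      2u∈S = ⊹-intro Q Q u∈Q u∈Q

      rest : ℕ → ℕ
      rest = ∑ (λ i → copies (θ + i))

      size-S : ∀ k → θ + k ≡ u → cnt S (suc (u + u)) ≡ cnt S θ + θ + rest k + 1
      size-S k eq = begin
        cnt S (suc (u + u))                     ≡⟨ cnt-step S (u + u) 2u∈S ⟩
        suc (cnt S (u + u))                     ≡⟨ +-comm 1 _ ⟩
        cnt S (u + u) + 1                       ≡⟨ cong (_+ 1) (begin
          cnt S (u + u)                           ≡⟨ cnt-split S u u ⟩
          cnt S u + cnt (shift u S) u             ≡⟨ ∑-+ _ _ u ⟨
          ∑ copies u                              ≡⟨ cong (∑ copies) eq ⟨
          ∑ copies (θ + k)                        ≡⟨ ∑-split copies θ k ⟩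
          ∑ copies θ + rest k                     ≡⟨ cong (_+ rest k) (∑-+ _ _ θ) ⟩
          cnt S θ + cnt (shift u S) θ + rest k    ≡⟨ cong (λ n → cnt S θ + n + rest k) (cnt-full (shift u S) θ
              λ i i<θ → high i (<-≤-trans i<θ (≤-trans (m≤n+m θ T) (≤-reflexive eθ)))) ⟩
          cnt S θ + θ + rest k                    ∎) ⟩
        cnt S θ + θ + rest k + 1                ∎
        where open ≡-Reasoning

      twos : ∀ n → θ + n ≤ e₂ → rest n ≡ n + n
      twos n le = trans (∑-cong n λ i i<n → both (θ + i) (m≤m+n θ i) (<-≤-trans (+-monoʳ-< θ i<n) le))
                        (trans (∑-const 2 n) (trans (*-comm n 2) (cong (n +_) (+-identityʳ n))))
        where
        both : ∀ f → θ ≤ f → f < e₂ → copies f ≡ 2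
        both f θ≤f f<e₂ rewrite low f θ≤f f<e₂ | high f f<e₂ = refl

      main : Good Q u g
      main with m≤n⇒m<n∨m≡n e₂≤
      -- No sum in [u , 2u] is missing: all residues from θ to u - 1 count twice, and Q lies
      -- entirely below g + θ.
      ... | inj₂ e₂≡ with k , ek ← m≤n⇒∃[o]m+o≡n θ≤u =
        E₁ q τ u θ T (cnt X (suc (g + (u + u)))) (cnt S (suc (u + u))) (cnt S θ) (rest k) k refl (sym eT)
          (subst (λ n → n + cnt S (suc (u + u)) ≤ cnt X (suc (g + (u + u))) + cnt S θ) all-Q size-X)
          (size-S k ek)
          (twos k (≤-trans (≤-reflexive ek) (≤-trans (n≤1+n u) (≤-reflexive (sym e₂≡))))) (trans eθ e₂≡)
          ek
        where
        all-Q : cnt Q (g + θ) ≡ q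
        all-Q = cnt-stop Q (suc u) (g + θ) (≤-trans (≤-reflexive (sym e₂≡)) (T₁ θ T g e₂ u τ eθ (sym eT) g-big))
          λ i u<i _ → not-∋ Q i λ h → <⇒≱ u<i (Q≤u i h)
      -- Residues e from e₂ on still count at least 1 + [e ∈ Q]; the elements of Q gained there make
      -- up for those that may lie beyond g + θ.
      ... | inj₁ e₂<su with k , ek ← m≤n⇒∃[o]m+o≡n (≤-pred e₂<su) =
        E₂ q τ u θ T (cnt X (suc (g + (u + u)))) (cnt S (suc (u + u))) (cnt S θ) (rest (T + k)) k
          (cnt Q (g + θ)) (cnt Q u) (cnt Q e₂) refl (sym eT) size-X
          (size-S (T + k) (trans (sym (+-assoc θ T k)) (trans (cong (_+ k) (trans (+-comm θ T) eθ)) ek)))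
          (∑-monoʳ _ (T₁ θ T g e₂ u τ eθ (sym eT) g-big))
          rest-big cnt-Q (trans (cong (_+ k) eθ) ek)
        where
        open ≤-Reasoning
        regroup : ∀ t k a b → t + t + k + (a + b) ≡ t + t + (k + b) + a
        regroup = solve-∀
        rest-big : T + T + k + cnt Q u ≤ rest (T + k) + cnt Q e₂
        rest-big = begin
          T + T + k + cnt Q u                                       ≡⟨ cong (λ n → T + T + k + cnt Q n) ek ⟨
          T + T + k + cnt Q (e₂ + k)                                ≡⟨ cong (T + T + k +_) (cnt-split Q e₂ k) ⟩
          T + T + k + (cnt Q e₂ + cnt (shift e₂ Q) k)               ≡⟨ regroup T k (cnt Q e₂) (cnt (shift e₂ Q) k) ⟩
          T + T + (k + cnt (shift e₂ Q) k) + cnt Q e₂               ≤⟨ +-monoˡ-≤ (cnt Q e₂) (+-mono-≤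
                (≤-reflexive (sym (twos T (≤-reflexive (trans (+-comm θ T) eθ))))) tail) ⟩
          rest T + ∑ (λ i → copies (θ + (T + i))) k + cnt Q e₂      ≡⟨ cong (_+ cnt Q e₂) (∑-split _ T k) ⟨
          rest (T + k) + cnt Q e₂                                   ∎
          where
          tail : k + cnt (shift e₂ Q) k ≤ ∑ (λ i → copies (θ + (T + i))) k
          tail = begin
            k + cnt (shift e₂ Q) k                                  ≡⟨ cong (_+ cnt (shift e₂ Q) k)
                (trans (∑-const 1 k) (*-identityʳ k)) ⟨
            ∑ (λ _ → 1) k + cnt (shift e₂ Q) k                      ≡⟨ ∑-+ _ _ k ⟨
            ∑ (λ i → 1 + ⟦ Q (e₂ + i) ⟧) k                          ≤⟨ ∑-mono k
                (λ i i<k → subst (λ z → 1 + ⟦ Q (e₂ + i) ⟧ ≤ copies z)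
                  (trans (cong (_+ i) (trans (sym eθ) (+-comm T θ))) (+-assoc θ T i))
                  (copies≥ (e₂ + i) (≤-trans (+-monoʳ-≤ e₂ (<⇒≤ i<k)) (≤-trans (≤-reflexive ek) (n≤1+n u))))) ⟩
            ∑ (λ i → copies (θ + (T + i))) k                        ∎

  point : ℕ → Pred
  point q e = e ≡ᵇ q

  point-elim : ∀ q e → point q ∋ e → e ≡ q
  point-elim q e h = ≡ᵇ⇒≡ e q (≡⇒T h)

  cnt-point : ∀ q n → q < n → cnt (point q) n ≡ 1
  cnt-point q n q<n = trans
    (∑-single (λ e → ⟦ point q e ⟧) q q<n (λ e _ e≢q → cong ⟦_⟧ (not-∋ (point q) e (λ h → e≢q (point-elim q e h)))))
    (cong ⟦_⟧ (T⇒≡ (≡⇒≡ᵇ q q refl)))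

  two≤ : ∀ {a b x} → (a ≡ true → x ≡ true) → (b ≡ true → x ≡ true) → (a ≡ true → b ≡ true → ⊥) →
         ⟦ a ⟧ + ⟦ b ⟧ ≤ ⟦ x ⟧
  two≤ {true}  {true}  f g h = ⊥-elim (h refl refl)
  two≤ {true}  {false} f g h = ⟦⟧-mono f
  two≤ {false} {b}     f g h = ⟦⟧-mono g

  three≤ : ∀ {a b c x} → (a ≡ true → x ≡ true) → (b ≡ true → x ≡ true) → (c ≡ true → x ≡ true) →
           (a ≡ true → b ≡ true → ⊥) → (a ≡ true → c ≡ true → ⊥) → (b ≡ true → c ≡ true → ⊥) →
           ⟦ a ⟧ + ⟦ b ⟧ + ⟦ c ⟧ ≤ ⟦ x ⟧
  three≤ {true}  {true}          f g h ab ac bc = ⊥-elim (ab refl refl)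
  three≤ {true}  {false} {true}  f g h ab ac bc = ⊥-elim (ac refl refl)
  three≤ {true}  {false} {false} f g h ab ac bc = ⟦⟧-mono f
  three≤ {false} {b} {c}         f g h ab ac bc = two≤ {b} {c} g h bc

  private abstract
    sat-good : ∀ q s x → 3 * q ≤ s + 3 → 1 + 1 + s ≤ x → 3 * q ≤ x + 1
    sat-good = linear 3 (λ q s x → 1 · 3 ⊛ q ⩽ s ⊕ con 3 ⇒ 1 · con 1 ⊕ con 1 ⊕ s ⩽ x ⇒
        ⊢ 0 · 3 ⊛ q ⩽ x ⊕ con 1)

    dis-good : ∀ q s x → q + q ≤ s + 1 → q + s ≤ x → 3 * q ≤ x + 1
    dis-good = linear 3 (λ q s x → 1 · q ⊕ q ⩽ s ⊕ con 1 ⇒ 1 · q ⊕ s ⩽ x ⇒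
        ⊢ 0 · 3 ⊛ q ⩽ x ⊕ con 1)

    single-good : ∀ q x → q ≤ 1 → 2 ≤ x → 3 * q ≤ x + 1
    single-good = linear 2 (λ q x → 3 · q ⩽ con 1 ⇒ 1 · con 2 ⩽ x ⇒ ⊢ 0 · 3 ⊛ q ⩽ x ⊕ con 1)

    cut-arith : ∀ a p s n x y S → a ≡ p + s → 3 * p ≤ x + 1 → 3 * s ≤ y + 1 → x ≤ n + 1 →
                n + y ≤ S → 3 * a ≤ S + 3
    cut-arith = linear 7 (λ a p s n x y S → 3 · a ≐ p ⊕ s ⇒ 1 · 3 ⊛ p ⩽ x ⊕ con 1 ⇒
        1 · 3 ⊛ s ⩽ y ⊕ con 1 ⇒ 1 · x ⩽ n ⊕ con 1 ⇒ 1 · n ⊕ y ⩽ S ⇒ ⊢ 0 · 3 ⊛ a ⩽ S ⊕ con 3)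

  delayed-elim : ∀ S g e → delayed S g ∋ e → ∃[ f ] g + f ≡ e × S ∋ f
  delayed-elim S g e h with l , s ← ∧-true {g ≤ᵇ e} h = e ∸ g , m+[n∸m]≡n (≤ᵇ-≤ {g} l) , s

  singleton-good : ∀ Q g → Supp Q 0 → Q ∋ 0 → 1 ≤ g → Good Q 0 g
  singleton-good Q g Q≤0 0∈Q 1≤g = single-good (cnt Q 1) _ (⟦⟧≤1 (Q 0)) (begin
    2                                                     ≡⟨ cong₂ _+_ (cnt-point 0 N z<s) (cnt-point g N g<N) ⟨
    cnt (point 0) N + cnt (point g) N                     ≡⟨ ∑-+ _ _ N ⟨
    ∑ (λ e → ⟦ point 0 e ⟧ + ⟦ point g e ⟧) N             ≤⟨ ∑-mono N
        (λ e _ → two≤ {point 0 e} {point g e} (at-0 e) (at-g e)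
                                                               λ h k → <⇒≢ 1≤g (trans (sym (point-elim 0 e h))
                                                                   (point-elim g e k))) ⟩
    cnt (gapped Q g) N                                    ∎)
    where
    open ≤-Reasoning
    N = suc (g + 0)
    g<N : g < N
    g<N = s≤s (m≤m+n g 0)
    at-0 : ∀ e → point 0 ∋ e → gapped Q g ∋ e
    at-0 e h rewrite point-elim 0 e h = ∨ˡ 0∈Q
    at-g : ∀ e → point g ∋ e → gapped Q g ∋ e
    at-g e h rewrite point-elim g e h = ∨ʳ {Q g} (subst (delayed (Q ⊹ Q) g ∋_) (+-identityʳ g)
      (delayed-intro (Q ⊹ Q) g 0 (⊹-intro Q Q 0∈Q 0∈Q)))

  module _ (Q : Pred) (u : ℕ) (Q≤u : Supp Q u) (0∈Q : Q ∋ 0) (u∈Q : Q ∋ u) (g : ℕ) (1≤g : 1 ≤ g) where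
    private
      N = suc (g + (u + u))
      S = Q ⊹ Q

    -- 0 and q lie in Q but not in g + Q + Q: two elements on top of the 3|Q| - 3 that saturation
    -- provides.
    extra⇒good : Saturated Q u → ∀ q → 1 ≤ q → Q ∋ q → delayed S g ∌ q → Good Q u g
    extra⇒good sat q 1≤q q∈Q q∉ = sat-good (cnt Q (suc u)) (cnt S (suc (u + u))) (cnt (gapped Q g) N) sat (begin
      1 + 1 + cnt S (suc (u + u))
        ≤⟨ +-mono-≤ (≤-reflexive (sym (cong₂ _+_ (cnt-point 0 N z<s) (cnt-point q N q<N))))
             (≤-trans (cnt-delayed S g (suc (u + u))) (≤-reflexive (cong (cnt (delayed S g)) (+-suc g (u + u))))) ⟩
      cnt (point 0) N + cnt (point q) N + cnt (delayed S g) N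
        ≡⟨ trans (cong (_+ cnt (delayed S g) N) (sym (∑-+ _ _ N))) (sym (∑-+ _ _ N)) ⟩
      ∑ (λ e → ⟦ point 0 e ⟧ + ⟦ point q e ⟧ + ⟦ delayed S g e ⟧) N
        ≤⟨ ∑-mono N (λ e _ → three≤ {point 0 e} {point q e} {delayed S g e} (at 0 0∈Q e) (at q q∈Q e) (∨ʳ {Q e})
             (λ h k → <⇒≢ 1≤q (trans (sym (point-elim 0 e h)) (point-elim q e k)))
             (λ h k → not-0 (subst (delayed S g ∋_) (point-elim 0 e h) k))
             (λ h k → ∋-∌ (delayed S g) q (subst (delayed S g ∋_) (point-elim q e h) k) q∉)) ⟩
      cnt (gapped Q g) N ∎)
      where
      open ≤-Reasoning
      q<N : q < N
      q<N = s≤s (≤-trans (Q≤u q q∈Q) (≤-trans (m≤m+n u u) (m≤n+m (u + u) g)))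
      at : ∀ x → Q ∋ x → ∀ e → point x ∋ e → gapped Q g ∋ e
      at x x∈Q e h rewrite point-elim x e h = ∨ˡ x∈Q
      not-0 : delayed S g ∋ 0 → ⊥
      not-0 h with f , eq , _ ← delayed-elim S g 0 h = <⇒≢ (≤-trans 1≤g (m≤m+n g f)) (sym eq)

    -- If every positive q ∈ Q equals g + x + y with x, y ∈ Q, then g divides q by induction.
    chain : (∀ q → 1 ≤ q → Q ∋ q → delayed S g ∋ q) → ∀ q → Q ∋ q → g ∣ q
    chain all = <-rec (λ q → Q ∋ q → g ∣ q) step
      where
      step : ∀ q → (∀ {x} → x < q → Q ∋ x → g ∣ x) → Q ∋ q → g ∣ q
      step zero    rec q∈Q = g ∣0
      step (suc q) rec q∈Q
        with f , eq , h ← delayed-elim S g (suc q) (all (suc q) z<s q∈Q)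
        with x , y , exy , x∈Q , y∈Q ← ⊹-elim Q Q f h =
        subst (g ∣_) (trans (cong (g +_) exy) eq) (∣m∣n⇒∣m+n ∣-refl
          (∣m∣n⇒∣m+n (rec (below (≤-trans (m≤m+n x y) (≤-reflexive exy))) x∈Q)
                     (rec (below (≤-trans (m≤n+m y x) (≤-reflexive exy))) y∈Q)))
        where
        below : ∀ {z} → z ≤ f → z < suc q
        below z≤f = ≤-trans (+-mono-≤ 1≤g z≤f) (≤-reflexive eq)

    good-or-multiples : Saturated Q u → Good Q u g ⊎ (∀ q → Q ∋ q → g ∣ q)
    good-or-multiples sat with find (λ q → (1 ≤ᵇ q) ∧ (Q q ∧ not (delayed S g q))) (suc u)
    ... | inj₁ (q , _ , h)
      with h₁ , h₂ ← ∧-true {1 ≤ᵇ q} h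
      with h₃ , h₄ ← ∧-true {Q q} h₂ =
      inj₁ (extra⇒good sat q (≤ᵇ-≤ {1} h₁) h₃ (not-true h₄))
    ... | inj₂ none = inj₂ (chain all)
      where
      all : ∀ q → 1 ≤ q → Q ∋ q → delayed S g ∋ q
      all q 1≤q q∈Q with ∋? (delayed S g) q
      ... | inj₁ h = h
      ... | inj₂ k = ⊥-elim (∋-∌ (λ z → (1 ≤ᵇ z) ∧ (Q z ∧ not (delayed S g z))) q
              (∧-intro (≤ᵇ-true 1≤q) (∧-intro q∈Q (cong not k))) (none q (s≤s (Q≤u q q∈Q))))

    -- Modulo d, Q lies in the class of 0 and g + Q + Q in that of g. So they are disjoint, and |Q|
    -- + |Q + Q| ≥ 3|Q| - 1.
    coprime⇒good : ∀ d → (∀ q → Q ∋ q → d ∣ q) → (d ∣ g → ⊥) → Good Q u g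
    coprime⇒good d d∣Q d∤g = dis-good (cnt Q (suc u)) (cnt S (suc (u + u))) (cnt (gapped Q g) N)
        (doubling Q u Q≤u 0∈Q u∈Q) (begin
      cnt Q (suc u) + cnt S (suc (u + u))
        ≤⟨ +-mono-≤ (∑-monoʳ _ (s≤s (≤-trans (m≤m+n u u) (m≤n+m (u + u) g))))
             (≤-trans (cnt-delayed S g (suc (u + u))) (≤-reflexive (cong (cnt (delayed S g)) (+-suc g (u + u))))) ⟩
      cnt Q N + cnt (delayed S g) N
        ≡⟨ ∑-+ _ _ N ⟨
      ∑ (λ e → ⟦ Q e ⟧ + ⟦ delayed S g e ⟧) N
        ≤⟨ ∑-mono N (λ e _ → two≤ {Q e} {delayed S g e} ∨ˡ (∨ʳ {Q e}) (excl e)) ⟩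
      cnt (gapped Q g) N ∎)
      where
      open ≤-Reasoning
      excl : ∀ e → Q ∋ e → delayed S g ∋ e → ⊥
      excl e q h
        with f , eq , k ← delayed-elim S g e h
        with x , y , exy , x∈Q , y∈Q ← ⊹-elim Q Q f k =
        d∤g (∣m+n∣m⇒∣n (subst (d ∣_) (trans (sym eq) (trans (cong (g +_) (sym exy)) (+-comm g (x + y)))) (d∣Q e q))
            (∣m∣n⇒∣m+n (d∣Q x x∈Q) (d∣Q y y∈Q)))

  -- The structured alternative, put as the hypothesis of `Dense` for A / d. The customary
  -- conclusion ℓ ≤ |A + A| - |A| then comes from `sumset-size`.
  Dense⁺ : Pred → ℕ → ℕ → ℕ → Set
  Dense⁺ A L d ℓ = L ≡ d * ℓ × (∀ x → A ∋ x → d ∣ x) × ℓ + 3 ≤ cnt A (suc L) + cnt A (suc L)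

  Outcome : Pred → ℕ → Set
  Outcome A L = Saturated A L ⊎ ∃[ d ] ∃[ ℓ ] Dense⁺ A L d ℓ

  module _ (Q : Pred) (u : ℕ) (Q≤u : Supp Q u) (0∈Q : Q ∋ 0) (u∈Q : Q ∋ u) (g : ℕ) (1≤g : 1 ≤ g)
           (g-big : cnt Q (suc u) + cnt Q (suc u) ≤ suc (u + g)) where

    -- Turns the induction hypothesis for one side of a gap into `Good`. What escapes is a gap of
    -- length 1, or a divisor d > 1 common to g and all of Q.
    resolve : Outcome Q u → Good Q u g ⊎ (g ≡ 1 ⊎ ∃[ d ] 1 < d × d ∣ g × (∀ x → Q ∋ x → d ∣ x))
    resolve (inj₁ sat) with good-or-multiples Q u Q≤u 0∈Q u∈Q g 1≤g sat
    ... | inj₁ good = inj₁ good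
    ... | inj₂ g∣Q with m≤n⇒m<n∨m≡n 1≤g
    ...   | inj₁ 1<g = inj₂ (inj₂ (g , 1<g , ∣-refl , g∣Q))
    ...   | inj₂ 1≡g = inj₂ (inj₁ (sym 1≡g))
    resolve (inj₂ (zero , ℓ , refl , d∣Q , dense)) =
      ⊥-elim (<⇒≱ (≤-trans (m≤n+m 3 ℓ) dense) (+-mono-≤ (cnt≤ Q 1) (cnt≤ Q 1)))
    resolve (inj₂ (suc zero , ℓ , u≡ , d∣Q , dense)) =
      inj₁ (dense⇒good Q u Q≤u 0∈Q u∈Q g (subst (λ z → z + 3 ≤ _) (sym (trans u≡ (+-identityʳ ℓ))) dense) g-big)
    resolve (inj₂ (d@(suc (suc _)) , ℓ , u≡ , d∣Q , dense)) with d ∣? g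
    ... | yes d∣g = inj₂ (inj₂ (d , s≤s z<s , d∣g , d∣Q))
    ... | no d∤g = inj₁ (coprime⇒good Q u Q≤u 0∈Q u∈Q g 1≤g d d∣Q d∤g)

  flip-supp : ∀ u A → Supp (flip-at u A) u
  flip-supp u A i h with x , eq , _ ← flip-elim u A i h = ≤-trans (m≤n+m i x) (≤-reflexive eq)

  module _ (A : Pred) (u g v : ℕ) (A≤L : Supp A (u + g + v)) (no-mid : ∀ i → u < i → i < u + g → A ∌ i)
      (1≤g : 1 ≤ g) where
    private
      P₀ S₀ SS : Pred
      P₀ = flip-at u A
      S₀ = shift (u + g) A
      SS = A ⊹ A
      L c : ℕ
      L = u + g + v
      c = u + u + g
      sizes : ∀ u g v → suc (u + g + v + (u + g + v)) ≡ u + u + g + suc (g + (v + v))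
      sizes = solve-∀
      right : ∀ u g x → u + (u + g + x) ≡ u + u + g + x
      right = solve-∀
      right₂ : ∀ u g x y → (u + g + x) + (u + g + y) ≡ u + u + g + (g + (x + y))
      right₂ = solve-∀
      left : ∀ x e g → x + (x + e + g) + e ≡ (x + e) + (x + e) + g
      left = solve-∀
      left₂ : ∀ x x' y y' g → x + y + (g + (x' + y')) ≡ (x + x') + (y + y') + g
      left₂ = solve-∀

    cnt-parts : cnt A (suc L) ≡ cnt A (suc u) + cnt S₀ (suc v)
    cnt-parts = begin
      cnt A (suc (u + g + v))                     ≡⟨ cong (cnt A) (+-suc (u + g) v) ⟨
      cnt A (u + g + suc v)                       ≡⟨ cnt-split A (u + g) (suc v) ⟩
      cnt A (u + g) + cnt S₀ (suc v)              ≡⟨ cong (_+ cnt S₀ (suc v)) (cnt-stop A (suc u) (u + g)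
                                                       (≤-trans (≤-reflexive (+-comm 1 u)) (+-monoʳ-≤ u 1≤g))
                                                         no-mid) ⟩
      cnt A (suc u) + cnt S₀ (suc v)              ∎
      where open ≡-Reasoning

    module _ (u∈A : A ∋ u) (β∈A : A ∋ u + g) where

      -- P + P and P + β lie below u + β, while S + u and S + S lie above it.
      good-parts : Good P₀ u g → Good S₀ v g → Saturated A L
      good-parts gP gS = cut-arith (cnt A (suc L)) (cnt A (suc u)) (cnt S₀ (suc v)) (cnt SS c)
        (cnt (gapped P₀ g) (suc (g + (u + u)))) (cnt (gapped S₀ g) (suc (g + (v + v)))) (cnt SS (suc (L + L)))
        cnt-parts (subst (λ n → 3 * n ≤ cnt (gapped P₀ g) (suc (g + (u + u))) + 1) (cnt-flip u A) gP) gS below above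
        where
        open ≤-Reasoning
        up : ∀ e → gapped S₀ g ∋ e → SS ∋ c + e
        up e h with gapped-elim S₀ g e h
        ... | inj₁ s = ⊹-intro≡ A A u∈A s (right u g e)
        ... | inj₂ (f , refl , k) with x , y , refl , sx , sy ← ⊹-elim S₀ S₀ f k = ⊹-intro≡ A A sx sy
            (right₂ u g x y)
        down : ∀ e → gapped P₀ g ∋ e → flip-at c SS ∋ e
        down e h with gapped-elim P₀ g e h
        ... | inj₁ p with x , refl , x∈ ← flip-elim u A e p = flip-intro c SS (x + (u + g)) e (left x e g)
            (⊹-intro A A x∈ β∈A)
        ... | inj₂ (f , refl , k)
          with x' , y' , refl , px , py ← ⊹-elim P₀ P₀ f k
          with x , ex , x∈ ← flip-elim u A x' px
          with y , ey , y∈ ← flip-elim u A y' py =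
          flip-intro c SS (x + y) (g + (x' + y')) (trans (left₂ x x' y y' g) (cong (_+ g) (cong₂ _+_ ex ey)))
              (⊹-intro A A x∈ y∈)
        below : cnt (gapped P₀ g) (suc (g + (u + u))) ≤ cnt SS c + 1
        below = begin
          cnt (gapped P₀ g) (suc (g + (u + u)))    ≡⟨ cong (λ n → cnt (gapped P₀ g) (suc n)) (+-comm g (u + u)) ⟩
          cnt (gapped P₀ g) (suc c)                ≤⟨ cnt-mono (suc c) (λ e _ → down e) ⟩
          cnt (flip-at c SS) (suc c)               ≡⟨ cnt-flip c SS ⟩
          cnt SS c + ⟦ SS c ⟧                      ≤⟨ +-monoʳ-≤ (cnt SS c) (⟦⟧≤1 (SS c)) ⟩
          cnt SS c + 1                             ∎
        above : cnt SS c + cnt (gapped S₀ g) (suc (g + (v + v))) ≤ cnt SS (suc (L + L))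
        above = begin
          cnt SS c + cnt (gapped S₀ g) (suc (g + (v + v)))   ≤⟨ +-monoʳ-≤ (cnt SS c)
              (cnt-mono (suc (g + (v + v))) λ e _ → up e) ⟩
          cnt SS c + cnt (shift c SS) (suc (g + (v + v)))    ≡⟨ cnt-split SS c (suc (g + (v + v))) ⟨
          cnt SS (c + suc (g + (v + v)))                     ≡⟨ cong (cnt SS) (sizes u g v) ⟨
          cnt SS (suc (L + L))                               ∎

  cnt-multiples : ∀ A d → 1 ≤ d → (∀ x → A ∋ x → d ∣ x) → ∀ m → cnt A (d * m) ≡ cnt (λ i → A (d * i)) m
  cnt-multiples A d 1≤d d∣A zero = cong (cnt A) (*-zeroʳ d)
  cnt-multiples A d 1≤d d∣A (suc m) = begin
    cnt A (d * suc m)                                ≡⟨ cong (cnt A) (trans (*-suc d m) (+-comm d (d * m))) ⟩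
    cnt A (d * m + d)                                ≡⟨ cnt-split A (d * m) d ⟩
    cnt A (d * m) + cnt (shift (d * m) A) d          ≡⟨ cong₂ _+_ (cnt-multiples A d 1≤d d∣A m) block ⟩
    cnt (λ i → A (d * i)) m + ⟦ A (d * m) ⟧          ∎
    where
    open ≡-Reasoning
    block : cnt (shift (d * m) A) d ≡ ⟦ A (d * m) ⟧
    block = trans (∑-single (λ i → ⟦ A (d * m + i) ⟧) 0 1≤d (λ i i<d i≢0 → cong ⟦_⟧ (not-∋ A (d * m + i) λ h →
        <⇒≱ i<d (∣⇒≤ {{≢-nonZero i≢0}} (∣m+n∣m⇒∣n (d∣A _ h) (m∣m*n m))))))
      (cong (λ z → ⟦ A z ⟧) (+-identityʳ (d * m)))

  cnt-multiples-suc : ∀ A d → 1 ≤ d → (∀ x → A ∋ x → d ∣ x) → ∀ m → cnt A (suc (d * m)) ≡ cnt (λ i → A (d * i))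
      (suc m)
  cnt-multiples-suc A d 1≤d d∣A m = cong (_+ ⟦ A (d * m) ⟧) (cnt-multiples A d 1≤d d∣A m)

  unscale : ∀ A d m → 1 ≤ d → (∀ x → A ∋ x → d ∣ x) → Outcome (λ i → A (d * i)) m → Outcome A (d * m)
  unscale A d m 1≤d d∣A (inj₁ sat) = inj₁ (begin
    3 * cnt A (suc (d * m))                              ≡⟨ cong (3 *_) (cnt-multiples-suc A d 1≤d d∣A m) ⟩
    3 * cnt A₁ (suc m)                                   ≤⟨ sat ⟩
    cnt (A₁ ⊹ A₁) (suc (m + m)) + 3                      ≤⟨ +-monoˡ-≤ 3 (cnt-mono (suc (m + m)) sub) ⟩
    cnt (λ i → (A ⊹ A) (d * i)) (suc (m + m)) + 3        ≡⟨ cong (_+ 3)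
        (cnt-multiples-suc (A ⊹ A) d 1≤d d∣AA (m + m)) ⟨
    cnt (A ⊹ A) (suc (d * (m + m))) + 3                  ≡⟨ cong (λ n → cnt (A ⊹ A) (suc n) + 3)
        (*-distribˡ-+ d m m) ⟩
    cnt (A ⊹ A) (suc (d * m + d * m)) + 3                ∎)
    where
    open ≤-Reasoning
    A₁ : Pred
    A₁ i = A (d * i)
    sub : ∀ i → i < suc (m + m) → A₁ ⊹ A₁ ∋ i → A ⊹ A ∋ d * i
    sub i _ h with x , y , refl , ax , ay ← ⊹-elim A₁ A₁ i h = ⊹-intro≡ A A ax ay (sym (*-distribˡ-+ d x y))
    d∣AA : ∀ z → A ⊹ A ∋ z → d ∣ z
    d∣AA z h with x , y , refl , ax , ay ← ⊹-elim A A z h = ∣m∣n⇒∣m+n (d∣A x ax) (d∣A y ay)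
  unscale A d m 1≤d d∣A (inj₂ (d' , ℓ , refl , d'∣ , dense)) =
    inj₂ (d * d' , ℓ , sym (*-assoc d d' ℓ) , div , subst (λ n → ℓ + 3 ≤ n + n)
        (sym (cnt-multiples-suc A d 1≤d d∣A (d' * ℓ))) dense)
    where
    div : ∀ x → A ∋ x → d * d' ∣ x
    div x h with divides i refl ← d∣A x h = subst (d * d' ∣_) (*-comm d i)
        (*-monoʳ-∣ d (d'∣ i (subst (A ∋_) (*-comm i d) h)))

  private abstract
    g-top : ∀ a p u g → a ≡ p + 1 → a + a ≤ u + g + 0 + 2 → p + p ≤ suc (u + g)
    g-top = linear 4 (λ a p u g → 2 · a ≐˘ p ⊕ con 1 ⇒ 1 · a ⊕ a ⩽ u ⊕ g ⊕ con 0 ⊕ con 2 ⇒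
        ⊢ 0 · p ⊕ p ⩽ suc′ (u ⊕ g))

    g-suf : ∀ a c s u g v → a ≡ c + s → a + a ≤ u + g + v + 2 → u + 2 ≤ c + c →
            s + s ≤ suc (v + g)
    g-suf = linear 6 (λ a c s u g v → 2 · a ≐˘ c ⊕ s ⇒ 1 · a ⊕ a ⩽ u ⊕ g ⊕ v ⊕ con 2 ⇒
        1 · u ⊕ con 2 ⩽ c ⊕ c ⇒ ⊢ 0 · s ⊕ s ⩽ suc′ (v ⊕ g))

    g-pre : ∀ b c u g → b ≡ c + 1 → b + b ≤ u + g + 2 → c + c ≤ suc (u + g)
    g-pre = linear 4 (λ b c u g → 2 · b ≐˘ c ⊕ con 1 ⇒ 1 · b ⊕ b ⩽ u ⊕ g ⊕ con 2 ⇒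
        ⊢ 0 · c ⊕ c ⩽ suc′ (u ⊕ g))

    g≥2 : ∀ b c u g → b ≡ c + 1 → b + b ≤ u + g + 2 → u + 2 ≤ c + c → u + 2 ≤ u + g
    g≥2 = linear 4 (λ b c u g → 2 · b ≐˘ c ⊕ con 1 ⇒ 1 · b ⊕ b ⩽ u ⊕ g ⊕ con 2 ⇒
        1 · u ⊕ con 2 ⩽ c ⊕ c ⇒ ⊢ 0 · u ⊕ con 2 ⩽ u ⊕ g)

    not-last : ∀ a p u → a ≡ p + 1 → a + a ≤ suc u + 2 → u + 3 ≤ p + p → ⊥
    not-last = linear 3 (λ a p u → 2 · a ≐˘ p ⊕ con 1 ⇒ 1 · a ⊕ a ⩽ suc′ u ⊕ con 2 ⇒
        1 · u ⊕ con 3 ⩽ p ⊕ p ⇒ ⊢⊥)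

    dense-of : ∀ z c → z + 2 < c + c → z + 3 ≤ c + c
    dense-of = linear 2 (λ z c → 1 · z ⊕ con 2 ≺ c ⊕ c ⇒ ⊢ 0 · z ⊕ con 3 ⩽ c ⊕ c)

  private
    light : Pred → Pred
    light A z = (1 ≤ᵇ z) ∧ (A z ∧ (cnt A (suc z) + cnt A (suc z) ≤ᵇ z + 2))

    light-intro : ∀ A z → 1 ≤ z → A ∋ z → cnt A (suc z) + cnt A (suc z) ≤ z + 2 → light A ∋ z
    light-intro A z p q r = ∧-intro (≤ᵇ-true p) (∧-intro q (≤ᵇ-true r))

    light-elim : ∀ A z → light A ∋ z → 1 ≤ z × A ∋ z × cnt A (suc z) + cnt A (suc z) ≤ z + 2
    light-elim A z h with h₁ , h₂ ← ∧-true {1 ≤ᵇ z} h with h₃ , h₄ ← ∧-true {A z} h₂ =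
      ≤ᵇ-≤ {1} h₁ , h₃ , ≤ᵇ-≤ {cnt A (suc z) + cnt A (suc z)} h₄

    not-light : ∀ A z → 1 ≤ z → A ∋ z → light A ∌ z → z + 3 ≤ cnt A (suc z) + cnt A (suc z)
    not-light A z p q h = dense-of z (cnt A (suc z)) (≰⇒> λ r → ∋-∌ (light A) z (light-intro A z p q r) h)

  prev : ∀ A z → 1 ≤ z → A ∋ 0 → ∃[ u ] ∃[ g ] 1 ≤ g × u + g ≡ z × A ∋ u × (∀ i → u < i → i < z → A ∌ i)
  prev A z 1≤z 0∈A with last A z
  ... | inj₂ none = ⊥-elim (∋-∌ A 0 0∈A (none 0 1≤z))
  ... | inj₁ (u , u<z , u∈A , h) with g , eq ← m≤n⇒∃[o]m+o≡n u<z = u , suc g , z<s , trans (+-suc u g) eq , u∈A , h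

  Freiman : ℕ → Set
  Freiman L = ∀ A → Supp A L → A ∋ 0 → A ∋ L → Outcome A L

  module Step (L : ℕ) (rec : ∀ {m} → m < L → Freiman m)
              (A : Pred) (A≤L : Supp A L) (0∈A : A ∋ 0) (L∈A : A ∋ L) (1≤L : 1 ≤ L)
              (sparse : cnt A (suc L) + cnt A (suc L) ≤ L + 2) where

    prefix-0 : ∀ u → A ∋ u → flip-at u A ∋ 0
    prefix-0 u u∈A = flip-intro u A u 0 (+-identityʳ u) u∈A

    prefix-u : ∀ u → flip-at u A ∋ u
    prefix-u u = flip-intro u A 0 u refl 0∈A

    -- The cut is placed before the first element β at which A ∩ [0 , β] stops being dense.
    cut : ∀ u → suc u ≡ L → A ∋ u → Outcome A L
    cut u refl u∈A with first (light A) (suc L)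
    ... | inj₂ none = ⊥-elim (∋-∌ (light A) L (light-intro A L 1≤L L∈A sparse) (none L (n<1+n L)))
    ... | inj₁ (β , β<sL , hβ , before) with 1≤β , β∈A , light-β ← light-elim A β hβ
      with w , g , 1≤g , refl , w∈A , gap ← prev A β 1≤β 0∈A
      with v , refl-L ← m≤n⇒∃[o]m+o≡n (≤-pred β<sL) = inj₁ main
      where
      A≤ : Supp A (w + g + v)
      A≤ = subst (Supp A) (sym refl-L) A≤L

      L∈ : A ∋ w + g + v
      L∈ = subst (A ∋_) (sym refl-L) L∈A

      cw = cnt A (suc w)

      w<wg : w < w + g
      w<wg = ≤-trans (≤-reflexive (+-comm 1 w)) (+-monoʳ-≤ w 1≤g)

      cnt-β : cnt A (suc (w + g)) ≡ cw + 1
      cnt-β = trans (cnt-step A (w + g) β∈A) (trans (cong suc (cnt-stop A (suc w) (w + g) w<wg gap)) (+-comm 1 cw))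

      w-dense : w ≡ 0 ⊎ w + 3 ≤ cw + cw
      w-dense with w ≟ 0
      ... | yes w≡0 = inj₁ w≡0
      ... | no w≢0 = inj₂ (not-light A w (n≢0⇒n>0 w≢0) w∈A (before w w<wg))

      w-weight : w + 2 ≤ cw + cw
      w-weight with w-dense
      ... | inj₁ refl = ≤-trans (+-mono-≤ (∋⇒1≤ 0∈A) (∋⇒1≤ 0∈A)) ≤-refl
      ... | inj₂ h = ≤-trans (+-monoʳ-≤ w (n≤1+n 2)) h

      -- A new element adds 2 to the doubled count, so density can only be lost by a jump of at
      -- least 2. This excludes the outcome g = 1 of `resolve` below.
      2≤g : 2 ≤ g
      2≤g = +-cancelˡ-≤ w 2 g (g≥2 (cnt A (suc (w + g))) cw w g cnt-β light-β w-weight)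

      sparse' : cnt A (suc (w + g + v)) + cnt A (suc (w + g + v)) ≤ w + g + v + 2
      sparse' = subst (λ z → cnt A (suc z) + cnt A (suc z) ≤ z + 2) (sym refl-L) sparse

      -- β < L: otherwise A ∩ [0 , u] would be dense, and appending L = u + 1 could not make A
      -- sparse. Hence both u and u + 1 lie in the right part.
      v-pos : ∀ v → w + g + v ≡ suc u → ∃[ v' ] v ≡ suc v'
      v-pos (suc v') _ = v' , refl
      v-pos zero eq with w+g≡ ← trans (sym (+-identityʳ (w + g))) eq with u ≟ 0
      ... | yes u≡0 = ⊥-elim (<⇒≱ 2≤g (≤-trans (m≤n+m g w) (≤-reflexive (trans w+g≡ (cong suc u≡0)))))
      ... | no u≢0 = ⊥-elim (not-last (cnt A (suc (suc u))) (cnt A (suc u)) u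
              (trans (cnt-step A (suc u) L∈A) (+-comm 1 _)) sparse
              (not-light A u (n≢0⇒n>0 u≢0) u∈A (before u (≤-reflexive (sym w+g≡)))))

      pre : Good (flip-at w A) w g
      pre with w-dense
      ... | inj₁ refl = singleton-good (flip-at 0 A) g (flip-supp 0 A) (prefix-0 0 w∈A) 1≤g
      ... | inj₂ h = dense⇒good (flip-at w A) w (flip-supp w A) (prefix-0 w w∈A) (prefix-u w) g
              (subst (λ n → w + 3 ≤ n + n) (sym (cnt-flip w A)) h)
              (subst (λ n → n + n ≤ suc (w + g)) (sym (cnt-flip w A))
                (g-pre (cnt A (suc (w + g))) cw w g cnt-β light-β))

      S₀ : Pred
      S₀ = shift (w + g) A

      S₀≤v : Supp S₀ v
      S₀≤v i h = +-cancelˡ-≤ (w + g) i v (A≤ _ h)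

      suf : Good S₀ v g
      suf with v' , ev ← v-pos v refl-L
          with resolve S₀ v S₀≤v (trans (cong A (+-identityʳ (w + g))) β∈A) L∈ g 1≤g
            (g-suf (cnt A (suc (w + g + v))) cw (cnt S₀ (suc v)) w g v (cnt-parts A w g v A≤ gap 1≤g) sparse'
              w-weight)
            (rec (≤-trans (+-monoˡ-≤ v (≤-trans 1≤g (m≤n+m g w))) (≤-reflexive refl-L)) S₀ S₀≤v
               (trans (cong A (+-identityʳ (w + g))) β∈A) L∈)
      ... | inj₁ good = good
      ... | inj₂ (inj₁ g≡1) = ⊥-elim (<⇒≢ 2≤g (sym g≡1))
      -- The right part contains two consecutive integers, so no d > 1 divides all its elements.
      ... | inj₂ (inj₂ (d , 1<d , d∣g , d∣S)) = ⊥-elim (<⇒≢ 1<d (sym (∣1⇒≡1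
              (∣m+n∣m⇒∣n (subst (d ∣_) (trans ev (+-comm 1 v')) (d∣S v L∈)) (d∣S v' u∈S₀)))))
        where
        u∈S₀ : S₀ ∋ v'
        u∈S₀ = subst (A ∋_) (suc-injective (trans (sym refl-L) (trans (cong (w + g +_) ev) (+-suc (w + g) v')))) u∈A

      main : Saturated A (suc u)
      main = subst (Saturated A) refl-L (good-parts A w g v A≤ gap 1≤g w∈A β∈A pre suf)

    -- d divides u and g, hence L and all of A, and the induction hypothesis applies to A / d, which
    -- is strictly shorter.
    scaled : ∀ u g d → 1 ≤ g → u + g ≡ L → (∀ i → u < i → i < L → A ∌ i) → 1 < d → d ∣ g →
             (∀ x → flip-at u A ∋ x → d ∣ x) → Outcome A L
    scaled u g d 1≤g refl gap 1<d d∣g d∣P = go d∣L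
      where
      d∣u : d ∣ u
      d∣u = d∣P u (prefix-u u)
      d∣L : d ∣ u + g
      d∣L = ∣m∣n⇒∣m+n d∣u d∣g
      d∣A : ∀ x → A ∋ x → d ∣ x
      d∣A x x∈A with m≤n⇒m<n∨m≡n (A≤L x x∈A)
      ... | inj₂ refl = d∣L
      ... | inj₁ x<L with x ≤? u
      ...   | no x≰u = ⊥-elim (∋-∌ A x x∈A (gap x (≰⇒> x≰u) x<L))
      ...   | yes x≤u with e , eq ← m≤n⇒∃[o]m+o≡n x≤u =
        ∣m+n∣m⇒∣n (subst (d ∣_) (trans (sym eq) (+-comm x e)) d∣u) (d∣P e (flip-intro u A x e eq x∈A))
      go : d ∣ u + g → Outcome A (u + g)
      go (divides m u+g≡) = subst (Outcome A) (sym eqL) (unscale A d m (<⇒≤ 1<d) d∣A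
        (rec m<L (λ i → A (d * i))
          (λ i h → *-cancelˡ-≤ d {{>-nonZero (<⇒≤ 1<d)}} (≤-trans (A≤L (d * i) h) (≤-reflexive eqL)))
          (trans (cong A (*-zeroʳ d)) 0∈A) (subst (A ∋_) eqL L∈A)))
        where
        eqL : u + g ≡ d * m
        eqL = trans u+g≡ (*-comm m d)
        pos : ∀ m → u + g ≡ m * d → 0 < m
        pos zero    eq = ⊥-elim (<⇒≢ (≤-trans 1≤g (m≤n+m g u)) (sym eq))
        pos (suc m) eq = z<s
        m<L : m < u + g
        m<L = subst (m <_) (sym u+g≡) (m<m*n m d {{>-nonZero (pos m u+g≡)}} 1<d)

    last-good : ∀ u g → 1 ≤ g → u + g ≡ L → A ∋ u → (∀ i → u < i → i < L → A ∌ i) →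
                Good (flip-at u A) u g → Outcome A L
    last-good u g 1≤g refl u∈A gap good = inj₁ (subst (Saturated A) (+-identityʳ (u + g))
      (good-parts A u g 0 A≤ gap 1≤g u∈A L∈A good
        (singleton-good (shift (u + g) A) g S≤0 (trans (cong A (+-identityʳ (u + g))) L∈A) 1≤g)))
      where
      A≤ : Supp A (u + g + 0)
      A≤ = subst (Supp A) (sym (+-identityʳ (u + g))) A≤L
      S≤0 : Supp (shift (u + g) A) 0
      S≤0 i h = +-cancelˡ-≤ (u + g) i 0 (A≤ _ h)

    -- Splits off the largest element: the left part is A without L, to which induction applies, and
    -- the right part is a single point.
    outcome : Outcome A L
    outcome with u , g , 1≤g , refl , u∈A , gap ← prev A L 1≤L 0∈A
      with u<L ← ≤-trans (≤-reflexive (+-comm 1 u)) (+-monoʳ-≤ u 1≤g)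
      with resolve (flip-at u A) u (flip-supp u A) (prefix-0 u u∈A) (prefix-u u) g 1≤g
             (g-top (cnt A (suc (u + g))) (cnt (flip-at u A) (suc u)) u g
               (trans (cnt-step A (u + g) L∈A) (trans (cong suc (trans (cnt-stop A (suc u) (u + g) u<L gap)
                 (sym (cnt-flip u A)))) (+-comm 1 _)))
               (≤-trans sparse (≤-reflexive (cong (_+ 2) (sym (+-identityʳ (u + g)))))))
             (rec u<L (flip-at u A) (flip-supp u A) (prefix-0 u u∈A) (prefix-u u))
    ... | inj₁ good = last-good u g 1≤g refl u∈A gap good
    ... | inj₂ (inj₁ refl) = cut u (+-comm 1 u) u∈A
    ... | inj₂ (inj₂ (d , 1<d , d∣g , d∣P)) = scaled u g d 1≤g refl gap 1<d d∣g d∣P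

  freiman : ∀ L → Freiman L
  freiman = <-rec Freiman step
    where
    step : ∀ L → (∀ {m} → m < L → Freiman m) → Freiman L
    step zero rec A A≤L 0∈A L∈A = inj₁ (≤-trans (*-monoʳ-≤ 3 (cnt≤ A 1)) (m≤n+m 3 _))
    step L@(suc _) rec A A≤L 0∈A L∈A with L + 3 ≤? cnt A (suc L) + cnt A (suc L)
    ... | yes dense = inj₂ (1 , L , sym (*-identityˡ L) , (λ x _ → 1∣ x) , dense)
    ... | no sparse = Step.outcome L rec A A≤L 0∈A L∈A z<s (≤-pred (≤-trans (≰⇒> sparse) (≤-reflexive (+-suc L 2))))

-- Inequalities, absolute values and sums in ℚ.

module Rationals where
  open import Data.Nat.Base as ℕ using (ℕ; zero; suc)
  import Data.Nat.Properties as ℕ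
  open import Data.Rational.Base
  open import Data.Rational.Properties
  open import Data.Maybe.Base using (Maybe; just; nothing)
  open import Data.Product.Base using (∃-syntax; _,_)
  open import Data.Sum.Base using (inj₁; inj₂)
  open import Relation.Nullary using (yes; no)
  open import Relation.Binary.PropositionalEquality
  open import Tactic.RingSolver using (solve-∀)
  open import Tactic.RingSolver.Core.AlmostCommutativeRing using (AlmostCommutativeRing; fromCommutativeRing)
  open import Level using (0ℓ)

  ℚR : AlmostCommutativeRing 0ℓ 0ℓ
  ℚR = fromCommutativeRing +-*-commutativeRing isZero
    where
    isZero : ∀ x → Maybe (0ℚ ≡ x)
    isZero x with 0ℚ ≟ x
    ... | yes p = just p
    ... | no  _ = nothing

  private
    cancel : ∀ x y → y ≡ x + (y - x)
    cancel = solve-∀ ℚR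
    self : ∀ x → x - x ≡ 0ℚ
    self = solve-∀ ℚR

  -- The certificate for x ≤ y is an expression for y - x visibly ≥ 0.
  by-diff : ∀ {x y} e → 0ℚ ≤ e → y ≡ x + e → x ≤ y
  by-diff {x} e 0≤e refl = subst (_≤ x + e) (+-identityʳ x) (+-monoʳ-≤ x 0≤e)

  diff≥0 : ∀ {x y} → x ≤ y → 0ℚ ≤ y - x
  diff≥0 {x} {y} x≤y = subst (_≤ y - x) (self x) (+-monoˡ-≤ (- x) x≤y)

  diff≥0⁻¹ : ∀ {x y} → 0ℚ ≤ y - x → x ≤ y
  diff≥0⁻¹ {x} {y} h = by-diff (y - x) h (cancel x y)

  0≤+ : ∀ {x y} → 0ℚ ≤ x → 0ℚ ≤ y → 0ℚ ≤ x + y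
  0≤+ = +-mono-≤

  0≤* : ∀ {x y} → 0ℚ ≤ x → 0ℚ ≤ y → 0ℚ ≤ x * y
  0≤* {x} {y} hx hy = subst (_≤ x * y) (*-zeroʳ x) (*-monoˡ-≤-nonNeg x {{nonNegative hx}} hy)

  *-mono : ∀ {a b c d} → 0ℚ ≤ a → 0ℚ ≤ d → a ≤ b → c ≤ d → a * c ≤ b * d
  *-mono {a} {b} {c} {d} 0≤a 0≤d a≤b c≤d =
    ≤-trans (*-monoˡ-≤-nonNeg a {{nonNegative 0≤a}} c≤d) (*-monoʳ-≤-nonNeg d {{nonNegative 0≤d}} a≤b)

  *-monoʳ : ∀ a {c d} → 0ℚ ≤ a → c ≤ d → a * c ≤ a * d
  *-monoʳ a 0≤a = *-monoˡ-≤-nonNeg a {{nonNegative 0≤a}}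

  0≤1 : 0ℚ ≤ 1ℚ
  0≤1 = nonNegative⁻¹ 1ℚ

  sq-abs : ∀ x → x * x ≡ ∣ x ∣ * ∣ x ∣
  sq-abs x with ∣p∣≡p∨∣p∣≡-p x
  ... | inj₁ e rewrite e = refl
  ... | inj₂ e rewrite e = square-neg x
    where
    square-neg : ∀ x → x * x ≡ (- x) * (- x)
    square-neg = solve-∀ ℚR

  0≤sq : ∀ x → 0ℚ ≤ x * x
  0≤sq x = subst (0ℚ ≤_) (sym (sq-abs x)) (0≤* (0≤∣p∣ x) (0≤∣p∣ x))

  ≤∣_∣ : ∀ x → x ≤ ∣ x ∣
  ≤∣ x ∣ with ≤-total 0ℚ x
  ... | inj₁ h = ≤-reflexive (sym (0≤p⇒∣p∣≡p h))
  ... | inj₂ h = ≤-trans h (0≤∣p∣ x)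

  -≤∣_∣ : ∀ x → - x ≤ ∣ x ∣
  -≤∣ x ∣ = subst (- x ≤_) (∣-p∣≡∣p∣ x) ≤∣ - x ∣

  abs≤ : ∀ {x a} → x ≤ a → - x ≤ a → ∣ x ∣ ≤ a
  abs≤ {x} h k with ∣p∣≡p∨∣p∣≡-p x
  ... | inj₁ e rewrite e = h
  ... | inj₂ e rewrite e = k

  abs-+ : ∀ {x y a b} → ∣ x ∣ ≤ a → ∣ y ∣ ≤ b → ∣ x + y ∣ ≤ a + b
  abs-+ {x} {y} h k = ≤-trans (∣p+q∣≤∣p∣+∣q∣ x y) (+-mono-≤ h k)

  abs-neg : ∀ {x a} → ∣ x ∣ ≤ a → ∣ - x ∣ ≤ a
  abs-neg {x} h = subst (_≤ _) (sym (∣-p∣≡∣p∣ x)) h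

  abs-- : ∀ {x y a b} → ∣ x ∣ ≤ a → ∣ y ∣ ≤ b → ∣ x - y ∣ ≤ a + b
  abs-- {x} {y} h k = abs-+ {x} { - y} h (abs-neg {y} k)

  abs-* : ∀ {x y a b} → ∣ x ∣ ≤ a → ∣ y ∣ ≤ b → ∣ x * y ∣ ≤ a * b
  abs-* {x} {y} {a} {b} h k = subst (_≤ a * b) (sym (∣p*q∣≡∣p∣*∣q∣ x y))
    (*-mono (0≤∣p∣ x) (≤-trans (0≤∣p∣ y) k) h k)

  abs≤-nonneg : ∀ {x a} → ∣ x ∣ ≤ a → 0ℚ ≤ a
  abs≤-nonneg {x} h = ≤-trans (0≤∣p∣ x) h

  abs≤1 : ∀ x → x * x ≤ 1ℚ → ∣ x ∣ ≤ 1ℚ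
  abs≤1 x h with ≤-total ∣ x ∣ 1ℚ
  ... | inj₁ k = k
  ... | inj₂ k = ≤-trans (subst (_≤ ∣ x ∣ * ∣ x ∣) (*-identityʳ ∣ x ∣) (*-monoʳ ∣ x ∣ (0≤∣p∣ x) k))
                   (subst (_≤ 1ℚ) (sq-abs x) h)

  open import Algebra.Structures using (IsCommutativeRing)
  open Sum (IsCommutativeRing.isCommutativeSemiring +-*-isCommutativeRing) public

  -- A sum of ones, so that additivity is an instance of `∑-split`.
  ι : ℕ → ℚ
  ι n = ∑ (λ _ → 1ℚ) n

  ι-+ : ∀ m n → ι (m ℕ.+ n) ≡ ι m + ι n
  ι-+ m n = ∑-split (λ _ → 1ℚ) m n

  ι-* : ∀ m n → ι (m ℕ.* n) ≡ ι m * ι n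
  ι-* zero    n = sym (*-zeroˡ (ι n))
  ι-* (suc m) n = trans (ι-+ n (m ℕ.* n)) (trans (cong (ι n +_) (ι-* m n)) (step (ι n) (ι m)))
    where
    step : ∀ a b → a + b * a ≡ (b + 1ℚ) * a
    step = solve-∀ ℚR

  0≤ι : ∀ n → 0ℚ ≤ ι n
  0≤ι zero    = ≤-refl
  0≤ι (suc n) = 0≤+ (0≤ι n) 0≤1

  ι-mono : ∀ {m n} → m ℕ.≤ n → ι m ≤ ι n
  ι-mono {m} m≤n with k , refl ← ℕ.m≤n⇒∃[o]m+o≡n m≤n = by-diff (ι k) (0≤ι k) (ι-+ m k)

  ι-< : ∀ n → ι n < ι (suc n)
  ι-< n = subst (_< ι n + 1ℚ) (+-identityʳ (ι n)) (+-monoʳ-< (ι n) (positive⁻¹ 1ℚ))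

  ι-reflects : ∀ {m n} → ι m ≤ ι n → m ℕ.≤ n
  ι-reflects {m} {n} h = ℕ.≮⇒≥ λ n<m → <-irrefl refl (<-≤-trans (<-≤-trans (ι-< n) (ι-mono n<m)) h)

  ∑-mono : ∀ {f g} n → (∀ i → i ℕ.< n → f i ≤ g i) → ∑ f n ≤ ∑ g n
  ∑-mono zero    h = ≤-refl
  ∑-mono (suc n) h = +-mono-≤ (∑-mono n λ i i<n → h i (ℕ.m<n⇒m<1+n i<n)) (h n (ℕ.n<1+n n))

  ∑-const : ∀ c n → ∑ (λ _ → c) n ≡ ι n * c
  ∑-const c zero    = sym (*-zeroˡ c)
  ∑-const c (suc n) = trans (cong (_+ c) (∑-const c n)) (step (ι n) c)
    where
    step : ∀ a b → a * b + b ≡ (a + 1ℚ) * b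
    step = solve-∀ ℚR

  ∑-neg : ∀ f n → ∑ (λ i → - f i) n ≡ - ∑ f n
  ∑-neg f zero    = refl
  ∑-neg f (suc n) = trans (cong (_+ (- f n)) (∑-neg f n)) (sym (neg-distrib-+ (∑ f n) (f n)))

  ∑-- : ∀ f g n → ∑ (λ i → f i - g i) n ≡ ∑ f n - ∑ g n
  ∑-- f g n = trans (∑-+ f (λ i → - g i) n) (cong (∑ f n +_) (∑-neg g n))

  ∑-abs : ∀ {f} b n → (∀ i → i ℕ.< n → ∣ f i ∣ ≤ b) → ∣ ∑ f n ∣ ≤ ι n * b
  ∑-abs b zero    h = ≤-reflexive (sym (*-zeroˡ b))
  ∑-abs {f} b (suc n) h = subst (∣ ∑ f n + f n ∣ ≤_) (step (ι n) b)
    (abs-+ {∑ f n} {f n} (∑-abs b n λ i i<n → h i (ℕ.m<n⇒m<1+n i<n)) (h n (ℕ.n<1+n n)))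
    where
    step : ∀ a b → a * b + b ≡ (a + 1ℚ) * b
    step = solve-∀ ℚR

-- Powers of a rational point of the unit circle.

module Trig (c s : ℚ.ℚ) (unit : c ℚ.* c ℚ.+ s ℚ.* s ≡ ℚ.1ℚ) where
  open import Data.Rational.Base hiding (_/_)
  open import Relation.Binary.PropositionalEquality
  open import Data.Nat.Base as ℕ using (ℕ; zero; suc)
  import Data.Nat.Properties as ℕ
  open import Data.Nat.DivMod using (_%_; _/_; m≡m%n+[m/n]*n; m%n<n; m<n*o⇒m/o<n)
  open import Data.Rational.Properties
  open import Data.Product.Base using (∃-syntax; _,_)
  open import Data.Empty using (⊥-elim)
  open import Relation.Binary.Definitions using (tri<; tri≈; tri>)
  open import Tactic.RingSolver using (solve-∀)
  open Rationals

  -- Real and imaginary part of the j-th power of c + s i, in the role of cos jφ and sin jφ.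
  C S : ℕ → ℚ
  C zero    = 1ℚ
  C (suc j) = c * C j - s * S j
  S zero    = 0ℚ
  S (suc j) = s * C j + c * S j

  private
    C-+₀ : ∀ y z → y ≡ 1ℚ * y - 0ℚ * z
    C-+₀ = solve-∀ ℚR
    S-+₀ : ∀ y z → z ≡ 0ℚ * y + 1ℚ * z
    S-+₀ = solve-∀ ℚR
    C-+₁ : ∀ c s x y z w → c * (x * y - z * w) - s * (z * y + x * w) ≡ (c * x - s * z) * y - (s * x + c * z) * w
    C-+₁ = solve-∀ ℚR
    S-+₁ : ∀ c s x y z w → s * (x * y - z * w) + c * (z * y + x * w) ≡ (s * x + c * z) * y + (c * x - s * z) * w
    S-+₁ = solve-∀ ℚR
    norm : ∀ c s x z → (c * x - s * z) * (c * x - s * z) + (s * x + c * z) * (s * x + c * z) ≡ (c * c + s * s) *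
        (x * x + z * z)
    norm = solve-∀ ℚR
    sub : ∀ x z y w → x * (y * y + w * w) ≡ (x * y - z * w) * y + (z * y + x * w) * w
    sub = solve-∀ ℚR
    subS : ∀ x z y w → z * (y * y + w * w) ≡ (z * y + x * w) * y - (x * y - z * w) * w
    subS = solve-∀ ℚR

  C-+ : ∀ i j → C (i ℕ.+ j) ≡ C i * C j - S i * S j
  S-+ : ∀ i j → S (i ℕ.+ j) ≡ S i * C j + C i * S j
  C-+ zero    j = C-+₀ (C j) (S j)
  C-+ (suc i) j = trans (cong₂ (λ a b → c * a - s * b) (C-+ i j) (S-+ i j)) (C-+₁ c s (C i) (C j) (S i) (S j))
  S-+ zero    j = S-+₀ (C j) (S j)
  S-+ (suc i) j = trans (cong₂ (λ a b → s * a + c * b) (C-+ i j) (S-+ i j)) (S-+₁ c s (C i) (C j) (S i) (S j))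

  pyth : ∀ i → C i * C i + S i * S i ≡ 1ℚ
  pyth zero    = refl
  pyth (suc i) = trans (norm c s (C i) (S i)) (cong₂ _*_ unit (pyth i))

  ∣C∣≤1 : ∀ i → ∣ C i ∣ ≤ 1ℚ
  ∣C∣≤1 i = abs≤1 (C i) (by-diff (S i * S i) (0≤sq (S i)) (sym (pyth i)))

  ∣S∣≤1 : ∀ i → ∣ S i ∣ ≤ 1ℚ
  ∣S∣≤1 i = abs≤1 (S i) (by-diff (C i * C i) (0≤sq (C i)) (trans (sym (pyth i)) (+-comm (C i * C i) (S i * S i))))

  C-sub : ∀ i t → C i ≡ C (i ℕ.+ t) * C t + S (i ℕ.+ t) * S t
  C-sub i t = begin
    C i                                           ≡⟨ *-identityʳ (C i) ⟨
    C i * 1ℚ                                      ≡⟨ cong (C i *_) (pyth t) ⟨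
    C i * (C t * C t + S t * S t)                 ≡⟨ sub (C i) (S i) (C t) (S t) ⟩
    (C i * C t - S i * S t) * C t + (S i * C t + C i * S t) * S t
                                                  ≡⟨ cong₂ (λ a b → a * C t + b * S t) (C-+ i t) (S-+ i t) ⟨
    C (i ℕ.+ t) * C t + S (i ℕ.+ t) * S t         ∎
    where open ≡-Reasoning

  S-sub : ∀ i t → S i ≡ S (i ℕ.+ t) * C t - C (i ℕ.+ t) * S t
  S-sub i t = begin
    S i                                           ≡⟨ *-identityʳ (S i) ⟨
    S i * 1ℚ                                      ≡⟨ cong (S i *_) (pyth t) ⟨
    S i * (C t * C t + S t * S t)                 ≡⟨ subS (C i) (S i) (C t) (S t) ⟩
    (S i * C t + C i * S t) * C t - (C i * C t - S i * S t) * S t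
                                                  ≡⟨ cong₂ (λ a b → a * C t - b * S t) (S-+ i t) (C-+ i t) ⟨
    S (i ℕ.+ t) * C t - C (i ℕ.+ t) * S t         ∎
    where open ≡-Reasoning

  -- With ζ = (c + s i)², ζⁿ = C₂ n + S₂ n i.
  C₂ S₂ : ℕ → ℚ
  C₂ n = C (n ℕ.+ n)
  S₂ n = S (n ℕ.+ n)

  private
    dir₀ : ∀ x y → x * (0ℚ + 1ℚ) ≡ (x * 1ℚ + y * 0ℚ) * 1ℚ
    dir₀ = solve-∀ ℚR
    dir₁ : ∀ t u y w → u * (y * w + u * t) + t * (y * y - u * u) ≡ (t * y + w * u) * y
    dir₁ = solve-∀ ℚR

  -- The Dirichlet kernel in closed form. The factor S t turns each term into a difference, and the
  -- sum telescopes.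
  dirichlet : ∀ t n → S t * ∑ (λ d → C₂ (d ℕ.* t)) (suc n) ≡ S (suc n ℕ.* t) * C (n ℕ.* t)
  dirichlet t zero    = trans (dir₀ (S t) (C t)) (cong (_* 1ℚ) (sym (S-+ t 0)))
  dirichlet t (suc n) = begin
    S t * (∑ (λ d → C₂ (d ℕ.* t)) (suc n) + C₂ Y)          ≡⟨ *-distribˡ-+ (S t) _ _ ⟩
    S t * ∑ (λ d → C₂ (d ℕ.* t)) (suc n) + S t * C₂ Y      ≡⟨ cong₂ _+_ (dirichlet t n) (cong (S t *_) (C-+ Y Y)) ⟩
    S Y * C (n ℕ.* t) + S t * (C Y * C Y - S Y * S Y)      ≡⟨ cong (λ z → S Y * z + S t * (C Y * C Y - S Y * S Y))
        back ⟩
    S Y * (C Y * C t + S Y * S t) + S t * (C Y * C Y - S Y * S Y)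
                                                           ≡⟨ dir₁ (S t) (S Y) (C Y) (C t) ⟩
    (S t * C Y + C t * S Y) * C Y                          ≡⟨ cong (_* C Y) (S-+ t Y) ⟨
    S (t ℕ.+ Y) * C Y                                      ∎
    where
    open ≡-Reasoning
    Y = suc n ℕ.* t
    back : C (n ℕ.* t) ≡ C Y * C t + S Y * S t
    back = trans (C-sub (n ℕ.* t) t) (cong (λ z → C z * C t + S z * S t) (ℕ.+-comm (n ℕ.* t) t))

  module Approx (p : ℕ) .{{_ : ℕ.NonZero p}} (δ : ℚ) (Sp≤δ : ∣ S p ∣ ≤ δ) where

    0≤δ : 0ℚ ≤ δ
    0≤δ = abs≤-nonneg {S p} Sp≤δ

    S-multiple : ∀ q → ∣ S (q ℕ.* p) ∣ ≤ ι q * δ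
    S-multiple zero    = ≤-reflexive (sym (*-zeroˡ δ))
    S-multiple (suc q) = subst₂ _≤_ (cong ∣_∣ (sym (S-+ p (q ℕ.* p)))) (bound (ι q) δ)
      (abs-+ {S p * C (q ℕ.* p)} (abs-* {S p} {C (q ℕ.* p)} Sp≤δ (∣C∣≤1 (q ℕ.* p)))
             (abs-* {C p} {S (q ℕ.* p)} (∣C∣≤1 p) (S-multiple q)))
      where
      bound : ∀ a b → b * 1ℚ + 1ℚ * (a * b) ≡ (a + 1ℚ) * b
      bound = solve-∀ ℚR

    private
      perC : ∀ a b u v → a * (u * u - v * v) - b * (v * u + u * v) - a * (u * u + v * v) ≡ -
          ((v + v) * (a * v + b * u))
      perC = solve-∀ ℚR
      perS : ∀ a b u v → b * (u * u - v * v) + a * (v * u + u * v) - b * (u * u + v * v) ≡ (v + v) * (a * u - b * v)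
      perS = solve-∀ ℚR
      four : ∀ e → (e + e) * (1ℚ * 1ℚ + 1ℚ * 1ℚ) ≡ ι 4 * e
      four = solve-∀ ℚR
      double : ∀ n m → (n ℕ.+ m) ℕ.+ (n ℕ.+ m) ≡ (n ℕ.+ n) ℕ.+ (m ℕ.+ m)
      double n m = Sum.+-interchange ℕ.+-*-isCommutativeSemiring n m n m

    module _ (n q : ℕ) where
      private
        m = q ℕ.* p
        a = C₂ n
        b = S₂ n
        u = C m
        v = S m

      -- A difference of cosines is a product of sines: the left side equals -2 S m times a sine, so
      -- the smallness of S m suffices and the sign of C m does not enter.
      C₂-period : ∣ C₂ (n ℕ.+ m) - C₂ n ∣ ≤ ι 4 * (ι q * δ)
      C₂-period = subst₂ _≤_ (cong ∣_∣ (sym eq)) (four (ι q * δ))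
        (abs-neg {(v + v) * (a * v + b * u)} (abs-* {v + v} {a * v + b * u}
          (abs-+ {v} {v} (S-multiple q) (S-multiple q))
          (abs-+ {a * v} {b * u} (abs-* {a} {v} (∣C∣≤1 (n ℕ.+ n)) (∣S∣≤1 m))
            (abs-* {b} {u} (∣S∣≤1 (n ℕ.+ n)) (∣C∣≤1 m)))))
        where
        open ≡-Reasoning
        eq : C₂ (n ℕ.+ m) - C₂ n ≡ - ((v + v) * (a * v + b * u))
        eq = begin
          C₂ (n ℕ.+ m) - a                                          ≡⟨ cong (λ z → C z - a) (double n m) ⟩
          C ((n ℕ.+ n) ℕ.+ (m ℕ.+ m)) - a                           ≡⟨ cong (_- a) (C-+ (n ℕ.+ n) (m ℕ.+ m)) ⟩
          a * C (m ℕ.+ m) - b * S (m ℕ.+ m) - a                     ≡⟨ cong₂ (λ x y → a * x - b * y - a) (C-+ m m)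
              (S-+ m m) ⟩
          a * (u * u - v * v) - b * (v * u + u * v) - a             ≡⟨ cong
              (λ z → a * (u * u - v * v) - b * (v * u + u * v) - z)
                                                                         (sym (trans (cong (a *_) (pyth m)) (*-identityʳ a))) ⟩
          a * (u * u - v * v) - b * (v * u + u * v) - a * (u * u + v * v) ≡⟨ perC a b u v ⟩
          - ((v + v) * (a * v + b * u))                             ∎

      S₂-period : ∣ S₂ (n ℕ.+ m) - S₂ n ∣ ≤ ι 4 * (ι q * δ)
      S₂-period = subst₂ _≤_ (cong ∣_∣ (sym eq)) (four (ι q * δ))
        (abs-* {v + v} {a * u - b * v}
          (abs-+ {v} {v} (S-multiple q) (S-multiple q))
          (abs-- {a * u} {b * v} (abs-* {a} {u} (∣C∣≤1 (n ℕ.+ n)) (∣C∣≤1 m))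
            (abs-* {b} {v} (∣S∣≤1 (n ℕ.+ n)) (∣S∣≤1 m))))
        where
        open ≡-Reasoning
        eq : S₂ (n ℕ.+ m) - S₂ n ≡ (v + v) * (a * u - b * v)
        eq = begin
          S₂ (n ℕ.+ m) - b                                          ≡⟨ cong (λ z → S z - b) (double n m) ⟩
          S ((n ℕ.+ n) ℕ.+ (m ℕ.+ m)) - b                           ≡⟨ cong (_- b) (S-+ (n ℕ.+ n) (m ℕ.+ m)) ⟩
          b * C (m ℕ.+ m) + a * S (m ℕ.+ m) - b                     ≡⟨ cong₂ (λ x y → b * x + a * y - b) (C-+ m m)
              (S-+ m m) ⟩
          b * (u * u - v * v) + a * (v * u + u * v) - b             ≡⟨ cong
              (λ z → b * (u * u - v * v) + a * (v * u + u * v) - z)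
                                                                         (sym (trans (cong (b *_) (pyth m)) (*-identityʳ b))) ⟩
          b * (u * u - v * v) + a * (v * u + u * v) - b * (u * u + v * v) ≡⟨ perS a b u v ⟩
          (v + v) * (a * u - b * v)                                 ∎

    private
      η : ℚ
      η = ι 4 * (ι p * δ)

    0≤η : 0ℚ ≤ η
    0≤η = 0≤* (0≤ι 4) (0≤* (0≤ι p) 0≤δ)

    C₂-% : ∀ n → ∣ C₂ n - C₂ (n % p) ∣ ≤ ι 4 * (ι (n / p) * δ)
    C₂-% n = subst (λ z → ∣ C₂ z - C₂ (n % p) ∣ ≤ ι 4 * (ι (n / p) * δ)) (sym (m≡m%n+[m/n]*n n p))
        (C₂-period (n % p) (n / p))

    S₂-% : ∀ n → ∣ S₂ n - S₂ (n % p) ∣ ≤ ι 4 * (ι (n / p) * δ)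
    S₂-% n = subst (λ z → ∣ S₂ z - S₂ (n % p) ∣ ≤ ι 4 * (ι (n / p) * δ)) (sym (m≡m%n+[m/n]*n n p))
        (S₂-period (n % p) (n / p))

    -- The inner product of two characters, that is, the real part of the sum over d of ζ^(dx) times
    -- the conjugate of ζ^(dy). For an exact root of unity it would be p or 0.
    Γ : ℕ → ℕ → ℚ
    Γ x y = ∑ (λ d → C₂ (d ℕ.* x) * C₂ (d ℕ.* y) + S₂ (d ℕ.* x) * S₂ (d ℕ.* y)) p

    private
      split : ∀ d x → d ℕ.* x ≡ d ℕ.* (x % p) ℕ.+ (d ℕ.* (x / p)) ℕ.* p
      split d x = trans (cong (d ℕ.*_) (m≡m%n+[m/n]*n x p))
        (trans (ℕ.*-distribˡ-+ d (x % p) _) (cong (d ℕ.* (x % p) ℕ.+_) (sym (ℕ.*-assoc d (x / p) p))))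

      period≤ : ∀ d x → d ℕ.< p → x ℕ.< p ℕ.+ p → ι 4 * (ι (d ℕ.* (x / p)) * δ) ≤ η
      period≤ d x d<p x<2p = *-monoʳ (ι 4) (0≤ι 4) (*-monoʳ-≤-nonNeg δ {{nonNegative 0≤δ}} (ι-mono (begin
        d ℕ.* (x / p)    ≤⟨ ℕ.*-monoʳ-≤ d (ℕ.≤-pred (m<n*o⇒m/o<n {x} {2} {p}
                              (ℕ.≤-trans x<2p (ℕ.≤-reflexive (cong (p ℕ.+_) (sym (ℕ.+-identityʳ p))))))) ⟩
        d ℕ.* 1          ≡⟨ ℕ.*-identityʳ d ⟩
        d                ≤⟨ ℕ.<⇒≤ d<p ⟩
        p                ∎)))
        where open ℕ.≤-Reasoning

      C₂-red : ∀ d x → d ℕ.< p → x ℕ.< p ℕ.+ p → ∣ C₂ (d ℕ.* x) - C₂ (d ℕ.* (x % p)) ∣ ≤ η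
      C₂-red d x d<p x<2p = ≤-trans (subst (λ z → ∣ C₂ z - C₂ (d ℕ.* (x % p)) ∣ ≤ ι 4 * (ι (d ℕ.* (x / p)) * δ))
        (sym (split d x)) (C₂-period (d ℕ.* (x % p)) (d ℕ.* (x / p)))) (period≤ d x d<p x<2p)

      S₂-red : ∀ d x → d ℕ.< p → x ℕ.< p ℕ.+ p → ∣ S₂ (d ℕ.* x) - S₂ (d ℕ.* (x % p)) ∣ ≤ η
      S₂-red d x d<p x<2p = ≤-trans (subst (λ z → ∣ S₂ z - S₂ (d ℕ.* (x % p)) ∣ ≤ ι 4 * (ι (d ℕ.* (x / p)) * δ))
        (sym (split d x)) (S₂-period (d ℕ.* (x % p)) (d ℕ.* (x / p)))) (period≤ d x d<p x<2p)

      telescope : ∀ a b a' b' x y x' y' → a * b + x * y - (a' * b' + x' * y') ≡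
        ((a - a') * b + a' * (b - b')) + ((x - x') * y + x' * (y - y'))
      telescope = solve-∀ ℚR

      four-η : ∀ e → (e * 1ℚ + 1ℚ * e) + (e * 1ℚ + 1ℚ * e) ≡ ι 4 * e
      four-η = solve-∀ ℚR

    Γ-red : ∀ x y → x ℕ.< p ℕ.+ p → y ℕ.< p ℕ.+ p → ∣ Γ x y - Γ (x % p) (y % p) ∣ ≤ ι p * (ι 4 * η)
    Γ-red x y x< y< = subst (λ z → ∣ z ∣ ≤ ι p * (ι 4 * η)) (∑-- _ _ p) (∑-abs (ι 4 * η) p λ d d<p →
      subst₂ (λ z w → ∣ z ∣ ≤ w)
        (sym (telescope (C₂ (d ℕ.* x)) (C₂ (d ℕ.* y)) (C₂ (d ℕ.* (x % p))) (C₂ (d ℕ.* (y % p)))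
                        (S₂ (d ℕ.* x)) (S₂ (d ℕ.* y)) (S₂ (d ℕ.* (x % p))) (S₂ (d ℕ.* (y % p))))) (four-η η)
        (abs-+ {(C₂ (d ℕ.* x) - C₂ (d ℕ.* (x % p))) * C₂ (d ℕ.* y) + C₂ (d ℕ.* (x % p)) *
          (C₂ (d ℕ.* y) - C₂ (d ℕ.* (y % p)))}
          (abs-+ {(C₂ (d ℕ.* x) - C₂ (d ℕ.* (x % p))) * C₂ (d ℕ.* y)}
            (abs-* {C₂ (d ℕ.* x) - C₂ (d ℕ.* (x % p))} {C₂ (d ℕ.* y)} (C₂-red d x d<p x<)
              (∣C∣≤1 (d ℕ.* y ℕ.+ d ℕ.* y)))
            (abs-* {C₂ (d ℕ.* (x % p))} {C₂ (d ℕ.* y) - C₂ (d ℕ.* (y % p))}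
              (∣C∣≤1 (d ℕ.* (x % p) ℕ.+ d ℕ.* (x % p))) (C₂-red d y d<p y<)))
          (abs-+ {(S₂ (d ℕ.* x) - S₂ (d ℕ.* (x % p))) * S₂ (d ℕ.* y)}
            (abs-* {S₂ (d ℕ.* x) - S₂ (d ℕ.* (x % p))} {S₂ (d ℕ.* y)} (S₂-red d x d<p x<)
              (∣S∣≤1 (d ℕ.* y ℕ.+ d ℕ.* y)))
            (abs-* {S₂ (d ℕ.* (x % p))} {S₂ (d ℕ.* y) - S₂ (d ℕ.* (y % p))}
              (∣S∣≤1 (d ℕ.* (x % p) ℕ.+ d ℕ.* (x % p))) (S₂-red d y d<p y<)))))

    Γ-diag : ∀ x → Γ x x ≡ ι p
    Γ-diag x = ∑-cong p λ d _ → pyth (d ℕ.* x ℕ.+ d ℕ.* x)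

    Γ-comm : ∀ x y → Γ x y ≡ Γ y x
    Γ-comm x y = ∑-cong p λ d _ → cong₂ _+_ (*-comm (C₂ (d ℕ.* x)) _) (*-comm (S₂ (d ℕ.* x)) _)

    Γ-diff : ∀ x t → Γ (t ℕ.+ x) x ≡ ∑ (λ d → C₂ (d ℕ.* t)) p
    Γ-diff x t = ∑-cong p λ d _ → sym (trans (C-sub (d ℕ.* t ℕ.+ d ℕ.* t) (d ℕ.* x ℕ.+ d ℕ.* x))
      (cong (λ z → C z * C₂ (d ℕ.* x) + S z * S₂ (d ℕ.* x))
        (trans (Sum.+-interchange ℕ.+-*-isCommutativeSemiring (d ℕ.* t) (d ℕ.* t) (d ℕ.* x) (d ℕ.* x))
               (cong₂ ℕ._+_ (sym (ℕ.*-distribˡ-+ d t x)) (sym (ℕ.*-distribˡ-+ d t x))))))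

    module Orthogonality (K : ℚ) (0≤K : 0ℚ ≤ K) (big : ∀ t → 1 ℕ.≤ t → t ℕ.< p → 1ℚ ≤ K * S t) where

      -- By `dirichlet` the sum times S t is S (pt) C ((p - 1)t), and S (pt) is at most tδ in
      -- absolute value. The lower bound `big` on S t permits the division.
      kernel : ∀ t → 1 ℕ.≤ t → t ℕ.< p → ∣ ∑ (λ d → C₂ (d ℕ.* t)) p ∣ ≤ K * (ι p * δ)
      kernel t 1≤t t<p = begin
        ∣ g ∣                                 ≡⟨ *-identityˡ ∣ g ∣ ⟨
        1ℚ * ∣ g ∣                            ≤⟨ *-monoʳ-≤-nonNeg ∣ g ∣ {{∣-∣-nonNeg g}}
            (≤-trans (big t 1≤t t<p) ≤∣ K * S t ∣) ⟩
        ∣ K * S t ∣ * ∣ g ∣                   ≡⟨ ∣p*q∣≡∣p∣*∣q∣ (K * S t) g ⟨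
        ∣ K * S t * g ∣                       ≡⟨ cong ∣_∣ (*-assoc K (S t) g) ⟩
        ∣ K * (S t * g) ∣                     ≤⟨ abs-* {K} {S t * g} (≤-reflexive (0≤p⇒∣p∣≡p 0≤K)) bound ⟩
        K * (ι p * δ)                         ∎
        where
        open ≤-Reasoning
        g = ∑ (λ d → C₂ (d ℕ.* t)) p
        p' = ℕ.pred p
        p≡ : suc p' ≡ p
        p≡ = ℕ.suc-pred p
        bound : ∣ S t * g ∣ ≤ ι p * δ
        bound = begin
          ∣ S t * g ∣                         ≡⟨ cong ∣_∣ (trans
              (cong (λ n → S t * ∑ (λ d → C₂ (d ℕ.* t)) n) (sym p≡)) (dirichlet t p')) ⟩
          ∣ S (suc p' ℕ.* t) * C (p' ℕ.* t) ∣ ≤⟨ abs-* {S (suc p' ℕ.* t)} {C (p' ℕ.* t)}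
                (subst (λ n → ∣ S n ∣ ≤ ι t * δ) (trans (ℕ.*-comm t p) (cong (ℕ._* t) (sym p≡))) (S-multiple t))
                  (∣C∣≤1 (p' ℕ.* t)) ⟩
          ι t * δ * 1ℚ                        ≡⟨ *-identityʳ _ ⟩
          ι t * δ                             ≤⟨ *-monoʳ-≤-nonNeg δ {{nonNegative 0≤δ}} (ι-mono (ℕ.<⇒≤ t<p)) ⟩
          ι p * δ                             ∎

      Γ-off : ∀ x y → x ℕ.< p → y ℕ.< p → x ≢ y → ∣ Γ x y ∣ ≤ K * (ι p * δ)
      Γ-off x y x<p y<p x≢y with ℕ.<-cmp x y
      ... | tri≈ _ x≡y _ = ⊥-elim (x≢y x≡y)
      ... | tri> _ _ y<x with t , eq ← ℕ.m≤n⇒∃[o]m+o≡n y<x =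
        subst (λ z → ∣ z ∣ ≤ K * (ι p * δ)) (trans (sym (Γ-diff y (suc t))) (cong (λ z → Γ z y) te))
          (kernel (suc t) (ℕ.s≤s ℕ.z≤n) (ℕ.≤-<-trans (ℕ.≤-trans (ℕ.m≤m+n (suc t) y) (ℕ.≤-reflexive te)) x<p))
        where te = trans (cong suc (ℕ.+-comm t y)) eq
      ... | tri< x<y _ _ with t , eq ← ℕ.m≤n⇒∃[o]m+o≡n x<y =
        subst (λ z → ∣ z ∣ ≤ K * (ι p * δ)) (trans (sym (Γ-diff x (suc t)))
            (trans (cong (λ z → Γ z x) te) (Γ-comm y x)))
          (kernel (suc t) (ℕ.s≤s ℕ.z≤n) (ℕ.≤-<-trans (ℕ.≤-trans (ℕ.m≤m+n (suc t) x) (ℕ.≤-reflexive te)) y<p))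
        where te = trans (cong suc (ℕ.+-comm t x)) eq

      E : ℚ
      E = ι p * (ι 4 * η) + K * (ι p * δ)

      private
        via : ∀ a b → a ≡ (a - b) + b
        via = solve-∀ ℚR

      orthogonal : ∀ x y → x ℕ.< p ℕ.+ p → y ℕ.< p ℕ.+ p → x % p ≢ y % p → ∣ Γ x y ∣ ≤ E
      orthogonal x y x< y< ne = subst (λ z → ∣ z ∣ ≤ E) (sym (via (Γ x y) (Γ (x % p) (y % p))))
        (abs-+ {Γ x y - Γ (x % p) (y % p)} (Γ-red x y x< y<) (Γ-off (x % p) (y % p) (m%n<n x p) (m%n<n y p) ne))

      normal : ∀ x y → x ℕ.< p ℕ.+ p → y ℕ.< p ℕ.+ p → x % p ≡ y % p → ∣ Γ x y - ι p ∣ ≤ E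
      normal x y x< y< eq = ≤-trans
        (subst (λ z → ∣ Γ x y - z ∣ ≤ ι p * (ι 4 * η)) (trans (cong (Γ (x % p)) (sym eq)) (Γ-diag (x % p)))
          (Γ-red x y x< y<))
        (by-diff (K * (ι p * δ)) (0≤* 0≤K (0≤* (0≤ι p) 0≤δ)) refl)

-- Half-circle counts integrated against a sine wave.

module Window (c s : ℚ.ℚ) (unit : c ℚ.* c ℚ.+ s ℚ.* s ≡ ℚ.1ℚ) where
  open import Data.Rational.Base hiding (_/_)
  open import Relation.Binary.PropositionalEquality
  open import Data.Nat.Base as ℕ using (ℕ; zero; suc; ⌈_/2⌉)
  import Data.Nat.Properties as ℕ
  open import Data.Rational.Properties
  open import Data.Product.Base using (∃-syntax; _,_)
  open import Data.Sum.Base using (_⊎_; inj₁; inj₂)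
  open import Tactic.RingSolver using (solve-∀)
  open Rationals
  open Trig c s unit

  wave : ℚ → ℚ → ℕ → ℚ
  wave X Y i = X * C i + Y * S i

  drop : ℚ → ℚ → ℕ → ℚ
  drop X Y i = wave X Y i - wave X Y (suc i)

  variation : ℚ → ℚ → ℕ → ℚ
  variation X Y = ∑ (λ i → ∣ drop X Y i ∣)

  private
    rec-id : ∀ c s a b x z →
      s * (a * (c * x - s * z) + b * (s * x + c * z) -
          (a * (c * (c * x - s * z) - s * (s * x + c * z)) + b * (s * (c * x - s * z) + c * (s * x + c * z)))) ≡
      ((a * (c * 1ℚ - s * 0ℚ) + b * (s * 1ℚ + c * 0ℚ)) -
       (a * (c * (c * 1ℚ - s * 0ℚ) - s * (s * 1ℚ + c * 0ℚ)) + b * (s * (c * 1ℚ - s * 0ℚ) + c * (s * 1ℚ + c * 0ℚ))))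
         * (s * x + c * z)
      - ((a * 1ℚ + b * 0ℚ) - (a * (c * 1ℚ - s * 0ℚ) + b * (s * 1ℚ + c * 0ℚ))) * z
      + (1ℚ - (c * c + s * s)) * (a * z * (1ℚ - c) - b * s * z)
    rec-id = solve-∀ ℚR
    rot-id : ∀ X Y a b x z → X * (a * x - b * z) + Y * (b * x + a * z) ≡ (X * a + Y * b) * x + (Y * a - X * b) * z
    rot-id = solve-∀ ℚR
    kill : ∀ m w → m + (1ℚ - 1ℚ) * w ≡ m
    kill = solve-∀ ℚR

  wave-shift : ∀ X Y i j → wave X Y (i ℕ.+ j) ≡ wave (wave X Y i) (Y * C i - X * S i) j
  wave-shift X Y i j = trans (cong₂ (λ a b → X * a + Y * b) (C-+ i j) (S-+ i j))
      (rot-id X Y (C i) (S i) (C j) (S j))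

  drop-shift : ∀ X Y i j → drop X Y (i ℕ.+ j) ≡ drop (wave X Y i) (Y * C i - X * S i) j
  drop-shift X Y i j = cong₂ _-_ (wave-shift X Y i j)
    (trans (cong (wave X Y) (sym (ℕ.+-suc i j))) (wave-shift X Y i (suc j)))

  -- A sinusoidal sequence is determined by two neighbouring values. On the half period the
  -- coefficients S (suc j) and S j are nonnegative, which lets signs propagate.
  drop-recurrence : ∀ X Y i j → s * drop X Y (i ℕ.+ suc j) ≡ drop X Y (i ℕ.+ 1) * S (suc j) - drop X Y (i ℕ.+ 0) * S
      j
  drop-recurrence X Y i j = begin
    s * drop X Y (i ℕ.+ suc j)                         ≡⟨ cong (s *_) (drop-shift X Y i (suc j)) ⟩
    s * drop a b (suc j)                               ≡⟨ rec-id c s a b (C j) (S j) ⟩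
    drop a b 1 * S (suc j) - drop a b 0 * S j + (1ℚ - (c * c + s * s)) * w  ≡⟨ cong
        (λ u → drop a b 1 * S (suc j) - drop a b 0 * S j + (1ℚ - u) * w) unit ⟩
    drop a b 1 * S (suc j) - drop a b 0 * S j + (1ℚ - 1ℚ) * w ≡⟨ kill _ w ⟩
    drop a b 1 * S (suc j) - drop a b 0 * S j          ≡⟨ cong₂ (λ u v → u * S (suc j) - v * S j)
        (drop-shift X Y i 1) (drop-shift X Y i 0) ⟨
    drop X Y (i ℕ.+ 1) * S (suc j) - drop X Y (i ℕ.+ 0) * S j ∎
    where
    open ≡-Reasoning
    a = wave X Y i
    b = Y * C i - X * S i
    w = a * S j * (1ℚ - c) - b * s * S j

  private
    neg-drop : ∀ X Y a b x y → (- X) * a + (- Y) * b - ((- X) * x + (- Y) * y) ≡ - (X * a + Y * b - (X * x + Y * y))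
    neg-drop = solve-∀ ℚR
    tv₁ : ∀ g0 gn gs → g0 - gn + (gn - gs) ≡ g0 - gs
    tv₁ = solve-∀ ℚR
    tv₂ : ∀ X Y C0 S0 Cn Sn Cs Ss →
      (X * C0 + Y * S0) - (X * Cn + Y * Sn) + - (X * Cn + Y * Sn - (X * Cs + Y * Ss)) ≡
      ((- X) * Cn + (- Y) * Sn) + ((- X) * Cn + (- Y) * Sn) -
        (((- X) * C0 + (- Y) * S0) + ((- X) * Cs + (- Y) * Ss))
    tv₂ = solve-∀ ℚR
    tv₃ : ∀ gk g0 gn gs → gk + gk - (g0 + gn) + (gn - gs) ≡ gk + gk - (g0 + gs)
    tv₃ = solve-∀ ℚR
    tv₄ : ∀ g0 gs → g0 - gs ≡ g0 + g0 - (g0 + gs)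
    tv₄ = solve-∀ ℚR
    neg≥0 : ∀ {x} → x ≤ 0ℚ → 0ℚ ≤ - x
    neg≥0 = neg-antimono-≤

  drop-neg : ∀ X Y i → drop (- X) (- Y) i ≡ - drop X Y i
  drop-neg X Y i = neg-drop X Y (C i) (S i) (C (suc i)) (S (suc i))

  module Unimodal (p : ℕ) (0<s : 0ℚ < s) (S≥0 : ∀ j → j ℕ.≤ p → 0ℚ ≤ S j) where

    -- By the recurrence, every drop after the turn is a nonnegative combination of the first drop
    -- after it and the negated drop before it.
    stays-up : ∀ X Y i j → suc j ℕ.≤ p → drop X Y i ≤ 0ℚ → 0ℚ ≤ drop X Y (suc i) → 0ℚ ≤ drop X Y (suc i ℕ.+ j)
    stays-up X Y i j j<p down up = *-cancelˡ-≤-pos s {{positive 0<s}} (subst₂ _≤_ (sym (*-zeroʳ s)) (sym eq)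
      (0≤+ (0≤* up (S≥0 (suc j) j<p)) (subst (0ℚ ≤_) (sym (neg-distribˡ-* (drop X Y i) (S j)))
        (0≤* (neg≥0 down) (S≥0 j (ℕ.≤-trans (ℕ.n≤1+n j) j<p))))))
      where
      eq : s * drop X Y (suc i ℕ.+ j) ≡ drop X Y (suc i) * S (suc j) - drop X Y i * S j
      eq = trans (cong (λ n → s * drop X Y n) (sym (ℕ.+-suc i j))) (trans (drop-recurrence X Y i j)
        (cong₂ (λ m n → drop X Y m * S (suc j) - drop X Y n * S j) (ℕ.+-comm i 1) (ℕ.+-identityʳ i)))

    -- The wave on [0 , n] up to sign: monotone, or with a single peak.
    data Shape (V : ℕ → ℚ) (X Y : ℚ) (n : ℕ) : Set where
      monotone : 0ℚ ≤ drop X Y n → V (suc n) ≡ wave X Y 0 - wave X Y (suc n) → Shape V X Y n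
      peak : ∀ i j → suc n ≡ suc i ℕ.+ j → drop X Y i ≤ 0ℚ → 0ℚ ≤ drop X Y (suc i) →
             V (suc n) ≡ wave X Y (suc i) + wave X Y (suc i) - (wave X Y 0 + wave X Y (suc n)) → Shape V X Y n

    module _ (X Y : ℚ) where
      private
        V = variation X Y

      Signed : ℕ → Set
      Signed n = Shape V X Y n ⊎ Shape V (- X) (- Y) n

      ∣drop∣⁺ : ∀ X Y i → 0ℚ ≤ drop X Y i → ∣ drop X Y i ∣ ≡ drop X Y i
      ∣drop∣⁺ X Y i = 0≤p⇒∣p∣≡p

      ∣drop∣⁻ : ∀ X Y i → drop X Y i ≤ 0ℚ → ∣ drop X Y i ∣ ≡ - drop X Y i
      ∣drop∣⁻ X Y i h = trans (sym (∣-p∣≡∣p∣ (drop X Y i))) (0≤p⇒∣p∣≡p (neg≥0 h))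

      module Extend (V : ℕ → ℚ) (X Y : ℚ) (V-suc : ∀ n → V (suc n) ≡ V n + ∣ drop X Y n ∣) where
        extend : ∀ n → suc (suc n) ℕ.≤ p → Shape V X Y n → Shape V X Y (suc n) ⊎ Shape V (- X) (- Y) (suc n)
        extend n n<p (monotone up eq) with ≤-total 0ℚ (drop X Y (suc n))
        ... | inj₁ up' = inj₁ (monotone up' (trans (V-suc (suc n)) (trans (cong₂ _+_ eq (∣drop∣⁺ X Y (suc n) up'))
                (tv₁ (wave X Y 0) (wave X Y (suc n)) (wave X Y (suc (suc n)))))))
        -- The wave has fallen so far and now rises, so its negative has a peak here.
        ... | inj₂ down = inj₂ (peak n 1 (ℕ.+-comm 1 (suc n))
            (subst (_≤ 0ℚ) (sym (drop-neg X Y n)) (neg-antimono-≤ up))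
                (subst (0ℚ ≤_) (sym (drop-neg X Y (suc n))) (neg≥0 down))
                (trans (V-suc (suc n)) (trans (cong₂ _+_ eq (∣drop∣⁻ X Y (suc n) down))
                  (tv₂ X Y (C 0) (S 0) (C (suc n)) (S (suc n)) (C (suc (suc n))) (S (suc (suc n)))))))
        extend n n<p (peak i j n≡ down up eq) = inj₁ (peak i (suc j) (trans (cong suc n≡) (sym (ℕ.+-suc (suc i) j)))
            down up
          (trans (V-suc (suc n)) (trans (cong₂ _+_ eq (∣drop∣⁺ X Y (suc n) up'))
            (tv₃ (wave X Y (suc i)) (wave X Y 0) (wave X Y (suc n)) (wave X Y (suc (suc n)))))))
          where
          j<p : suc j ℕ.≤ p
          j<p = ℕ.≤-trans (ℕ.s≤s (ℕ.m≤n+m j i)) (ℕ.≤-trans (ℕ.≤-reflexive (sym n≡)) (ℕ.<⇒≤ n<p))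
          up' : 0ℚ ≤ drop X Y (suc n)
          up' = subst (λ z → 0ℚ ≤ drop X Y z) (sym n≡) (stays-up X Y i j j<p down up)

      neg-neg : ∀ x → - (- x) ≡ x
      neg-neg = solve-∀ ℚR

      swap : ∀ n → Shape V (- (- X)) (- (- Y)) n → Shape V X Y n
      swap n = subst₂ (λ x y → Shape V x y n) (neg-neg X) (neg-neg Y)

      shape₀ : 0ℚ ≤ drop X Y 0 ⊎ drop X Y 0 ≤ 0ℚ → Signed 0
      shape₀ (inj₁ up) = inj₁ (monotone up (trans (+-identityˡ ∣ drop X Y 0 ∣) (∣drop∣⁺ X Y 0 up)))
      shape₀ (inj₂ down) = inj₂ (monotone (subst (0ℚ ≤_) (sym (drop-neg X Y 0)) (neg≥0 down))
        (trans (+-identityˡ ∣ drop X Y 0 ∣) (trans (∣drop∣⁻ X Y 0 down) (sym (drop-neg X Y 0)))))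

      V-suc⁻ : ∀ m → V (suc m) ≡ V m + ∣ drop (- X) (- Y) m ∣
      V-suc⁻ m = cong (V m +_) (trans (sym (∣-p∣≡∣p∣ (drop X Y m))) (cong ∣_∣ (sym (drop-neg X Y m))))

      unswap : ∀ n → Shape V (- X) (- Y) n ⊎ Shape V (- (- X)) (- (- Y)) n → Signed n
      unswap n (inj₁ k) = inj₂ k
      unswap n (inj₂ k) = inj₁ (swap n k)

      shape-suc : ∀ n → suc (suc n) ℕ.≤ p → Signed n → Signed (suc n)
      shape-suc n n<p (inj₁ h) = Extend.extend V X Y (λ _ → refl) n n<p h
      shape-suc n n<p (inj₂ h) = unswap (suc n) (Extend.extend V (- X) (- Y) V-suc⁻ n n<p h)

      shape : ∀ n → suc n ℕ.≤ p → Signed n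
      shape zero    _   = shape₀ (≤-total 0ℚ (drop X Y 0))
      shape (suc n) n<p = shape-suc n n<p (shape n (ℕ.<⇒≤ n<p))

      record Peak (n : ℕ) : Set where
        field
          X' Y' : ℚ
          k     : ℕ
          same  : X' * X' + Y' * Y' ≡ X * X + Y * Y
          ends  : ∣ wave X' Y' 0 + wave X' Y' n ∣ ≡ ∣ wave X Y 0 + wave X Y n ∣
          total : V n ≡ wave X' Y' k + wave X' Y' k - (wave X' Y' 0 + wave X' Y' n)

      private
        same-neg : ∀ x y → (- x) * (- x) + (- y) * (- y) ≡ x * x + y * y
        same-neg = solve-∀ ℚR
        ends-neg : ∀ X Y a b x y → (- X) * a + (- Y) * b + ((- X) * x + (- Y) * y) ≡ -
            (X * a + Y * b + (X * x + Y * y))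
        ends-neg = solve-∀ ℚR

        turning : ∀ {X' Y'} n → Shape V X' Y' n → ∃[ k ] V (suc n) ≡ wave X' Y' k + wave X' Y' k -
            (wave X' Y' 0 + wave X' Y' (suc n))
        turning {X'} {Y'} n (monotone _ eq)   = 0 , trans eq (tv₄ (wave X' Y' 0) (wave X' Y' (suc n)))
        turning n (peak i _ _ _ _ eq) = suc i , eq

      peak-of : ∀ n → suc n ℕ.≤ p → Peak (suc n)
      peak-of n n<p with shape n n<p
      ... | inj₁ h with k , eq ← turning n h = record { X' = X ; Y' = Y ; k = k ; same = refl ; ends = refl ; total
          = eq }
      ... | inj₂ h with k , eq ← turning n h = record { X' = - X ; Y' = - Y ; k = k ; same = same-neg X Y
              ; ends = trans (cong ∣_∣ (ends-neg X Y (C 0) (S 0) (C (suc n)) (S (suc n))))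
                  (∣-p∣≡∣p∣ (wave X Y 0 + wave X Y (suc n)))
              ; total = eq }

      private
        amgm : ∀ m X Y C S → m * m + (X * X + Y * Y) * (C * C + S * S) ≡
               m * ((X * C + Y * S) + (X * C + Y * S)) + ((m - (X * C + Y * S)) * (m - (X * C + Y * S)) +
                   (X * S - Y * C) * (X * S - Y * C))
        amgm = solve-∀ ℚR

      -- 2Mf ≤ M² + f² and f² ≤ X² + Y² in one step; the defects are (M - f)² and (X S k - Y C k)².
      wave-bound : ∀ M X Y k → M * (wave X Y k + wave X Y k) ≤ M * M + (X * X + Y * Y)
      wave-bound M X Y k = by-diff _ (0≤+ (0≤sq (M - wave X Y k)) (0≤sq (X * S k - Y * C k)))
        (trans (cong (M * M +_) (trans (sym (*-identityʳ _)) (cong ((X * X + Y * Y) *_) (sym (pyth k)))))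
          (amgm M X Y (C k) (S k)))

      -- With a single peak at k the variation is 2f(k) - (f(0) + f(p)). The end values stay in the
      -- bound; antiperiodicity makes their sum negligible.
      variation-bound : ∀ M → 0ℚ ≤ M → ∀ n → suc n ≡ p → M * V p ≤ M * M + (X * X + Y * Y) + M * ∣ wave X Y 0 + wave
          X Y p ∣
      variation-bound M 0≤M n refl = begin
        M * V p                                                  ≡⟨ cong (M *_) total ⟩
        M * (w - e)                                              ≡⟨ *-distribˡ-+ M w (- e) ⟩
        M * w + M * (- e)                                        ≤⟨ +-mono-≤ (wave-bound M X' Y' k)
            (*-monoʳ M 0≤M (≤-trans -≤∣ e ∣ (≤-reflexive ends))) ⟩
        M * M + (X' * X' + Y' * Y') + M * ∣ wave X Y 0 + wave X Y p ∣ ≡⟨ cong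
            (λ z → M * M + z + M * ∣ wave X Y 0 + wave X Y p ∣) same ⟩
        M * M + (X * X + Y * Y) + M * ∣ wave X Y 0 + wave X Y p ∣ ∎
        where
        open ≤-Reasoning
        open Peak (peak-of n ℕ.≤-refl)
        w = wave X' Y' k + wave X' Y' k
        e = wave X' Y' 0 + wave X' Y' p

  abel : ∀ (H f : ℕ → ℚ) n → ∑ (λ i → (H i - H (suc i)) * f i) n ≡
         H 0 * f 0 - H n * f n - ∑ (λ i → H (suc i) * (f i - f (suc i))) n
  abel H f zero    = start (H 0 * f 0)
    where
    start : ∀ x → 0ℚ ≡ x - x - 0ℚ
    start = solve-∀ ℚR
  abel H f (suc n) = trans (cong (_+ (H n - H (suc n)) * f n) (abel H f n))
    (step (H 0 * f 0) (H n) (H (suc n)) (f n) (f (suc n)) (∑ (λ i → H (suc i) * (f i - f (suc i))) n))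
    where
    step : ∀ a h h' x x' t → a - h * x - t + (h - h') * x ≡ a - h' * x' - (t + h' * (x - x'))
    step = solve-∀ ℚR

  -- σ counts the elements below a point of ℤ/p and τ those below a point of ½ℤ/p: the half-circles of ½ℤ/p are the
  -- windows [i , i + p), i ≤ p.
  module HalfCircles (σ : ℕ → ℚ) where

    τ : ℕ → ℚ
    τ i = σ ⌈ i /2⌉

    double : ℕ → ℕ
    double zero    = 0
    double (suc n) = suc (suc (double n))

    double≡ : ∀ n → double n ≡ n ℕ.+ n
    double≡ zero    = refl
    double≡ (suc n) = cong suc (trans (cong suc (double≡ n)) (sym (ℕ.+-suc n n)))

    half-step : ∀ i → ⌈ suc i /2⌉ ≡ ⌈ i /2⌉ ⊎ ⌈ suc i /2⌉ ≡ suc ⌈ i /2⌉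
    half-step zero = inj₂ refl
    half-step (suc zero) = inj₁ refl
    half-step (suc (suc i)) with half-step i
    ... | inj₁ eq = inj₁ (cong suc eq)
    ... | inj₂ eq = inj₂ (cong suc eq)

    τ-double : ∀ n → ⌈ double n /2⌉ ≡ n
    τ-double zero    = refl
    τ-double (suc n) = cong suc (τ-double n)

    τ-odd : ∀ n → ⌈ suc (double n) /2⌉ ≡ suc n
    τ-odd zero    = refl
    τ-odd (suc n) = cong suc (τ-odd n)

    -- τ does not move from 2n + 1 to 2n + 2, so the odd positions of f that are inserted contribute
    -- nothing.
    interleave : ∀ f n → ∑ (λ j → (σ (suc j) - σ j) * f (j ℕ.+ j)) n ≡ ∑ (λ i → (τ (suc i) - τ i) * f i) (double n)
    interleave f zero    = refl
    interleave f (suc n) = trans (cong₂ _+_ (interleave f n)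
        (cong ((σ (suc n) - σ n) *_) (cong f (sym (double≡ n)))))
      (trans (insert (∑ (λ i → (τ (suc i) - τ i) * f i) (double n)) ((σ (suc n) - σ n) * f (double n)) (σ (suc n))
        (f (suc (double n))))
        (cong₂ (λ a b → ∑ (λ i → (τ (suc i) - τ i) * f i) (double n) + (σ a - σ b) * f (double n) +
          (σ (suc b) - σ a) * f (suc (double n)))
          (sym (τ-odd n)) (sym (τ-double n))))
      where
      insert : ∀ a b x y → a + b ≡ a + b + (x - x) * y
      insert = solve-∀ ℚR

  module _ (p : ℕ) (0<s : 0ℚ < s) (S≥0 : ∀ j → j ℕ.≤ p → 0ℚ ≤ S j) (δ : ℚ)
           (Cp : ∣ 1ℚ + C p ∣ ≤ δ) (Sp : ∣ S p ∣ ≤ δ) (R X Y : ℚ) (X≤R : ∣ X ∣ ≤ R) (Y≤R : ∣ Y ∣ ≤ R) where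
    private
      f = wave X Y
      opp-id : ∀ X Y a b x y → X * a + Y * b + (X * (x * a - y * b) + Y * (y * a + x * b)) ≡
               X * (a * (1ℚ + x) - b * y) + Y * (b * (1ℚ + x) + a * y)
      opp-id = solve-∀ ℚR
      four : ∀ R d → R * (1ℚ * d + 1ℚ * d) + R * (1ℚ * d + 1ℚ * d) ≡ ι 4 * (R * d)
      four = solve-∀ ℚR

    antiperiodic : ∀ i → ∣ f i + f (p ℕ.+ i) ∣ ≤ ι 4 * (R * δ)
    antiperiodic i = subst₂ (λ z w → ∣ z ∣ ≤ w)
      (sym (trans (cong₂ (λ a b → f i + (X * a + Y * b)) (C-+ p i) (S-+ p i)) (opp-id X Y (C i) (S i) (C p) (S p))))
        (four R δ)
      (abs-+ {X * (C i * (1ℚ + C p) - S i * S p)}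
        (abs-* {X} {C i * (1ℚ + C p) - S i * S p} X≤R (abs-- {C i * (1ℚ + C p)} {S i * S p}
          (abs-* {C i} {1ℚ + C p} (∣C∣≤1 i) Cp) (abs-* {S i} {S p} (∣S∣≤1 i) Sp)))
        (abs-* {Y} {S i * (1ℚ + C p) + C i * S p} Y≤R (abs-+ {S i * (1ℚ + C p)} {C i * S p}
          (abs-* {S i} {1ℚ + C p} (∣S∣≤1 i) Cp) (abs-* {C i} {S p} (∣C∣≤1 i) Sp))))

    ends : ∣ f 0 + f p ∣ ≤ ι 4 * (R * δ)
    ends = subst (λ n → ∣ f 0 + f n ∣ ≤ ι 4 * (R * δ)) (ℕ.+-identityʳ p) (antiperiodic 0)

    module _ (σ : ℕ → ℚ) (M k : ℚ) (0≤M : 0ℚ ≤ M) (1≤p : 1 ℕ.≤ p) where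
      open HalfCircles σ
      private
        -- N i counts the half circle of ½ℤ/p that starts at i / 2, and H i is twice its deviation
        -- from k / 2.
        N H : ℕ → ℚ
        N i = τ (p ℕ.+ i) - τ i
        H i = (N i + N i) - k

      module _ (σ-step : ∀ j → ∣ σ (suc j) - σ j ∣ ≤ 1ℚ) (k≡ : σ p - σ 0 ≡ k)
          (balanced : ∀ i → i ℕ.≤ p → ∣ H i ∣ ≤ M) where
        private
          e = ι 4 * (R * δ)

          τ-step : ∀ i → ∣ τ (suc i) - τ i ∣ ≤ 1ℚ
          τ-step i = by-parity (half-step i)
            where
            by-parity : ⌈ suc i /2⌉ ≡ ⌈ i /2⌉ ⊎ ⌈ suc i /2⌉ ≡ suc ⌈ i /2⌉ → ∣ τ (suc i) - τ i ∣ ≤ 1ℚ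
            by-parity (inj₁ eq) = subst (λ z → ∣ z ∣ ≤ 1ℚ) (sym
                (trans (cong (λ m → σ m - τ i) eq) (+-inverseʳ (τ i)))) 0≤1
            by-parity (inj₂ eq) = subst (λ m → ∣ σ m - τ i ∣ ≤ 1ℚ) (sym eq) (σ-step ⌈ i /2⌉)

          pair-id : ∀ ti tsi tp tsp a b → (tsi - ti) * a + (tsp - tp) * b ≡ ((tp - ti) - (tsp - tsi)) * a +
              (tsp - tp) * (a + b)
          pair-id = solve-∀ ℚR

          A B : ℚ
          A = ∑ (λ i → (N i - N (suc i)) * f i) p
          B = ∑ (λ i → (τ (suc (p ℕ.+ i)) - τ (p ℕ.+ i)) * (f i + f (p ℕ.+ i))) p

          -- Positions i and p + i are opposite, so f changes sign between them up to an error
          -- collected in B. On the remaining half period f is weighted by differences of window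
          -- counts.
          folded : ∑ (λ j → (σ (suc j) - σ j) * f (j ℕ.+ j)) p ≡ A + B
          folded = begin
            ∑ (λ j → (σ (suc j) - σ j) * f (j ℕ.+ j)) p      ≡⟨ interleave f p ⟩
            ∑ v (double p)                                   ≡⟨ cong (∑ v) (double≡ p) ⟩
            ∑ v (p ℕ.+ p)                                    ≡⟨ ∑-split v p p ⟩
            ∑ v p + ∑ (λ i → v (p ℕ.+ i)) p                  ≡⟨ ∑-+ v (λ i → v (p ℕ.+ i)) p ⟨
            ∑ (λ i → v i + v (p ℕ.+ i)) p                    ≡⟨ ∑-cong p (λ i _ → trans
                (pair-id (τ i) (τ (suc i)) (τ (p ℕ.+ i)) (τ (suc (p ℕ.+ i))) (f i) (f (p ℕ.+ i)))
                (cong (λ z → (N i - (τ z - τ (suc i))) * f i + (τ (suc (p ℕ.+ i)) - τ (p ℕ.+ i)) *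
                  (f i + f (p ℕ.+ i))) (sym (ℕ.+-suc p i)))) ⟩
            ∑ (λ i → (N i - N (suc i)) * f i + (τ (suc (p ℕ.+ i)) - τ (p ℕ.+ i)) * (f i + f (p ℕ.+ i))) p ≡⟨ ∑-+ _ _
                p ⟩
            A + B                                            ∎
            where
            open ≡-Reasoning
            v : ℕ → ℚ
            v i = (τ (suc i) - τ i) * f i

          B≤ : ∣ B ∣ ≤ ι p * (1ℚ * e)
          B≤ = ∑-abs (1ℚ * e) p λ i _ → abs-* {τ (suc (p ℕ.+ i)) - τ (p ℕ.+ i)} {f i + f (p ℕ.+ i)}
              (τ-step (p ℕ.+ i)) (antiperiodic i)

          H-id : ∀ a b k x → (a - b) * x + (a - b) * x ≡ (a + a - k - (b + b - k)) * x
          H-id = solve-∀ ℚR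

          2A : A + A ≡ H 0 * f 0 - H p * f p - ∑ (λ i → H (suc i) * drop X Y i) p
          2A = trans (sym (∑-+ _ _ p)) (trans (∑-cong p λ i _ → H-id (N i) (N (suc i)) k (f i)) (abel H f p))

          -- The windows at 0 and at p are complementary half circles.
          Hp : H p ≡ - H 0
          Hp = begin
            N p + N p - k                                                    ≡⟨ cong₂
                (λ a b → (a - τ p) + (a - τ p) - b) τ2p (sym k≡) ⟩
            (σ p - τ p) + (σ p - τ p) - (σ p - σ 0)                          ≡⟨ flip-id (σ p) (τ p) (σ 0) ⟩
            - ((τ p - σ 0) + (τ p - σ 0) - (σ p - σ 0))                      ≡⟨ cong₂
                (λ a b → - ((τ a - σ 0) + (τ a - σ 0) - b)) (sym (ℕ.+-identityʳ p)) k≡ ⟩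
            - H 0                                                            ∎
            where
            open ≡-Reasoning
            τ2p : τ (p ℕ.+ p) ≡ σ p
            τ2p = cong σ (sym (ℕ.n≡⌈n+n/2⌉ p))
            flip-id : ∀ a b d → (a - b) + (a - b) - (a - d) ≡ - ((b - d) + (b - d) - (a - d))
            flip-id = solve-∀ ℚR

          boundary : H 0 * f 0 - H p * f p ≤ M * e
          boundary = ≤-trans (≤-reflexive (trans (cong (λ z → H 0 * f 0 - z * f p) Hp) (merge (H 0) (f 0) (f p))))
            (≤-trans ≤∣ H 0 * (f 0 + f p) ∣ (abs-* {H 0} {f 0 + f p} (balanced 0 ℕ.z≤n) ends))
            where
            merge : ∀ h x y → h * x - (- h) * y ≡ h * (x + y)
            merge = solve-∀ ℚR

          M*V : - ∑ (λ i → H (suc i) * drop X Y i) p ≤ M * variation X Y p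
          M*V = ≤-trans (≤-reflexive (sym (∑-neg _ p))) (≤-trans (∑-mono p λ i i<p →
            ≤-trans -≤∣ H (suc i) * drop X Y i ∣ (abs-* {H (suc i)} {drop X Y i} (balanced (suc i) i<p) ≤-refl))
            (≤-reflexive (sym (∑-*ˡ M (λ i → ∣ drop X Y i ∣) p))))

          2A≤ : A + A ≤ M * e + (M * M + (X * X + Y * Y) + M * e)
          2A≤ = ≤-trans (≤-reflexive 2A) (+-mono-≤ boundary (≤-trans M*V (≤-trans
            (Unimodal.variation-bound p 0<s S≥0 X Y M 0≤M (ℕ.pred p) (ℕ.suc-pred p {{ℕ.>-nonZero 1≤p}}))
            (+-monoʳ-≤ (M * M + (X * X + Y * Y)) (*-monoʳ M 0≤M ends)))))

        -- Intended for X + Y i equal to the Fourier coefficient itself: the left side is then twice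
        -- its squared modulus and the right side contains it once, so up to the error the modulus
        -- is at most M.
        half-circle-bound : ∑ (λ j → (σ (suc j) - σ j) * (X * C₂ j + Y * S₂ j)) p + ∑
            (λ j → (σ (suc j) - σ j) * (X * C₂ j + Y * S₂ j)) p
          ≤ M * M + (X * X + Y * Y) + (M + ι p) * (ι 8 * (R * δ))
        half-circle-bound = begin
          LHS + LHS                              ≡⟨ cong (λ z → z + z) folded ⟩
          (A + B) + (A + B)                      ≡⟨ +-interchange A B A B ⟩
          (A + A) + (B + B)                      ≤⟨ +-mono-≤ 2A≤ (+-mono-≤ (≤-trans ≤∣ B ∣ B≤) (≤-trans ≤∣ B ∣ B≤))
            ⟩
          (M * e + (M * M + (X * X + Y * Y) + M * e)) + (ι p * (1ℚ * e) + ι p * (1ℚ * e)) ≡⟨ total M (X * X + Y * Y)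
            (ι p) (R * δ) ⟩
          M * M + (X * X + Y * Y) + (M + ι p) * (ι 8 * (R * δ)) ∎
          where
          open ≤-Reasoning
          LHS = ∑ (λ j → (σ (suc j) - σ j) * f (j ℕ.+ j)) p
          total : ∀ M z p r → (M * (ι 4 * r) + (M * M + z + M * (ι 4 * r))) +
              (p * (1ℚ * (ι 4 * r)) + p * (1ℚ * (ι 4 * r))) ≡
                  M * M + z + (M + p) * (ι 8 * r)
          total = solve-∀ ℚR

-- Rational points of the unit circle and their powers.

module Roots where
  open import Data.Nat.Base as ℕ using (ℕ; zero; suc)
  import Data.Nat.Properties as ℕ
  open import Data.Integer.Base as ℤ using (ℤ)
  import Data.Integer.Properties as ℤ
  open import Data.Rational.Base
  open import Data.Rational.Properties
  import Data.Rational.Unnormalised.Base as ℚᵘ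
  import Data.Rational.Unnormalised.Properties as ℚᵘ
  open import Data.Product.Base using (∃-syntax; _×_; _,_)
  open import Data.Sum.Base using (_⊎_; inj₁; inj₂)
  open import Data.Empty using (⊥-elim)
  open import Relation.Binary.PropositionalEquality
  open import Tactic.RingSolver using (solve-∀)
  open Rationals

  private
    one-more : ∀ n → (ℤ.+ suc n) ℤ.* (ℤ.+ 1) ≡ (((ℤ.+ n) ℤ.* (ℤ.+ 1)) ℤ.+ (ℤ.+ 1)) ℤ.* (ℤ.+ 1)
    one-more n = cong (ℤ._* (ℤ.+ 1)) (trans (cong ℤ.+_ (ℕ.+-comm 1 n))
        (cong (ℤ._+ (ℤ.+ 1)) (sym (ℤ.*-identityʳ (ℤ.+ n)))))

  /1≡ι : ∀ n → ℤ.+ n / 1 ≡ ι n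
  /1≡ι zero    = refl
  /1≡ι (suc n) = trans (toℚᵘ-injective (begin
      toℚᵘ (ℤ.+ suc n / 1)                                 ≈⟨ toℚᵘ-fromℚᵘ (ℚᵘ.mkℚᵘ (ℤ.+ suc n) 0) ⟩
      ℚᵘ.mkℚᵘ (ℤ.+ suc n) 0                                ≈⟨ ℚᵘ.*≡* (one-more n) ⟩
      ℚᵘ.mkℚᵘ (ℤ.+ n) 0 ℚᵘ.+ ℚᵘ.1ℚᵘ                        ≈⟨ ℚᵘ.+-congˡ ℚᵘ.1ℚᵘ
          (ℚᵘ.≃-sym (toℚᵘ-fromℚᵘ (ℚᵘ.mkℚᵘ (ℤ.+ n) 0))) ⟩
      toℚᵘ (ℤ.+ n / 1) ℚᵘ.+ toℚᵘ 1ℚ                        ≈⟨ ℚᵘ.≃-sym (toℚᵘ-homo-+ (ℤ.+ n / 1) 1ℚ) ⟩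
      toℚᵘ (ℤ.+ n / 1 + 1ℚ)                                ∎)) (cong (_+ 1ℚ) (/1≡ι n))
    where open ℚᵘ.≃-Reasoning

  private
    archimedean₀ : ∀ q → ∃[ n ] q ≤ ι n
    archimedean₀ q@record{} = n , subst (q ≤_) (/1≡ι n)
        (toℚᵘ-cancel-≤ (ℚᵘ.≤-respʳ-≃ (ℚᵘ.≃-sym (toℚᵘ-fromℚᵘ (ℚᵘ.mkℚᵘ (ℤ.+ n) 0)))
        (ℚᵘ.*≤* (ℤ.≤-trans (ℤ.≤-reflexive (ℤ.*-identityʳ (↥ q)))
          (ℤ.≤-trans bound (ℤ.≤-reflexive (ℤ.pos-* n (↧ₙ q))))))))
      where
      n = ℤ.∣ ↥ q ∣
      i≤∣i∣ : ∀ i → i ℤ.≤ ℤ.+ ℤ.∣ i ∣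
      i≤∣i∣ (ℤ.+ m) = ℤ.≤-refl
      i≤∣i∣ (ℤ.-[1+ m ]) = ℤ.-≤+
      bound : ↥ q ℤ.≤ ℤ.+ (n ℕ.* ↧ₙ q)
      bound = ℤ.≤-trans (i≤∣i∣ (↥ q)) (ℤ.+≤+ (ℕ.m≤m*n n (↧ₙ q)))

    inverse₀ : ∀ x → 0ℚ < x → ∃[ y ] 0ℚ < y × x * y ≡ 1ℚ
    inverse₀ x 0<x = (1/ x) {{nz}} , positive⁻¹ _ {{1/pos⇒pos x {{positive 0<x}}}} , *-inverseʳ x {{nz}}
      where nz = pos⇒nonZero x {{positive 0<x}}

  abstract
    -- Sealed together with `inverse`, so that the witnesses stay symbolic in the constructions that
    -- nest them.
    archimedean : ∀ q → ∃[ n ] q ≤ ι n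
    archimedean = archimedean₀

    inverse : ∀ x → 0ℚ < x → ∃[ y ] 0ℚ < y × x * y ≡ 1ℚ
    inverse = inverse₀

  -- The rational parametrisation c = (1 - τ²) / (1 + τ²), s = 2τ / (1 + τ²), where τ is the tangent
  -- of half the angle. The reciprocal r of 1 + τ² is an argument with its equation, so that all
  -- identities are polynomial.
  module Circle (τ r : ℚ) (0≤τ : 0ℚ ≤ τ) (τ≤1 : τ ≤ 1ℚ) (0≤r : 0ℚ ≤ r) (r-eq : (1ℚ + τ * τ) * r ≡ 1ℚ) where
    c s : ℚ
    c = r + r - 1ℚ
    s = (τ + τ) * r

    private
      unit-id : ∀ τ r → (r + r - 1ℚ) * (r + r - 1ℚ) + ((τ + τ) * r) * ((τ + τ) * r) ≡ 1ℚ + ι 4 * r *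
          ((1ℚ + τ * τ) * r - 1ℚ)
      unit-id = solve-∀ ℚR
      zero-id : ∀ x → 1ℚ + x * (1ℚ - 1ℚ) ≡ 1ℚ
      zero-id = solve-∀ ℚR
      c-id : ∀ τ r → r + r - 1ℚ ≡ (1ℚ - (τ + τ) * r * τ) + (ι 2 * ((1ℚ + τ * τ) * r) - ι 2)
      c-id = solve-∀ ℚR
      cs-id : ∀ τ s → (1ℚ - s * τ) + (ι 2 * 1ℚ - ι 2) ≡ 1ℚ - s + s * (1ℚ - τ)
      cs-id = solve-∀ ℚR
      s-id : ∀ τ r → (τ + τ) * r ≡ τ * ((1ℚ + τ * τ) * r) + τ * r * (1ℚ - τ * τ)
      s-id = solve-∀ ℚR

    unit : c * c + s * s ≡ 1ℚ
    unit = trans (unit-id τ r) (trans (cong (λ z → 1ℚ + ι 4 * r * (z - 1ℚ)) r-eq) (zero-id (ι 4 * r)))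

    0≤s : 0ℚ ≤ s
    0≤s = 0≤* (0≤+ 0≤τ 0≤τ) 0≤r

    1-s≤c : 1ℚ - s ≤ c
    1-s≤c = by-diff (s * (1ℚ - τ)) (0≤* 0≤s (diff≥0 τ≤1))
      (trans (c-id τ r) (trans (cong (λ z → (1ℚ - s * τ) + (ι 2 * z - ι 2)) r-eq) (cs-id τ s)))

    τ≤s : τ ≤ s
    τ≤s = by-diff (τ * r * (1ℚ - τ * τ)) (0≤* (0≤* 0≤τ 0≤r)
        (diff≥0 (subst (τ * τ ≤_) (*-identityˡ 1ℚ) (*-mono 0≤τ 0≤1 τ≤1 τ≤1))))
      (trans (s-id τ r) (cong (_+ τ * r * (1ℚ - τ * τ)) (trans (cong (τ *_) r-eq) (*-identityʳ τ))))

    r≤1 : r ≤ 1ℚ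
    r≤1 = by-diff (τ * τ * r) (0≤* (0≤sq τ) 0≤r) (trans (sym r-eq) (expand τ r))
      where
      expand : ∀ τ r → (1ℚ + τ * τ) * r ≡ r + τ * τ * r
      expand = solve-∀ ℚR

    s≤2τ : s ≤ τ + τ
    s≤2τ = subst (s ≤_) (*-identityʳ (τ + τ)) (*-monoʳ (τ + τ) (0≤+ 0≤τ 0≤τ) r≤1)

    open Trig c s unit

    private
      step-id : ∀ c s x z → c * x - s * z ≡ (x - (s + s)) + ((c - (1ℚ - s)) * x + (s * (1ℚ - x) + s * (1ℚ - z)))
      step-id = solve-∀ ℚR
      lin-id : ∀ j s → 1ℚ - (j + 1ℚ) * (s + s) ≡ 1ℚ - j * (s + s) - (s + s)
      lin-id = solve-∀ ℚR

    module SmallAngle (n : ℕ) (h : ι n * (s + s) ≤ 1ℚ) where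
      private
        0≤2s : 0ℚ ≤ s + s
        0≤2s = 0≤+ 0≤s 0≤s

        multiples : ∀ j → j ℕ.≤ n → ι j * (s + s) ≤ 1ℚ
        multiples j j≤n = ≤-trans (*-monoʳ-≤-nonNeg (s + s) {{nonNegative 0≤2s}} (ι-mono j≤n)) h

        0≤c : 1 ℕ.≤ n → 0ℚ ≤ c
        0≤c 1≤n = ≤-trans (diff≥0 s≤1) 1-s≤c
          where
          s≤1 : s ≤ 1ℚ
          s≤1 = ≤-trans (by-diff {s} {s + s} s 0≤s refl)
            (≤-trans (≤-reflexive (sym (*-identityˡ (s + s))))
              (subst (λ z → z * (s + s) ≤ 1ℚ) (+-identityˡ 1ℚ) (multiples 1 1≤n)))

        next-S : ∀ j → 1 ℕ.≤ n → 0ℚ ≤ C j → 0ℚ ≤ S j → 0ℚ ≤ S (suc j)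
        next-S j 1≤n hC hS = 0≤+ (0≤* 0≤s hC) (0≤* (0≤c 1≤n) hS)

        next-C : ∀ j → 0ℚ ≤ C j → 1ℚ - ι j * (s + s) ≤ C j → 1ℚ - ι (suc j) * (s + s) ≤ C (suc j)
        next-C j 0≤Cj hC = ≤-trans (≤-reflexive (lin-id (ι j) s)) (≤-trans (+-monoˡ-≤ (- (s + s)) hC)
          (by-diff ((c - (1ℚ - s)) * C j + (s * (1ℚ - C j) + s * (1ℚ - S j)))
            (0≤+ (0≤* (diff≥0 1-s≤c) 0≤Cj) (0≤+ (0≤* 0≤s (diff≥0 (≤-trans ≤∣ C j ∣ (∣C∣≤1 j))))
                                                (0≤* 0≤s (diff≥0 (≤-trans ≤∣ S j ∣ (∣S∣≤1 j))))))
            (step-id c s (C j) (S j))))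

        zero-lin : ∀ s → 1ℚ - 0ℚ * (s + s) ≡ 1ℚ
        zero-lin = solve-∀ ℚR

      -- A step costs at most 2s: for 0 ≤ C j ≤ 1 the bound c ≥ 1 - s loses at most s, and s S j is
      -- at most s.
      C-lower : ∀ j → j ℕ.≤ n → 1ℚ - ι j * (s + s) ≤ C j
      0≤C : ∀ j → j ℕ.≤ n → 0ℚ ≤ C j
      C-lower zero    _   = ≤-reflexive (zero-lin s)
      C-lower (suc j) j<n = next-C j (0≤C j (ℕ.<⇒≤ j<n)) (C-lower j (ℕ.<⇒≤ j<n))
      0≤C j j≤n = ≤-trans (diff≥0 (multiples j j≤n)) (C-lower j j≤n)

      small-angle : ∀ j → j ℕ.≤ n → 0ℚ ≤ S j
      small-angle zero    _   = ≤-refl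
      small-angle (suc j) j<n = next-S j (ℕ.≤-trans (ℕ.s≤s ℕ.z≤n) j<n) (0≤C j (ℕ.<⇒≤ j<n))
          (small-angle j (ℕ.<⇒≤ j<n))

  -- A crude Lipschitz constant for the j-th power on the circle. Any finite value would serve,
  -- since the mesh of the search is chosen after it.
  lip : ℕ → ℚ
  lip zero    = 0ℚ
  lip (suc j) = (1ℚ + lip j) + (1ℚ + lip j)

  0≤lip : ∀ j → 0ℚ ≤ lip j
  0≤lip zero    = ≤-refl
  0≤lip (suc j) = 0≤+ (0≤+ 0≤1 (0≤lip j)) (0≤+ 0≤1 (0≤lip j))

  lip-mono : ∀ {i j} → i ℕ.≤ j → lip i ≤ lip j
  lip-mono {j = j} ℕ.z≤n = 0≤lip j
  lip-mono (ℕ.s≤s h) = +-mono-≤ (+-monoʳ-≤ 1ℚ (lip-mono h)) (+-monoʳ-≤ 1ℚ (lip-mono h))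

  module Lipschitz (c s : ℚ) (unit : c * c + s * s ≡ 1ℚ) (c' s' : ℚ) (unit' : c' * c' + s' * s' ≡ 1ℚ)
                   (d : ℚ) (Δc : ∣ c - c' ∣ ≤ d) (Δs : ∣ s - s' ∣ ≤ d) where
    module T = Trig c s unit
    module T' = Trig c' s' unit'

    private
      ∣c'∣≤1 : ∣ c' ∣ ≤ 1ℚ
      ∣c'∣≤1 = abs≤1 c' (by-diff (s' * s') (0≤sq s') (sym unit'))
      ∣s'∣≤1 : ∣ s' ∣ ≤ 1ℚ
      ∣s'∣≤1 = abs≤1 s' (by-diff (c' * c') (0≤sq c') (trans (sym unit') (+-comm (c' * c') (s' * s'))))
      c-id : ∀ c s x z c' s' x' z' → (c * x - s * z) - (c' * x' - s' * z') ≡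
             ((c - c') * x + c' * (x - x')) - ((s - s') * z + s' * (z - z'))
      c-id = solve-∀ ℚR
      s-id : ∀ c s x z c' s' x' z' → (s * x + c * z) - (s' * x' + c' * z') ≡
             ((s - s') * x + s' * (x - x')) + ((c - c') * z + c' * (z - z'))
      s-id = solve-∀ ℚR
      size : ∀ d l → (d * 1ℚ + 1ℚ * (l * d)) + (d * 1ℚ + 1ℚ * (l * d)) ≡ ((1ℚ + l) + (1ℚ + l)) * d
      size = solve-∀ ℚR

    lipschitz : ∀ j → ∣ T.C j - T'.C j ∣ ≤ lip j * d × ∣ T.S j - T'.S j ∣ ≤ lip j * d
    lipschitz zero = ≤-reflexive (sym (*-zeroˡ d)) , ≤-reflexive (sym (*-zeroˡ d))
    lipschitz (suc j) with hC , hS ← lipschitz j =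
      subst₂ (λ z w → ∣ z ∣ ≤ w) (sym (c-id c s (T.C j) (T.S j) c' s' (T'.C j) (T'.S j))) (size d (lip j))
        (abs-- {(c - c') * T.C j + c' * (T.C j - T'.C j)} {(s - s') * T.S j + s' * (T.S j - T'.S j)}
          (abs-+ {(c - c') * T.C j} (abs-* {c - c'} {T.C j} Δc (T.∣C∣≤1 j)) (abs-* {c'} {T.C j - T'.C j} ∣c'∣≤1 hC))
          (abs-+ {(s - s') * T.S j} (abs-* {s - s'} {T.S j} Δs (T.∣S∣≤1 j))
            (abs-* {s'} {T.S j - T'.S j} ∣s'∣≤1 hS))) ,
      subst₂ (λ z w → ∣ z ∣ ≤ w) (sym (s-id c s (T.C j) (T.S j) c' s' (T'.C j) (T'.S j))) (size d (lip j))
        (abs-+ {(s - s') * T.C j + s' * (T.C j - T'.C j)} {(c - c') * T.S j + c' * (T.S j - T'.S j)}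
          (abs-+ {(s - s') * T.C j} (abs-* {s - s'} {T.C j} Δs (T.∣C∣≤1 j)) (abs-* {s'} {T.C j - T'.C j} ∣s'∣≤1 hC))
          (abs-+ {(c - c') * T.S j} (abs-* {c - c'} {T.S j} Δc (T.∣S∣≤1 j))
            (abs-* {c'} {T.S j - T'.S j} ∣c'∣≤1 hS)))

  module CircleLipschitz (τ r τ' r' h : ℚ) (0≤τ : 0ℚ ≤ τ) (τ≤1 : τ ≤ 1ℚ) (0≤r : 0ℚ ≤ r) (e : (1ℚ + τ * τ) * r ≡ 1ℚ)
                         (0≤τ' : 0ℚ ≤ τ') (τ'≤1 : τ' ≤ 1ℚ) (0≤r' : 0ℚ ≤ r') (e' : (1ℚ + τ' * τ') * r' ≡ 1ℚ)
                         (step : ∣ τ - τ' ∣ ≤ h) where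
    open Circle τ r 0≤τ τ≤1 0≤r e using (c; s; r≤1)
    open Circle τ' r' 0≤τ' τ'≤1 0≤r' e' using () renaming (c to c'; s to s'; r≤1 to r'≤1)

    private
      abs1 : ∀ x → 0ℚ ≤ x → x ≤ 1ℚ → ∣ x ∣ ≤ 1ℚ
      abs1 x h k = subst (_≤ 1ℚ) (sym (0≤p⇒∣p∣≡p h)) k
      τ₁ = abs1 τ 0≤τ τ≤1
      τ₁' = abs1 τ' 0≤τ' τ'≤1
      rr : ∣ r * r' ∣ ≤ 1ℚ * 1ℚ
      rr = abs-* {r} {r'} (abs1 r 0≤r r≤1) (abs1 r' 0≤r' r'≤1)
      c-id : ∀ τ r τ' r' → (r + r - 1ℚ) - (r' + r' - 1ℚ) ≡
        (- (τ - τ')) * ((r * r') * ((τ + τ') + (τ + τ'))) +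
          (ι 2 * (r' * ((1ℚ + τ * τ) * r - 1ℚ)) - ι 2 * (r * ((1ℚ + τ' * τ') * r' - 1ℚ)))
      c-id = solve-∀ ℚR
      s-id : ∀ τ r τ' r' → (τ + τ) * r - (τ' + τ') * r' ≡
        (τ - τ') * ((r * r') * ((1ℚ - τ * τ') + (1ℚ - τ * τ'))) +
        (ι 2 * (τ' * (r' * ((1ℚ + τ * τ) * r - 1ℚ))) - ι 2 * (τ * (r * ((1ℚ + τ' * τ') * r' - 1ℚ))))
      s-id = solve-∀ ℚR
      c-0 : ∀ w r r' → w + (ι 2 * (r' * (1ℚ - 1ℚ)) - ι 2 * (r * (1ℚ - 1ℚ))) ≡ w
      c-0 = solve-∀ ℚR
      s-0 : ∀ w r r' τ τ' → w + (ι 2 * (τ' * (r' * (1ℚ - 1ℚ))) - ι 2 * (τ * (r * (1ℚ - 1ℚ)))) ≡ w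
      s-0 = solve-∀ ℚR
      size : ∀ h → h * ((1ℚ * 1ℚ) * ((1ℚ + 1ℚ) + (1ℚ + 1ℚ))) ≡ ι 4 * h
      size = solve-∀ ℚR

    Δc : ∣ c - c' ∣ ≤ ι 4 * h
    Δc = subst₂ (λ z w → ∣ z ∣ ≤ w)
      (sym (trans (c-id τ r τ' r') (trans (cong₂ (λ a b → w + (ι 2 * (r' * (a - 1ℚ)) - ι 2 * (r * (b - 1ℚ)))) e e')
        (c-0 w r r')))) (size h)
      (abs-* { - (τ - τ')} {(r * r') * ((τ + τ') + (τ + τ'))} (abs-neg {τ - τ'} step)
        (abs-* {r * r'} {(τ + τ') + (τ + τ')} rr (abs-+ {τ + τ'} {τ + τ'} (abs-+ {τ} {τ'} τ₁ τ₁')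
          (abs-+ {τ} {τ'} τ₁ τ₁'))))
      where w = (- (τ - τ')) * ((r * r') * ((τ + τ') + (τ + τ')))

    Δs : ∣ s - s' ∣ ≤ ι 4 * h
    Δs = subst₂ (λ z w → ∣ z ∣ ≤ w)
      (sym (trans (s-id τ r τ' r') (trans (cong₂ (λ a b → w +
        (ι 2 * (τ' * (r' * (a - 1ℚ))) - ι 2 * (τ * (r * (b - 1ℚ))))) e e') (s-0 w r r' τ τ')))) (size h)
      (abs-* {τ - τ'} {(r * r') * ((1ℚ - τ * τ') + (1ℚ - τ * τ'))} step
        (abs-* {r * r'} {(1ℚ - τ * τ') + (1ℚ - τ * τ')} rr (abs-+ {1ℚ - τ * τ'} {1ℚ - τ * τ'} one one)))
      where
      w = (τ - τ') * ((r * r') * ((1ℚ - τ * τ') + (1ℚ - τ * τ')))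
      one : ∣ 1ℚ - τ * τ' ∣ ≤ 1ℚ + 1ℚ * 1ℚ
      one = abs-- {1ℚ} {τ * τ'} ≤-refl (abs-* {τ} {τ'} τ₁ τ₁')

  module Concave (c s : ℚ) (unit : c * c + s * s ≡ 1ℚ) (p : ℕ) (S≥0 : ∀ j → j ℕ.≤ p → 0ℚ ≤ Trig.S c s unit j) where
    open Trig c s unit

    private
      c≤1 : c ≤ 1ℚ
      c≤1 = ≤-trans ≤∣ c ∣ (abs≤1 c (by-diff (s * s) (0≤sq s) (sym unit)))
      conc-id : ∀ c s x z → (s * x + c * z) - (s * (c * x - s * z) + c * (s * x + c * z)) ≡
        (z - (s * x + c * z)) + (ι 2 * ((1ℚ - c) * (s * x + c * z)) + (1ℚ - (c * c + s * s)) * (- z))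
      conc-id = solve-∀ ℚR
      drop-0 : ∀ a b z → a + (b + (1ℚ - 1ℚ) * z) ≡ a + b
      drop-0 = solve-∀ ℚR

    -- Discrete concavity: the second difference of S at i is -2 (1 - c) S (i + 1), which is ≤ 0 as
    -- long as S is nonnegative.
    falling : ∀ i → suc i ℕ.≤ p → S (suc i) ≤ S i → S (suc (suc i)) ≤ S (suc i)
    falling i i<p h = diff≥0⁻¹ (≤-trans (0≤+ (diff≥0 h) (0≤* (0≤ι 2) (0≤* (diff≥0 c≤1) (S≥0 (suc i) i<p))))
      (≤-reflexive (sym (trans (conc-id c s (C i) (S i)) (trans
        (cong (λ u → (S i - S (suc i)) + (ι 2 * ((1ℚ - c) * S (suc i)) + (1ℚ - u) * (- S i))) unit)
        (drop-0 (S i - S (suc i)) (ι 2 * ((1ℚ - c) * S (suc i))) (- S i)))))))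

    falls : ∀ i k → suc i ℕ.+ k ℕ.≤ p → S (suc i) ≤ S i → S (suc i ℕ.+ k) ≤ S i × S (suc (suc i ℕ.+ k)) ≤ S
        (suc i ℕ.+ k)
    falls i zero    le h rewrite ℕ.+-identityʳ i = h , falling i le h
    falls i (suc k) le h with le' ← subst (ℕ._≤ p) (cong suc (ℕ.+-suc i k)) le rewrite ℕ.+-suc i k
      with a , b ← falls i k (ℕ.≤-trans (ℕ.n≤1+n _) le') h = ≤-trans b a , falling (suc i ℕ.+ k) le' b

    rise-or-fall : ∀ t → suc t ℕ.≤ p → S 1 ≤ S (suc t) ⊎ S (suc (suc t)) ≤ S (suc t)
    rise-or-fall zero    _ = inj₁ ≤-refl
    rise-or-fall (suc t) t<p with ≤-total (S (suc t)) (S (suc (suc t)))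
    ... | inj₂ fall = inj₂ (falling (suc t) t<p fall)
    ... | inj₁ rise with rise-or-fall t (ℕ.<⇒≤ t<p)
    ...   | inj₁ h = inj₁ (≤-trans h rise)
    ...   | inj₂ fall = inj₂ (falling (suc t) t<p fall)

    after-fall : ∀ t k → suc (suc t ℕ.+ k) ℕ.≤ suc p → S (suc (suc t)) ≤ S (suc t) → S (suc t ℕ.+ k) ≤ S (suc t)
    after-fall t zero    le h = ≤-reflexive (cong S (cong suc (ℕ.+-identityʳ t)))
    after-fall t (suc k) le h = subst (λ n → S n ≤ S (suc t)) (cong suc (sym (ℕ.+-suc t k)))
      (let a , _ = falls (suc t) k (subst (ℕ._≤ p) (cong suc (ℕ.+-suc t k)) (ℕ.≤-pred le)) h in a)

    small-later : ∀ j → 1 ℕ.≤ j → j ℕ.≤ p → S j < S 1 → S p ≤ S j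
    small-later (suc t) _ j≤p small with rise-or-fall t j≤p | ℕ.m≤n⇒∃[o]m+o≡n j≤p
    ... | inj₁ h | _ = ⊥-elim (<-irrefl refl (≤-<-trans h small))
    ... | inj₂ h | k , eq = subst (λ n → S n ≤ S (suc t)) eq (after-fall t k (ℕ.s≤s (ℕ.≤-reflexive eq)) h)

    min-ends : ∀ q → suc q ≡ p → ∀ t → 1 ℕ.≤ t → t ℕ.< p → S 1 ≤ S t ⊎ S q ≤ S t
    min-ends q refl (suc t) _ t<p with rise-or-fall t (ℕ.<⇒≤ t<p) | ℕ.m≤n⇒∃[o]m+o≡n (ℕ.≤-pred t<p)
    ... | inj₁ h | _ = inj₁ h
    ... | inj₂ h | k , eq = inj₂ (subst (λ n → S n ≤ S (suc t)) eq
        (after-fall t k (ℕ.≤-trans (ℕ.≤-reflexive (cong suc eq)) (ℕ.n≤1+n _)) h))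

  -- The value 16p as it arises: 4p because the search starts at half-angle tangent 1 / (4p), and 4
  -- from the endpoint estimate s ≤ 4 S t.
  stretch : ℕ → ℚ
  stretch p = ι (4 ℕ.* p) * ι 4

  -- c + s i is close to exp(πi/p) in that its p-th power is within 2δ of -1 while its lower powers
  -- stay in the upper half plane.
  record NearRoot (p : ℕ) (δ : ℚ) : Set where
    field
      c s  : ℚ
      unit : c * c + s * s ≡ 1ℚ
    open Trig c s unit public
    field
      0<s : 0ℚ < s
      S≥0 : ∀ j → j ℕ.≤ p → 0ℚ ≤ S j
      Cp  : ∣ 1ℚ + C p ∣ ≤ δ
      Sp  : ∣ S p ∣ ≤ δ
      big : ∀ t → 1 ℕ.≤ t → t ℕ.< p → 1ℚ ≤ stretch p * S t

-- Why a small imaginary part forces the p-th power close to -1.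

module RootEndpoint where
  open import Data.Nat.Base as ℕ using (ℕ; suc)
  import Data.Nat.Properties as ℕ
  open import Data.Rational.Base
  open import Data.Rational.Properties
  open import Data.Sum.Base using (_⊎_; inj₁; inj₂)
  open import Relation.Binary.PropositionalEquality
  open import Tactic.RingSolver using (solve-∀)
  open Rationals
  open Roots

  module Endpoint (p q : ℕ) (p≡ : suc q ≡ p) (c s : ℚ) (unit : c * c + s * s ≡ 1ℚ) (0<s : 0ℚ < s)
                  (S≥0 : ∀ j → j ℕ.≤ p → 0ℚ ≤ Trig.S c s unit j)
                  (η : ℚ) (0≤η : 0ℚ ≤ η) (4η≤s : ι 4 * η ≤ s)
                  (j : ℕ) (1≤j : 1 ℕ.≤ j) (j≤p : j ℕ.≤ p) (Sj≤η : Trig.S c s unit j ≤ η) where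
    open Trig c s unit
    open Concave c s unit p S≥0
    private
      0≤s : 0ℚ ≤ s
      0≤s = <⇒≤ 0<s

      C1 : C 1 ≡ c
      C1 = id c s
        where
        id : ∀ c s → c * 1ℚ - s * 0ℚ ≡ c
        id = solve-∀ ℚR
      S1 : S 1 ≡ s
      S1 = id c s
        where
        id : ∀ c s → s * 1ℚ + c * 0ℚ ≡ s
        id = solve-∀ ℚR

      4-id : ∀ e → ι 4 * e ≡ e + (e + (e + e))
      4-id = solve-∀ ℚR

      2η≤s : η + η ≤ s
      2η≤s = ≤-trans (by-diff (η + η) (0≤+ 0≤η 0≤η) (trans (4-id η) (sym (+-assoc η η (η + η))))) 4η≤s

      η<s : η < s
      η<s = ≰⇒> λ s≤η → <-irrefl refl (<-≤-trans (subst (_< s + s) (+-identityʳ s) (+-monoʳ-< s 0<s))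
          (≤-trans (+-mono-≤ s≤η s≤η) 2η≤s))

      Sp≤η : S p ≤ η
      Sp≤η = ≤-trans (small-later j 1≤j j≤p (subst (S j <_) (sym S1) (≤-<-trans Sj≤η η<s))) Sj≤η

      0≤Sp : 0ℚ ≤ S p
      0≤Sp = S≥0 p ℕ.≤-refl

      ∣c∣≤1 : ∣ c ∣ ≤ 1ℚ
      ∣c∣≤1 = subst (λ z → ∣ z ∣ ≤ 1ℚ) C1 (∣C∣≤1 1)

      ∣cSp∣≤η : ∣ c * S p ∣ ≤ η
      ∣cSp∣≤η = subst (∣ c * S p ∣ ≤_) (*-identityˡ η) (abs-* {c} {S p} ∣c∣≤1
          (subst (_≤ η) (sym (0≤p⇒∣p∣≡p 0≤Sp)) Sp≤η))

      Sq : S q ≡ c * S p - s * C p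
      Sq = trans (S-sub q 1) (trans (cong₂ (λ a b → S (q ℕ.+ 1) * a - C (q ℕ.+ 1) * b) C1 S1)
        (trans (cong (λ n → S n * c - C n * s) (trans (ℕ.+-comm q 1) p≡))
          (cong₂ _-_ (*-comm (S p) c) (*-comm (C p) s))))

      -- S q = c S p - s C p is nonnegative by assumption: if the p-th power were near 1, the one
      -- before it would lie below the real axis.
      sCp≤η : s * C p ≤ η
      sCp≤η = ≤-trans (by-diff (S q) (S≥0 q (ℕ.≤-trans (ℕ.n≤1+n q) (ℕ.≤-reflexive p≡)))
          (trans (via (c * S p) (s * C p)) (cong (s * C p +_) (sym Sq))))
        (≤-trans ≤∣ c * S p ∣ ∣cSp∣≤η)
        where
        via : ∀ a b → a ≡ b + (a - b)
        via = solve-∀ ℚR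

      2Cp≤1 : C p + C p ≤ 1ℚ
      2Cp≤1 = *-cancelˡ-≤-pos s {{positive 0<s}} (≤-trans (≤-reflexive (*-distribˡ-+ s (C p) (C p)))
        (≤-trans (+-mono-≤ sCp≤η sCp≤η) (≤-trans 2η≤s (≤-reflexive (sym (*-identityʳ s))))))

      0≤1+Cp : 0ℚ ≤ 1ℚ + C p
      0≤1+Cp = subst (0ℚ ≤_) (id (C p)) (diff≥0 { - C p} {1ℚ} (≤-trans -≤∣ C p ∣ (∣C∣≤1 p)))
        where
        id : ∀ x → 1ℚ - (- x) ≡ 1ℚ + x
        id = solve-∀ ℚR

      1+Cp≤2η : 1ℚ + C p ≤ η + η
      1+Cp≤2η = begin
        -- As 2 C p ≤ 1, the factor 2 (1 - C p) is at least 1. Inserting it trades 1 + C p for 1 -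
        -- (C p)² = (S p)².
        1ℚ + C p                                    ≤⟨ by-diff {1ℚ + C p} ((1ℚ + C p) * (1ℚ - (C p + C p)))
            (0≤* 0≤1+Cp (diff≥0 2Cp≤1)) (id₁ (C p)) ⟩
        ι 2 * ((1ℚ + C p) * (1ℚ - C p))             ≡⟨ id₂ (C p) ⟩
        ι 2 * (1ℚ - C p * C p)                      ≡⟨ cong (λ z → ι 2 * (z - C p * C p)) (pyth p) ⟨
        ι 2 * ((C p * C p + S p * S p) - C p * C p) ≡⟨ id₃ (C p) (S p) ⟩
        S p * S p + S p * S p                       ≤⟨ +-mono-≤ Sp²≤η Sp²≤η ⟩
        η + η                                       ∎
        where
        open ≤-Reasoning
        id₁ : ∀ x → ι 2 * ((1ℚ + x) * (1ℚ - x)) ≡ (1ℚ + x) + (1ℚ + x) * (1ℚ - (x + x))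
        id₁ = solve-∀ ℚR
        id₂ : ∀ x → ι 2 * ((1ℚ + x) * (1ℚ - x)) ≡ ι 2 * (1ℚ - x * x)
        id₂ = solve-∀ ℚR
        id₃ : ∀ x z → ι 2 * ((x * x + z * z) - x * x) ≡ z * z + z * z
        id₃ = solve-∀ ℚR
        Sp²≤η : S p * S p ≤ η
        Sp²≤η = ≤-trans (*-mono 0≤Sp 0≤1 Sp≤η (≤-trans ≤∣ S p ∣ (∣S∣≤1 p))) (≤-reflexive (*-identityʳ η))

    ∣1+Cp∣ : ∣ 1ℚ + C p ∣ ≤ η + η
    ∣1+Cp∣ = subst (_≤ η + η) (sym (0≤p⇒∣p∣≡p 0≤1+Cp)) 1+Cp≤2η

    ∣Sp∣ : ∣ S p ∣ ≤ η + η
    ∣Sp∣ = subst (_≤ η + η) (sym (0≤p⇒∣p∣≡p 0≤Sp)) (≤-trans Sp≤η (by-diff η 0≤η refl))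

    private
      -- S q = c S p - s C p is close to s because S p ≈ 0 and C p ≈ -1; the assumption 4η ≤ s
      -- leaves room for the errors.
      s≤4Sq : s ≤ ι 4 * S q
      s≤4Sq = by-diff (ι 4 * (c * S p + η) + (ι 4 * (s * ((η + η) - (1ℚ + C p))) +
          (ι 8 * (η * (1ℚ - s)) + ι 3 * (s - ι 4 * η))))
        (0≤+ (0≤* (0≤ι 4) lower) (0≤+ (0≤* (0≤ι 4) (0≤* 0≤s (diff≥0 1+Cp≤2η)))
          (0≤+ (0≤* (0≤ι 8) (0≤* 0≤η (diff≥0 s≤1))) (0≤* (0≤ι 3) (diff≥0 4η≤s)))))
        (trans (cong (ι 4 *_) Sq) (id c s (C p) (S p) η))
        where
        s≤1 : s ≤ 1ℚ
        s≤1 = ≤-trans ≤∣ s ∣ (subst (λ z → ∣ z ∣ ≤ 1ℚ) S1 (∣S∣≤1 1))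
        lower : 0ℚ ≤ c * S p + η
        lower = ≤-trans (diff≥0 (≤-trans -≤∣ c * S p ∣ ∣cSp∣≤η)) (≤-reflexive (flip (c * S p) η))
          where
          flip : ∀ a e → e - (- a) ≡ a + e
          flip = solve-∀ ℚR
        id : ∀ c s x z e → ι 4 * (c * z - s * x) ≡
             s + (ι 4 * (c * z + e) + (ι 4 * (s * ((e + e) - (1ℚ + x))) +
                 (ι 8 * (e * (1ℚ - s)) + ι 3 * (s - ι 4 * e))))
        id = solve-∀ ℚR

    lower : ∀ t → 1 ℕ.≤ t → t ℕ.< p → s ≤ ι 4 * S t
    lower t 1≤t t<p = from (min-ends q p≡ t 1≤t t<p)
      where
      from : S 1 ≤ S t ⊎ S q ≤ S t → s ≤ ι 4 * S t
      from (inj₁ h) = ≤-trans (by-diff (s + (s + s)) (0≤+ 0≤s (0≤+ 0≤s 0≤s)) (4-id s))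
        (*-monoʳ (ι 4) (0≤ι 4) (subst (_≤ S t) S1 h))
      from (inj₂ h) = ≤-trans s≤4Sq (*-monoʳ (ι 4) (0≤ι 4) h)

-- Existence of near-roots by a finite search.

module RootExistence where
  open import Data.Nat.Base as ℕ using (ℕ; zero; suc)
  import Data.Nat.Properties as ℕ
  open import Data.Rational.Base
  open import Data.Rational.Properties
  open import Data.Product.Base using (∃-syntax; _×_; _,_; proj₁; proj₂)
  open import Data.Sum.Base using (_⊎_; inj₁; inj₂)
  open import Data.Empty using (⊥; ⊥-elim)
  open import Relation.Nullary using (yes; no)
  open import Relation.Binary.PropositionalEquality
  open import Tactic.RingSolver using (solve-∀)
  open Rationals
  open Roots
  open RootEndpoint

  -- A discrete intermediate value argument: a walk from an index with `Up` to N, where `Up` is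
  -- impossible, crosses from `Up` to `Low`.
  module Transition (N : ℕ) (Up Low : ∀ i → i ℕ.≤ N → Set) (decide : ∀ i le → Up i le ⊎ Low i le)
                    (end : ∀ le → Up N le → ⊥) where

    record Crossing (Q : ℕ) : Set where
      field
        i   : ℕ
        i≥  : Q ℕ.≤ i
        le  : i ℕ.≤ N
        le' : suc i ℕ.≤ N
        up  : Up i le
        low : Low (suc i) le'

    at-end : ∀ {i} → i ≡ N → (le : i ℕ.≤ N) → Up i le → ⊥
    at-end refl = end

    search : ∀ Q k i → Q ℕ.≤ i → i ℕ.+ k ≡ N → (le : i ℕ.≤ N) → Up i le → Crossing Q
    search Q zero    i Q≤i eq le up = ⊥-elim (at-end (trans (sym (ℕ.+-identityʳ i)) eq) le up)
    search Q (suc k) i Q≤i eq le up = next (decide (suc i) le')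
      where
      eq' : suc i ℕ.+ k ≡ N
      eq' = trans (sym (ℕ.+-suc i k)) eq
      le' : suc i ℕ.≤ N
      le' = ℕ.≤-trans (ℕ.m≤m+n (suc i) k) (ℕ.≤-reflexive eq')
      next : Up (suc i) le' ⊎ Low (suc i) le' → Crossing Q
      next (inj₁ up') = search Q k (suc i) (ℕ.m≤n⇒m≤1+n Q≤i) eq' le' up'
      next (inj₂ low) = record { i = i ; i≥ = Q≤i ; le = le ; le' = le' ; up = up ; low = low }

  -- Among the points with half-angle tangent i / N, take the last i for which the first p powers
  -- stay in the upper half plane.
  module Search (p q : ℕ) (p≡ : suc q ≡ p) (3≤p : 3 ℕ.≤ p) (N : ℕ) (h : ℚ) (0≤h : 0ℚ ≤ h)
      (Nh≡1 : ι N * h ≡ 1ℚ) where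
    τ r : ℕ → ℚ
    τ i = ι i * h
    r i = proj₁ (inverse (1ℚ + τ i * τ i) (<-≤-trans (positive⁻¹ 1ℚ) (by-diff {1ℚ} (τ i * τ i) (0≤sq (τ i)) refl)))

    0≤r : ∀ i → 0ℚ ≤ r i
    0≤r i = <⇒≤ (proj₁ (proj₂ (inverse (1ℚ + τ i * τ i)
        (<-≤-trans (positive⁻¹ 1ℚ) (by-diff {1ℚ} (τ i * τ i) (0≤sq (τ i)) refl)))))

    r-eq : ∀ i → (1ℚ + τ i * τ i) * r i ≡ 1ℚ
    r-eq i = proj₂ (proj₂ (inverse (1ℚ + τ i * τ i) (<-≤-trans (positive⁻¹ 1ℚ)
        (by-diff {1ℚ} (τ i * τ i) (0≤sq (τ i)) refl))))

    0≤τ : ∀ i → 0ℚ ≤ τ i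
    0≤τ i = 0≤* (0≤ι i) 0≤h

    τ-mono : ∀ {i j} → i ℕ.≤ j → τ i ≤ τ j
    τ-mono le = *-monoʳ-≤-nonNeg h {{nonNegative 0≤h}} (ι-mono le)

    τ≤1 : ∀ i → i ℕ.≤ N → τ i ≤ 1ℚ
    τ≤1 i le = ≤-trans (τ-mono le) (≤-reflexive Nh≡1)

    module Pt (i : ℕ) (le : i ℕ.≤ N) where
      open Circle (τ i) (r i) (0≤τ i) (τ≤1 i le) (0≤r i) (r-eq i) public
      open Trig c s unit public using (S)

    Upper Lower : (i : ℕ) → i ℕ.≤ N → Set
    Upper i le = ∀ j → j ℕ.≤ p → 0ℚ ≤ Pt.S i le j
    Lower i le = ∃[ j ] j ℕ.≤ p × Pt.S i le j < 0ℚ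

    decide : ∀ i le n → (∀ j → j ℕ.≤ n → 0ℚ ≤ Pt.S i le j) ⊎ (∃[ j ] j ℕ.≤ n × Pt.S i le j < 0ℚ)
    decide i le zero = inj₁ λ { .zero ℕ.z≤n → ≤-refl }
    decide i le (suc n) = grow (decide i le n) (Pt.S i le (suc n) <? 0ℚ)
      where
      open import Relation.Nullary using (Dec)
      grow : (∀ j → j ℕ.≤ n → 0ℚ ≤ Pt.S i le j) ⊎ (∃[ j ] j ℕ.≤ n × Pt.S i le j < 0ℚ) → Dec (Pt.S i le (suc n) < 0ℚ)
          →
             (∀ j → j ℕ.≤ suc n → 0ℚ ≤ Pt.S i le j) ⊎ (∃[ j ] j ℕ.≤ suc n × Pt.S i le j < 0ℚ)
      grow (inj₂ (j , j≤n , neg)) _ = inj₂ (j , ℕ.m≤n⇒m≤1+n j≤n , neg)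
      grow (inj₁ _) (yes neg) = inj₂ (suc n , ℕ.≤-refl , neg)
      grow (inj₁ h) (no ¬neg) = inj₁ below
        where
        below : ∀ j → j ℕ.≤ suc n → 0ℚ ≤ Pt.S i le j
        below j j≤n = from (ℕ.m≤n⇒m<n∨m≡n j≤n)
          where
          from : j ℕ.< suc n ⊎ j ≡ suc n → 0ℚ ≤ Pt.S i le j
          from (inj₁ j<n) = h j (ℕ.≤-pred j<n)
          from (inj₂ eq) = subst (λ m → 0ℚ ≤ Pt.S i le m) (sym eq) (≮⇒≥ ¬neg)

    -- At τ = 1 the point is i, whose third power is -i.
    end-lower : ∀ le → Upper N le → ⊥
    end-lower le up = <-irrefl refl (<-≤-trans (negative⁻¹ (- 1ℚ))
        (≤-trans (up 3 3≤p) (≤-reflexive (trans (S3 c s) cube))))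
      where
      open Pt N le
      S3 : ∀ c s → s * (c * (c * 1ℚ - s * 0ℚ) - s * (s * 1ℚ + c * 0ℚ)) + c *
          (s * (c * 1ℚ - s * 0ℚ) + c * (s * 1ℚ + c * 0ℚ)) ≡
           ι 3 * (c * c * s) - s * s * s
      S3 = solve-∀ ℚR
      2r≡1 : r N + r N ≡ 1ℚ
      2r≡1 = trans (id (r N)) (trans (cong (λ t → (1ℚ + t * t) * r N) (sym Nh≡1)) (r-eq N))
        where
        id : ∀ r → r + r ≡ (1ℚ + 1ℚ * 1ℚ) * r
        id = solve-∀ ℚR
      c≡0 : c ≡ 0ℚ
      c≡0 = cong (_- 1ℚ) 2r≡1
      s≡1 : s ≡ 1ℚ
      s≡1 = trans (cong (λ t → (t + t) * r N) Nh≡1) (trans (id (r N)) 2r≡1)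
        where
        id : ∀ r → (1ℚ + 1ℚ) * r ≡ r + r
        id = solve-∀ ℚR
      cube : ι 3 * (c * c * s) - s * s * s ≡ - 1ℚ
      cube = cong₂ (λ x y → ι 3 * (x * x * y) - y * y * y) c≡0 s≡1

    open Transition N Upper Lower (λ i le → decide i le p) end-lower

    η : ℚ
    η = lip p * (ι 4 * h)

    0≤4h : 0ℚ ≤ ι 4 * h
    0≤4h = 0≤* (0≤ι 4) 0≤h

    0≤η : 0ℚ ≤ η
    0≤η = 0≤* (0≤lip p) 0≤4h

    module _ (Q : ℕ) (4pτ≡1 : ι (4 ℕ.* p) * τ Q ≡ 1ℚ) (4η≤τ : ι 4 * η ≤ τ Q) (Q≤N : Q ℕ.≤ N) (0<τ : 0ℚ < τ Q) where

      -- At half-angle tangent 1 / (4p) one has 2ps ≤ 4p τ Q = 1, which is what `small-angle` asks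
      -- for.
      first-upper : Upper Q Q≤N
      first-upper = SmallAngle.small-angle p (≤-trans (*-monoʳ (ι p) (0≤ι p) (+-mono-≤ s≤2τ s≤2τ))
        (≤-reflexive (trans (trans (id (ι p) (τ Q)) (cong (_* τ Q) (sym (ι-* 4 p)))) 4pτ≡1)))
        where
        open Circle (τ Q) (r Q) (0≤τ Q) (τ≤1 Q Q≤N) (0≤r Q) (r-eq Q)
        id : ∀ p t → p * ((t + t) + (t + t)) ≡ (ι 4 * p) * t
        id = solve-∀ ℚR

      crossing : Crossing Q
      crossing = let k , eq = ℕ.m≤n⇒∃[o]m+o≡n Q≤N in search Q k Q ℕ.≤-refl eq Q≤N first-upper

      open Crossing crossing

      private
        module P = Pt i le
        module P' = Pt (suc i) le'
        j = proj₁ low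
        j≤p = proj₁ (proj₂ low)

        gap : ∣ τ i - τ (suc i) ∣ ≤ h
        gap = ≤-reflexive (trans (cong ∣_∣ (id (ι i) h)) (trans (∣-p∣≡∣p∣ h) (0≤p⇒∣p∣≡p 0≤h)))
          where
          id : ∀ a h → a * h - (a + 1ℚ) * h ≡ - h
          id = solve-∀ ℚR

        module CL = CircleLipschitz (τ i) (r i) (τ (suc i)) (r (suc i)) h (0≤τ i) (τ≤1 i le) (0≤r i) (r-eq i)
                      (0≤τ (suc i)) (τ≤1 (suc i) le') (0≤r (suc i)) (r-eq (suc i)) gap

        -- The next mesh point has S j < 0, and one mesh width changes S j by at most η.
        Sj≤η : P.S j ≤ η
        Sj≤η = ≤-trans (by-diff (- P'.S j) (neg-antimono-≤ (<⇒≤ (proj₂ (proj₂ low)))) refl)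
          (≤-trans ≤∣ P.S j - P'.S j ∣ (≤-trans (proj₂ (Lipschitz.lipschitz P.c P.s P.unit P'.c P'.s P'.unit
            (ι 4 * h) CL.Δc CL.Δs j))
            (*-monoʳ-≤-nonNeg (ι 4 * h) {{nonNegative 0≤4h}} (lip-mono j≤p))))

        1≤j : 1 ℕ.≤ j
        1≤j = ℕ.n≢0⇒n>0 λ j≡0 → <-irrefl refl (subst (λ n → P'.S n < 0ℚ) j≡0 (proj₂ (proj₂ low)))

        τ≤s : τ Q ≤ P.s
        τ≤s = ≤-trans (τ-mono i≥) P.τ≤s

        0<s : 0ℚ < P.s
        0<s = <-≤-trans 0<τ τ≤s

        module EP = Endpoint p q p≡ P.c P.s P.unit 0<s up η 0≤η (≤-trans 4η≤τ τ≤s) j 1≤j j≤p Sj≤η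

      root : ∀ δ → η + η ≤ δ → NearRoot p δ
      root δ small = record
        { c = P.c ; s = P.s ; unit = P.unit ; 0<s = 0<s ; S≥0 = up
        ; Cp = ≤-trans EP.∣1+Cp∣ small ; Sp = ≤-trans EP.∣Sp∣ small
        ; big = λ t 1≤t t<p → ≤-trans (≤-reflexive (sym 4pτ≡1))
            (≤-trans (*-monoʳ (ι (4 ℕ.* p)) (0≤ι (4 ℕ.* p)) (≤-trans τ≤s (EP.lower t 1≤t t<p)))
            (≤-reflexive (sym (*-assoc (ι (4 ℕ.* p)) (ι 4) (P.S t))))) }

  nearRoot : ∀ p → 3 ℕ.≤ p → ∀ δ → 0ℚ < δ → NearRoot p δ
  nearRoot zero () δ 0<δ
  nearRoot p@(suc q) 3≤p δ 0<δ = Search.root p q refl 3≤p N h 0≤h Nh≡1 Q 4pτ≡1 4η≤τ Q≤N 0<τ δ 2η≤δ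
    where
    l = proj₁ (archimedean (lip p))
    lip≤l : lip p ≤ ι l
    lip≤l = proj₂ (archimedean (lip p))
    δ⁻¹ = proj₁ (inverse δ 0<δ)
    n = proj₁ (archimedean δ⁻¹)
    1≤nδ : 1ℚ ≤ δ * ι n
    1≤nδ = ≤-trans (≤-reflexive (sym (proj₂ (proj₂ (inverse δ 0<δ)))))
        (*-monoʳ δ (<⇒≤ 0<δ) (proj₂ (archimedean δ⁻¹)))
    -- N = 4pQ puts Q / N at 1 / (4p). The summand 16l yields 4η ≤ Q h, because 4η = 16 (lip p) h;
    -- the summand 8ln yields 2η ≤ δ, because 1 ≤ nδ and Q h ≤ 1.
    Q N : ℕ
    Q = suc (16 ℕ.* l ℕ.+ 8 ℕ.* l ℕ.* n)
    N = 4 ℕ.* p ℕ.* Q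
    0<ι : ∀ m → 0ℚ < ι (suc m)
    0<ι m = ≤-<-trans (0≤ι m) (ι-< m)
    Q≤N : Q ℕ.≤ N
    Q≤N = ℕ.m≤n*m Q (4 ℕ.* p)
    0<N : 0ℚ < ι N
    0<N = <-≤-trans (0<ι (16 ℕ.* l ℕ.+ 8 ℕ.* l ℕ.* n)) (ι-mono Q≤N)
    h = proj₁ (inverse (ι N) 0<N)
    0<h : 0ℚ < h
    0<h = proj₁ (proj₂ (inverse (ι N) 0<N))
    0≤h = <⇒≤ 0<h
    Nh≡1 : ι N * h ≡ 1ℚ
    Nh≡1 = proj₂ (proj₂ (inverse (ι N) 0<N))
    0<τ : 0ℚ < ι Q * h
    0<τ = subst (_< ι Q * h) (*-zeroˡ h) (*-monoˡ-<-pos h {{positive 0<h}} (0<ι (16 ℕ.* l ℕ.+ 8 ℕ.* l ℕ.* n)))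
    4pτ≡1 : ι (4 ℕ.* p) * (ι Q * h) ≡ 1ℚ
    4pτ≡1 = trans (sym (*-assoc (ι (4 ℕ.* p)) (ι Q) h)) (trans (cong (_* h) (sym (ι-* (4 ℕ.* p) Q))) Nh≡1)
    η = lip p * (ι 4 * h)
    scale : ∀ a b → a ≤ b → a * h ≤ b * h
    scale a b = *-monoʳ-≤-nonNeg h {{nonNegative 0≤h}}
    16l≤Q : ι (16 ℕ.* l) ≤ ι Q
    16l≤Q = ι-mono (ℕ.m≤n⇒m≤1+n (ℕ.m≤m+n (16 ℕ.* l) (8 ℕ.* l ℕ.* n)))
    8ln≤Q : ι (8 ℕ.* l ℕ.* n) ≤ ι Q
    8ln≤Q = ι-mono (ℕ.m≤n⇒m≤1+n (ℕ.m≤n+m (8 ℕ.* l ℕ.* n) (16 ℕ.* l)))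
    4η≤τ : ι 4 * η ≤ ι Q * h
    4η≤τ = ≤-trans (≤-reflexive (id (lip p) h)) (scale (ι 16 * lip p) (ι Q)
      (≤-trans (*-monoʳ (ι 16) (0≤ι 16) lip≤l) (≤-trans (≤-reflexive (sym (ι-* 16 l))) 16l≤Q)))
      where
      id : ∀ a h → ι 4 * (a * (ι 4 * h)) ≡ (ι 16 * a) * h
      id = solve-∀ ℚR
    τ≤1 : ι Q * h ≤ 1ℚ
    τ≤1 = ≤-trans (scale (ι Q) (ι N) (ι-mono Q≤N)) (≤-reflexive Nh≡1)
    2η≤δ : η + η ≤ δ
    2η≤δ = begin
      η + η                                   ≡⟨ id₁ (lip p) h ⟩
      (ι 8 * lip p * h) * 1ℚ                  ≤⟨ *-mono (0≤* (0≤* (0≤ι 8) (0≤lip p)) 0≤h) (0≤* (<⇒≤ 0<δ) (0≤ι n))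
                                                   (scale (ι 8 * lip p) (ι 8 * ι l) (*-monoʳ (ι 8) (0≤ι 8) lip≤l))
                                                     1≤nδ ⟩
      (ι 8 * ι l * h) * (δ * ι n)             ≡⟨ id₂ (ι l) h δ (ι n) ⟩
      (ι 8 * ι l * ι n) * h * δ               ≡⟨ cong (λ z → z * h * δ)
        (sym (trans (ι-* (8 ℕ.* l) n) (cong (_* ι n) (ι-* 8 l)))) ⟩
      ι (8 ℕ.* l ℕ.* n) * h * δ               ≤⟨ *-monoʳ-≤-nonNeg δ {{nonNegative (<⇒≤ 0<δ)}}
          (≤-trans (scale (ι (8 ℕ.* l ℕ.* n)) (ι Q) 8ln≤Q) τ≤1) ⟩
      1ℚ * δ                                  ≡⟨ *-identityˡ δ ⟩
      δ                                       ∎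
      where
      open ≤-Reasoning
      id₁ : ∀ a h → a * (ι 4 * h) + a * (ι 4 * h) ≡ (ι 8 * a * h) * 1ℚ
      id₁ = solve-∀ ℚR
      id₂ : ∀ l h d n → (ι 8 * l * h) * (d * n) ≡ (ι 8 * l * n) * h * d
      id₂ = solve-∀ ℚR

-- Arithmetic modulo p, periodic sets and dilations.

module Residues where
  open import Data.Nat.Base
  open import Data.Nat.Properties
  open import Data.Nat.DivMod
  open import Data.Nat.Primality using (Prime; prime⇒nonZero)
  open import Data.Nat.Coprimality using (coprime-Bézout; prime⇒coprime)
  open import Data.Nat.GCD using (module Bézout)
  open import Data.Product.Base using (∃-syntax; _,_)
  open import Data.Empty using (⊥)
  open import Relation.Binary.PropositionalEquality
  open import Data.Nat.Tactic.RingSolver using (solve-∀)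
  open Count

  module _ (p : ℕ) .{{_ : NonZero p}} where

    %-+ : ∀ a b → (a + b) % p ≡ (a % p + b % p) % p
    %-+ a b = %-distribˡ-+ a b p

    %-+ʳ : ∀ a b → (a + b % p) % p ≡ (a + b) % p
    %-+ʳ a b = trans (%-+ a (b % p)) (trans (cong (λ z → (a % p + z) % p) (m%n%n≡m%n b p)) (sym (%-+ a b)))

    %-+ˡ : ∀ a b → (a % p + b) % p ≡ (a + b) % p
    %-+ˡ a b = trans (cong (_% p) (+-comm (a % p) b)) (trans (%-+ʳ b a) (cong (_% p) (+-comm b a)))

    %-*ʳ : ∀ a b → (a * (b % p)) % p ≡ (a * b) % p
    %-*ʳ a b = trans (%-distribˡ-* a (b % p) p) (trans (cong (λ z → ((a % p) * z) % p) (m%n%n≡m%n b p))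
        (sym (%-distribˡ-* a b p)))

    %-*ˡ : ∀ a b → ((a % p) * b) % p ≡ (a * b) % p
    %-*ˡ a b = trans (cong (_% p) (*-comm (a % p) b)) (trans (%-*ʳ b a) (cong (_% p) (*-comm b a)))

    %-cong-*ʳ : ∀ c {a b} → a % p ≡ b % p → (c * a) % p ≡ (c * b) % p
    %-cong-*ʳ c {a} {b} eq = trans (sym (%-*ʳ c a)) (trans (cong (λ z → (c * z) % p) eq) (%-*ʳ c b))

    Periodic : Pred → Set
    Periodic B = ∀ i → B (i + p) ≡ B i

    periodic-% : ∀ f → Periodic (λ i → f (i % p))
    periodic-% f i = cong f ([m+n]%n≡m%n i p)

    periodic-shift : ∀ B u → Periodic B → Periodic (shift u B)
    periodic-shift B u per i = trans (cong B (sym (+-assoc u i p))) (per (u + i))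

    -- Splits [0 , u + p) once at u and once at p.
    cnt-period : ∀ B → Periodic B → ∀ u → cnt (shift u B) p ≡ cnt B p
    cnt-period B per u = +-cancelˡ-≡ (cnt B u) _ _ (begin
      cnt B u + cnt (shift u B) p        ≡⟨ cnt-split B u p ⟨
      cnt B (u + p)                      ≡⟨ cong (cnt B) (+-comm u p) ⟩
      cnt B (p + u)                      ≡⟨ cnt-split B p u ⟩
      cnt B p + cnt (shift p B) u        ≡⟨ cong (cnt B p +_)
          (cnt-cong u λ i _ → trans (cong B (+-comm p i)) (per i)) ⟩
      cnt B p + cnt B u                  ≡⟨ +-comm (cnt B p) _ ⟩
      cnt B u + cnt B p                  ∎)
      where open ≡-Reasoning

    record Unit (d e : ℕ) : Set where
      field
        de : (d * e) % p ≡ 1 % p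

      ed : (e * d) % p ≡ 1 % p
      ed = trans (cong (_% p) (*-comm e d)) de

      undo : ∀ a → a < p → (e * ((d * a) % p)) % p ≡ a
      undo a a<p = begin
        (e * ((d * a) % p)) % p      ≡⟨ %-*ʳ e (d * a) ⟩
        (e * (d * a)) % p            ≡⟨ cong (_% p) (*-assoc e d a) ⟨
        (e * d * a) % p              ≡⟨ %-*ˡ (e * d) a ⟨
        ((e * d) % p * a) % p        ≡⟨ cong (λ z → (z * a) % p) ed ⟩
        (1 % p * a) % p              ≡⟨ %-*ˡ 1 a ⟩
        (1 * a) % p                  ≡⟨ cong (_% p) (*-identityˡ a) ⟩
        a % p                        ≡⟨ m<n⇒m%n≡m a<p ⟩
        a                            ∎
        where open ≡-Reasoning

    unit-sym : ∀ {d e} → Unit d e → Unit e d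
    unit-sym {d} {e} u = record { de = trans (cong (_% p) (*-comm e d)) (Unit.de u) }

    unit-pos : ∀ {d e} → 1 < p → Unit d e → (d % p ≡ 0 → ⊥)
    unit-pos {d} {e} 1<p u d≡0 = 0≢1 (trans (sym (trans
        (%-cong-*ʳ e {d} {0} (trans d≡0 (sym (m<n⇒m%n≡m (<-trans z<s 1<p)))))
        (trans (cong (_% p) (*-zeroʳ e)) (m<n⇒m%n≡m (<-trans z<s 1<p))))) (trans (Unit.ed u) (m<n⇒m%n≡m 1<p)))
      where
      0≢1 : 0 ≡ 1 → ⊥
      0≢1 ()

    cnt-dilate : ∀ f {d e} → Unit d e → cnt (λ i → f ((d * i) % p)) p ≡ cnt f p
    cnt-dilate f {d} {e} u = ∑-reindex (λ i → ⟦ f i ⟧) p (λ i → (d * i) % p) (λ j → (e * j) % p)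
      (λ i _ → m%n<n (d * i) p) (λ j _ → m%n<n (e * j) p) (Unit.undo u) (Unit.undo (unit-sym u))

  prime-unit : ∀ p (pr : Prime p) d → 0 < d → d < p → ∃[ e ] Unit p {{prime⇒nonZero pr}} d e
  prime-unit p pr d 0<d d<p = from (coprime-Bézout (prime⇒coprime pr {{>-nonZero 0<d}} d<p))
    where
    instance nz = prime⇒nonZero pr
    from : Bézout.Identity 1 p d → ∃[ e ] Unit p d e
    from (Bézout.-+ x y eq) = y , record { de = trans (cong (_% p) (trans (*-comm d y) (sym eq)))
        ([m+kn]%n≡m%n 1 x p) }
    -- Here 1 + y d = x p, so the inverse of d is -y, written as y (p - 1).
    from (Bézout.+- x y eq) = y * (p ∸ 1) , record { de = begin
        (d * (y * (p ∸ 1))) % p            ≡⟨ cong (_% p)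
          (trans (sym (*-assoc d y (p ∸ 1))) (cong (_* (p ∸ 1)) (*-comm d y))) ⟩
        (y * d * (p ∸ 1)) % p              ≡⟨ [m+n]%n≡m%n (y * d * (p ∸ 1)) p ⟨
        (y * d * (p ∸ 1) + p) % p          ≡⟨ cong (λ z → (y * d * (p ∸ 1) + z) % p) p≡ ⟩
        (y * d * (p ∸ 1) + suc (p ∸ 1)) % p ≡⟨ cong (_% p) (rearrange (y * d) (p ∸ 1)) ⟩
        (1 + (1 + y * d) * (p ∸ 1)) % p    ≡⟨ cong (λ z → (1 + z * (p ∸ 1)) % p) eq ⟩
        (1 + x * p * (p ∸ 1)) % p          ≡⟨ cong (λ z → (1 + z) % p) (swap x p (p ∸ 1)) ⟩
        (1 + x * (p ∸ 1) * p) % p          ≡⟨ [m+kn]%n≡m%n 1 (x * (p ∸ 1)) p ⟩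
        1 % p                              ∎ }
      where
      open ≡-Reasoning
      p≡ : p ≡ suc (p ∸ 1)
      p≡ = sym (trans (+-comm 1 (p ∸ 1)) (m∸n+n≡m (<-trans 0<d d<p)))
      rearrange : ∀ a b → a * b + suc b ≡ 1 + (1 + a) * b
      rearrange = solve-∀
      swap : ∀ a b c → a * b * c ≡ a * c * b
      swap = solve-∀

-- Parseval's identity, approximately, for multisets of residues.

module Parseval (c s : ℚ.ℚ) (unit : c ℚ.* c ℚ.+ s ℚ.* s ≡ ℚ.1ℚ) where
  open import Data.Rational.Base hiding (_/_)
  open import Relation.Binary.PropositionalEquality
  open import Data.Nat.Base as ℕ using (ℕ)
  import Data.Nat.Properties as ℕ
  open import Data.Nat.DivMod using (_%_; m%n<n)
  open import Data.Rational.Properties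
  open import Data.List.Base using (List; []; _∷_; _++_; map; length)
  open import Data.List.Properties using (length-++; length-map)
  open import Data.List.Relation.Unary.All as All using (All; []; _∷_)
  open import Relation.Nullary using (yes; no; Dec)
  open import Data.Empty using (⊥-elim)
  open import Tactic.RingSolver using (solve-∀)
  open Rationals
  open Trig c s unit

  sumL : (ℕ → ℚ) → List ℕ → ℚ
  sumL f []       = 0ℚ
  sumL f (x ∷ xs) = f x + sumL f xs

  sumL-cong : ∀ {f g} xs → (∀ x → f x ≡ g x) → sumL f xs ≡ sumL g xs
  sumL-cong []       h = refl
  sumL-cong (x ∷ xs) h = cong₂ _+_ (h x) (sumL-cong xs h)

  sumL-++ : ∀ f xs ys → sumL f (xs ++ ys) ≡ sumL f xs + sumL f ys
  sumL-++ f []       ys = sym (+-identityˡ (sumL f ys))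
  sumL-++ f (x ∷ xs) ys = trans (cong (f x +_) (sumL-++ f xs ys)) (sym (+-assoc (f x) (sumL f xs) (sumL f ys)))

  sumL-map : ∀ f g xs → sumL f (map g xs) ≡ sumL (λ x → f (g x)) xs
  sumL-map f g []       = refl
  sumL-map f g (x ∷ xs) = cong (f (g x) +_) (sumL-map f g xs)

  sumL-+ : ∀ f g xs → sumL (λ x → f x + g x) xs ≡ sumL f xs + sumL g xs
  sumL-+ f g []       = refl
  sumL-+ f g (x ∷ xs) = trans (cong (f x + g x +_) (sumL-+ f g xs))
      (+-interchange (f x) (g x) (sumL f xs) (sumL g xs))

  sumL-* : ∀ a f xs → sumL (λ x → a * f x) xs ≡ a * sumL f xs
  sumL-* a f []       = sym (*-zeroʳ a)
  sumL-* a f (x ∷ xs) = trans (cong (a * f x +_) (sumL-* a f xs)) (sym (*-distribˡ-+ a (f x) (sumL f xs)))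

  ∑-sumL : ∀ (f : ℕ → ℕ → ℚ) n xs → ∑ (λ d → sumL (f d) xs) n ≡ sumL (λ x → ∑ (λ d → f d x) n) xs
  ∑-sumL f n []       = ∑-0 n
  ∑-sumL f n (x ∷ xs) = trans (∑-+ (λ d → f d x) (λ d → sumL (f d) xs) n)
      (cong (∑ (λ d → f d x) n +_) (∑-sumL f n xs))

  size : List ℕ → ℚ
  size xs = ι (length xs)

  private
    grow : ∀ l e → e + l * e ≡ (l + 1ℚ) * e
    grow = solve-∀ ℚR
    diff : ∀ a b u v → (a + u) - (b + v) ≡ (a - b) + (u - v)
    diff = solve-∀ ℚR

  sumL-close : ∀ {P : ℕ → Set} f g e xs → All P xs → (∀ x → P x → ∣ f x - g x ∣ ≤ e) → ∣ sumL f xs - sumL g xs ∣ ≤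
      size xs * e
  sumL-close f g e []       []       h = ≤-reflexive (sym (*-zeroˡ e))
  sumL-close f g e (x ∷ xs) (p ∷ ps) h = subst₂ (λ z w → ∣ z ∣ ≤ w) (sym (diff (f x) (g x) (sumL f xs) (sumL g xs)))
      (grow (size xs) e)
    (abs-+ {f x - g x} {sumL f xs - sumL g xs} (h x p) (sumL-close f g e xs ps h))

  X Y : ℕ → List ℕ → ℚ
  X d = sumL (λ x → C₂ (d ℕ.* x))
  Y d = sumL (λ x → S₂ (d ℕ.* x))

  -- The squared modulus of the Fourier coefficient at d. Lists stand for multisets, so that sums of
  -- pairs keep their multiplicity.
  power : ℕ → List ℕ → ℚ
  power d xs = X d xs * X d xs + Y d xs * Y d xs

  pairs : List ℕ → List ℕ → List ℕ
  pairs []       ys = []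
  pairs (x ∷ xs) ys = map (x ℕ.+_) ys ++ pairs xs ys

  private
    dist : ∀ d x y → d ℕ.* (x ℕ.+ y) ℕ.+ d ℕ.* (x ℕ.+ y) ≡ (d ℕ.* x ℕ.+ d ℕ.* x) ℕ.+ (d ℕ.* y ℕ.+ d ℕ.* y)
    dist d x y = trans (cong₂ ℕ._+_ (ℕ.*-distribˡ-+ d x y) (ℕ.*-distribˡ-+ d x y))
      (Sum.+-interchange ℕ.+-*-isCommutativeSemiring (d ℕ.* x) (d ℕ.* y) (d ℕ.* x) (d ℕ.* y))

    C₂-+ : ∀ d x y → C₂ (d ℕ.* (x ℕ.+ y)) ≡ C₂ (d ℕ.* x) * C₂ (d ℕ.* y) - S₂ (d ℕ.* x) * S₂ (d ℕ.* y)
    C₂-+ d x y = trans (cong C (dist d x y)) (C-+ (d ℕ.* x ℕ.+ d ℕ.* x) (d ℕ.* y ℕ.+ d ℕ.* y))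

    S₂-+ : ∀ d x y → S₂ (d ℕ.* (x ℕ.+ y)) ≡ S₂ (d ℕ.* x) * C₂ (d ℕ.* y) + C₂ (d ℕ.* x) * S₂ (d ℕ.* y)
    S₂-+ d x y = trans (cong S (dist d x y)) (S-+ (d ℕ.* x ℕ.+ d ℕ.* x) (d ℕ.* y ℕ.+ d ℕ.* y))

    sumL-- : ∀ f g xs → sumL (λ x → f x - g x) xs ≡ sumL f xs - sumL g xs
    sumL-- f g []       = refl
    sumL-- f g (x ∷ xs) = trans (cong (f x - g x +_) (sumL-- f g xs))
        (sym (diff (f x) (g x) (sumL f xs) (sumL g xs)))

    X-row : ∀ d x ys → X d (map (x ℕ.+_) ys) ≡ C₂ (d ℕ.* x) * X d ys - S₂ (d ℕ.* x) * Y d ys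
    X-row d x ys = trans (sumL-map _ (x ℕ.+_) ys) (trans (sumL-cong ys (C₂-+ d x))
      (trans (sumL-- (λ y → C₂ (d ℕ.* x) * C₂ (d ℕ.* y)) (λ y → S₂ (d ℕ.* x) * S₂ (d ℕ.* y)) ys)
        (cong₂ _-_ (sumL-* (C₂ (d ℕ.* x)) _ ys) (sumL-* (S₂ (d ℕ.* x)) _ ys))))

    Y-row : ∀ d x ys → Y d (map (x ℕ.+_) ys) ≡ S₂ (d ℕ.* x) * X d ys + C₂ (d ℕ.* x) * Y d ys
    Y-row d x ys = trans (sumL-map _ (x ℕ.+_) ys) (trans (sumL-cong ys (S₂-+ d x))
      (trans (sumL-+ (λ y → S₂ (d ℕ.* x) * C₂ (d ℕ.* y)) (λ y → C₂ (d ℕ.* x) * S₂ (d ℕ.* y)) ys)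
        (cong₂ _+_ (sumL-* (S₂ (d ℕ.* x)) _ ys) (sumL-* (C₂ (d ℕ.* x)) _ ys))))

    X-id : ∀ c s x y u v → (c * x - s * y) + (u * x - v * y) ≡ (c + u) * x - (s + v) * y
    X-id = solve-∀ ℚR
    Y-id : ∀ c s x y u v → (s * x + c * y) + (v * x + u * y) ≡ (s + v) * x + (c + u) * y
    Y-id = solve-∀ ℚR
    X-0 : ∀ x y → 0ℚ ≡ 0ℚ * x - 0ℚ * y
    X-0 = solve-∀ ℚR
    Y-0 : ∀ x y → 0ℚ ≡ 0ℚ * x + 0ℚ * y
    Y-0 = solve-∀ ℚR
    square : ∀ x y → (x * x - y * y) * (x * x - y * y) + (y * x + x * y) * (y * x + x * y) ≡ (x * x + y * y) *
        (x * x + y * y)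
    square = solve-∀ ℚR

  X-pairs : ∀ d xs ys → X d (pairs xs ys) ≡ X d xs * X d ys - Y d xs * Y d ys
  X-pairs d []       ys = X-0 (X d ys) (Y d ys)
  X-pairs d (x ∷ xs) ys = trans (sumL-++ _ (map (x ℕ.+_) ys) (pairs xs ys))
      (trans (cong₂ _+_ (X-row d x ys) (X-pairs d xs ys))
    (X-id (C₂ (d ℕ.* x)) (S₂ (d ℕ.* x)) (X d ys) (Y d ys) (X d xs) (Y d xs)))

  Y-pairs : ∀ d xs ys → Y d (pairs xs ys) ≡ Y d xs * X d ys + X d xs * Y d ys
  Y-pairs d []       ys = Y-0 (X d ys) (Y d ys)
  Y-pairs d (x ∷ xs) ys = trans (sumL-++ _ (map (x ℕ.+_) ys) (pairs xs ys))
      (trans (cong₂ _+_ (Y-row d x ys) (Y-pairs d xs ys))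
    (Y-id (C₂ (d ℕ.* x)) (S₂ (d ℕ.* x)) (X d ys) (Y d ys) (X d xs) (Y d xs)))

  -- The transform of the multiset A + A is the square of that of A. Fourth moments of A thereby
  -- become second moments, and `parseval` serves for both.
  power-pairs : ∀ d xs → power d (pairs xs xs) ≡ power d xs * power d xs
  power-pairs d xs = trans (cong₂ (λ a b → a * a + b * b) (X-pairs d xs xs) (Y-pairs d xs xs))
      (square (X d xs) (Y d xs))

  length-pairs : ∀ xs ys → length (pairs xs ys) ≡ length xs ℕ.* length ys
  length-pairs []       ys = refl
  length-pairs (x ∷ xs) ys = trans (length-++ (map (x ℕ.+_) ys))
      (cong₂ ℕ._+_ (length-map (x ℕ.+_) ys) (length-pairs xs ys))

  power₀ : ∀ xs → power 0 xs ≡ size xs * size xs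
  power₀ xs = trans (cong₂ (λ a b → a * a + b * b) (ones xs) (zeros xs)) (id (size xs))
    where
    ones : ∀ xs → X 0 xs ≡ size xs
    ones []       = refl
    ones (x ∷ xs) = trans (cong (1ℚ +_) (ones xs)) (+-comm 1ℚ (size xs))
    zeros : ∀ xs → Y 0 xs ≡ 0ℚ
    zeros []       = refl
    zeros (x ∷ xs) = trans (+-identityˡ (Y 0 xs)) (zeros xs)
    id : ∀ a → a * a + 0ℚ * 0ℚ ≡ a * a
    id = solve-∀ ℚR

  module Norms (p : ℕ) .{{_ : ℕ.NonZero p}} (δ : ℚ) (Sp≤δ : ∣ S p ∣ ≤ δ) (K : ℚ) (0≤K : 0ℚ ≤ K)
               (big : ∀ t → 1 ℕ.≤ t → t ℕ.< p → 1ℚ ≤ K * S t) where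
    open Approx p δ Sp≤δ
    open Orthogonality K 0≤K big

    parseval-id : ∀ xs → ∑ (λ d → power d xs) p ≡ sumL (λ x → sumL (Γ x) xs) xs
    parseval-id xs = trans (∑-cong p (λ d _ → expand d)) (trans (∑-sumL (λ d x → sumL (term d x) xs) p xs)
      (sumL-cong xs λ x → ∑-sumL (λ d y → term d x y) p xs))
      where
      term : ℕ → ℕ → ℕ → ℚ
      term d x y = C₂ (d ℕ.* x) * C₂ (d ℕ.* y) + S₂ (d ℕ.* x) * S₂ (d ℕ.* y)
      comm : ∀ a b → a * b ≡ b * a
      comm = *-comm
      expand : ∀ d → power d xs ≡ sumL (λ x → sumL (term d x) xs) xs
      expand d = sym (trans (sumL-cong xs λ x → trans (sumL-+ (λ y → C₂ (d ℕ.* x) * C₂ (d ℕ.* y))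
          (λ y → S₂ (d ℕ.* x) * S₂ (d ℕ.* y)) xs)
          (cong₂ _+_ (trans (sumL-* (C₂ (d ℕ.* x)) _ xs) (comm (C₂ (d ℕ.* x)) (X d xs)))
            (trans (sumL-* (S₂ (d ℕ.* x)) _ xs) (comm (S₂ (d ℕ.* x)) (Y d xs)))))
        (trans (sumL-+ (λ x → X d xs * C₂ (d ℕ.* x)) (λ x → Y d xs * S₂ (d ℕ.* x)) xs)
          (cong₂ _+_ (sumL-* (X d xs) _ xs) (sumL-* (Y d xs) _ xs))))

    same : ℕ → ℕ → ℚ
    same x y = indicator (x % p ℕ.≟ y % p)
      where
      indicator : ∀ {A : Set} → Dec A → ℚ
      indicator (yes _) = 1ℚ
      indicator (no _)  = 0ℚ

    Γ≈ : ∀ x y → x ℕ.< p ℕ.+ p → y ℕ.< p ℕ.+ p → ∣ Γ x y - ι p * same x y ∣ ≤ E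
    Γ≈ x y x< y< with x % p ℕ.≟ y % p
    ... | yes eq = subst (λ z → ∣ Γ x y - z ∣ ≤ E) (sym (*-identityʳ (ι p))) (normal x y x< y< eq)
    ... | no ne = subst (λ z → ∣ z ∣ ≤ E) (id (Γ x y) (ι p)) (orthogonal x y x< y< ne)
      where
      id : ∀ g p → g ≡ g - p * 0ℚ
      id = solve-∀ ℚR

    multiplicity : List ℕ → ℕ → ℚ
    multiplicity xs z = sumL (λ x → same x z) xs

    same-sum : ∀ x y → ∑ (λ z → same x z * same y z) p ≡ same x y
    same-sum x y = trans (∑-single (λ z → same x z * same y z) (x % p) (m%n<n x p) off)
        (trans (cong (_* same y (x % p)) on) (trans (*-identityˡ (same y (x % p))) flip))
      where
      open import Data.Nat.DivMod using (m%n%n≡m%n; m<n⇒m%n≡m)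
      on : same x (x % p) ≡ 1ℚ
      on with x % p ℕ.≟ (x % p) % p
      ... | yes _ = refl
      ... | no ne = ⊥-elim (ne (sym (m%n%n≡m%n x p)))
      off : ∀ z → z ℕ.< p → z ≢ x % p → same x z * same y z ≡ 0ℚ
      off z z<p ne with x % p ℕ.≟ z % p
      ... | yes eq = ⊥-elim (ne (trans (sym (m<n⇒m%n≡m z<p)) (sym eq)))
      ... | no _ = *-zeroˡ (same y z)
      flip : same y (x % p) ≡ same x y
      flip with y % p ℕ.≟ (x % p) % p | x % p ℕ.≟ y % p
      ... | yes _ | yes _ = refl
      ... | no _  | no _  = refl
      ... | yes a | no b = ⊥-elim (b (trans (sym (m%n%n≡m%n x p)) (sym a)))
      ... | no a  | yes b = ⊥-elim (a (trans (sym b) (sym (m%n%n≡m%n x p))))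

    -- A congruent pair is recorded at its common residue z, by `same-sum`.
    collisions : ∀ xs → sumL (λ x → sumL (same x) xs) xs ≡ ∑ (λ z → multiplicity xs z * multiplicity xs z) p
    collisions xs = sym (trans (∑-cong p (λ z _ → sym (trans
        (sumL-cong xs λ x → trans (sumL-* (same x z) (λ y → same y z) xs) (*-comm (same x z) (multiplicity xs z)))
        (sumL-* (multiplicity xs z) (λ x → same x z) xs))))
      (trans (∑-sumL (λ z x → sumL (λ y → same x z * same y z) xs) p xs)
        (sumL-cong xs λ x → trans (∑-sumL (λ z y → same x z * same y z) p xs) (sumL-cong xs λ y → same-sum x y))))

    -- Expanding the square leaves one `Γ` per pair, which is p for congruent pairs and 0 for
    -- others, up to E. The range below 2p accommodates sums of two residues.
    parseval : ∀ xs → All (ℕ._< p ℕ.+ p) xs →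
               ∣ ∑ (λ d → power d xs) p - ι p * ∑ (λ z → multiplicity xs z * multiplicity xs z) p ∣ ≤ size xs *
                   (size xs * E)
    parseval xs all = subst (λ z → ∣ z ∣ ≤ size xs * (size xs * E))
      (cong₂ _-_ (sym (parseval-id xs)) (trans (sumL-cong xs λ x → sumL-* (ι p) (same x) xs)
        (trans (sumL-* (ι p) (λ x → sumL (same x) xs) xs)
        (cong (ι p *_) (collisions xs)))))
      (sumL-close (λ x → sumL (Γ x) xs) (λ x → sumL (λ y → ι p * same x y) xs) (size xs * E) xs all λ x x< →
        sumL-close (Γ x) (λ y → ι p * same x y) E xs all λ y y< → Γ≈ x y x< y<)

-- Indicator sums, limits and half windows.

module Fourier where
  open import Data.Nat.Base as ℕ using (ℕ; zero; suc; ⌈_/2⌉)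
  import Data.Nat.Properties as ℕ
  open import Data.Bool.Base using (true; false)
  open import Data.Rational.Base hiding (_/_)
  open import Data.Rational.Properties
  open import Data.List.Base using (List; []; _∷_; length)
  open import Data.List.Relation.Unary.All as All using (All; []; _∷_)
  open import Data.Product.Base using (∃-syntax; _×_; _,_; proj₁; proj₂)
  open import Relation.Binary.PropositionalEquality
  open import Tactic.RingSolver using (solve-∀)
  open Rationals
  open Roots using (inverse)
  open Count using (Pred; _∋_; ⟦_⟧; cnt)

  elements : Pred → ℕ → List ℕ
  elements f zero = []
  elements f (suc n) with f n
  ... | true  = n ∷ elements f n
  ... | false = elements f n

  elements-< : ∀ f n → All (ℕ._< n) (elements f n)
  elements-< f zero = []
  elements-< f (suc n) with f n
  ... | true  = ℕ.n<1+n n ∷ All.map ℕ.m<n⇒m<1+n (elements-< f n)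
  ... | false = All.map ℕ.m<n⇒m<1+n (elements-< f n)

  elements-∋ : ∀ f n → All (f ∋_) (elements f n)
  elements-∋ f zero = []
  elements-∋ f (suc n) with f n in eq
  ... | true  = eq ∷ elements-∋ f n
  ... | false = elements-∋ f n

  length-elements : ∀ f n → length (elements f n) ≡ cnt f n
  length-elements f zero = refl
  length-elements f (suc n) with f n
  ... | true  = trans (cong suc (length-elements f n)) (ℕ.+-comm 1 (cnt f n))
  ... | false = trans (length-elements f n) (sym (ℕ.+-identityʳ (cnt f n)))

  φ : Pred → ℕ → ℚ
  φ f i = ι ⟦ f i ⟧

  ∑φ : ∀ f n → ∑ (φ f) n ≡ ι (cnt f n)
  ∑φ f zero    = refl
  ∑φ f (suc n) = trans (cong (_+ φ f n) (∑φ f n)) (sym (ι-+ (cnt f n) ⟦ f n ⟧))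

  ∣φ∣≤1 : ∀ f i → ∣ φ f i ∣ ≤ 1ℚ
  ∣φ∣≤1 f i = subst (_≤ 1ℚ) (sym (0≤p⇒∣p∣≡p (0≤ι ⟦ f i ⟧)))
      (≤-trans (ι-mono (Count.⟦⟧≤1 (f i))) (≤-reflexive (+-identityˡ 1ℚ)))

  φ-idem : ∀ f i → φ f i * φ f i ≡ φ f i
  φ-idem f i with f i
  ... | true  = refl
  ... | false = refl

  -- If d = x - y were positive, δ = d / (d + B) would be at most 1 with δB < d. This is how
  -- estimates with an error linear in δ become exact.
  limit : ∀ x y B → 0ℚ ≤ B → (∀ δ → 0ℚ < δ → δ ≤ 1ℚ → x ≤ y + δ * B) → x ≤ y
  limit x y B 0≤B h = ≮⇒≥ λ y<x → contra y<x
    where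
    contra : y < x → _
    contra y<x = <-irrefl refl (<-≤-trans δB<d (≤-trans (≤-reflexive (id₁ x y))
        (≤-trans (+-monoˡ-≤ (- y) (h δ 0<δ δ≤1)) (≤-reflexive (id₂ y (δ * B))))))
      where
      d = x - y
      0<d : 0ℚ < d
      0<d = subst (_< d) (+-inverseʳ y) (+-monoˡ-< (- y) y<x)
      0<t : 0ℚ < d + B
      0<t = <-≤-trans 0<d (by-diff B 0≤B refl)
      w = proj₁ (inverse (d + B) 0<t)
      0<w : 0ℚ < w
      0<w = proj₁ (proj₂ (inverse (d + B) 0<t))
      tw≡1 : (d + B) * w ≡ 1ℚ
      tw≡1 = proj₂ (proj₂ (inverse (d + B) 0<t))
      δ = d * w
      0<δ : 0ℚ < δ
      0<δ = subst (_< δ) (*-zeroˡ w) (*-monoˡ-<-pos w {{positive 0<w}} 0<d)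
      δ≤1 : δ ≤ 1ℚ
      δ≤1 = ≤-trans (*-monoʳ-≤-nonNeg w {{nonNegative (<⇒≤ 0<w)}} (by-diff {d} {d + B} B 0≤B refl))
          (≤-reflexive tw≡1)
      δB<d : δ * B < d
      δB<d = subst₂ _<_ (id₃ d w B) (trans (id₄ d B w) (trans (cong (d *_) tw≡1) (*-identityʳ d)))
        (+-monoʳ-< (d * w * B) (*-monoʳ-<-pos d {{positive 0<d}} 0<δ))
        where
        id₃ : ∀ d w B → d * w * B + d * 0ℚ ≡ d * w * B
        id₃ = solve-∀ ℚR
        id₄ : ∀ d B w → d * w * B + d * (d * w) ≡ d * ((d + B) * w)
        id₄ = solve-∀ ℚR
      id₁ : ∀ x y → x - y ≡ x + (- y)
      id₁ x y = refl
      id₂ : ∀ y e → y + e + (- y) ≡ e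
      id₂ = solve-∀ ℚR

  ⅓ : ℚ
  ⅓ = 1ℚ ÷ (1ℚ + 1ℚ + 1ℚ)

  -- A window of p = 2m + 1 points of ½ℤ contains m + 1 or m integers, according to the parity of
  -- its start.
  half-windows : ∀ m i → ∃[ len ] ⌈ i /2⌉ ℕ.+ len ≡ ⌈ suc (m ℕ.+ m) ℕ.+ i /2⌉ × len ℕ.≤ suc m × m ℕ.≤ len
  half-windows m zero = suc m , cong suc (trans (ℕ.n≡⌊n+n/2⌋ m) (cong ⌊_/2⌋ (sym (ℕ.+-identityʳ (m ℕ.+ m))))) ,
      ℕ.≤-refl , ℕ.n≤1+n m
    where open import Data.Nat.Base using (⌊_/2⌋)
  half-windows m (suc zero) = m , cong suc (trans (ℕ.n≡⌈n+n/2⌉ m) (cong ⌊_/2⌋ (sym (ℕ.+-comm (m ℕ.+ m) 1)))) ,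
      ℕ.n≤1+n m , ℕ.≤-refl
    where open import Data.Nat.Base using (⌊_/2⌋)
  half-windows m (suc (suc i)) with half-windows m i
  ... | len , eq , le , ge = len , trans (cong suc eq)
      (cong ⌈_/2⌉ (sym (trans (ℕ.+-suc (suc (m ℕ.+ m)) (suc i)) (cong suc (ℕ.+-suc (suc (m ℕ.+ m)) i))))) , le , ge

-- Fourier coefficients, additive energy and the resulting inequality.

module FourierBound where
  open import Data.Nat.Base as ℕ using (ℕ; zero; suc; ⌈_/2⌉)
  import Data.Nat.Properties as ℕ
  open import Data.Nat.DivMod using (_%_; _/_; m%n<n; m<n⇒m%n≡m; m<n*o⇒m/o<n)
  open import Data.Bool.Base using (true; false)
  open import Data.Rational.Base hiding (_/_)
  open import Data.Rational.Properties
  open import Data.List.Base using (List; []; _∷_; length)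
  open import Data.List.Relation.Unary.All as All using (All; []; _∷_)
  open import Data.List.Relation.Unary.All.Properties using (++⁺; map⁺)
  open import Data.Product.Base using (∃-syntax; _×_; _,_)
  open import Data.Empty using (⊥-elim)
  open import Relation.Nullary using (yes; no)
  open import Relation.Binary.PropositionalEquality
  open import Tactic.RingSolver using (solve-∀)
  open Rationals
  open Roots using (NearRoot; stretch)
  open RootExistence using (nearRoot)
  open Residues
  open Count using (Pred; _∋_; ⟦_⟧; cnt; shift)
  open Fourier

  module Setup (p m : ℕ) .{{nz : ℕ.NonZero p}} (p≡ : suc (m ℕ.+ m) ≡ p) (f : Pred) (μ k : ℕ) (k≡ : cnt f p ≡ k)
               (windows : ∀ d e → Unit p d e → ∀ u → 6 ℕ.* cnt (λ j → f ((e ℕ.* (u ℕ.+ j)) % p)) (suc m) ℕ.≤ μ ℕ.+ 3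
                 ℕ.* k) where

    -- `windows` says that a half circle with N points satisfies 2N - k ≤ μ / 3.
    M : ℚ
    M = ι μ * ⅓

    0≤M : 0ℚ ≤ M
    0≤M = 0≤* (0≤ι μ) (nonNegative⁻¹ ⅓)

    -- R bounds both parts of any Fourier coefficient. `c₁` and `c₂` are the factors of δ in the
    -- orthogonality error and in the bound on one coefficient, see `E≡` and `E₂≡`; `slope` gathers
    -- them for the final estimate.
    K R c₁ c₂ : ℚ
    K = ι k
    R = ι p * (1ℚ * 1ℚ)
    c₁ = ι p * (ι 4 * (ι 4 * ι p)) + stretch p * ι p
    c₂ = (M + ι p) * (ι 8 * R) + (ι p * (R * (ι 4 * ι p) + R * (ι 4 * ι p)) + ι p *
        (R * (ι 4 * ι p) + R * (ι 4 * ι p)))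

    slope : ℚ → ℚ
    slope sq = sq * (K * K * (K * K) * c₁ + (M * M + c₂) * (K * K * c₁) + c₂ * (ι p * K))

    private
      third : ι 3 * M ≡ ι μ
      third = id (ι μ)
        where
        id : ∀ x → ι 3 * (x * ⅓) ≡ x
        id = solve-∀ ℚR

    module Dilate (d e : ℕ) (unit : Unit p d e) where
      B : Pred
      B j = f ((e ℕ.* j) % p)

      B-periodic : Periodic p B
      B-periodic i = cong f (trans (cong (_% p) (trans (ℕ.*-distribˡ-+ e i p) refl))
          (trans (%-+ p (e ℕ.* i) (e ℕ.* p))
        (trans (cong (λ z → ((e ℕ.* i) % p ℕ.+ z) % p) (m*n%n≡0 e p))
          (trans (cong (_% p) (ℕ.+-identityʳ ((e ℕ.* i) % p))) (m%n%n≡m%n (e ℕ.* i) p)))))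
        where open import Data.Nat.DivMod using (m*n%n≡0; m%n%n≡m%n)

      cnt-B : cnt B p ≡ k
      cnt-B = trans (cnt-dilate p f (unit-sym p unit)) k≡

      σ : ℕ → ℚ
      σ n = ι (cnt B n)

      σ-diff : ∀ j → σ (suc j) - σ j ≡ φ B j
      σ-diff j = trans (cong (_- σ j) (ι-+ (cnt B j) ⟦ B j ⟧)) (id (σ j) (φ B j))
        where
        id : ∀ a b → a + b - a ≡ b
        id = solve-∀ ℚR

      window-nat : ∀ u len → len ℕ.≤ suc m → 6 ℕ.* cnt (shift u B) len ℕ.≤ μ ℕ.+ 3 ℕ.* k
      window-nat u len le = ℕ.≤-trans (ℕ.*-monoʳ-≤ 6 (Count.∑-monoʳ _ le)) (windows d e unit u)

      -- The upper bound is `windows`. The lower bound is the same for the complementary window,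
      -- whose length p - len is again at most m + 1.
      balanced : ∀ i → i ℕ.≤ p → ∣ (σ ⌈ p ℕ.+ i /2⌉ - σ ⌈ i /2⌉) + (σ ⌈ p ℕ.+ i /2⌉ - σ ⌈ i /2⌉) - ι k ∣ ≤ M
      balanced i _ = from (half-windows m i)
        where
        u = ⌈ i /2⌉
        module _ (len : ℕ) (eq : u ℕ.+ len ≡ ⌈ suc (m ℕ.+ m) ℕ.+ i /2⌉) (le : len ℕ.≤ suc m) (ge : m ℕ.≤ len) where
          rest = suc (m ℕ.+ m) ℕ.∸ len
          N N' : ℕ
          N  = cnt (shift u B) len
          N' = cnt (shift (u ℕ.+ len) B) rest
          len+rest : len ℕ.+ rest ≡ p
          len+rest = trans (ℕ.m+[n∸m]≡n (ℕ.≤-trans le (ℕ.s≤s (ℕ.m≤m+n m m)))) p≡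
          rest≤ : rest ℕ.≤ suc m
          rest≤ = ℕ.≤-trans (ℕ.∸-monoʳ-≤ (suc (m ℕ.+ m)) ge) (ℕ.≤-reflexive (ℕ.m+n∸n≡m (suc m) m))
          split : k ≡ N ℕ.+ N'
          split = begin
            k                                            ≡⟨ cnt-B ⟨
            cnt B p                                      ≡⟨ cnt-period p B B-periodic u ⟨
            cnt (shift u B) p                            ≡⟨ cong (cnt (shift u B)) len+rest ⟨
            cnt (shift u B) (len ℕ.+ rest)               ≡⟨ Count.cnt-split (shift u B) len rest ⟩
            N ℕ.+ cnt (shift len (shift u B)) rest       ≡⟨ cong (N ℕ.+_)
                (Count.cnt-cong rest λ j _ → cong B (sym (ℕ.+-assoc u len j))) ⟩
            N ℕ.+ N'                                     ∎
            where open ≡-Reasoning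
          h₁ : 6 ℕ.* N ℕ.≤ μ ℕ.+ 3 ℕ.* k
          h₁ = window-nat u len le
          h₂ : 6 ℕ.* N' ℕ.≤ μ ℕ.+ 3 ℕ.* k
          h₂ = window-nat (u ℕ.+ len) rest rest≤
          q₁ : ι 6 * ι N ≤ ι μ + ι 3 * ι k
          q₁ = subst₂ _≤_ (ι-* 6 N) (trans (ι-+ μ (3 ℕ.* k)) (cong (ι μ +_) (ι-* 3 k))) (ι-mono h₁)
          q₂ : ι 6 * ι N' ≤ ι μ + ι 3 * ι k
          q₂ = subst₂ _≤_ (ι-* 6 N') (trans (ι-+ μ (3 ℕ.* k)) (cong (ι μ +_) (ι-* 3 k))) (ι-mono h₂)
          ιk : ι k ≡ ι N + ι N'
          ιk = trans (cong ι split) (ι-+ N N')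
          diff : σ ⌈ p ℕ.+ i /2⌉ - σ u ≡ ι N
          diff = trans (cong (λ z → σ z - σ u) (trans (cong (λ z → ⌈ z ℕ.+ i /2⌉) (sym p≡)) (sym eq)))
            (trans (cong (_- σ u) (trans (cong ι (Count.cnt-split B u len)) (ι-+ (cnt B u) N))) (id (σ u) (ι N)))
            where
            id : ∀ a b → a + b - a ≡ b
            id = solve-∀ ℚR
          cancel3 : ∀ {x} → ι 3 * x ≤ ι μ → x ≤ M
          cancel3 {x} h = *-cancelˡ-≤-pos (ι 3) (≤-trans h (≤-reflexive (sym third)))
          up : ι N + ι N - ι k ≤ M
          up = cancel3 (by-diff (ι μ + ι 3 * ι k - ι 6 * ι N) (diff≥0 q₁) (id (ι N) (ι k) (ι μ)))
            where
            id : ∀ n k u → u ≡ ι 3 * (n + n - k) + (u + ι 3 * k - ι 6 * n)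
            id = solve-∀ ℚR
          down : - (ι N + ι N - ι k) ≤ M
          down = cancel3 (by-diff (ι μ + ι 3 * ι k - ι 6 * ι N') (diff≥0 q₂)
            (trans (id (ι N) (ι N') (ι μ)) (cong (λ z → ι 3 * (- (ι N + ι N - z)) + (ι μ + ι 3 * z - ι 6 * ι N'))
              (sym ιk))))
            where
            id : ∀ n n' u → u ≡ ι 3 * (- (n + n - (n + n'))) + (u + ι 3 * (n + n') - ι 6 * n')
            id = solve-∀ ℚR
          done : ∣ (σ ⌈ p ℕ.+ i /2⌉ - σ u) + (σ ⌈ p ℕ.+ i /2⌉ - σ u) - ι k ∣ ≤ M
          done = subst (λ z → ∣ z + z - ι k ∣ ≤ M) (sym diff) (abs≤ up down)
        from : (∃[ len ] u ℕ.+ len ≡ ⌈ suc (m ℕ.+ m) ℕ.+ i /2⌉ × len ℕ.≤ suc m × m ℕ.≤ len) →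
               ∣ (σ ⌈ p ℕ.+ i /2⌉ - σ u) + (σ ⌈ p ℕ.+ i /2⌉ - σ u) - ι k ∣ ≤ M
        from (len , eq , le , ge) = done len eq le ge

    0≤R : 0ℚ ≤ R
    0≤R = 0≤* (0≤ι p) (nonNegative⁻¹ (1ℚ * 1ℚ))

    0≤c₁ : 0ℚ ≤ c₁
    0≤c₁ = 0≤+ (0≤* (0≤ι p) (0≤* (0≤ι 4) (0≤* (0≤ι 4) (0≤ι p)))) (0≤* (0≤* (0≤ι (4 ℕ.* p)) (0≤ι 4)) (0≤ι p))

    0≤c₂ : 0ℚ ≤ c₂
    0≤c₂ = 0≤+ (0≤* (0≤+ 0≤M (0≤ι p)) (0≤* (0≤ι 8) 0≤R)) (0≤+ half half)
      where
      quarter : 0ℚ ≤ R * (ι 4 * ι p)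
      quarter = 0≤* 0≤R (0≤* (0≤ι 4) (0≤ι p))
      half : 0ℚ ≤ ι p * (R * (ι 4 * ι p) + R * (ι 4 * ι p))
      half = 0≤* (0≤ι p) (0≤+ quarter quarter)

    0≤K : 0ℚ ≤ K
    0≤K = 0≤ι k

    0≤slope : ∀ sq → 0ℚ ≤ sq → 0ℚ ≤ slope sq
    0≤slope sq 0≤sq' = 0≤* 0≤sq' (0≤+ (0≤+ (0≤* (0≤* (0≤sq K) (0≤sq K)) 0≤c₁)
        (0≤* (0≤+ (0≤sq M) 0≤c₂) (0≤* (0≤sq K) 0≤c₁))) (0≤* 0≤c₂ (0≤* (0≤ι p) 0≤K)))

    as : List ℕ
    as = elements f p

    module Root (1≤p : 1 ℕ.≤ p) (δ : ℚ) (0<δ : 0ℚ < δ) (ξ : NearRoot p δ) where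
      open NearRoot ξ using (c; s; unit; 0<s; S≥0; Cp; Sp; big)
      open Trig c s unit
      open Parseval c s unit
      open Approx p δ Sp using (C₂-%; S₂-%)
      open Norms p δ Sp (stretch p) (0≤* (0≤ι (4 ℕ.* p)) (0≤ι 4)) big

      0≤δ : 0ℚ ≤ δ
      0≤δ = <⇒≤ 0<δ

      sumL-elements : ∀ F n → sumL F (elements f n) ≡ ∑ (λ i → φ f i * F i) n
      sumL-elements F zero = refl
      sumL-elements F (suc n) with f n
      ... | true  = trans (+-comm (F n) _) (cong₂ _+_ (sumL-elements F n) (sym (*-identityˡ (F n))))
      ... | false = trans (sumL-elements F n) (sym (trans (cong (∑ (λ i → φ f i * F i) n +_) (*-zeroˡ (F n)))
          (+-identityʳ (∑ (λ i → φ f i * F i) n))))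

      size-as : size as ≡ ι k
      size-as = cong ι (trans (length-elements f p) k≡)

      X≤R : ∀ d → ∣ X d as ∣ ≤ R
      X≤R d = subst (λ z → ∣ z ∣ ≤ R) (sym (sumL-elements (λ x → C₂ (d ℕ.* x)) p))
        (∑-abs (1ℚ * 1ℚ) p λ i _ → abs-* {φ f i} {C₂ (d ℕ.* i)} (∣φ∣≤1 f i) (∣C∣≤1 (d ℕ.* i ℕ.+ d ℕ.* i)))

      Y≤R : ∀ d → ∣ Y d as ∣ ≤ R
      Y≤R d = subst (λ z → ∣ z ∣ ≤ R) (sym (sumL-elements (λ x → S₂ (d ℕ.* x)) p))
        (∑-abs (1ℚ * 1ℚ) p λ i _ → abs-* {φ f i} {S₂ (d ℕ.* i)} (∣φ∣≤1 f i) (∣S∣≤1 (d ℕ.* i ℕ.+ d ℕ.* i)))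

      module Frequency (d e : ℕ) (ed-unit : Unit p d e) (d<p : d ℕ.< p) where
        open Dilate d e ed-unit
        x y P : ℚ
        x = X d as
        y = Y d as
        P = power d as

        -- The real part of ζⁿ times the conjugate of the coefficient x + y i. Pairing the
        -- coefficient with itself rotates it to the real axis without dividing by its modulus.
        w : ℕ → ℚ
        w n = x * C₂ n + y * S₂ n

        P-sum : P ≡ ∑ (λ a → φ f a * w (d ℕ.* a)) p
        P-sum = begin
          x * x + y * y
            ≡⟨ cong₂ (λ u v → x * u + y * v) (sumL-elements (λ a → C₂ (d ℕ.* a)) p)
                (sumL-elements (λ a → S₂ (d ℕ.* a)) p) ⟩
          x * ∑ (λ a → φ f a * C₂ (d ℕ.* a)) p + y * ∑ (λ a → φ f a * S₂ (d ℕ.* a)) p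
            ≡⟨ cong₂ _+_ (∑-*ˡ x (λ a → φ f a * C₂ (d ℕ.* a)) p) (∑-*ˡ y (λ a → φ f a * S₂ (d ℕ.* a)) p) ⟩
          ∑ (λ a → x * (φ f a * C₂ (d ℕ.* a))) p + ∑ (λ a → y * (φ f a * S₂ (d ℕ.* a))) p
            ≡⟨ ∑-+ (λ a → x * (φ f a * C₂ (d ℕ.* a))) (λ a → y * (φ f a * S₂ (d ℕ.* a))) p ⟨
          ∑ (λ a → x * (φ f a * C₂ (d ℕ.* a)) + y * (φ f a * S₂ (d ℕ.* a))) p
            ≡⟨ ∑-cong p (λ a _ → id x y (φ f a) (C₂ (d ℕ.* a)) (S₂ (d ℕ.* a))) ⟩
          ∑ (λ a → φ f a * w (d ℕ.* a)) p ∎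
          where
          open ≡-Reasoning
          id : ∀ x y f c s → x * (f * c) + y * (f * s) ≡ f * (x * c + y * s)
          id = solve-∀ ℚR

        reduced : ℚ
        reduced = ∑ (λ a → φ f a * w ((d ℕ.* a) % p)) p

        η err : ℚ
        η = ι 4 * (ι p * δ)
        err = ι p * (1ℚ * (R * η + R * η))

        reduction : ∣ P - reduced ∣ ≤ err
        reduction = subst (λ z → ∣ z ∣ ≤ err) (trans (∑-- _ _ p) (cong (_- reduced) (sym P-sum)))
          (∑-abs (1ℚ * (R * η + R * η)) p λ a a<p → subst (λ z → ∣ z ∣ ≤ 1ℚ * (R * η + R * η))
            (id (φ f a) x y (C₂ (d ℕ.* a)) (C₂ ((d ℕ.* a) % p)) (S₂ (d ℕ.* a)) (S₂ ((d ℕ.* a) % p)))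
            (abs-* {φ f a} {x * (C₂ (d ℕ.* a) - C₂ ((d ℕ.* a) % p)) + y * (S₂ (d ℕ.* a) - S₂ ((d ℕ.* a) % p))}
              (∣φ∣≤1 f a)
              (abs-+ {x * (C₂ (d ℕ.* a) - C₂ ((d ℕ.* a) % p))}
                (abs-* {x} {C₂ (d ℕ.* a) - C₂ ((d ℕ.* a) % p)} (X≤R d) (≤-trans (C₂-% (d ℕ.* a)) (quot a a<p)))
                (abs-* {y} {S₂ (d ℕ.* a) - S₂ ((d ℕ.* a) % p)} (Y≤R d) (≤-trans (S₂-% (d ℕ.* a)) (quot a a<p))))))
          where
          id : ∀ f x y c c' s s' → f * (x * (c - c') + y * (s - s')) ≡ f * (x * c + y * s) - f * (x * c' + y * s')
          id = solve-∀ ℚR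
          quot : ∀ a → a ℕ.< p → ι 4 * (ι ((d ℕ.* a) / p) * δ) ≤ η
          quot a a<p = *-monoʳ (ι 4) (0≤ι 4) (*-monoʳ-≤-nonNeg δ {{nonNegative 0≤δ}}
            (ι-mono (ℕ.<⇒≤ (m<n*o⇒m/o<n {d ℕ.* a} {p} {p} (ℕ.*-mono-< d<p a<p)))))

        -- The substitution j = d a mod p turns the coefficient of A at d into that of the dilate
        -- `B` at 1, where the half-circle bound applies.
        reindexed : reduced ≡ ∑ (λ j → (σ (suc j) - σ j) * w j) p
        reindexed = begin
          ∑ (λ a → φ f a * w ((d ℕ.* a) % p)) p
            ≡⟨ ∑-cong p (λ a a<p → cong (λ z → φ f z * w ((d ℕ.* a) % p)) (sym (Unit.undo ed-unit a a<p))) ⟩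
          ∑ (λ a → φ B ((d ℕ.* a) % p) * w ((d ℕ.* a) % p)) p
            ≡⟨ ∑-reindex (λ j → φ B j * w j) p (λ a → (d ℕ.* a) % p) (λ j → (e ℕ.* j) % p)
                (λ a _ → m%n<n (d ℕ.* a) p) (λ j _ → m%n<n (e ℕ.* j) p)
                 (Unit.undo ed-unit) (Unit.undo (unit-sym p ed-unit)) ⟩
          ∑ (λ j → φ B j * w j) p
            ≡⟨ ∑-cong p (λ j _ → cong (_* w j) (sym (σ-diff j))) ⟩
          ∑ (λ j → (σ (suc j) - σ j) * w j) p ∎
          where open ≡-Reasoning

        half : reduced + reduced ≤ M * M + P + (M + ι p) * (ι 8 * (R * δ))
        half = subst (λ z → z + z ≤ M * M + P + (M + ι p) * (ι 8 * (R * δ))) (sym reindexed)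
          (Window.half-circle-bound c s unit p 0<s S≥0 δ Cp Sp R x y (X≤R d) (Y≤R d) σ M (ι k) 0≤M 1≤p
            (λ j → subst (λ z → ∣ z ∣ ≤ 1ℚ) (sym (σ-diff j)) (∣φ∣≤1 B j))
            (trans (id (σ p)) (cong ι cnt-B)) balanced)
          where
          id : ∀ a → a - 0ℚ ≡ a
          id = solve-∀ ℚR

        E₂ : ℚ
        E₂ = (M + ι p) * (ι 8 * (R * δ)) + (err + err)

        -- Apart from errors, `half` reads 2P ≤ M² + P.
        power≤ : P ≤ M * M + E₂
        power≤ = by-diff ((M * M + P + g - (reduced + reduced)) + ((err - (P - reduced)) + (err - (P - reduced))))
          (0≤+ (diff≥0 half) (0≤+ (diff≥0 r) (diff≥0 r))) (id (M * M) P g reduced err)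
          where
          g = (M + ι p) * (ι 8 * (R * δ))
          r : P - reduced ≤ err
          r = ≤-trans ≤∣ P - reduced ∣ reduction
          id : ∀ m P g r e → m + (g + (e + e)) ≡ P + ((m + P + g - (r + r)) + ((e - (P - r)) + (e - (P - r))))
          id = solve-∀ ℚR

      E : ℚ
      E = Approx.Orthogonality.E p δ Sp (stretch p) (0≤* (0≤ι (4 ℕ.* p)) (0≤ι 4)) big

      E≡ : E ≡ c₁ * δ
      E≡ = id (ι p) δ (stretch p)
        where
        id : ∀ p d s → p * (ι 4 * (ι 4 * (p * d))) + s * (p * d) ≡ (p * (ι 4 * (ι 4 * p)) + s * p) * d
        id = solve-∀ ℚR

      E₂≡ : ∀ d e u d<p → Frequency.E₂ d e u d<p ≡ c₂ * δ
      E₂≡ d e u d<p = id M (ι p) R δ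
        where
        id : ∀ M p R d → (M + p) * (ι 8 * (R * d)) + (p * (1ℚ * (R * (ι 4 * (p * d)) + R * (ι 4 * (p * d)))) + p *
            (1ℚ * (R * (ι 4 * (p * d)) + R * (ι 4 * (p * d))))) ≡
             ((M + p) * (ι 8 * R) + (p * (R * (ι 4 * p) + R * (ι 4 * p)) + p * (R * (ι 4 * p) + R * (ι 4 * p)))) * d
        id = solve-∀ ℚR

      as-< : All (ℕ._< p ℕ.+ p) as
      as-< = All.map (λ a<p → ℕ.<-≤-trans a<p (ℕ.m≤m+n p p)) (elements-< f p)

      pairs-< : ∀ xs ys → All (ℕ._< p) xs → All (ℕ._< p) ys → All (ℕ._< p ℕ.+ p) (pairs xs ys)
      pairs-< []       ys []       hy = []
      pairs-< (x ∷ xs) ys (h ∷ hx) hy = ++⁺ (map⁺ (All.map (ℕ.+-mono-< h) hy)) (pairs-< xs ys hx hy)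

      same-self : ∀ i z → i ℕ.< p → z ℕ.< p → i ≢ z → same i z ≡ 0ℚ
      same-self i z i<p z<p ne with i % p ℕ.≟ z % p
      ... | no _ = refl
      ... | yes eq = ⊥-elim (ne (trans (sym (m<n⇒m%n≡m i<p)) (trans eq (m<n⇒m%n≡m z<p))))

      same-refl : ∀ z → same z z ≡ 1ℚ
      same-refl z with z % p ℕ.≟ z % p
      ... | yes _ = refl
      ... | no ne = ⊥-elim (ne refl)

      multiplicity-as : ∀ z → z ℕ.< p → multiplicity as z ≡ φ f z
      multiplicity-as z z<p = trans (sumL-elements (λ x → same x z) p)
        (trans (∑-single (λ i → φ f i * same i z) z z<p (λ i i<p ne → trans
          (cong (φ f i *_) (same-self i z i<p z<p ne)) (*-zeroʳ (φ f i))))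
          (trans (cong (φ f z *_) (same-refl z)) (*-identityʳ (φ f z))))

      norm-as : ∑ (λ z → multiplicity as z * multiplicity as z) p ≡ ι k
      norm-as = trans (∑-cong p λ z z<p → trans (cong₂ _*_ (multiplicity-as z z<p) (multiplicity-as z z<p))
          (φ-idem f z))
        (trans (∑φ f p) (cong ι k≡))

      ∑P≤ : ∑ (λ d → power d as) p ≤ ι p * K + K * (K * (c₁ * δ))
      ∑P≤ = by-diff (K * (K * (c₁ * δ)) - (∑P - ι p * K)) (diff≥0 (≤-trans ≤∣ ∑P - ι p * K ∣ bound))
          (id ∑P (ι p * K) (K * (K * (c₁ * δ))))
        where
        ∑P = ∑ (λ d → power d as) p
        id : ∀ a b e → b + e ≡ a + (e - (a - b))
        id = solve-∀ ℚR
        bound : ∣ ∑P - ι p * K ∣ ≤ K * (K * (c₁ * δ))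
        bound = subst₂ (λ u v → ∣ ∑P - ι p * u ∣ ≤ v) norm-as (cong₂ (λ a b → a * (a * b)) size-as E≡)
            (parseval as as-<)

      pp : List ℕ
      pp = pairs as as

      Q₂ : ℚ
      Q₂ = ∑ (λ z → multiplicity pp z * multiplicity pp z) p

      size-pp : size pp ≡ K * K
      size-pp = trans (cong ι (length-pairs as as)) (trans (ι-* (length as) (length as))
          (cong₂ _*_ size-as size-as))

      ∑P²≥ : ι p * Q₂ ≤ ∑ (λ d → power d as * power d as) p + K * K * (K * K * (c₁ * δ))
      ∑P²≥ = by-diff (K * K * (K * K * (c₁ * δ)) - (- (∑P² - ι p * Q₂)))
          (diff≥0 (≤-trans -≤∣ ∑P² - ι p * Q₂ ∣ bound))
               (id ∑P² (ι p * Q₂) (K * K * (K * K * (c₁ * δ))))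
        where
        ∑P² = ∑ (λ d → power d as * power d as) p
        id : ∀ a b e → a + e ≡ b + (e - (- (a - b)))
        id = solve-∀ ℚR
        bound : ∣ ∑P² - ι p * Q₂ ∣ ≤ K * K * (K * K * (c₁ * δ))
        bound = subst₂ (λ u v → ∣ u - ι p * Q₂ ∣ ≤ v) (∑-cong p λ d _ → power-pairs d as)
            (cong₂ (λ a b → a * (a * b)) size-pp E≡)
          (parseval pp (pairs-< as as (elements-< f p) (elements-< f p)))

      ∑-multiplicity : ∀ xs → ∑ (multiplicity xs) p ≡ size xs
      ∑-multiplicity []       = ∑-0 p
      ∑-multiplicity (x ∷ xs) = trans (∑-+ (same x) (multiplicity xs) p)
          (trans (cong₂ _+_ one (∑-multiplicity xs)) (+-comm 1ℚ (size xs)))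
        where
        one : ∑ (same x) p ≡ 1ℚ
        one = trans (∑-cong p λ z _ → sym (idem z)) (trans (same-sum x x) (same-refl x))
          where
          idem : ∀ z → same x z * same x z ≡ same x z
          idem z with x % p ℕ.≟ z % p
          ... | yes _ = refl
          ... | no _  = refl

      module Sumset (SA : Pred) (sn : ℕ) (sn≡ : cnt SA p ≡ sn) (1≤sn : 1 ℕ.≤ sn)
                    (closed : ∀ a b → f ∋ a → f ∋ b → SA ∋ (a ℕ.+ b) % p)
                      (unit-of : ∀ d → 1 ℕ.≤ d → d ℕ.< p → ∃[ e ] Unit p d e) where

        pairs-in : ∀ xs ys → All (f ∋_) xs → All (f ∋_) ys → All (λ x → SA ∋ x % p) (pairs xs ys)
        pairs-in []       ys []       hy = []
        pairs-in (x ∷ xs) ys (h ∷ hx) hy = ++⁺ (map⁺ (All.map (closed x _ h) hy)) (pairs-in xs ys hx hy)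

        supported : ∀ xs z → All (λ x → SA ∋ x % p) xs → z ℕ.< p → multiplicity xs z ≡ multiplicity xs z * φ SA z
        supported xs z all z<p with SA z in eq
        ... | true = sym (*-identityʳ (multiplicity xs z))
        ... | false = trans (absent xs all) (sym (*-zeroʳ (multiplicity xs z)))
          where
          differ : ∀ x → SA ∋ x % p → same x z ≡ 0ℚ
          differ x h with x % p ℕ.≟ z % p
          ... | no _ = refl
          ... | yes e = ⊥-elim (Count.∋-∌ SA z (subst (SA ∋_) (trans e (m<n⇒m%n≡m z<p)) h) eq)
          absent : ∀ xs → All (λ x → SA ∋ x % p) xs → multiplicity xs z ≡ 0ℚ
          absent []       []       = refl
          absent (x ∷ xs) (h ∷ hs) = trans (cong₂ _+_ (differ x h) (absent xs hs)) (+-identityˡ 0ℚ)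

        sq : ℚ
        sq = ι sn

        0<sq : 0ℚ < sq
        0<sq = <-≤-trans (≤-<-trans (0≤ι 0) (ι-< 0)) (ι-mono 1≤sn)

        -- Cauchy–Schwarz for the number of representations of a sum.
        energy : K * K * (K * K) ≤ sq * Q₂
        energy = *-cancelˡ-≤-pos sq {{positive 0<sq}} (by-diff (∑ (λ z → t z * t z) p) (nonneg p)
            (trans (id₀ sq Q₂ T) (cong (sq * (T * T) +_) (sym expand))) )
          where
          r : ℕ → ℚ
          r = multiplicity pp
          T : ℚ
          T = K * K
          t : ℕ → ℚ
          t z = sq * r z - T * φ SA z
          nonneg : ∀ n → 0ℚ ≤ ∑ (λ z → t z * t z) n
          nonneg zero    = ≤-refl
          nonneg (suc n) = 0≤+ (nonneg n) (0≤sq (t n))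
          ∑r : ∑ r p ≡ T
          ∑r = trans (∑-multiplicity pp) size-pp
          id₀ : ∀ s q t → s * (s * q) ≡ s * (t * t) + (s * s * q + (- ((t * s + t * s)) * t + t * t * s))
          id₀ = solve-∀ ℚR
          point : ∀ z → z ℕ.< p → t z * t z ≡ sq * sq * (r z * r z) + ((- (T * sq + T * sq)) * r z + T * T * φ SA z)
          point z z<p = trans (id₁ sq (r z) T (φ SA z)) (cong₂
              (λ a b → sq * sq * (r z * r z) + ((- (T * sq + T * sq)) * a + T * T * b))
            (sym (supported pp z (pairs-in as as (elements-∋ f p) (elements-∋ f p)) z<p)) (φ-idem SA z))
            where
            id₁ : ∀ s r t i → (s * r - t * i) * (s * r - t * i) ≡ s * s * (r * r) +
                ((- (t * s + t * s)) * (r * i) + t * t * (i * i))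
            id₁ = solve-∀ ℚR
          expand : ∑ (λ z → t z * t z) p ≡ sq * sq * Q₂ + ((- (T * sq + T * sq)) * T + T * T * sq)
          expand = trans (∑-cong p point) (trans (∑-+ (λ z → sq * sq * (r z * r z))
              (λ z → (- (T * sq + T * sq)) * r z + T * T * φ SA z) p)
            (cong₂ _+_ (sym (∑-*ˡ (sq * sq) (λ z → r z * r z) p))
              (trans (∑-+ (λ z → (- (T * sq + T * sq)) * r z) (λ z → T * T * φ SA z) p)
              (cong₂ _+_ (trans (sym (∑-*ˡ (- (T * sq + T * sq)) r p)) (cong ((- (T * sq + T * sq)) *_) ∑r))
                (trans (sym (∑-*ˡ (T * T) (φ SA) p)) (cong (T * T *_) (trans (∑φ SA p) (cong ι sn≡))))))))

        0≤P : ∀ d → 0ℚ ≤ power d as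
        0≤P d = 0≤+ (0≤sq (X d as)) (0≤sq (Y d as))

        P≤ : ∀ d → 1 ℕ.≤ d → d ℕ.< p → power d as ≤ M * M + c₂ * δ
        P≤ d 1≤d d<p = let e , u = unit-of d 1≤d d<p in
          subst (λ z → power d as ≤ M * M + z) (E₂≡ d e u d<p) (Frequency.power≤ d e u d<p)

        peel : ∀ F → ∑ F p ≡ F 0 + ∑ (λ i → F (suc i)) (m ℕ.+ m)
        peel F = trans (cong (∑ F) (sym p≡)) (∑-head F (m ℕ.+ m))

        -- Frequency 0 contributes exactly k⁴. At the others one factor is bounded by `P≤`, and the
        -- other factors sum to the total power minus k².
        fourth : ∑ (λ d → power d as * power d as) p ≤ K * K * (K * K) + (M * M + c₂ * δ) *
            (∑ (λ d → power d as) p - K * K)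
        fourth = ≤-trans (≤-reflexive (trans (peel (λ d → power d as * power d as))
            (cong (λ z → z * z + tail²) p₀)))
          (+-monoʳ-≤ (K * K * (K * K)) (≤-trans (∑-mono (m ℕ.+ m) λ i i< → *-monoʳ-≤-nonNeg (power (suc i) as)
            {{nonNegative (0≤P (suc i))}}
              (P≤ (suc i) (ℕ.s≤s ℕ.z≤n) (ℕ.≤-trans (ℕ.s≤s i<) (ℕ.≤-reflexive p≡))))
            (≤-reflexive (trans (sym (∑-*ˡ (M * M + c₂ * δ) (λ i → power (suc i) as) (m ℕ.+ m)))
              (cong ((M * M + c₂ * δ) *_) tail≡)))))
          where
          tail² = ∑ (λ i → power (suc i) as * power (suc i) as) (m ℕ.+ m)
          p₀ : power 0 as ≡ K * K
          p₀ = trans (power₀ as) (cong₂ _*_ size-as size-as)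
          id : ∀ a b → b ≡ (a + b) - a
          id = solve-∀ ℚR
          tail≡ : ∑ (λ i → power (suc i) as) (m ℕ.+ m) ≡ ∑ (λ d → power d as) p - K * K
          tail≡ = trans (id (K * K) _) (cong (_- K * K) (sym
              (trans (peel (λ d → power d as)) (cong (_+ ∑ (λ i → power (suc i) as) (m ℕ.+ m)) p₀))))

        approximate : δ ≤ 1ℚ → ι p * (K * K * (K * K)) ≤ sq * (K * K * (K * K) + M * M * (ι p * K - K * K)) + δ *
            slope sq
        approximate δ≤1 = begin
          ι p * (K * K * (K * K))                ≤⟨ *-monoʳ (ι p) (0≤ι p) energy ⟩
          ι p * (sq * Q₂)                        ≡⟨ id₁ (ι p) sq Q₂ ⟩
          sq * (ι p * Q₂)                        ≤⟨ *-monoʳ sq (0≤ι sn)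
              (≤-trans ∑P²≥ (+-monoˡ-≤ (K * K * (K * K * (c₁ * δ))) (≤-trans fourth
                                                      (+-monoʳ-≤ (K * K * (K * K)) (*-monoʳ (M * M + c₂ * δ)
                                                        (0≤+ (0≤sq M) (0≤* 0≤c₂ 0≤δ)) (+-monoˡ-≤ (- (K * K))
                                                          ∑P≤)))))) ⟩
          sq * (K * K * (K * K) + (M * M + c₂ * δ) * (ι p * K + K * (K * (c₁ * δ)) - K * K) + K * K *
              (K * K * (c₁ * δ)))
                                                 -- δ² ≤ δ absorbs the quadratic error, so that what
                                                 -- remains is linear in δ, as `limit` demands.
                                                 ≤⟨ by-diff (sq * (c₂ * (K * K) * (c₁ * (δ * (1ℚ - δ)) + δ)))
                                                      (0≤* (0≤ι sn) (0≤* (0≤* 0≤c₂ (0≤sq K)) (0≤+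
                                                        (0≤* 0≤c₁ (0≤* 0≤δ (diff≥0 δ≤1))) 0≤δ)))
                                                      (id₂ sq K (ι p) (M * M) c₁ c₂ δ) ⟩
          sq * (K * K * (K * K) + M * M * (ι p * K - K * K)) + δ * slope sq ∎
          where
          open ≤-Reasoning
          id₁ : ∀ a b c → a * (b * c) ≡ b * (a * c)
          id₁ = solve-∀ ℚR
          id₂ : ∀ s K p M c₁ c₂ d → s * (K * K * (K * K) + M * (p * K - K * K)) + d *
              (s * (K * K * (K * K) * c₁ + (M + c₂) * (K * K * c₁) + c₂ * (p * K))) ≡
                s * (K * K * (K * K) + (M + c₂ * d) * (p * K + K * (K * (c₁ * d)) - K * K) + K * K *
                    (K * K * (c₁ * d)))
                + s * (c₂ * (K * K) * (c₁ * (d * (1ℚ - d)) + d))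
          id₂ = solve-∀ ℚR

    module Conclusion (SA : Pred) (sn : ℕ) (sn≡ : cnt SA p ≡ sn) (1≤sn : 1 ℕ.≤ sn) (3≤p : 3 ℕ.≤ p)
                      (closed : ∀ a b → f ∋ a → f ∋ b → SA ∋ (a ℕ.+ b) % p)
                        (unit-of : ∀ d → 1 ℕ.≤ d → d ℕ.< p → ∃[ e ] Unit p d e) where

      exact : ι p * (K * K * (K * K)) ≤ ι sn * (K * K * (K * K) + M * M * (ι p * K - K * K))
      exact = limit _ _ (slope (ι sn)) (0≤slope (ι sn) (0≤ι sn)) λ δ 0<δ δ≤1 →
        Root.Sumset.approximate (ℕ.≤-trans (ℕ.s≤s ℕ.z≤n) 3≤p) δ 0<δ (nearRoot p 3≤p δ 0<δ) SA sn sn≡ 1≤sn closed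
            unit-of δ≤1

      -- The factor 9 clears both denominators of M² = (μ / 3)², and subtracted terms change sides.
      in-naturals : 9 ℕ.* (p ℕ.* (k ℕ.* k ℕ.* (k ℕ.* k))) ℕ.+ sn ℕ.* (μ ℕ.* μ ℕ.* (k ℕ.* k)) ℕ.≤
                    9 ℕ.* (sn ℕ.* (k ℕ.* k ℕ.* (k ℕ.* k))) ℕ.+ sn ℕ.* (μ ℕ.* μ ℕ.* (p ℕ.* k))
      in-naturals = ι-reflects (subst₂ _≤_ (sym lhs) (sym rhs)
        (by-diff (ι 9 * (ι sn * (K * K * (K * K) + M * M * (ι p * K - K * K)) - ι p * (K * K * (K * K))))
          (0≤* (0≤ι 9) (diff≥0 exact)) (id (ι p) K (ι sn) (ι μ))))
        where
        id : ∀ p k s u → ι 9 * (s * (k * k * (k * k))) + s * (u * u * (p * k)) ≡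
             (ι 9 * (p * (k * k * (k * k))) + s * (u * u * (k * k))) + ι 9 *
               (s * (k * k * (k * k) + (u * ⅓) * (u * ⅓) * (p * k - k * k)) - p * (k * k * (k * k)))
        id = solve-∀ ℚR
        k⁴ : ∀ a → ι (a ℕ.* a ℕ.* (a ℕ.* a)) ≡ ι a * ι a * (ι a * ι a)
        k⁴ a = trans (ι-* (a ℕ.* a) (a ℕ.* a)) (cong₂ _*_ (ι-* a a) (ι-* a a))
        term₁ : ∀ q → ι (9 ℕ.* (q ℕ.* (k ℕ.* k ℕ.* (k ℕ.* k)))) ≡ ι 9 * (ι q * (K * K * (K * K)))
        term₁ q = trans (ι-* 9 (q ℕ.* (k ℕ.* k ℕ.* (k ℕ.* k))))
            (cong (ι 9 *_) (trans (ι-* q (k ℕ.* k ℕ.* (k ℕ.* k))) (cong (ι q *_) (k⁴ k))))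
        term₂ : ∀ a → ι (sn ℕ.* (μ ℕ.* μ ℕ.* (a ℕ.* k))) ≡ ι sn * (ι μ * ι μ * (ι a * K))
        term₂ a = trans (ι-* sn (μ ℕ.* μ ℕ.* (a ℕ.* k))) (cong (ι sn *_)
            (trans (ι-* (μ ℕ.* μ) (a ℕ.* k)) (cong₂ _*_ (ι-* μ μ) (ι-* a k))))
        lhs = trans (ι-+ (9 ℕ.* (p ℕ.* (k ℕ.* k ℕ.* (k ℕ.* k)))) (sn ℕ.* (μ ℕ.* μ ℕ.* (k ℕ.* k))))
            (cong₂ _+_ (term₁ p) (term₂ k))
        rhs = trans (ι-+ (9 ℕ.* (sn ℕ.* (k ℕ.* k ℕ.* (k ℕ.* k)))) (sn ℕ.* (μ ℕ.* μ ℕ.* (p ℕ.* k))))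
            (cong₂ _+_ (term₁ sn) (term₂ p))

-- From a heavy half circle to a short progression containing all of A.

module Rectification where
  open import Data.Nat.Base
  open import Data.Nat.Properties
  open import Data.Nat.DivMod using (_%_; m<n⇒m%n≡m)
  open import Data.Nat.Divisibility using (_∣_)
  open import Data.Nat.Tactic.RingSolver using (solve-∀)
  open import Data.Bool.Base using (true; false; not; _∧_)
  open import Data.Product.Base using (∃-syntax; _×_; _,_; proj₁; proj₂)
  open import Data.Sum.Base using (_⊎_; inj₁; inj₂)
  open import Data.Empty using (⊥; ⊥-elim)
  open LinearArithmetic using (linear; _⊕_; _⊛_; con; suc′; _⩽_; _≺_; _≐_; _≐˘_; _·_⇒_; ⊢_·_; ⊢⊥)
  open import Relation.Nullary using (yes; no)
  open import Relation.Binary.PropositionalEquality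
  open Count
  open TwoSets
  open Freiman
  open Residues

  cnt-not : ∀ P n → cnt P n + cnt (λ i → not (P i)) n ≡ n
  cnt-not P n = trans (sym (∑-+ (λ i → ⟦ P i ⟧) (λ i → ⟦ not (P i) ⟧) n))
    (trans (∑-cong n λ i _ → one (P i)) (trans (∑-const 1 n) (*-identityʳ n)))
    where
    one : ∀ b → ⟦ b ⟧ + ⟦ not b ⟧ ≡ 1
    one true  = refl
    one false = refl

  initial : Pred → ℕ → Pred
  initial P L j = P j ∧ (j ≤ᵇ L)

  initial-intro : ∀ P L j → P ∋ j → j ≤ L → initial P L ∋ j
  initial-intro P L j h le = ∧-intro h (≤ᵇ-true le)

  initial-elim : ∀ P L j → initial P L ∋ j → P ∋ j × j ≤ L
  initial-elim P L j h with a , b ← ∧-true {P j} h = a , ≤ᵇ-≤ {j} b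

  cnt-initial : ∀ P L → cnt (initial P L) (suc L) ≡ cnt P (suc L)
  cnt-initial P L = cnt-cong (suc L) λ j j≤L → trans (cong (P j ∧_) (≤ᵇ-true (≤-pred j≤L))) (∧-true-right (P j))
    where
    ∧-true-right : ∀ b → b ∧ true ≡ b
    ∧-true-right true  = refl
    ∧-true-right false = refl

  private abstract
    too-few : ∀ n s x → s + 4 ≤ 3 * n → 3 * n ≤ x + 3 → x ≤ s → ⊥
    too-few = linear 3 (λ n s x → 1 · s ⊕ con 4 ⩽ 3 ⊛ n ⇒ 1 · 3 ⊛ n ⩽ x ⊕ con 3 ⇒ 1 · x ⩽ s ⇒
        ⊢⊥)

    too-few₂ : ∀ n s x → s + 4 ≤ 3 * n → n + (n + n) ≤ x + 3 → x ≤ s → ⊥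
    too-few₂ = linear 3 (λ n s x → 1 · s ⊕ con 4 ⩽ 3 ⊛ n ⇒ 1 · n ⊕ (n ⊕ n) ⩽ x ⊕ con 3 ⇒
        1 · x ⩽ s ⇒ ⊢⊥)

    2≤n : ∀ n s → s + 4 ≤ 3 * n → 2 ≤ n
    2≤n = linear 2 (λ n s → 1 · s ⊕ con 4 ⩽ 3 ⊛ n ⇒ ⊢ 2 · con 2 ⩽ n)

  module Circle (p m : ℕ) .{{nz : NonZero p}} (p≡ : suc (m + m) ≡ p)
      (unit-of : ∀ d → 1 ≤ d → d < p → ∃[ e ] Unit p d e)
                (f g : Pred) (k s : ℕ) (k≡ : cnt f p ≡ k) (s≡ : cnt g p ≡ s)
                (closed : ∀ i j → f ∋ i % p → f ∋ j % p → g ∋ (i + j) % p) where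

    -- P read along the progression a + d j, which replaces translating and dilating the set.
    along : Pred → ℕ → ℕ → Pred
    along P a d j = P ((a + d * j) % p)

    along-periodic : ∀ P a d → Periodic p (along P a d)
    along-periodic P a d i = cong P (trans (cong (_% p) (regroup a d i p)) (%-kp (a + d * i) d))
      where
      regroup : ∀ a d i p → a + d * (i + p) ≡ a + d * i + d * p
      regroup = solve-∀
      %-kp : ∀ x d → (x + d * p) % p ≡ x % p
      %-kp x d = [m+kn]%n≡m%n x d p
        where open import Data.Nat.DivMod using ([m+kn]%n≡m%n)

    cnt-along : ∀ P a d e → Unit p d e → cnt (along P a d) p ≡ cnt P p
    cnt-along P a d e u = begin
      cnt (along P a d) p                          ≡⟨ cnt-cong p (λ j _ → cong P (sym (%-+ʳ p a (d * j)))) ⟩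
      cnt (λ j → P ((a + (d * j) % p) % p)) p      ≡⟨ cnt-dilate p (λ i → P ((a + i) % p)) u ⟩
      cnt (shift a (λ i → P (i % p))) p            ≡⟨ cnt-period p (λ i → P (i % p)) (periodic-% p P) a ⟩
      cnt (λ i → P (i % p)) p                      ≡⟨ cnt-cong p (λ i i<p → cong P (m<n⇒m%n≡m i<p)) ⟩
      cnt P p                                      ∎
      where open ≡-Reasoning

    along-sum : ∀ a d i j → along f a d ∋ i → along f a d ∋ j → along g (a + a) d ∋ i + j
    along-sum a d i j hi hj = subst (λ z → g ∋ z % p) (regroup a d i j) (closed (a + d * i) (a + d * j) hi hj)
      where
      regroup : ∀ a d i j → (a + d * i) + (a + d * j) ≡ a + a + d * (i + j)
      regroup = solve-∀

    along-shift : ∀ P a d u j → along P (a + d * u) d j ≡ along P a d (u + j)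
    along-shift P a d u j = cong (λ z → P (z % p)) (regroup a d u j)
      where
      regroup : ∀ a d u j → a + d * u + d * j ≡ a + d * (u + j)
      regroup = solve-∀

    along-scale : ∀ P a d e j → along P a (d * e) j ≡ along P a d (e * j)
    along-scale P a d e j = cong (λ z → P ((a + z) % p)) (*-assoc d e j)

    unit-* : ∀ {d d' e e'} → Unit p d d' → Unit p e e' → Unit p (d * e) (d' * e')
    unit-* {d} {d'} {e} {e'} u v = record { de = begin
      (d * e * (d' * e')) % p        ≡⟨ cong (_% p) (regroup d e d' e') ⟩
      (d * d' * (e * e')) % p        ≡⟨ %-*ˡ p (d * d') (e * e') ⟨
      ((d * d') % p * (e * e')) % p  ≡⟨ cong (λ z → (z * (e * e')) % p) (Unit.de u) ⟩
      (1 % p * (e * e')) % p         ≡⟨ %-*ˡ p 1 (e * e') ⟩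
      (1 * (e * e')) % p             ≡⟨ cong (_% p) (*-identityˡ (e * e')) ⟩
      (e * e') % p                   ≡⟨ Unit.de v ⟩
      1 % p                          ∎ }
      where
      open ≡-Reasoning
      regroup : ∀ a b c d → a * b * (c * d) ≡ a * c * (b * d)
      regroup = solve-∀

    -- n points of f on the progression a + d [0 , ℓ], and 2n - 1 consecutive terms (run) of a progression with
    -- the same difference inside g ⊇ f + f.
    record Config (n : ℕ) : Set where
      field
        a d d⁻¹ : ℕ
        unit    : Unit p d d⁻¹
        ℓ       : ℕ
        count   : cnt (along f a d) (suc ℓ) ≡ n
        0∈      : along f a d ∋ 0
        ℓ∈      : along f a d ∋ ℓ
        short   : ℓ + 3 ≤ n + n
        size    : ℓ + n ≤ s
        2ℓ<p    : suc (ℓ + ℓ) ≤ p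
        θ       : ℕ
        run     : ∀ i → suc i < n + n → along g (a + a) d ∋ θ + i

    module _ (a d d⁻¹ : ℕ) (unit : Unit p d d⁻¹) (P : Pred) (L : ℕ) (P⊆ : ∀ i → P ∋ i → along f a d ∋ i)
        (P≤L : Supp P L)
             (2L<p : suc (L + L) ≤ p) where

      sums : ∀ z → P ⊹ P ∋ z → along g (a + a) d ∋ z
      sums z h with x , y , refl , hx , hy ← ⊹-elim P P z h = along-sum a d x y (P⊆ x hx) (P⊆ y hy)

      cnt-sums : cnt (P ⊹ P) (suc (L + L)) ≤ s
      cnt-sums = begin
        cnt (P ⊹ P) (suc (L + L))           ≤⟨ ∑-monoʳ _ 2L<p ⟩
        cnt (P ⊹ P) p                       ≤⟨ cnt-mono p (λ z _ → sums z) ⟩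
        cnt (along g (a + a) d) p           ≡⟨ cnt-along g (a + a) d d⁻¹ unit ⟩
        cnt g p                             ≡⟨ s≡ ⟩
        s                                   ∎
        where open ≤-Reasoning

    module Densify (a d d⁻¹ : ℕ) (unit : Unit p d d⁻¹) (n : ℕ) (n≡ : cnt (along f a d) (suc m) ≡ n)
        (large : s + 4 ≤ 3 * n) where
      H : Pred
      H = along f a d

      -- `large-or-interval` for W + W: the large alternative gives 3n ≤ |W + W| + 3 ≤ s + 3,
      -- against s + 4 ≤ 3n. The bound 2ℓ < p makes integer sums distinct modulo p.
      normalised : ∀ a' d' d'⁻¹ → Unit p d' d'⁻¹ → ∀ ℓ → suc (ℓ + ℓ) ≤ p → along f a' d' ∋ 0 → along f a' d' ∋ ℓ →
                   cnt (along f a' d') (suc ℓ) ≡ n → ℓ + 3 ≤ n + n → Config n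
      normalised a' d' d'⁻¹ unit' ℓ 2ℓ<p 0∈ ℓ∈ count short = from large-or-interval
        where
        H' W : Pred
        H' = along f a' d'
        W = initial H' ℓ
        W≤ : Supp W ℓ
        W≤ i h = proj₂ (initial-elim H' ℓ i h)
        W-count : cnt W (suc ℓ) ≡ n
        W-count = trans (cnt-initial H' ℓ) count
        open Sumset W W ℓ W≤ W≤
        open Dense (initial-intro H' ℓ 0 0∈ z≤n) (initial-intro H' ℓ ℓ ℓ∈ ≤-refl)
            (subst (λ z → ℓ + 3 ≤ z + z) (sym W-count) short)
        few : cnt (W ⊹ W) (suc (ℓ + ℓ)) ≤ s
        few = cnt-sums a' d' d'⁻¹ unit' W ℓ (λ i h → proj₁ (initial-elim H' ℓ i h)) W≤ 2ℓ<p
        from : Large ⊎ Interval → Config n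
        from (inj₁ l) = ⊥-elim (too-few₂ n s (cnt (W ⊹ W) (suc (ℓ + ℓ))) large
            (subst (λ z → z + (z + z) ≤ cnt (W ⊹ W) (suc (ℓ + ℓ)) + 3) W-count l) few)
        from (inj₂ (θ , _ , run)) = record
          { a = a' ; d = d' ; d⁻¹ = d'⁻¹ ; unit = unit' ; ℓ = ℓ ; count = count ; 0∈ = 0∈ ; ℓ∈ = ℓ∈ ; short = short
          ; size = ≤-trans (subst (λ z → ℓ + z ≤ cnt (W ⊹ W) (suc (ℓ + ℓ))) W-count sumset-size) few
          ; 2ℓ<p = 2ℓ<p ; θ = θ
          ; run = λ i i< → sums a' d' d'⁻¹ unit' W ℓ (λ i h → proj₁ (initial-elim H' ℓ i h)) W≤ 2ℓ<p (θ + i)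
                    (run i (subst (λ z → suc i < z + z) (sym W-count) i<)) }

      -- The points on the half circle are trimmed to run from the first to the last of them, since
      -- `freiman` requires both ends. L ≤ m keeps 2L below p.
      module Hull (u L : ℕ) (u+L≤m : u + L ≤ m) (u∈ : H ∋ u) (L∈ : H ∋ u + L) (below : ∀ j → j < u → H ∌ j)
                  (above : ∀ j → u + L < j → j < suc m → H ∌ j) where
        a' = a + d * u
        W : Pred
        W = initial (along f a' d) L
        L≤m : L ≤ m
        L≤m = ≤-trans (m≤n+m L u) u+L≤m
        2L<p : suc (L + L) ≤ p
        2L<p = ≤-trans (s≤s (+-mono-≤ L≤m L≤m)) (≤-reflexive p≡)
        W≤ : Supp W L
        W≤ i h = proj₂ (initial-elim (along f a' d) L i h)
        0∈' : along f a' d ∋ 0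
        0∈' = trans (along-shift f a d u 0) (trans (cong H (+-identityʳ u)) u∈)
        L∈' : along f a' d ∋ L
        L∈' = trans (along-shift f a d u L) L∈
        count : cnt W (suc L) ≡ n
        count = begin
          cnt W (suc L)                            ≡⟨ cnt-initial (along f a' d) L ⟩
          cnt (along f a' d) (suc L)               ≡⟨ cnt-cong (suc L) (λ j _ → along-shift f a d u j) ⟩
          cnt (shift u H) (suc L)                  ≡⟨ cong (_+ cnt (shift u H) (suc L)) (cnt-empty H u below) ⟨
          cnt H u + cnt (shift u H) (suc L)        ≡⟨ cnt-split H u (suc L) ⟨
          cnt H (u + suc L)                        ≡⟨ cnt-stop H (u + suc L) (suc m)
              (≤-trans (≤-reflexive (+-suc u L)) (s≤s u+L≤m))
                                                        (λ j le lt → above j (≤-trans (≤-reflexive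
                                                          (sym (+-suc u L))) le) lt) ⟨
          cnt H (suc m)                            ≡⟨ n≡ ⟩
          n                                        ∎
          where open ≡-Reasoning

        few : cnt (W ⊹ W) (suc (L + L)) ≤ s
        few = cnt-sums a' d d⁻¹ unit W L (λ i h → proj₁ (initial-elim (along f a' d) L i h)) W≤ 2L<p

        1≤L : 1 ≤ L
        1≤L = n≢0⇒n>0 λ L≡0 → <⇒≱ (2≤n n s large) (≤-trans (≤-reflexive (sym count))
            (subst (λ z → cnt W (suc z) ≤ 1) (sym L≡0) (cnt≤ W 1)))

        config : Config n
        config = from (freiman L W W≤ (initial-intro (along f a' d) L 0 0∈' z≤n)
            (initial-intro (along f a' d) L L L∈' ≤-refl))
          where
          from : Outcome W L → Config n
          from (inj₁ sat) = ⊥-elim (too-few n s (cnt (W ⊹ W) (suc (L + L))) large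
              (subst (λ z → 3 * z ≤ cnt (W ⊹ W) (suc (L + L)) + 3) count sat) few)
          from (inj₂ (e , ℓ , L≡ , e∣W , short)) = scaled e ℓ L≡ e∣W (1≤e e L≡) (1≤ℓ ℓ L≡)
              (subst (λ z → ℓ + 3 ≤ z + z) count short)
            where
            1≤e : ∀ e → L ≡ e * ℓ → 1 ≤ e
            1≤e zero    eq = ⊥-elim (<⇒≢ 1≤L (sym eq))
            1≤e (suc e) eq = s≤s z≤n
            1≤ℓ : ∀ ℓ → L ≡ e * ℓ → 1 ≤ ℓ
            1≤ℓ zero    eq = ⊥-elim (<⇒≢ 1≤L (sym (trans eq (*-zeroʳ e))))
            1≤ℓ (suc ℓ) eq = s≤s z≤n
            -- The common divisor e of W is absorbed into the difference of the progression; d e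
            -- stays invertible because 1 ≤ e ≤ L < p.
            scaled : ∀ e ℓ → L ≡ e * ℓ → (∀ x → W ∋ x → e ∣ x) → 1 ≤ e → 1 ≤ ℓ → ℓ + 3 ≤ n + n → Config n
            scaled e ℓ L≡ e∣W 1≤e 1≤ℓ short =
              normalised a' (d * e) (d⁻¹ * e⁻¹) (unit-* unit (proj₂ (unit-of e 1≤e e<p))) ℓ
                (≤-trans (s≤s (+-mono-≤ ℓ≤L ℓ≤L)) 2L<p)
                (trans (along-scale f a' d e 0) (trans (cong (along f a' d) (*-zeroʳ e)) 0∈'))
                (trans (along-scale f a' d e ℓ) (trans (cong (along f a' d) (sym L≡)) L∈'))
                (begin
                  cnt (along f a' (d * e)) (suc ℓ)      ≡⟨ cnt-cong (suc ℓ)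
                      (λ j j≤ → trans (along-scale f a' d e j) (sym (in-W j (≤-pred j≤)))) ⟩
                  cnt (λ i → W (e * i)) (suc ℓ)         ≡⟨ cnt-multiples-suc W e 1≤e e∣W ℓ ⟨
                  cnt W (suc (e * ℓ))                   ≡⟨ cong (λ z → cnt W (suc z)) L≡ ⟨
                  cnt W (suc L)                         ≡⟨ count ⟩
                  n                                     ∎) short
              where
              open ≡-Reasoning
              ℓ≤L : ℓ ≤ L
              ℓ≤L = ≤-trans (m≤n*m ℓ e {{>-nonZero 1≤e}}) (≤-reflexive (sym L≡))
              e≤L : e ≤ L
              e≤L = ≤-trans (m≤m*n e ℓ {{>-nonZero 1≤ℓ}}) (≤-reflexive (sym L≡))
              e<p : e < p
              e<p = ≤-trans (s≤s (≤-trans e≤L (m≤m+n L L))) 2L<p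
              e⁻¹ = proj₁ (unit-of e 1≤e e<p)
              in-W : ∀ j → j ≤ ℓ → W (e * j) ≡ along f a' d (e * j)
              in-W j j≤ℓ = trans (cong (along f a' d (e * j) ∧_)
                  (≤ᵇ-true (≤-trans (*-monoʳ-≤ e j≤ℓ) (≤-reflexive (sym L≡))))) (right (along f a' d (e * j)))
                where
                right : ∀ b → b ∧ true ≡ b
                right true  = refl
                right false = refl

      densify : Config n
      densify with first H (suc m) | last H (suc m)
      ... | inj₂ none | _ = ⊥-elim (<⇒≱ (≤-trans (s≤s z≤n) (2≤n n s large))
          (≤-reflexive (trans (sym n≡) (cnt-empty H (suc m) none))))
      ... | inj₁ _ | inj₂ none = ⊥-elim (<⇒≱ (≤-trans (s≤s z≤n) (2≤n n s large))
          (≤-reflexive (trans (sym n≡) (cnt-empty H (suc m) none))))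
      ... | inj₁ (u , u<m , u∈ , below) | inj₁ (v , v<m , v∈ , above) with u ≤? v
      ...   | no u≰v = ⊥-elim (∋-∌ H u u∈ (above u (≰⇒> u≰v) u<m))
      ...   | yes u≤v with L , refl ← m≤n⇒∃[o]m+o≡n u≤v = Hull.config u L (≤-pred v<m) u∈ v∈ below above

    private abstract
      b-bound : ∀ b y x n p → y + b ≡ x → x < p → n + n ≤ suc y → b + n + n ≤ p
      b-bound = linear 5 (λ b y x n p → 1 · y ⊕ b ≐ x ⇒ 1 · x ≺ p ⇒ 1 · n ⊕ n ⩽ suc′ y ⇒
          ⊢ 0 · b ⊕ n ⊕ n ⩽ p)

      dense₁ : ∀ b n c s p → b + n + n ≤ p → c + s ≡ p → s + 4 ≤ 3 * n → b + 3 ≤ c + n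
      dense₁ = linear 5 (λ b n c s p → 1 · b ⊕ n ⊕ n ⩽ p ⇒ 1 · c ⊕ s ≐˘ p ⇒
          1 · s ⊕ con 4 ⩽ 3 ⊛ n ⇒ ⊢ 0 · b ⊕ con 3 ⩽ c ⊕ n)

      dense₂ : ∀ l n c s p → l + n ≤ s → c + s ≡ p → s + 4 ≤ 3 * n → 4 * s ≤ 3 * p → l + 3 ≤ n + c
      dense₂ = linear 5 (λ l n c s p → 3 · l ⊕ n ⩽ s ⇒ 3 · c ⊕ s ≐˘ p ⇒ 2 · s ⊕ con 4 ⩽ 3 ⊛ n ⇒
          1 · 4 ⊛ s ⩽ 3 ⊛ p ⇒ ⊢ 2 · l ⊕ con 3 ⩽ n ⊕ c)

      fits : ∀ b n l p → b + n + n ≤ p → l + 3 ≤ n + n → b + l < p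
      fits = linear 4 (λ b n l p → 1 · b ⊕ n ⊕ n ⩽ p ⇒ 1 · l ⊕ con 3 ⩽ n ⊕ n ⇒ ⊢ 0 · b ⊕ l ≺ p)

      large₁ : ∀ n c s p k x → n + (c + n) ≤ x + 3 → x + k ≤ p → c + s ≡ p → n < k →
               s + 4 ≤ 3 * n → ⊥
      large₁ = linear 6 (λ n c s p k x → 1 · n ⊕ (c ⊕ n) ⩽ x ⊕ con 3 ⇒ 1 · x ⊕ k ⩽ p ⇒
          1 · c ⊕ s ≐˘ p ⇒ 1 · n ≺ k ⇒ 1 · s ⊕ con 4 ⩽ 3 ⊛ n ⇒ ⊢⊥)

      large₂ : ∀ n c s p k x → c + (n + c) ≤ x + 3 → x + k ≤ p → c + s ≡ p → n < k →
               s + 4 ≤ 3 * n → 4 * s ≤ 3 * p → ⊥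
      large₂ = linear 6 (λ n c s p k x → 3 · c ⊕ (n ⊕ c) ⩽ x ⊕ con 3 ⇒ 3 · x ⊕ k ⩽ p ⇒
          6 · c ⊕ s ≐˘ p ⇒ 3 · n ≺ k ⇒ 2 · s ⊕ con 4 ⩽ 3 ⊛ n ⇒ 1 · 4 ⊛ s ⩽ 3 ⊛ p ⇒ ⊢⊥)

      tail₁ : ∀ i t m p c s n → suc (i + t) ≡ p → suc m ≤ t → c + s ≡ p → c + n ≤ suc i →
              n + m + 1 ≤ s
      tail₁ = linear 7 (λ i t m p c s n → 1 · suc′ (i ⊕ t) ≐ p ⇒ 1 · suc′ m ⩽ t ⇒ 1 · c ⊕ s ≐˘ p ⇒
          1 · c ⊕ n ⩽ suc′ i ⇒ ⊢ 0 · n ⊕ m ⊕ con 1 ⩽ s)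

      tail₂ : ∀ m p s n → n + m + 1 ≤ s → s + 4 ≤ 3 * n → 4 * s ≤ 3 * p → suc (m + m) ≡ p → ⊥
      tail₂ = linear 4 (λ m p s n → 6 · n ⊕ m ⊕ con 1 ⩽ s ⇒ 2 · s ⊕ con 4 ⩽ 3 ⊛ n ⇒
          1 · 4 ⊛ s ⩽ 3 ⊛ p ⇒ 3 · suc′ (m ⊕ m) ≐˘ p ⇒ ⊢⊥)

      p≰s : ∀ s p → p ≤ s → 4 * s ≤ 3 * p → 1 ≤ p → ⊥
      p≰s = linear 2 (λ s p → 4 · p ⩽ s ⇒ 1 · 4 ⊛ s ⩽ 3 ⊛ p ⇒ 1 · con 1 ⩽ p ⇒ ⊢⊥)

      big-k : ∀ s n k → s + 4 ≤ 3 * n → n < k → s + 4 ≤ 3 * k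
      big-k = linear 3 (λ s n k → 1 · s ⊕ con 4 ⩽ 3 ⊛ n ⇒ 3 · n ≺ k ⇒ ⊢ 0 · s ⊕ con 4 ⩽ 3 ⊛ k)

    -- If c ∉ A + A and a ∈ A then c - a ∉ A, so a long interval in C - A, for C the complement of A + A,
    -- confines A to a short arc.
    module Complement (n : ℕ) (cfg : Config n) (large : s + 4 ≤ 3 * n) (n<k : n < k) (4s≤3p : 4 * s ≤ 3 * p) where
      open Config cfg

      H G N W : Pred
      H = along f a d
      G = shift θ (along g (a + a) d)
      N t = not (G t)
      W = initial H ℓ

      H-periodic : Periodic p H
      H-periodic = along-periodic f a d

      G-periodic : Periodic p G
      G-periodic = periodic-shift p (along g (a + a) d) θ (along-periodic g (a + a) d)

      1≤p : 1 ≤ p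
      1≤p = ≤-trans (s≤s z≤n) (≤-reflexive p≡)

      cnt-G : cnt G p ≡ s
      cnt-G = trans (cnt-period p _ (along-periodic g (a + a) d) θ) (trans (cnt-along g (a + a) d d⁻¹ unit) s≡)

      cnt-H : ∀ v → cnt (shift v H) p ≡ k
      cnt-H v = trans (cnt-period p H H-periodic v) (trans (cnt-along f a d d⁻¹ unit) k≡)

      -- Coordinates are such that the known run of sums starts at 0. Between the first missing
      -- position y ≥ 2n - 1 and the last one y + b < p lies the whole complement C.
      module Bounds (y b : ℕ) (x<p : y + b < p) (y∉ : N ∋ y) (x∉ : N ∋ y + b) (before : ∀ t → t < y → N ∌ t)
                    (after : ∀ t → y + b < t → t < p → N ∌ t) where
        x : ℕ
        x = y + b

        2n≤ : n + n ≤ suc y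
        2n≤ = ≮⇒≥ λ lt → ∋-∌ G y (run y lt) (not-true y∉)

        b≤ : b + n + n ≤ p
        b≤ = b-bound b y x n p refl x<p 2n≤

        -- C reflected by c ↦ x - c. The difference c - j turns into x - (i + j) with i = x - c, so
        -- a theorem on sums applies to C - A.
        C* : Pred
        C* = flip-at b (shift y N)

        nC : ℕ
        nC = cnt C* (suc b)

        C*≤ : Supp C* b
        C*≤ = flip-supp b (shift y N)

        nC+s : nC + s ≡ p
        nC+s = begin
          nC + s                                       ≡⟨ cong (_+ s) (cnt-flip b (shift y N)) ⟩
          cnt (shift y N) (suc b) + s                  ≡⟨ cong (λ z → z + cnt (shift y N) (suc b) + s)
              (cnt-empty N y before) ⟨
          cnt N y + cnt (shift y N) (suc b) + s        ≡⟨ cong (_+ s) (cnt-split N y (suc b)) ⟨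
          cnt N (y + suc b) + s                        ≡⟨ cong (_+ s)
              (cnt-stop N (y + suc b) p (≤-trans (≤-reflexive (+-suc y b)) x<p)
                                                            (λ t le → after t (≤-trans (≤-reflexive (sym
                                                              (+-suc y b))) le))) ⟨
          cnt N p + s                                  ≡⟨ +-comm (cnt N p) s ⟩
          s + cnt N p                                  ≡⟨ cong (_+ cnt N p) cnt-G ⟨
          cnt G p + cnt N p                            ≡⟨ cnt-not G p ⟩
          p                                            ∎
          where open ≡-Reasoning

        -- If θ + x - (i + j) were in A, adding the element j of A would give the missing θ + x - i.
        -- The number w = p - (i + j) replaces the negative summand.
        avoid : ∀ i j w → C* ∋ i → W ∋ j → w + (i + j) ≡ p → H ∌ θ + x + w
        avoid i j w ci wj eq with t , et , nt ← flip-elim b (shift y N) i ci = not-∋ H (θ + x + w) λ h →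
          ∋-∌ G (y + t) (trans (sym (G-periodic (y + t)))
            (subst (along g (a + a) d ∋_) (position θ y t i w j p et eq)
              (along-sum a d (θ + x + w) j h (proj₁ (initial-elim H ℓ j wj))))) (not-true nt)
          where
          regroup : ∀ θ y t i w j → θ + (y + (t + i)) + w + j ≡ θ + (y + t + (w + (i + j)))
          regroup = solve-∀
          position : ∀ θ y t i w j p → t + i ≡ b → w + (i + j) ≡ p → θ + (y + b) + w + j ≡ θ + (y + t + p)
          position θ y t i w j p refl refl = regroup θ y t i w j

        Avoiding : Pred → Set
        Avoiding T = ∀ z → T ∋ z → z < p × H ∌ θ + x + (p ∸ z)

        avoid-sum : ∀ i j → C* ∋ i → W ∋ j → i + j < p × H ∌ θ + x + (p ∸ (i + j))
        avoid-sum i j ci wj = lt , avoid i j (p ∸ (i + j)) ci wj (m∸n+n≡m (<⇒≤ lt))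
          where
          lt : i + j < p
          lt = ≤-<-trans (+-mono-≤ (C*≤ i ci) (proj₂ (initial-elim H ℓ j wj))) (fits b n ℓ p b≤ short)

        -- Modulo p the map z ↦ θ + x - z is injective and sends T into the complement of A.
        few : ∀ T → Avoiding T → ∀ M → cnt T M + k ≤ p
        few T av M = begin
          cnt T M + k                                        ≤⟨ +-monoˡ-≤ k restrict ⟩
          cnt T p + k                                        ≤⟨ +-monoˡ-≤ k
              (cnt-mono p λ z z<p h → missing z z<p (proj₂ (av z h))) ⟩
          cnt (λ z → not (shift (θ + x + 1) H (p ∸ suc z))) p + k  ≡⟨ cong₂ _+_
              (∑-rev (λ j → ⟦ not (shift (θ + x + 1) H j) ⟧) p) (sym (cnt-H (θ + x + 1))) ⟩
          cnt (λ j → not (shift (θ + x + 1) H j)) p + cnt (shift (θ + x + 1) H) p ≡⟨ +-comm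
              (cnt (λ j → not (shift (θ + x + 1) H j)) p) _ ⟩
          cnt (shift (θ + x + 1) H) p + cnt (λ j → not (shift (θ + x + 1) H j)) p ≡⟨ cnt-not (shift (θ + x + 1) H) p
              ⟩
          p                                                  ∎
          where
          open ≤-Reasoning
          restrict : cnt T M ≤ cnt T p
          restrict with ≤-total M p
          ... | inj₁ M≤p = ∑-monoʳ _ M≤p
          ... | inj₂ p≤M = ≤-reflexive (cnt-stop T p M p≤M λ i p≤i _ → not-∋ T i λ h → <⇒≱ (proj₁ (av i h)) p≤i)
          missing : ∀ z → z < p → H ∌ θ + x + (p ∸ z) → not (shift (θ + x + 1) H (p ∸ suc z)) ≡ true
          missing z z<p h = cong not (trans (cong H (trans (+-assoc (θ + x) 1 (p ∸ suc z))
              (cong (θ + x +_) (sym (step z z<p))))) h)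
            where
            step : ∀ z → z < p → p ∸ z ≡ suc (p ∸ suc z)
            step z z<p = ∸-suc z<p
              where
              ∸-suc : ∀ {z q} → z < q → q ∸ z ≡ suc (q ∸ suc z)
              ∸-suc {zero}  {suc q} _ = refl
              ∸-suc {suc z} {suc q} h = ∸-suc {z} {q} (≤-pred h)

        -- The run in T excludes nC + n - 1 consecutive positions, and the other s - n + 1 fit into
        -- m + 1 by `tail₁` and `tail₂`. Since the reflection reverses the order, v is the position
        -- just past the image of ψ, and from there one half circle holds all of A.
        confine : ∀ T → Avoiding T → ∀ ψ → (∀ i → suc i < nC + n → T ∋ ψ + i) → Config k
        confine T av ψ run' = Densify.densify (a + d * v) d d⁻¹ unit k refound (big-k s n k large n<k)
          where
          v = suc (θ + x + (p ∸ ψ))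
          gone : ∀ t → suc m ≤ t → t < p → shift v H ∌ t
          gone t m<t t<p with i , eq ← m≤n⇒∃[o]m+o≡n t<p = trans (cong H (place))
              (trans (H-periodic _) (proj₂ here))
            where
            here : ψ + i < p × H ∌ θ + x + (p ∸ (ψ + i))
            here = av (ψ + i) (run' i (≰⇒> λ le → tail₂ m p s n
                (tail₁ i t m p nC s n (trans (cong suc (+-comm i t)) eq) m<t nC+s le) large 4s≤3p p≡))
            regroup : ∀ A w i t → suc (A + (w + i)) + t ≡ A + w + suc (t + i)
            regroup = solve-∀
            place : v + t ≡ θ + x + (p ∸ (ψ + i)) + p
            place = trans (cong (λ z → suc (θ + x + z) + t) split)
                (trans (regroup (θ + x) (p ∸ (ψ + i)) i t) (cong (θ + x + (p ∸ (ψ + i)) +_) eq))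
              where
              split : p ∸ ψ ≡ (p ∸ (ψ + i)) + i
              split = trans (sym (m∸n+n≡m (≤-trans i≤ ≤-refl))) (cong (_+ i) (∸-+-assoc p ψ i))
                where
                i≤ : i ≤ p ∸ ψ
                i≤ = ≤-trans (≤-reflexive (sym (m+n∸m≡n ψ i))) (∸-monoˡ-≤ ψ (<⇒≤ (proj₁ here)))
          refound : cnt (along f (a + d * v) d) (suc m) ≡ k
          refound = begin
            cnt (along f (a + d * v) d) (suc m)      ≡⟨ cnt-cong (suc m) (λ j _ → along-shift f a d v j) ⟩
            cnt (shift v H) (suc m)                  ≡⟨ cnt-stop (shift v H) (suc m) p
                (≤-trans (s≤s (m≤m+n m m)) (≤-reflexive p≡)) gone ⟨
            cnt (shift v H) p                        ≡⟨ cnt-H v ⟩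
            k                                        ∎
            where open ≡-Reasoning

        W≤ : Supp W ℓ
        W≤ i h = proj₂ (initial-elim H ℓ i h)

        W-count : cnt W (suc ℓ) ≡ n
        W-count = trans (cnt-initial H ℓ) count

        0∈C : C* ∋ 0
        0∈C = flip-intro b (shift y N) b 0 (+-identityʳ b) x∉

        b∈C : C* ∋ b
        b∈C = flip-intro b (shift y N) 0 b refl (trans (cong N (+-identityʳ y)) y∉)

        grown : ∀ P u v → Supp P u → u ≤ v → cnt P (suc v) ≡ cnt P (suc u)
        grown P u v P≤ u≤v = cnt-stop P (suc u) (suc v) (s≤s u≤v) λ i u<i _ → not-∋ P i λ h → <⇒≱ u<i (P≤ i h)

        -- `Dense` requires the first set to contain both ends of the common interval, so the longer
        -- of `C*` and `W` goes first. In the large alternative too many residues would miss A,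
        -- against `few`.
        config : Config k
        config with ≤-total ℓ b
        ... | inj₁ ℓ≤b = from large-or-interval
          where
          wn : cnt W (suc b) ≡ n
          wn = trans (grown W ℓ b W≤ ℓ≤b) W-count
          open Sumset C* W b C*≤ (λ i h → ≤-trans (W≤ i h) ℓ≤b)
          open Dense 0∈C b∈C (subst (λ z → b + 3 ≤ nC + z) (sym wn) (dense₁ b n nC s p b≤ nC+s large))
          av : Avoiding (C* ⊹ W)
          av z h with i , j , refl , ci , wj ← ⊹-elim C* W z h = avoid-sum i j ci wj
          from : Large ⊎ Interval → Config k
          from (inj₁ l) = ⊥-elim (large₁ n nC s p k (cnt (C* ⊹ W) (suc (b + b)))
            (subst (λ z → z + (nC + z) ≤ cnt (C* ⊹ W) (suc (b + b)) + 3) wn l) (few (C* ⊹ W) av (suc (b + b))) nC+s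
              n<k large)
          from (inj₂ (ψ , _ , r)) = confine (C* ⊹ W) av ψ λ i lt → r i (subst (λ z → suc i < nC + z) (sym wn) lt)
        ... | inj₂ b≤ℓ = from large-or-interval
          where
          cn : cnt C* (suc ℓ) ≡ nC
          cn = grown C* b ℓ C*≤ b≤ℓ
          open Sumset W C* ℓ W≤ (λ i h → ≤-trans (C*≤ i h) b≤ℓ)
          open Dense (initial-intro H ℓ 0 0∈ z≤n) (initial-intro H ℓ ℓ ℓ∈ ≤-refl)
            (subst₂ (λ u v → ℓ + 3 ≤ u + v) (sym W-count) (sym cn) (dense₂ ℓ n nC s p size nC+s large 4s≤3p))
          av : Avoiding (W ⊹ C*)
          av z h with j , i , refl , wj , ci ← ⊹-elim W C* z h =
            subst (λ z → z < p × H ∌ θ + x + (p ∸ z)) (+-comm i j) (avoid-sum i j ci wj)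
          from : Large ⊎ Interval → Config k
          from (inj₁ l) = ⊥-elim (large₂ n nC s p k (cnt (W ⊹ C*) (suc (ℓ + ℓ)))
            (subst₂ (λ u v → v + (u + v) ≤ cnt (W ⊹ C*) (suc (ℓ + ℓ)) + 3) W-count cn l)
              (few (W ⊹ C*) av (suc (ℓ + ℓ))) nC+s n<k large 4s≤3p)
          from (inj₂ (ψ , _ , r)) = confine (W ⊹ C*) av ψ λ i lt → r i
            (subst₂ (λ u v → suc i < u + v) (sym W-count) (sym cn) (≤-trans lt (≤-reflexive (+-comm nC n))))

      complete : Config k
      complete with first N p | last N p
      ... | inj₂ none | _ = ⊥-elim (<⇒≢ (≰⇒> λ p≤s → p≰s s p p≤s 4s≤3p 1≤p)
          (trans (sym cnt-G) (cnt-full G p λ i i<p → not-false (none i i<p))))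
      ... | inj₁ _ | inj₂ none = ⊥-elim (<⇒≢ (≰⇒> λ p≤s → p≰s s p p≤s 4s≤3p 1≤p)
          (trans (sym cnt-G) (cnt-full G p λ i i<p → not-false (none i i<p))))
      ... | inj₁ (y , y<p , y∉ , before) | inj₁ (x , x<p , x∉ , after) with y ≤? x
      ...   | no y≰x = ⊥-elim (∋-∌ N y y∉ (after y (≰⇒> y≰x) y<p))
      ...   | yes y≤x with b , refl ← m≤n⇒∃[o]m+o≡n y≤x = Bounds.config y b x<p y∉ x∉ before after

    -- Either the heavy half circle already contains all of A, or n < k and the complement argument
    -- enlarges it.
    whole : ∀ a d d⁻¹ → Unit p d d⁻¹ → s + 4 ≤ 3 * cnt (along f a d) (suc m) → 4 * s ≤ 3 * p → Config k
    whole a d d⁻¹ u large 4s≤3p with m≤n⇒m<n∨m≡n (≤-trans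
        (∑-monoʳ (λ i → ⟦ along f a d i ⟧) (≤-trans (s≤s (m≤m+n m m)) (≤-reflexive p≡)))
                                                 (≤-reflexive (trans (cnt-along f a d d⁻¹ u) k≡)))
    ... | inj₁ n<k = Complement.complete _ (Densify.densify a d d⁻¹ u _ refl large) large n<k 4s≤3p
    ... | inj₂ n≡k = Densify.densify a d d⁻¹ u k n≡k (subst (λ z → s + 4 ≤ 3 * z) n≡k large)

-- From the real root α to an inequality between integers.

module Cubic where
  open import Defs
  open import Data.Nat.Base as ℕ using (ℕ)
  import Data.Nat.Properties as ℕ
  open import Data.Rational.Base
  open import Data.Rational.Properties
  open import Data.Product.Base using (_,_)
  open import Relation.Binary.PropositionalEquality
  open import Tactic.RingSolver using (solve-∀)
  open Rationals
  open Roots using (/1≡ι)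
  open Fourier using (limit)

  module _ (α : ℝ) (root : fromℕ 4 *ᴿ α ^ᴿ 3 +ᴿ fromℕ 9 *ᴿ α ^ᴿ 2 +ᴿ fromℕ 6 *ᴿ α -ᴿ fromℕ 1 ≃ᴿ fromℕ 0)
           (s k y : ℕ) (small : fromℕ s ≤ᴿ (fromℕ 2 +ᴿ α) *ᴿ fromℕ k -ᴿ fromℕ 3) (s≡ : s ℕ.+ 3 ≡ 2 ℕ.* k ℕ.+ y)
             (1≤y : 1 ℕ.≤ y) where
    private
      K Y : ℚ
      K = ι k
      Y = ι y

      -- The homogeneous cubic: h (a K) = K³ (4a³ + 9a² + 6a).
      h : ℚ → ℚ
      h b = ι 4 * (b * b * b) + ι 9 * (b * b * K) + ι 6 * (b * (K * K))

      slope : ℚ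
      slope = (ι 12 * (Y * Y) + ι 18 * (Y * K) + ι 6 * (K * K)) + K * K * K

      0≤K : 0ℚ ≤ K
      0≤K = 0≤ι k

      0≤Y : 0ℚ ≤ Y
      0≤Y = 0≤ι y

      0≤slope : 0ℚ ≤ slope
      0≤slope = 0≤+ (0≤+ (0≤+ (0≤* (0≤ι 12) (0≤sq Y)) (0≤* (0≤ι 18) (0≤* 0≤Y 0≤K))) (0≤* (0≤ι 6) (0≤sq K)))
          (0≤* (0≤sq K) 0≤K)

      -- Here a is a term of the sequence α. The hypothesis gives Y - ε ≤ a K, h is increasing on
      -- nonnegative arguments, and h (a K) ≤ K³ (1 + ε); `slope` also pays for passing from Y - ε
      -- to Y. The bounds ε ≤ 1 ≤ Y keep Y - ε nonnegative.
      at : ∀ ε → 0ℚ < ε → ε ≤ 1ℚ → ∀ a → ι s < (ι 2 + a) * K - ι 3 + ε →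
           ι 4 * (a * (a * (a * 1ℚ))) + ι 9 * (a * (a * 1ℚ)) + ι 6 * a - 1ℚ - 0ℚ < ε → h Y ≤ K * K * K + ε * slope
      at ε 0<ε ε≤1 a lower upper = begin
        h Y                                                      ≡⟨ cong h Y≡ ⟩
        h (t + ε)                                                ≤⟨ by-diff
            (ι 12 * (t * (ε * ε)) + (ι 8 * (ε * (ε * ε)) + ι 9 * (K * (ε * ε))))
                                                                     (0≤+ (0≤* (0≤ι 12) (0≤* 0≤t (0≤sq ε))) (0≤+
                                                                       (0≤* (0≤ι 8) (0≤* 0≤ε (0≤sq ε))) (0≤* (0≤ι 9)
                                                                         (0≤* 0≤K (0≤sq ε)))))
                                                                     (convex t ε K) ⟩
        h t + ε * (ι 12 * ((t + ε) * (t + ε)) + ι 18 * ((t + ε) * K) + ι 6 * (K * K))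
                                                                 ≡⟨ cong (λ z → h t + ε * (ι 12 * (z * z) + ι 18 *
                                                                     (z * K) + ι 6 * (K * K))) Y≡ ⟨
        h t + ε * (ι 12 * (Y * Y) + ι 18 * (Y * K) + ι 6 * (K * K)) ≤⟨ +-monoˡ-≤
            (ε * (ι 12 * (Y * Y) + ι 18 * (Y * K) + ι 6 * (K * K))) (≤-trans mono cubic) ⟩
        (K * K * K + ε * (K * K * K)) + ε * (ι 12 * (Y * Y) + ι 18 * (Y * K) + ι 6 * (K * K))
                                                                 ≡⟨ collect (K * K * K) ε (ι 12 * (Y * Y) + ι 18 *
                                                                     (Y * K) + ι 6 * (K * K)) ⟩
        K * K * K + ε * slope                                    ∎
        where
        open ≤-Reasoning
        b t : ℚ
        b = a * K
        t = Y - ε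
        0≤ε : 0ℚ ≤ ε
        0≤ε = <⇒≤ 0<ε
        Y≡ : Y ≡ t + ε
        Y≡ = id Y ε
          where
          id : ∀ y e → y ≡ (y - e) + e
          id = solve-∀ ℚR
        0≤t : 0ℚ ≤ t
        0≤t = diff≥0 (≤-trans ε≤1 (≤-trans (≤-reflexive (sym (+-identityˡ 1ℚ))) (ι-mono 1≤y)))
        ιs : ι s ≡ ι 2 * K + Y - ι 3
        ιs = trans (id (ι s)) (cong (_- ι 3) (trans (sym (ι-+ s 3))
            (trans (cong ι s≡) (trans (ι-+ (2 ℕ.* k) y) (cong (_+ Y) (ι-* 2 k))))))
          where
          id : ∀ x → x ≡ x + ι 3 - ι 3
          id = solve-∀ ℚR
        t≤b : t ≤ b
        t≤b = by-diff ((ι 2 + a) * K - ι 3 + ε - (ι 2 * K + Y - ι 3))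
            (diff≥0 (<⇒≤ (subst (_< (ι 2 + a) * K - ι 3 + ε) ιs lower))) (id a K Y ε)
          where
          id : ∀ a K Y e → a * K ≡ (Y - e) + ((ι 2 + a) * K - ι 3 + e - (ι 2 * K + Y - ι 3))
          id = solve-∀ ℚR
        0≤b : 0ℚ ≤ b
        0≤b = ≤-trans 0≤t t≤b
        tt≤bb : t * t ≤ b * b
        tt≤bb = *-mono 0≤t 0≤b t≤b t≤b
        mono : h t ≤ h b
        mono = +-mono-≤ (+-mono-≤ (*-monoʳ (ι 4) (0≤ι 4) (*-mono (0≤sq t) 0≤b tt≤bb t≤b))
            (*-monoʳ (ι 9) (0≤ι 9) (*-monoʳ-≤-nonNeg K {{nonNegative 0≤K}} tt≤bb)))
                 (*-monoʳ (ι 6) (0≤ι 6) (*-monoʳ-≤-nonNeg (K * K) {{nonNegative (0≤sq K)}} t≤b))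
        cubic : h b ≤ K * K * K + ε * (K * K * K)
        cubic = by-diff ((K * K * K) * (ε - (ι 4 * (a * (a * (a * 1ℚ))) + ι 9 * (a * (a * 1ℚ)) + ι 6 * a - 1ℚ -
            0ℚ)))
          (0≤* (0≤* (0≤sq K) 0≤K) (diff≥0 (<⇒≤ upper))) (id a K ε)
          where
          id : ∀ a K e → K * K * K + e * (K * K * K) ≡ (ι 4 * ((a * K) * (a * K) * (a * K)) + ι 9 *
              ((a * K) * (a * K) * K) + ι 6 * ((a * K) * (K * K))) +
               (K * K * K) * (e - (ι 4 * (a * (a * (a * 1ℚ))) + ι 9 * (a * (a * 1ℚ)) + ι 6 * a - 1ℚ - 0ℚ))
          id = solve-∀ ℚR
        convex : ∀ t e K → (ι 4 * (t * t * t) + ι 9 * (t * t * K) + ι 6 * (t * (K * K))) + e *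
            (ι 12 * ((t + e) * (t + e)) + ι 18 * ((t + e) * K) + ι 6 * (K * K)) ≡
                 (ι 4 * ((t + e) * (t + e) * (t + e)) + ι 9 * ((t + e) * (t + e) * K) + ι 6 * ((t + e) * (K * K))) +
                 (ι 12 * (t * (e * e)) + (ι 8 * (e * (e * e)) + ι 9 * (K * (e * e))))
        convex = solve-∀ ℚR
        collect : ∀ c e d → (c + e * c) + e * d ≡ c + e * (d + c)
        collect = solve-∀ ℚR

      bound : h Y ≤ K * K * K
      bound = limit (h Y) (K * K * K) slope 0≤slope λ ε 0<ε ε≤1 →
        let N₁ , h₁ = root ε 0<ε
            N₂ , h₂ = small ε 0<ε
            n = N₁ ℕ.⊔ N₂
        in at ε 0<ε ε≤1 (seq α n)
             (subst₂ (λ u v → u < (ι 2 + seq α n) * v - ι 3 + ε) (/1≡ι s) (/1≡ι k) (h₂ n (ℕ.m≤n⊔m N₁ N₂)))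
             (≤-<-trans ≤∣ ι 4 * (seq α n * (seq α n * (seq α n * 1ℚ))) + ι 9 * (seq α n * (seq α n * 1ℚ)) + ι 6 *
               seq α n - 1ℚ - 0ℚ ∣
                (h₁ n (ℕ.m≤m⊔n N₁ N₂)))

    cubic-bound : 4 ℕ.* (y ℕ.* y ℕ.* y) ℕ.+ 9 ℕ.* (y ℕ.* y ℕ.* k) ℕ.+ 6 ℕ.* (y ℕ.* (k ℕ.* k)) ℕ.≤ k ℕ.* k ℕ.* k
    cubic-bound = ι-reflects (subst₂ _≤_ (sym lhs) (sym (cube k k k)) bound)
      where
      cube : ∀ a b c → ι (a ℕ.* b ℕ.* c) ≡ ι a * ι b * ι c
      cube a b c = trans (ι-* (a ℕ.* b) c) (cong (_* ι c) (ι-* a b))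
      lhs : ι (4 ℕ.* (y ℕ.* y ℕ.* y) ℕ.+ 9 ℕ.* (y ℕ.* y ℕ.* k) ℕ.+ 6 ℕ.* (y ℕ.* (k ℕ.* k))) ≡ h Y
      lhs = trans (ι-+ (4 ℕ.* (y ℕ.* y ℕ.* y) ℕ.+ 9 ℕ.* (y ℕ.* y ℕ.* k)) (6 ℕ.* (y ℕ.* (k ℕ.* k))))
        (cong₂ _+_ (trans (ι-+ (4 ℕ.* (y ℕ.* y ℕ.* y)) (9 ℕ.* (y ℕ.* y ℕ.* k)))
          (cong₂ _+_ (trans (ι-* 4 (y ℕ.* y ℕ.* y)) (cong (ι 4 *_) (cube y y y)))
            (trans (ι-* 9 (y ℕ.* y ℕ.* k)) (cong (ι 9 *_) (cube y y k)))))
          (trans (ι-* 6 (y ℕ.* (k ℕ.* k))) (cong (ι 6 *_) (trans (ι-* y (k ℕ.* k)) (cong (Y *_) (ι-* k k))))))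

-- The contradiction when no half circle is heavy.

module Search where
  open import Data.Nat.Base
  open import Data.Nat.Properties
  open import Data.Nat.DivMod using (_%_; _/_; m%n<n; m<n⇒m%n≡m; m≡m%n+[m/n]*n)
  open import Data.Nat.Divisibility using (divides)
  open import Data.Nat.Primality using (Prime; prime⇒irreducible)
  open import Data.Nat.Tactic.RingSolver using (solve-∀)
  open import Data.Bool.Base using (false; _∧_)
  open import Data.List.Base using ([])
  open import Data.Product.Base using (∃-syntax; _,_)
  open import Data.Sum.Base using (inj₁; inj₂)
  open import Data.Empty using (⊥; ⊥-elim)
  open import Data.Vec.Base using ([])
  open LinearArithmetic using (linear; _⊕_; _⊛_; con; _⩽_; _≺_; _·_⇒_; ⊢_·_; ⊢⊥)
  open import Relation.Binary.PropositionalEquality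
  open Count
  open Residues
  open Rectification

  cube : ℕ → ℕ → ℕ
  cube y k = 4 * (y * y * y) + 9 * (y * y * k) + 6 * (y * (k * k))

  private abstract
    -- Supplies s (k + 2y)² ≤ 9k³, the sign that `at-least-p` needs. The left side is at most 2k³ +
    -- 2 `cube y k`, hence at most 4k³.
    su-poly : ∀ y k → cube y k ≤ k * k * k → (2 * k + y) * ((k + 2 * y) * (k + 2 * y)) ≤ 9 * (k * k * k)
    su-poly y k h = ≤-trans (m≤m+n _ (rest y k)) (≤-trans (≤-reflexive (expand y k))
      (≤-trans (+-monoʳ-≤ (2 * (k * k * k)) (*-monoʳ-≤ 2 h))
        (≤-trans (m≤m+n _ (5 * (k * k * k))) (≤-reflexive (gather (k * k * k))))))
      where
      rest : ℕ → ℕ → ℕ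
      rest y k = 4 * (y * y * y) + 6 * (y * y * k) + 3 * (y * (k * k))
      expand : ∀ y k → (2 * k + y) * ((k + 2 * y) * (k + 2 * y)) +
          (4 * (y * y * y) + 6 * (y * y * k) + 3 * (y * (k * k))) ≡
               2 * (k * k * k) + 2 * (4 * (y * y * y) + 9 * (y * y * k) + 6 * (y * (k * k)))
      expand = solve-∀
      gather : ∀ c → 2 * c + 2 * c + 5 * c ≡ 9 * c
      gather = solve-∀

    -- The left side is exactly 5k³ + 4 `cube y k`, the identity behind the coefficients 4, 9 and 6.
    last-poly : ∀ y k → cube y k ≤ k * k * k → (5 * k + 4 * y) * ((k + 2 * y) * (k + 2 * y)) ≤ 9 * (k * k * k)
    last-poly y k h = ≤-trans (≤-reflexive (expand y k))
        (≤-trans (+-monoʳ-≤ (5 * (k * k * k)) (*-monoʳ-≤ 4 h)) (≤-reflexive (gather (k * k * k))))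
      where
      expand : ∀ y k → (5 * k + 4 * y) * ((k + 2 * y) * (k + 2 * y)) ≡ 5 * (k * k * k) + 4 *
          (4 * (y * y * y) + 9 * (y * y * k) + 6 * (y * (k * k)))
      expand = solve-∀
      gather : ∀ c → 5 * c + 4 * c ≡ 9 * c
      gather = solve-∀

    s≤ : ∀ s k y → s + 3 ≤ 2 * k + y → s ≤ 2 * k + y
    s≤ = linear 3 (λ s k y → 1 · s ⊕ con 3 ⩽ 2 ⊛ k ⊕ y ⇒ ⊢ 0 · s ⩽ 2 ⊛ k ⊕ y)

    4s≤ : ∀ s k y → s + 3 ≤ 2 * k + y → 4 * s + 12 ≤ 8 * k + 4 * y
    4s≤ = linear 3 (λ s k y → 4 · s ⊕ con 3 ⩽ 2 ⊛ k ⊕ y ⇒ ⊢ 0 · 4 ⊛ s ⊕ con 12 ⩽ 8 ⊛ k ⊕ 4 ⊛ y)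

    absurd : ∀ K u uk us w → 9 * K + 3 * uk ≤ 4 * us → 4 * us + 12 * u ≤ 8 * uk + w →
             5 * uk + w ≤ 9 * K → 1 ≤ u → ⊥
    absurd = linear 5 (λ K u uk us w → 1 · 9 ⊛ K ⊕ 3 ⊛ uk ⩽ 4 ⊛ us ⇒
        1 · 4 ⊛ us ⊕ 12 ⊛ u ⩽ 8 ⊛ uk ⊕ w ⇒ 1 · 5 ⊛ uk ⊕ w ⩽ 9 ⊛ K ⇒ 1 · con 1 ⩽ u ⇒ ⊢⊥)

    times-3 : ∀ p k s u → 9 * (p * (k * k * (k * k))) + s * (u * (k * k)) ≤ 9 * (s * (k * k * (k * k))) + s *
        (u * (p * k)) → 1 ≤ k →
              9 * (p * (k * k * k)) + s * (u * k) ≤ 9 * (s * (k * k * k)) + s * (u * p)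
    times-3 p k s u h 1≤k = *-cancelˡ-≤ k {{>-nonZero 1≤k}}
        (≤-trans (≤-reflexive (e₁ p k s u)) (≤-trans h (≤-reflexive (e₂ p k s u))))
      where
      e₁ : ∀ p k s u → k * (9 * (p * (k * k * k)) + s * (u * k)) ≡ 9 * (p * (k * k * (k * k))) + s * (u * (k * k))
      e₁ = solve-∀
      e₂ : ∀ p k s u → 9 * (s * (k * k * (k * k))) + s * (u * (p * k)) ≡ k * (9 * (s * (k * k * k)) + s * (u * p))
      e₂ = solve-∀

    -- The bound is linear in p with coefficient 9 k³ - s u ≥ 0, so it may be tested at 3 p = 4 s.
    at-least-p : ∀ p K s u k t → 9 * (p * K) + s * (u * k) ≤ 9 * (s * K) + s * (u * p) → 3 * p ≡ 4 * s + t → s * u ≤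
        9 * K → 1 ≤ s →
                 9 * K + 3 * (u * k) ≤ 4 * (u * s)
    at-least-p p K s u k t h 3p su≤ 1≤s = *-cancelˡ-≤ s {{>-nonZero 1≤s}}
        (+-cancelʳ-≤ (27 * (s * K) + 9 * (t * K)) _ _ (begin
      s * (9 * K + 3 * (u * k)) + (27 * (s * K) + 9 * (t * K))  ≡⟨ e₁ s K u k t ⟩
      9 * ((4 * s + t) * K) + 3 * (s * (u * k))                 ≡⟨ cong (λ z → 9 * (z * K) + 3 * (s * (u * k)))
          (sym 3p) ⟩
      9 * (3 * p * K) + 3 * (s * (u * k))                       ≡⟨ e₂ p K s u k ⟩
      3 * (9 * (p * K) + s * (u * k))                           ≤⟨ *-monoʳ-≤ 3 h ⟩
      3 * (9 * (s * K) + s * (u * p))                           ≡⟨ e₃ s K u p ⟩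
      27 * (s * K) + s * u * (3 * p)                            ≡⟨ cong (λ z → 27 * (s * K) + s * u * z) 3p ⟩
      27 * (s * K) + s * u * (4 * s + t)                        ≡⟨ e₄ s K u t ⟩
      s * (4 * (u * s)) + (27 * (s * K) + t * (s * u))          ≤⟨ +-monoʳ-≤ (s * (4 * (u * s)))
          (+-monoʳ-≤ (27 * (s * K)) (*-monoʳ-≤ t su≤)) ⟩
      s * (4 * (u * s)) + (27 * (s * K) + t * (9 * K))          ≡⟨ cong
          (λ z → s * (4 * (u * s)) + (27 * (s * K) + z)) (e₅ t K) ⟩
      s * (4 * (u * s)) + (27 * (s * K) + 9 * (t * K))          ∎))
      where
      open ≤-Reasoning
      e₁ : ∀ s K u k t → s * (9 * K + 3 * (u * k)) + (27 * (s * K) + 9 * (t * K)) ≡ 9 * ((4 * s + t) * K) + 3 *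
          (s * (u * k))
      e₁ = solve-∀
      e₂ : ∀ p K s u k → 9 * (3 * p * K) + 3 * (s * (u * k)) ≡ 3 * (9 * (p * K) + s * (u * k))
      e₂ = solve-∀
      e₃ : ∀ s K u p → 3 * (9 * (s * K) + s * (u * p)) ≡ 27 * (s * K) + s * u * (3 * p)
      e₃ = solve-∀
      e₄ : ∀ s K u t → 27 * (s * K) + s * u * (4 * s + t) ≡ s * (4 * (u * s)) + (27 * (s * K) + t * (s * u))
      e₄ = solve-∀
      e₅ : ∀ t K → t * (9 * K) ≡ 9 * (t * K)
      e₅ = solve-∀

    -- With u = (k + 2y)², the bound at 3p = 4s reads 9k³ + 3uk ≤ 4us, and 4s + 12 ≤ 8k + 4y turns
    -- it into 9k³ + 12u ≤ (5k + 4y) u ≤ 9k³, against u ≥ 1.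
    no-small-windows : ∀ p k s y → cube y k ≤ k * k * k → s + 3 ≤ 2 * k + y → 4 * s ≤ 3 * p → 1 ≤ k → 1 ≤ s →
      9 * (p * (k * k * (k * k))) + s * ((k + 2 * y) * (k + 2 * y) * (k * k)) ≤ 9 * (s * (k * k * (k * k))) + s *
          ((k + 2 * y) * (k + 2 * y) * (p * k)) → ⊥
    no-small-windows p k s y hc hs hp 1≤k 1≤s h with t , et ← m≤n⇒∃[o]m+o≡n hp =
      absurd K u (u * k) (u * s) (4 * (u * y))
        (at-least-p p K s u k t (times-3 p k s u h 1≤k) (sym et)
          (≤-trans (*-monoˡ-≤ u (s≤ s k y hs)) (su-poly y k hc)) 1≤s)
        (≤-trans (≤-reflexive (e₁ u s)) (≤-trans (*-monoʳ-≤ u (4s≤ s k y hs)) (≤-reflexive (e₂ u k y))))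
        (≤-trans (≤-reflexive (e₃ u k y)) (last-poly y k hc))
        (*-mono-≤ 1≤μ 1≤μ)
      where
      u K : ℕ
      u = (k + 2 * y) * (k + 2 * y)
      K = k * k * k
      1≤μ : 1 ≤ k + 2 * y
      1≤μ = ≤-trans 1≤k (m≤m+n k (2 * y))
      e₁ : ∀ u s → 4 * (u * s) + 12 * u ≡ u * (4 * s + 12)
      e₁ = solve-∀
      e₂ : ∀ u k y → u * (8 * k + 4 * y) ≡ 8 * (u * k) + 4 * (u * y)
      e₂ = solve-∀
      e₃ : ∀ u k y → 5 * (u * k) + 4 * (u * y) ≡ (5 * k + 4 * y) * u
      e₃ = solve-∀

    -- The origin of μ = k + 2y: 6w ≤ 2 (s + 3) ≤ 4k + 2y = μ + 3k.
    six : ∀ w s k y → 3 * w < s + 4 → s + 3 ≤ 2 * k + y → 6 * w ≤ k + 2 * y + 3 * k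
    six = linear 4 (λ w s k y → 2 · 3 ⊛ w ≺ s ⊕ con 4 ⇒ 2 · s ⊕ con 3 ⩽ 2 ⊛ k ⊕ y ⇒
        ⊢ 0 · 6 ⊛ w ⩽ k ⊕ 2 ⊛ y ⊕ 3 ⊛ k)

  module _ (p m : ℕ) .{{nz : NonZero p}} (p≡ : suc (m + m) ≡ p) (3≤p : 3 ≤ p)
      (unit-of : ∀ d → 1 ≤ d → d < p → ∃[ e ] Unit p d e)
           (f g : Pred) (k s : ℕ) (k≡ : cnt f p ≡ k) (s≡ : cnt g p ≡ s)
           (closed : ∀ i j → f ∋ i % p → f ∋ j % p → g ∋ (i + j) % p) (f<p : ∀ i → f ∋ i → i < p)
           (y : ℕ) (hc : cube y k ≤ k * k * k) (hs : s + 3 ≤ 2 * k + y) (hp : 4 * s ≤ 3 * p) (1≤k : 1 ≤ k)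
             (1≤s : 1 ≤ s) where
    open Circle p m p≡ unit-of f g k s k≡ s≡ closed

    heavy : ℕ → Pred
    heavy d a = (1 ≤ᵇ d) ∧ (s + 4 ≤ᵇ 3 * cnt (along f a d) (suc m))

    private
      1<p : 1 < p
      1<p = ≤-trans (s≤s (s≤s z≤n)) 3≤p

      -- A window of a dilate is a stretch of m + 1 terms of a progression in A's own coordinates.
      -- Its start and difference may be reduced modulo p, so finitely many tests cover all windows.
      light : (∀ d → d < p → ∀ a → a < p → heavy d a ≡ false) → ⊥
      light none = no-small-windows p k s y hc hs hp 1≤k 1≤s
        (FourierBound.Setup.Conclusion.in-naturals p m p≡ f (k + 2 * y) k k≡ windows g s s≡ 1≤s 3≤p
          (λ a b fa fb → closed a b (subst (f ∋_) (sym (m<n⇒m%n≡m (f<p a fa))) fa)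
            (subst (f ∋_) (sym (m<n⇒m%n≡m (f<p b fb))) fb)) unit-of)
        where
        windows : ∀ d e → Unit p d e → ∀ u → 6 * cnt (λ j → f ((e * (u + j)) % p)) (suc m) ≤ k + 2 * y + 3 * k
        windows d e unit u = six (cnt (λ j → f ((e * (u + j)) % p)) (suc m)) s k y (≰⇒> λ le →
          ∋-∌ (heavy (e % p)) ((e * u) % p)
            (∧-intro (≤ᵇ-true (n≢0⇒n>0 (unit-pos p 1<p (unit-sym p unit))))
              (≤ᵇ-true (subst (λ z → s + 4 ≤ 3 * z) (cnt-cong (suc m) (λ j _ → cong f (reduce j))) le)))
            (none (e % p) (m%n<n e p) ((e * u) % p) (m%n<n (e * u) p))) hs
          where
          reduce : ∀ j → (e * (u + j)) % p ≡ ((e * u) % p + e % p * j) % p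
          reduce j = begin
            (e * (u + j)) % p                        ≡⟨ cong (_% p) (*-distribˡ-+ e u j) ⟩
            (e * u + e * j) % p                      ≡⟨ %-+ˡ p (e * u) (e * j) ⟨
            ((e * u) % p + e * j) % p                ≡⟨ %-+ʳ p ((e * u) % p) (e * j) ⟨
            ((e * u) % p + (e * j) % p) % p          ≡⟨ cong (λ z → ((e * u) % p + z) % p) (%-*ˡ p e j) ⟨
            ((e * u) % p + (e % p * j) % p) % p      ≡⟨ %-+ʳ p ((e * u) % p) (e % p * j) ⟩
            ((e * u) % p + e % p * j) % p            ∎
            where open ≡-Reasoning

    config : Config k
    config with find (λ d → any (heavy d) p) p
    ... | inj₁ (d , d<p , h) with a , a<p , ha ← any-elim (heavy d) p h with h₁ , h₂ ← ∧-true {1 ≤ᵇ d} ha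
      with e , u ← unit-of d (≤ᵇ-≤ {1} h₁) d<p = whole a d e u (≤ᵇ-≤ {s + 4} h₂) hp
    ... | inj₂ none = ⊥-elim (light λ d d<p a a<p → any-none (heavy d) p (none d d<p) a a<p)

  odd-prime : ∀ p → Prime p → 2 < p → ∃[ m ] suc (m + m) ≡ p
  odd-prime p pr 2<p with p % 2 in eq | m≡m%n+[m/n]*n p 2 | m%n<n p 2
  ... | suc zero | e | _ = p / 2 , trans (cong suc (trans (cong (p / 2 +_) (sym (+-identityʳ (p / 2))))
      (*-comm 2 (p / 2)))) (sym e)
  ... | suc (suc _) | _ | s≤s (s≤s ())
  ... | zero | e | _ with prime⇒irreducible pr (divides (p / 2) e)
  ...   | inj₁ ()
  ...   | inj₂ 2≡p = ⊥-elim (<⇒≢ 2<p 2≡p)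

-- From configurations of residues to subsets of `Fin p`.

module Progressions where
  open import Defs
  open import Data.Nat.Base
  open import Data.Nat.Properties
  open import Data.Nat.DivMod using (_%_; _mod_; m%n<n; m<n⇒m%n≡m; [m+n]%n≡m%n)
  open import Data.Nat.Primality using (Prime; prime⇒nonZero)
  open import Data.Nat.Tactic.RingSolver using (solve-∀)
  open import Data.Fin.Base as Fin using (Fin; toℕ; fromℕ<)
  open import Data.Fin.Properties using (any?; toℕ<n; toℕ-fromℕ<; toℕ-injective)
  import Data.Fin.Properties as Fin
  open import Data.Fin.Subset using (Subset; _∈_; _⊆_) renaming (∣_∣ to card)
  open import Data.Fin.Subset.Properties using (_∈?_)
  open import Data.Vec.Base using (Vec; []; _∷_; lookup; tabulate)
  open import Data.Vec.Properties using (lookup∘tabulate; lookup⇒[]=; []=⇒lookup)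
  open import Data.Bool.Base using (true; false)
  open import Data.Product.Base using (∃-syntax; _×_; _,_)
  open import Data.Empty using (⊥)
  open import Function.Bundles using (_⇔_; mk⇔)
  open import Relation.Nullary using (yes; does; Dec; _×-dec_)
  open import Relation.Nullary.Decidable using (dec-true)
  open import Relation.Binary.PropositionalEquality
  open Count
  open Residues
  open Rectification
  open Search using (config; cube)

  ind : ∀ {n} → Subset n → Pred
  ind []      _       = false
  ind (b ∷ v) zero    = b
  ind (b ∷ v) (suc i) = ind v i

  ind-toℕ : ∀ {n} (v : Subset n) x → ind v (toℕ x) ≡ lookup v x
  ind-toℕ (b ∷ v) Fin.zero    = refl
  ind-toℕ (b ∷ v) (Fin.suc x) = ind-toℕ v x

  ind-< : ∀ {n} (v : Subset n) i → ind v ∋ i → i < n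
  ind-< (b ∷ v) zero    h = z<s
  ind-< (b ∷ v) (suc i) h = s≤s (ind-< v i h)

  card-ind : ∀ {n} (v : Subset n) → cnt (ind v) n ≡ card v
  card-ind []                = refl
  card-ind {suc n} (b ∷ v) = trans (∑-head (λ i → ⟦ ind (b ∷ v) i ⟧) n)
      (trans (cong (⟦ b ⟧ +_) (card-ind v)) (tally b))
    where
    tally : ∀ b → ⟦ b ⟧ + card v ≡ card (b ∷ v)
    tally true  = refl
    tally false = refl

  ∈⇒ind : ∀ {n} {v : Subset n} {x} → x ∈ v → ind v ∋ toℕ x
  ∈⇒ind {v = v} {x} h = trans (ind-toℕ v x) ([]=⇒lookup h)

  ind⇒∈ : ∀ {n} (v : Subset n) {x} → ind v ∋ toℕ x → x ∈ v
  ind⇒∈ v {x} h = lookup⇒[]= x v (trans (sym (ind-toℕ v x)) h)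

  dec-∋ : ∀ {P : Set} (d : Dec P) → does d ≡ true → P
  dec-∋ (yes p) _ = p

  ∈-tabulate : ∀ {n} {P : Fin n → Set} (P? : ∀ x → Dec (P x)) {x} → P x → x ∈ tabulate (λ x → does (P? x))
  ∈-tabulate P? {x} px = lookup⇒[]= x _ (trans (lookup∘tabulate (λ x → does (P? x)) x) (dec-true (P? x) px))

  tabulate-∈ : ∀ {n} {P : Fin n → Set} (P? : ∀ x → Dec (P x)) {x} → x ∈ tabulate (λ x → does (P? x)) → P x
  tabulate-∈ P? {x} h = dec-∋ (P? x) (trans (sym (lookup∘tabulate (λ x → does (P? x)) x)) ([]=⇒lookup h))

  ∈-⊞ : ∀ {n} (A B : Subset n) {x y} → x ∈ A → y ∈ B → x ⊕ y ∈ A ⊞ B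
  ∈-⊞ A B {x} {y} hx hy = ∈-tabulate (λ z → any? λ x → any? λ y → x ∈? A ×-dec (y ∈? B ×-dec z Fin.≟ x ⊕ y))
      (x , y , hx , hy , refl)

  module _ (p : ℕ) .{{nz : NonZero p}} where

    toℕ-mod : ∀ i → toℕ (i mod p) ≡ i % p
    toℕ-mod i = toℕ-fromℕ< (m%n<n i p)

    toℕ-⊕ : ∀ (x y : Fin p) → toℕ (x ⊕ y) ≡ (toℕ x + toℕ y) % p
    toℕ-⊕ x y = toℕ-fromℕ< _

    toℕ-apTerm : ∀ (a d : Fin p) i → toℕ (apTerm a d i) ≡ (toℕ a + toℕ d * i) % p
    toℕ-apTerm a d i = trans (toℕ-fromℕ< _) (cong (λ z → (toℕ a + z) % p) (*-comm i (toℕ d)))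

    ⊞-closed : ∀ (A : Subset p) i j → ind A ∋ i % p → ind A ∋ j % p → ind (A ⊞ A) ∋ (i + j) % p
    ⊞-closed A i j hi hj = subst (ind (A ⊞ A) ∋_)
      (trans (toℕ-⊕ (i mod p) (j mod p)) (trans (cong₂ (λ a b → (a + b) % p) (toℕ-mod i) (toℕ-mod j))
        (sym (%-+ p i j))))
      (∈⇒ind (∈-⊞ A A (at i hi) (at j hj)))
      where
      at : ∀ i → ind A ∋ i % p → i mod p ∈ A
      at i h = ind⇒∈ A (subst (ind A ∋_) (sym (toℕ-mod i)) h)

    progression : Fin p → Fin p → ℕ → Subset p
    progression a d len = tabulate λ x → does (any? {n = len} λ i → x Fin.≟ apTerm a d (toℕ i))

    progression-⇔ : ∀ a d len x → x ∈ progression a d len ⇔ (∃[ i ] i < len × x ≡ apTerm a d i)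
    progression-⇔ a d len x = mk⇔
      (λ h → let i , eq = tabulate-∈ (λ x → any? {n = len} λ i → x Fin.≟ apTerm a d (toℕ i)) h in toℕ i , toℕ<n i , eq)
      (λ (i , i<len , eq) → ∈-tabulate (λ x → any? {n = len} λ i → x Fin.≟ apTerm a d (toℕ i))
        (fromℕ< i<len , trans eq (cong (apTerm a d) (sym (toℕ-fromℕ< i<len)))))

    cancel-+ : ∀ a x y → a ≤ p → (a + x) % p ≡ (a + y) % p → x % p ≡ y % p
    cancel-+ a x y a≤p eq = trans (sym (add x)) (trans (trans (sym (%-+ʳ p (p ∸ a) (a + x)))
        (trans (cong (λ z → ((p ∸ a) + z) % p) eq) (%-+ʳ p (p ∸ a) (a + y)))) (add y))
      where
      add : ∀ x → ((p ∸ a) + (a + x)) % p ≡ x % p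
      add x = trans (cong (_% p) (trans (sym (+-assoc (p ∸ a) a x))
          (trans (cong (_+ x) (m∸n+n≡m a≤p)) (+-comm p x)))) ([m+n]%n≡m%n x p)

    module _ {d e : ℕ} (unit : Unit p d e) where

      term-injective : ∀ a i j → i < p → j < p → a < p → (a + d * i) % p ≡ (a + d * j) % p → i ≡ j
      term-injective a i j i<p j<p a<p eq = trans (sym (Unit.undo unit i i<p))
        (trans (cong (λ z → (e * z) % p) (cancel-+ a (d * i) (d * j) (<⇒≤ a<p) eq)) (Unit.undo unit j j<p))

      position : ∀ a x → a < p → x < p → ∃[ j ] j < p × (a + d * j) % p ≡ x
      position a x a<p x<p = (e * w) % p , m%n<n (e * w) p , (begin
        (a + d * ((e * w) % p)) % p         ≡⟨ %-+ʳ p a (d * ((e * w) % p)) ⟨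
        (a + (d * ((e * w) % p)) % p) % p   ≡⟨ cong (λ z → (a + z) % p) (%-*ʳ p d (e * w)) ⟩
        (a + (d * (e * w)) % p) % p         ≡⟨ cong (λ z → (a + z) % p)
          (trans (cong (_% p) (sym (*-assoc d e w))) (trans (sym (%-*ˡ p (d * e) w))
            (cong (λ z → (z * w) % p) (Unit.de unit)))) ⟩
        (a + (1 % p * w) % p) % p           ≡⟨ cong (λ z → (a + z) % p)
          (trans (%-*ˡ p 1 w) (cong (_% p) (*-identityˡ w))) ⟩
        (a + w % p) % p                     ≡⟨ %-+ʳ p a w ⟩
        (a + w) % p                         ≡⟨ cong (_% p)
          (trans (cong (a +_) (+-comm x (p ∸ a))) (trans (sym (+-assoc a (p ∸ a) x))
            (trans (cong (_+ x) (m+[n∸m]≡n (<⇒≤ a<p))) (+-comm p x)))) ⟩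
        (x + p) % p                         ≡⟨ [m+n]%n≡m%n x p ⟩
        x % p                               ≡⟨ m<n⇒m%n≡m x<p ⟩
        x                                   ∎)
        where
        open ≡-Reasoning
        w = x + (p ∸ a)

  cnt-all : ∀ P {m n} → m ≤ n → cnt P n ≡ cnt P m → ∀ j → m ≤ j → j < n → P ∌ j
  cnt-all P {m} {n} m≤n eq j m≤j j<n = not-∋ P j λ h → <-irrefl refl (begin-strict
    cnt P m           ≤⟨ ∑-monoʳ _ m≤j ⟩
    cnt P j           <⟨ n<1+n _ ⟩
    suc (cnt P j)     ≡⟨ cnt-step P j h ⟨
    cnt P (suc j)     ≤⟨ ∑-monoʳ _ j<n ⟩
    cnt P n           ≡⟨ eq ⟩
    cnt P m           ∎)
    where open ≤-Reasoning

  -- `card PA + k ≤ suc s` is the required |P_A| ≤ |A| + r + 1 with r = s - 2k eliminated, which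
  -- keeps the construction inside ℕ.
  Structure : (p : ℕ) → Subset p → ℕ → ℕ → Set
  Structure p A k s = ∃[ g ] ∃[ PA ] ∃[ P2A ] IsAP {p} g PA × IsAP {p} g P2A ×
    A ⊆ PA × card PA + k ≤ suc s × P2A ⊆ A ⊞ A × card P2A ≡ k + k ∸ 1

  module _ (p m : ℕ) (pr : Prime p) (p≡ : suc (m + m) ≡ p) (3≤p : 3 ≤ p) (A : Subset p) (1≤k : 1 ≤ card A)
      (k≤s : card A ≤ card (A ⊞ A))
           (y : ℕ) (hc : cube y (card A) ≤ card A * card A * card A) (hs : card (A ⊞ A) + 3 ≤ 2 * card A + y)
             (hp : 4 * card (A ⊞ A) ≤ 3 * p) where
    private
      instance
        nz : NonZero p
        nz = prime⇒nonZero pr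
      k = card A
      s = card (A ⊞ A)
    open Circle p m p≡ (prime-unit p pr) (ind A) (ind (A ⊞ A)) k s (card-ind A) (card-ind (A ⊞ A)) (⊞-closed p A)

    cfg : Config k
    cfg = config p m p≡ 3≤p (prime-unit p pr) (ind A) (ind (A ⊞ A)) k s (card-ind A) (card-ind (A ⊞ A))
        (⊞-closed p A) (ind-< A)
            y hc hs hp 1≤k (≤-trans 1≤k k≤s)

    open Config cfg

    private
      aF dF bF : Fin p
      aF = a mod p
      dF = d mod p
      bF = (a + a + d * θ) mod p

      unitF : Unit p (toℕ dF) d⁻¹
      unitF = record { de = trans (cong (λ z → (z * d⁻¹) % p) (toℕ-mod p d)) (trans (%-*ˡ p d d⁻¹) (Unit.de unit)) }

      1<p : 1 < p
      1<p = ≤-trans (s≤s (s≤s z≤n)) 3≤p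

      dF≢0 : toℕ dF ≢ 0
      dF≢0 eq = unit-pos p 1<p unit (trans (sym (toℕ-mod p d)) eq)

      card-progression : ∀ c len → len ≤ p → card (progression p c dF len) ≡ len
      card-progression c len len≤p = begin
        card P                                         ≡⟨ card-ind P ⟨
        cnt (ind P) p                                  ≡⟨ cnt-along (ind P) (toℕ c) (toℕ dF) d⁻¹ unitF ⟨
        cnt (along (ind P) (toℕ c) (toℕ dF)) p         ≡⟨ cnt-stop (along (ind P) (toℕ c) (toℕ dF)) len p len≤p
            outside ⟩
        cnt (along (ind P) (toℕ c) (toℕ dF)) len       ≡⟨ cnt-full (along (ind P) (toℕ c) (toℕ dF)) len inside ⟩
        len                                            ∎
        where
        open ≡-Reasoning
        open Function.Bundles.Equivalence
        P = progression p c dF len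
        inside : ∀ j → j < len → along (ind P) (toℕ c) (toℕ dF) ∋ j
        inside j j<len = subst (ind P ∋_) (toℕ-apTerm p c dF j)
            (∈⇒ind (from (progression-⇔ p c dF len (apTerm c dF j)) (j , j<len , refl)))
        outside : ∀ j → len ≤ j → j < p → along (ind P) (toℕ c) (toℕ dF) ∌ j
        outside j len≤j j<p = not-∋ (along (ind P) (toℕ c) (toℕ dF)) j λ h →
          let i , i<len , eq = to (progression-⇔ p c dF len (apTerm c dF j)) (ind⇒∈ P (subst (ind P ∋_) (sym (toℕ-apTerm p c dF j)) h))
          in <⇒≱ i<len (≤-trans len≤j (≤-reflexive (term-injective p unitF (toℕ c) j i j<p (<-≤-trans i<len len≤p) (toℕ<n c)
               (trans (sym (toℕ-apTerm p c dF j)) (trans (cong toℕ eq) (toℕ-apTerm p c dF i))))))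

      is-progression : ∀ c len → 1 ≤ len → len ≤ p → IsAP dF (progression p c dF len)
      is-progression c len 1≤len len≤p = dF≢0 , c , len , 1≤len , len≤p , progression-⇔ p c dF len

      sℓ≤p : suc ℓ ≤ p
      sℓ≤p = ≤-trans (s≤s (m≤m+n ℓ ℓ)) 2ℓ<p

      along-F : ∀ P j → along P (toℕ aF) (toℕ dF) j ≡ along P a d j
      along-F P j = cong P (trans (cong₂ (λ u v → (u + v * j) % p) (toℕ-mod p a) (toℕ-mod p d))
          (trans (%-+ˡ p a (d % p * j))
        (trans (sym (%-+ʳ p a (d % p * j))) (trans (cong (λ z → (a + z) % p) (%-*ˡ p d j)) (%-+ʳ p a (d * j))))))

      -- Positions 0 to ℓ already carry k points, and A has only k, so no later position of the
      -- period is occupied.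
      covers : A ⊆ progression p aF dF (suc ℓ)
      covers {x} x∈A = located (position p unitF (toℕ aF) (toℕ x) (toℕ<n aF) (toℕ<n x))
        where
        open Function.Bundles.Equivalence
        located : (∃[ j ] j < p × (toℕ aF + toℕ dF * j) % p ≡ toℕ x) → x ∈ progression p aF dF (suc ℓ)
        located (j , j<p , eq) = from (progression-⇔ p aF dF (suc ℓ) x)
            (j , ≰⇒> too-far , toℕ-injective (trans (sym eq) (sym (toℕ-apTerm p aF dF j))))
          where
          hit : along (ind A) a d ∋ j
          hit = trans (sym (along-F (ind A) j)) (trans (cong (ind A) eq) (∈⇒ind x∈A))
          too-far : suc ℓ ≤ j → ⊥
          too-far ℓ<j = ∋-∌ (along (ind A) a d) j hit (cnt-all (along (ind A) a d) sℓ≤p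
            (trans (cnt-along (ind A) a d d⁻¹ unit) (trans (card-ind A) (sym count))) j ℓ<j j<p)

      len₂ : ℕ
      len₂ = k + k ∸ 1

      len₂+1 : len₂ + 1 ≡ k + k
      len₂+1 = m∸n+n≡m (≤-trans 1≤k (m≤m+n k k))

      k≤sℓ : k ≤ suc ℓ
      k≤sℓ = ≤-trans (≤-reflexive (sym count)) (cnt≤ (along (ind A) a d) (suc ℓ))

      s≤p : s ≤ p
      s≤p = ≤-trans (≤-reflexive (sym (card-ind (A ⊞ A)))) (cnt≤ (ind (A ⊞ A)) p)

      len₂≤p : len₂ ≤ p
      len₂≤p = ≤-trans (∸-monoˡ-≤ 1 (+-monoˡ-≤ k k≤sℓ)) (≤-trans size s≤p)

      1≤len₂ : 1 ≤ len₂
      1≤len₂ = ∸-monoˡ-≤ 1 (+-mono-≤ 1≤k 1≤k)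

      contained : progression p bF dF len₂ ⊆ A ⊞ A
      contained {z} z∈ = found (to (progression-⇔ p bF dF len₂ z) z∈)
        where
        open Function.Bundles.Equivalence
        found : (∃[ i ] i < len₂ × z ≡ apTerm bF dF i) → z ∈ A ⊞ A
        found (i , i<len , eq) = ind⇒∈ (A ⊞ A) (subst (ind (A ⊞ A) ∋_) (sym place) (run i si<))
          where
          si< : suc i < k + k
          si< = ≤-trans (s≤s i<len) (≤-reflexive (trans (+-comm 1 len₂) len₂+1))
          regroup : ∀ a d θ i → a + a + d * θ + d * i ≡ a + a + d * (θ + i)
          regroup = solve-∀
          place : toℕ z ≡ (a + a + d * (θ + i)) % p
          place = begin
            toℕ z                                           ≡⟨ cong toℕ eq ⟩
            toℕ (apTerm bF dF i)                            ≡⟨ toℕ-apTerm p bF dF i ⟩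
            (toℕ bF + toℕ dF * i) % p                       ≡⟨ cong₂ (λ u v → (u + v * i) % p)
              (toℕ-mod p (a + a + d * θ)) (toℕ-mod p d) ⟩
            ((a + a + d * θ) % p + d % p * i) % p           ≡⟨ %-+ˡ p (a + a + d * θ) (d % p * i) ⟩
            (a + a + d * θ + d % p * i) % p                 ≡⟨ %-+ʳ p (a + a + d * θ) (d % p * i) ⟨
            (a + a + d * θ + (d % p * i) % p) % p           ≡⟨ cong (λ w → (a + a + d * θ + w) % p) (%-*ˡ p d i) ⟩
            (a + a + d * θ + (d * i) % p) % p               ≡⟨ %-+ʳ p (a + a + d * θ) (d * i) ⟩
            (a + a + d * θ + d * i) % p                     ≡⟨ cong (_% p) (regroup a d θ i) ⟩
            (a + a + d * (θ + i)) % p                       ∎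
            where open ≡-Reasoning

    structure : Structure p A k s
    structure = dF , progression p aF dF (suc ℓ) , progression p bF dF len₂ ,
      is-progression aF (suc ℓ) (s≤s z≤n) sℓ≤p , is-progression bF len₂ 1≤len₂ len₂≤p ,
      covers , ≤-trans (≤-reflexive (cong (_+ k) (card-progression aF (suc ℓ) sℓ≤p))) (s≤s size) ,
      contained , card-progression bF len₂ len₂≤p

open import Defs
open import Data.Fin.Base using (Fin)
open import Data.Fin.Subset using (Subset; Nonempty; _⊆_) renaming (∣_∣ to card)
open import Data.Integer.Base as ℤ using (ℤ; +_)
open import Data.Nat.Base using (ℕ)
open import Data.Nat.Primality using (Prime)
open import Data.Product.Base using (∃-syntax; _×_)
open import Data.Rational.Base as ℚ using (_/_)
open import Relation.Binary.PropositionalEquality using (_≡_)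

-- Hypotheses and conclusions between ℤ, ℚ, ℝ and ℕ.

module Transfer where
  open import Data.Nat.Base as ℕ using (zero; suc)
  import Data.Nat.Properties as ℕ
  open import Data.Nat.Primality using (prime⇒nonZero)
  open import Data.Fin.Base using (toℕ)
  open import Data.Fin.Properties using (toℕ<n)
  open import Data.Nat.DivMod using (_%_; m<n⇒m%n≡m)
  import Data.Integer.Properties as ℤ
  import Data.Integer.Tactic.RingSolver as ℤ
  open import Data.Rational.Properties using (≤-trans; ≤-reflexive)
  open import Data.Product.Base using (_,_)
  open import Data.Empty using (⊥)
  open import Relation.Binary.PropositionalEquality
  open import Tactic.RingSolver using (solve-∀)
  open Rationals
  open Roots using (/1≡ι)
  open Count using (cnt; _∋_; ⟦_⟧)
  open Residues
  open Search using (cube)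
  open Progressions

  private
    upper-id : ∀ k r → k ℤ.+ r ℤ.+ + 1 ≡ (+ 2 ℤ.* k ℤ.+ r) ℤ.+ + 1 ℤ.- k
    upper-id = ℤ.solve-∀
    slack-id : ∀ c k t → (c ℤ.+ k) ℤ.+ t ℤ.- k ≡ c ℤ.+ t
    slack-id = ℤ.solve-∀
    double-id : ∀ k → + 2 ℤ.* k ≡ k ℤ.+ k
    double-id = ℤ.solve-∀
    pred-id : ∀ c → (c ℤ.+ + 1) ℤ.- + 1 ≡ c
    pred-id = ℤ.solve-∀

  upper : ∀ c k s r → + s ≡ + 2 ℤ.* + k ℤ.+ r → c ℕ.+ k ℕ.≤ suc s → + c ℤ.≤ + k ℤ.+ r ℤ.+ + 1
  upper c k s r eq le with t , et ← ℕ.m≤n⇒∃[o]m+o≡n le = subst (+ c ℤ.≤_) (sym total) (ℤ.i≤i+j (+ c) (+ t))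
    where
    total : + k ℤ.+ r ℤ.+ + 1 ≡ + c ℤ.+ + t
    total = begin
      + k ℤ.+ r ℤ.+ + 1                          ≡⟨ upper-id (+ k) r ⟩
      (+ 2 ℤ.* + k ℤ.+ r) ℤ.+ + 1 ℤ.- + k        ≡⟨ cong (λ z → z ℤ.+ + 1 ℤ.- + k) (sym eq) ⟩
      + (s ℕ.+ 1) ℤ.- + k                        ≡⟨ cong (λ z → + z ℤ.- + k) (trans (ℕ.+-comm s 1) (sym et)) ⟩
      + (c ℕ.+ k ℕ.+ t) ℤ.- + k                  ≡⟨ slack-id (+ c) (+ k) (+ t) ⟩
      + c ℤ.+ + t                                ∎
      where open ≡-Reasoning

  lower : ∀ c k → 1 ℕ.≤ k → c ≡ k ℕ.+ k ℕ.∸ 1 → + c ℤ.≥ + 2 ℤ.* + k ℤ.- + 1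
  lower c k 1≤k refl = ℤ.≤-reflexive (begin
    + 2 ℤ.* + k ℤ.- + 1                          ≡⟨ cong (ℤ._- + 1) (double-id (+ k)) ⟩
    + (k ℕ.+ k) ℤ.- + 1                          ≡⟨ cong (λ z → + z ℤ.- + 1) (ℕ.m∸n+n≡m (ℕ.≤-trans 1≤k (ℕ.m≤m+n k k))) ⟨
    + (k ℕ.+ k ℕ.∸ 1 ℕ.+ 1) ℤ.- + 1              ≡⟨ pred-id (+ (k ℕ.+ k ℕ.∸ 1)) ⟩
    + (k ℕ.+ k ℕ.∸ 1)                            ∎)
    where open ≡-Reasoning

  three-quarters : ∀ s p → (+ s / 1) ℚ.≤ (+ 3 / 4) ℚ.* (+ p / 1) → 4 ℕ.* s ℕ.≤ 3 ℕ.* p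
  three-quarters s p h = ι-reflects (subst₂ ℚ._≤_ (sym (ι-* 4 s)) (trans (clear (ι p)) (sym (ι-* 3 p)))
    (*-monoʳ (ι 4) (0≤ι 4) (subst₂ (λ u v → u ℚ.≤ (+ 3 / 4) ℚ.* v) (/1≡ι s) (/1≡ι p) h)))
    where
    clear : ∀ x → ι 4 ℚ.* ((+ 3 / 4) ℚ.* x) ≡ ι 3 ℚ.* x
    clear = solve-∀ ℚR

  module _ (p : ℕ) (pr : Prime p) (A : Subset p) (A≢∅ : Nonempty A) where
    private
      instance
        nz : ℕ.NonZero p
        nz = prime⇒nonZero pr

    card-pos : 1 ℕ.≤ card A
    card-pos = let x , x∈A = A≢∅ in ℕ.≤-trans (ℕ.≤-trans (Count.∋⇒1≤ (∈⇒ind x∈A)) (Count.∑-term (λ i → ⟦ ind A i ⟧) p (toℕ x) (toℕ<n x)))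
      (ℕ.≤-reflexive (card-ind A))

    card-sumset : card A ℕ.≤ card (A ⊞ A)
    card-sumset = let x , x∈A = A≢∅ in begin
      card A                                                   ≡⟨ card-ind A ⟨
      cnt (ind A) p                                            ≤⟨ Count.cnt-mono p (λ j j<p h → ⊞-closed p A (toℕ x) j (reduced (toℕ<n x) (∈⇒ind x∈A)) (reduced j<p h)) ⟩
      cnt (Count.shift (toℕ x) (λ i → ind (A ⊞ A) (i % p))) p  ≡⟨ cnt-period p _ (periodic-% p (ind (A ⊞ A))) (toℕ x) ⟩
      cnt (λ i → ind (A ⊞ A) (i % p)) p                        ≡⟨ Count.cnt-cong p (λ i i<p → cong (ind (A ⊞ A)) (m<n⇒m%n≡m i<p)) ⟩
      cnt (ind (A ⊞ A)) p                                      ≡⟨ card-ind (A ⊞ A) ⟩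
      card (A ⊞ A)                                             ∎
      where
      open ℕ.≤-Reasoning
      reduced : ∀ {i} → i ℕ.< p → ind A ∋ i → ind A ∋ i % p
      reduced i<p h = trans (cong (ind A) (m<n⇒m%n≡m i<p)) h

  cubic : ∀ (α : ℝ) → fromℕ 4 *ᴿ α ^ᴿ 3 +ᴿ fromℕ 9 *ᴿ α ^ᴿ 2 +ᴿ fromℕ 6 *ᴿ α -ᴿ fromℕ 1 ≃ᴿ fromℕ 0 → ∀ s k →
          fromℕ s ≤ᴿ (fromℕ 2 +ᴿ α) *ᴿ fromℕ k -ᴿ fromℕ 3 → cube (s ℕ.+ 3 ℕ.∸ 2 ℕ.* k) k ℕ.≤ k ℕ.* k ℕ.* k
  cubic α root s k small with s ℕ.+ 3 ℕ.∸ 2 ℕ.* k in eq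
  -- For s + 3 ≤ 2k the truncated difference is 0, and the cubic form vanishes with it.
  ... | zero = ℕ.z≤n
  ... | y@(suc _) = Cubic.cubic-bound α root s k y small
    (trans (sym (ℕ.m+[n∸m]≡n {2 ℕ.* k} {s ℕ.+ 3} (ℕ.<⇒≤ (ℕ.m∸n≢0⇒n<m λ z → ℕ.1+n≢0 (trans (sym eq) z))))) (cong (2 ℕ.* k ℕ.+_) eq)) (ℕ.s≤s ℕ.z≤n)

  -- p ≤ 2 leaves only s = k = 1, where y = 2 and `cube` takes the value 80 > 1.
  big-prime : ∀ p → Prime p → ∀ s k → 1 ℕ.≤ k → k ℕ.≤ s → 4 ℕ.* s ℕ.≤ 3 ℕ.* p → cube (s ℕ.+ 3 ℕ.∸ 2 ℕ.* k) k ℕ.≤ k ℕ.* k ℕ.* k → 2 ℕ.< p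
  big-prime p pr s k 1≤k k≤s hp hc = ℕ.≰⇒> λ p≤2 → tiny s k 1≤k k≤s (at-most-1 p p≤2 hp) hc
    where
    tiny : ∀ s k → 1 ℕ.≤ k → k ℕ.≤ s → s ℕ.≤ 1 → cube (s ℕ.+ 3 ℕ.∸ 2 ℕ.* k) k ℕ.≤ k ℕ.* k ℕ.* k → ⊥
    tiny (suc zero) (suc zero) _ _ _ (ℕ.s≤s ())
    tiny (suc zero) (suc (suc _)) _ (ℕ.s≤s ()) _ _
    tiny (suc (suc _)) k _ _ (ℕ.s≤s ()) _
    at-most-1 : ∀ p → p ℕ.≤ 2 → 4 ℕ.* s ℕ.≤ 3 ℕ.* p → s ℕ.≤ 1
    at-most-1 p p≤2 h = ℕ.≤-pred (ℕ.*-cancelˡ-< 4 s 2 (ℕ.<-≤-trans (ℕ.s≤s (ℕ.≤-trans h (ℕ.*-monoʳ-≤ 3 p≤2))) (ℕ.n≤1+n 7)))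

theorem1p3 : (p : ℕ) → Prime p →
    (A : Subset p) → Nonempty A →
    (r : ℤ) → + card (A ⊞ A) ≡ + 2 ℤ.* + card A ℤ.+ r →
    (α : ℝ) →
    fromℕ 4 *ᴿ α ^ᴿ 3 +ᴿ fromℕ 9 *ᴿ α ^ᴿ 2 +ᴿ fromℕ 6 *ᴿ α -ᴿ fromℕ 1 ≃ᴿ fromℕ 0 →
    fromℕ (card (A ⊞ A)) ≤ᴿ (fromℕ 2 +ᴿ α) *ᴿ fromℕ (card A) -ᴿ fromℕ 3 →
    (+ card (A ⊞ A) / 1) ℚ.≤ (+ 3 / 4) ℚ.* (+ p / 1) →
    ∃[ g ] ∃[ PA ] ∃[ P2A ]
    IsAP {p} g PA × IsAP {p} g P2A ×
    A ⊆ PA × + card PA ℤ.≤ + card A ℤ.+ r ℤ.+ + 1 ×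
    P2A ⊆ A ⊞ A × + card P2A ℤ.≥ + 2 ℤ.* + card A ℤ.- + 1
theorem1p3 p pr A A≢∅ r r≡ α root small quarter =
  let g , PA , P2A , apA , ap2A , A⊆ , cA , ⊆2A , c2A =
        Progressions.structure p m pr p≡ 2<p A 1≤k k≤s y hc (ℕ.m≤n+m∸n (s ℕ.+ 3) (2 ℕ.* k)) hp
  in g , PA , P2A , apA , ap2A , A⊆ , upper (card PA) k s r r≡ cA , ⊆2A , lower (card P2A) k 1≤k c2A
  where
  open Transfer
  open import Data.Product.Base using (_,_; proj₁; proj₂)
  import Data.Nat.Base as ℕ
  import Data.Nat.Properties as ℕ
  k s y : ℕ
  k = card A
  s = card (A ⊞ A)
  -- Truncated subtraction: s + 3 ≤ 2k + y holds in every case, and that is the form in which the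
  -- bound on s is used.
  y = s ℕ.+ 3 ℕ.∸ 2 ℕ.* k
  1≤k : 1 ℕ.≤ k
  1≤k = card-pos p pr A A≢∅
  k≤s : k ℕ.≤ s
  k≤s = card-sumset p pr A A≢∅
  hp : 4 ℕ.* s ℕ.≤ 3 ℕ.* p
  hp = three-quarters s p quarter
  hc : Search.cube y k ℕ.≤ k ℕ.* k ℕ.* k
  hc = cubic α root s k small
  2<p : 2 ℕ.< p
  2<p = big-prime p pr s k 1≤k k≤s hp hc
  m : ℕ
  m = proj₁ (Search.odd-prime p pr 2<p)
  p≡ : ℕ.suc (m ℕ.+ m) ≡ p
  p≡ = proj₂ (Search.odd-prime p pr 2<p)
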